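{- For all $\Delta \in \mathbb{N}$ and $d,\eta>0$, there exist constants $\rho,\beta,n_0>0$ such that for every $n \geq n_0$ the following holds. Let $H$ be an $n$-vertex graph with $\Delta(H) \leq \Delta$ and bandwidth at most $\beta n$. Then any $(\rho,d)$-dense graph $G$ on $n$ vertices with $\delta(G)\geq (1/2+\eta)n$ contains a copy of $H$ (i.e. a subgraph isomorphic to $H$).
   Context: An $n$-vertex graph $G$ is $(\rho,d)$-dense if every $X \subseteq V(G)$ satisfies $e(G[X]) \geq d\binom{|X|}{2}-\rho n^2$. A graph $H$ on $n$ vertices has bandwidth at most $b$ if there is a labelling of its vertices by $1,\dots,n$ such that $|i-j|\le b$ for every edge $ij\in E(H)$. $\Delta(H)$ is the maximum degree and $\delta(G)$ the minimum degree. -}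

module Defs where

open import Data.Bool using (Bool; true; false; _∧_; if_then_else_)
open import Data.Nat using (ℕ; _+_; _*_; _<ᵇ_; ∣_-_∣; _≤_)
open import Data.Nat.Combinatorics using (_C_)
open import Data.Fin using (Fin; toℕ)
open import Data.Fin.Subset using (Subset; ∣_∣)
open import Data.Fin.Permutation using (Permutation′; _⟨$⟩ʳ_)
open import Data.Vec using (lookup)
open import Data.List using (map; allFin)
open import Data.Nat.ListAction using (sum)
open import Data.Integer using (+_)
open import Data.Rational using (ℚ; _/_) renaming (_-_ to _-ℚ_; _+_ to _+ℚ_; _*_ to _*ℚ_; _≤_ to _≤ℚ_)
open import Data.Product using (Σ; ∃; _×_)
open import Relation.Binary.PropositionalEquality using (_≡_)
open import Function.Definitions using (Injective)

record Graph (n : ℕ) : Set where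
  field
    adj    : Fin n → Fin n → Bool
    sym    : ∀ i j → adj i j ≡ adj j i
    irrefl : ∀ i → adj i i ≡ false
open Graph public

ℕ→ℚ : ℕ → ℚ
ℕ→ℚ k = + k / 1

count : (n : ℕ) → (Fin n → Bool) → ℕ
count n p = sum (map (λ i → if p i then 1 else 0) (allFin n))

deg : ∀ {n} → Graph n → Fin n → ℕ
deg {n} G v = count n (adj G v)

MaxDegree≤ : ∀ {n} → Graph n → ℕ → Set
MaxDegree≤ G D = ∀ v → deg G v ≤ D

edgesIn : ∀ {n} → Graph n → Subset n → ℕ
edgesIn {n} G X =
  sum (map (λ i → count n (λ j → (toℕ i <ᵇ toℕ j) ∧ lookup X i ∧ lookup X j ∧ adj G i j))
           (allFin n))

Dense : ∀ {n} → ℚ → ℚ → Graph n → Set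
Dense {n} ρ d G =
  ∀ (X : Subset n) → (d *ℚ ℕ→ℚ (∣ X ∣ C 2)) -ℚ (ρ *ℚ ℕ→ℚ (n * n)) ≤ℚ ℕ→ℚ (edgesIn G X)

BandwidthAtMost : ∀ {n} → Graph n → ℚ → Set
BandwidthAtMost {n} H b =
  Σ (Permutation′ n) λ σ → ∀ i j → adj H i j ≡ true →
    ℕ→ℚ ∣ toℕ (σ ⟨$⟩ʳ i) - toℕ (σ ⟨$⟩ʳ j) ∣ ≤ℚ b

ContainsCopy : ∀ {n} → Graph n → Graph n → Set
ContainsCopy {n} G H =
  Σ (Fin n → Fin n) λ f → Injective _≡_ _≡_ f ×
    (∀ i j → adj H i j ≡ true → adj G (f i) (f j) ≡ true)

{-# OPTIONS --safe #-}

-- Neither the regularity lemma nor the blow-up lemma is needed.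
--
-- Every linear-sized vertex set of G spans a positive density of cliques, and a density increment turns a positive density
-- of a fixed configuration of tuples into linear-sized sets whose pairs are bi-dense (no large subsets span a sparse pair).
-- A piece of H that is tiny compared with these sets embeds greedily into them, by the colours of a colouring of H.  Hence
-- H is embedded interval by interval: for each interval a fresh bi-dense tuple (a "hub") is found among the unused vertices,
-- and the old hub is joined to the new one through a small reservoir U in which all pairs of vertices keep many common
-- neighbours.  Such a U exists, and the two hubs can be joined, because δ(G) ≥ (1/2 + η) n makes all codegrees linear.
--
-- This leaves a small set Y of vertices of H (at mutual distance > 8) and equally many vertices u of G.  An absorber for
-- (u , y) is a vertex x of H with N(x) embedded into N(u) and x embedded into the common neighbourhood of the images of
-- N(y): then x can move to u and y can take the old place of x.  The balls around far apart vertices x are embedded first,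
-- one at a time; an exponential potential over all pairs (u , y) ensures that every pair obtains linearly many absorbers.
module Submission where

open import Data.Bool using (Bool; true; false; _∧_; _∨_; not; if_then_else_)
open import Data.Nat
open import Data.Nat.Properties
open import Data.Nat.DivMod using (/-monoˡ-≤; m/n≡1+[m∸n]/n; m/n*n≤m; m≡m%n+[m/n]*n; m%n<n; m≥n⇒m/n>0; m*n/n≡m)
open import Data.Nat.Tactic.RingSolver using (solve-∀)
open import Data.Fin using (Fin; zero; suc; toℕ; fromℕ<; _↑ˡ_; _↑ʳ_)
import Data.Fin.Properties as Finₚ
open import Data.Fin.Subset using (Subset)
open import Data.Fin.Subset.Properties using (anySubset?)
open import Data.Vec using (Vec; []; _∷_; lookup; _++_; replicate; _[_]≔_; tabulate; take; drop)
open import Data.Vec.Properties using (lookup∘update; lookup∘update′; lookup∘tabulate; take++drop≡id; lookup-++ˡ; lookup-++ʳ; lookup-replicate)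
open import Data.Product using (Σ; ∃; _×_; _,_; proj₁; proj₂)
open import Data.Sum using (_⊎_; inj₁; inj₂)
open import Data.Empty using (⊥; ⊥-elim)
open import Function using (_∘_)
open import Relation.Nullary using (¬_; Dec; yes; no; does)
open import Relation.Nullary.Decidable using (dec-true; _×-dec_; ¬?)
open import Relation.Binary.PropositionalEquality

-- Local density yields cliques inside every linear set but no edge between two given sets, so hubs
-- found separately are unrelated. Codegrees repair this: for every `t` in one set and `b` in the
-- other, the common neighbourhood is linear and contains cliques; by averaging, some clique is
-- joined to linear parts of both sets, and these contain cliques in turn. This three-layer
-- configuration serves twice. It joins consecutive hubs, and it leads the ball of an absorber `x`
-- back to a hub, with `N(x)` inside `N(u)`, distance 2 in the middle layer and distance 3 in the
-- hub. The leftover set `Y` has a second purpose: while it is unembedded, linearly many vertices of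
-- `G` are free, so a new hub exists at every stage. Only the interval around `Y` precedes the
-- balls, because the candidate set of `y` must be final before absorbers for `y` are sought.
-- Densities are expressed by natural numbers: `x ≤ c * y` says that `y` is at least the fraction
-- `1 / c` of `x`.

-- Arithmetic, finite sets and sums

-- Linear arithmetic by certificate: s is the slack.
lin : ∀ {X Y a b} s → X ≤ Y → a + Y + s ≡ b + X → a ≤ b
lin {X} {Y} {a} {b} s X≤Y eq = +-cancelʳ-≤ X a b (≤-trans (+-monoʳ-≤ a X≤Y) (≤-trans (m≤m+n (a + Y) s) (≤-reflexive eq)))

scale-trans : ∀ {x y z} a b → x ≤ a * y → y ≤ b * z → x ≤ (a * b) * z
scale-trans {x} {y} {z} a b p r = ≤-trans p (≤-trans (*-monoʳ-≤ a r) (≤-reflexive (sym (*-assoc a b z))))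

pos-factorʳ : ∀ {x} a b → 0 < x → x ≤ a * b → 0 < b
pos-factorʳ a zero p q = ⊥-elim (<⇒≱ p (≤-trans q (≤-reflexive (*-zeroʳ a))))
pos-factorʳ a (suc b) p q = s≤s z≤n

^-≥1 : ∀ b e → 1 ≤ b → 1 ≤ b ^ e
^-≥1 b zero p = ≤-refl
^-≥1 b (suc e) p = *-mono-≤ p (^-≥1 b e p)

^-monoʳ : ∀ b {e f} → 1 ≤ b → e ≤ f → b ^ e ≤ b ^ f
^-monoʳ b {f = f} p z≤n = ^-≥1 b f p
^-monoʳ b p (s≤s q) = *-monoʳ-≤ b (^-monoʳ b p q)

1≤* : ∀ {a b} → 1 ≤ a → 1 ≤ b → 1 ≤ a * b
1≤* p q = *-mono-≤ p q

≤-*ˡ : ∀ {a} b → 1 ≤ a → b ≤ a * b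
≤-*ˡ {a} b p = ≤-trans (≤-reflexive (sym (*-identityˡ b))) (*-monoˡ-≤ b p)

≤-*ʳ : ∀ {a} b → 1 ≤ a → b ≤ b * a
≤-*ʳ {a} b p = ≤-trans (≤-*ˡ b p) (≤-reflexive (*-comm a b))

Sub : ℕ → Set
Sub n = Fin n → Bool

infix 4 _∈_ _⊆_
infixl 7 _∩_
infixl 6 _∖_

_∈_ : ∀ {n} → Fin n → Sub n → Set
x ∈ A = A x ≡ true

_⊆_ : ∀ {n} → Sub n → Sub n → Set
A ⊆ B = ∀ x → x ∈ A → x ∈ B

_∩_ _∖_ : ∀ {n} → Sub n → Sub n → Sub n
(A ∩ B) x = A x ∧ B x
(A ∖ B) x = A x ∧ not (B x)

_≡ᶠ_ : ∀ {n} → Fin n → Fin n → Bool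
x ≡ᶠ y = does (x Finₚ.≟ y)

true≢false : ∀ {b} → b ≡ true → b ≡ false → ⊥
true≢false refl ()

¬true : ∀ {b} → ¬ b ≡ true → b ≡ false
¬true {true} p = ⊥-elim (p refl)
¬true {false} p = refl

true? : ∀ b → Dec (b ≡ true)
true? true = yes refl
true? false = no λ ()

∧-intro : ∀ {a b} → a ≡ true → b ≡ true → a ∧ b ≡ true
∧-intro refl refl = refl

∧-elimˡ : ∀ {a b} → a ∧ b ≡ true → a ≡ true
∧-elimˡ {true} p = refl

∧-elimʳ : ∀ {a b} → a ∧ b ≡ true → b ≡ true
∧-elimʳ {true} p = p

∨-elim : ∀ {a b} → a ∨ b ≡ true → a ≡ true ⊎ b ≡ true
∨-elim {true} p = inj₁ refl
∨-elim {false} p = inj₂ p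

∨-introˡ : ∀ {a} b → a ≡ true → a ∨ b ≡ true
∨-introˡ b refl = refl

∨-introʳ : ∀ a {b} → b ≡ true → a ∨ b ≡ true
∨-introʳ true p = refl
∨-introʳ false p = p

∨-false : ∀ {a b} → a ≡ false → b ≡ false → a ∨ b ≡ false
∨-false refl refl = refl

∨-falseˡ : ∀ {a b} → a ∨ b ≡ false → a ≡ false
∨-falseˡ {false} p = refl

∨-falseʳ : ∀ {a b} → a ∨ b ≡ false → b ≡ false
∨-falseʳ {false} p = p

not-intro : ∀ {a} → a ≡ false → not a ≡ true
not-intro refl = refl

not-elim : ∀ {a} → not a ≡ true → a ≡ false
not-elim {false} p = refl

does-elim : ∀ {P : Set} (d : Dec P) → does d ≡ true → P
does-elim (yes p) _ = p

≡ᶠ-refl : ∀ {n} (x : Fin n) → (x ≡ᶠ x) ≡ true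
≡ᶠ-refl x = dec-true (x Finₚ.≟ x) refl

≡ᶠ-sound : ∀ {n} {x y : Fin n} → (x ≡ᶠ y) ≡ true → x ≡ y
≡ᶠ-sound {x = x} {y} = does-elim (x Finₚ.≟ y)

any : ∀ {n} → Sub n → Bool
any A = does (Finₚ.any? (λ x → true? (A x)))

any-elim : ∀ {n} {A : Sub n} → any A ≡ true → ∃ λ x → x ∈ A
any-elim {A = A} = does-elim (Finₚ.any? (λ x → true? (A x)))

any-intro : ∀ {n} {A : Sub n} x → x ∈ A → any A ≡ true
any-intro {A = A} x p = dec-true (Finₚ.any? (λ x → true? (A x))) (x , p)

all : ∀ {n} → Sub n → Bool
all A = does (Finₚ.all? (λ x → true? (A x)))

all-elim : ∀ {n} {A : Sub n} → all A ≡ true → ∀ x → x ∈ A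
all-elim {A = A} = does-elim (Finₚ.all? (λ x → true? (A x)))

all-intro : ∀ {n} {A : Sub n} → (∀ x → x ∈ A) → all A ≡ true
all-intro {A = A} = dec-true (Finₚ.all? (λ x → true? (A x)))

opaque
  ∑ : ∀ {n} → (Fin n → ℕ) → ℕ
  ∑ {zero} f = 0
  ∑ {suc n} f = f zero + ∑ (λ i → f (suc i))

  ∑-mono : ∀ {n} {f g : Fin n → ℕ} → (∀ i → f i ≤ g i) → ∑ f ≤ ∑ g
  ∑-mono {zero} p = z≤n
  ∑-mono {suc n} p = +-mono-≤ (p zero) (∑-mono (p ∘ suc))

  ∑-const : ∀ n c → ∑ {n} (λ _ → c) ≡ n * c
  ∑-const zero c = refl
  ∑-const (suc n) c = cong (c +_) (∑-const n c)

  ∑-cong : ∀ {n} {f g : Fin n → ℕ} → (∀ i → f i ≡ g i) → ∑ f ≡ ∑ g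
  ∑-cong {zero} p = refl
  ∑-cong {suc n} p = cong₂ _+_ (p zero) (∑-cong (λ i → p (suc i)))

  ∑-+ : ∀ {n} (f g : Fin n → ℕ) → ∑ (λ i → f i + g i) ≡ ∑ f + ∑ g
  ∑-+ {zero} f g = refl
  ∑-+ {suc n} f g = trans (cong (f zero + g zero +_) (∑-+ (λ i → f (suc i)) (λ i → g (suc i)))) (interchange (f zero) (g zero) _ _)
    where
    interchange : ∀ a b c d → a + b + (c + d) ≡ a + c + (b + d)
    interchange = solve-∀

  ∑-comm : ∀ {m n} (f : Fin m → Fin n → ℕ) → ∑ (λ i → ∑ (λ j → f i j)) ≡ ∑ (λ j → ∑ (λ i → f i j))
  ∑-comm {zero} {n} f = sym (trans (∑-const n 0) (*-zeroʳ n))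
  ∑-comm {suc m} f = trans (cong (∑ (f zero) +_) (∑-comm (λ i → f (suc i)))) (sym (∑-+ (f zero) _))

  ∑-*ˡ : ∀ {n} c (f : Fin n → ℕ) → ∑ (λ i → c * f i) ≡ c * ∑ f
  ∑-*ˡ {zero} c f = sym (*-zeroʳ c)
  ∑-*ˡ {suc n} c f = trans (cong (c * f zero +_) (∑-*ˡ c (λ i → f (suc i)))) (sym (*-distribˡ-+ c _ _))

  ∑-*ʳ : ∀ {n} c (f : Fin n → ℕ) → ∑ (λ i → f i * c) ≡ ∑ f * c
  ∑-*ʳ c f = trans (∑-cong (λ i → *-comm (f i) c)) (trans (∑-*ˡ c f) (*-comm c _))

  ∑-< : ∀ {n} {f g : Fin n → ℕ} → 0 < n → (∀ i → f i < g i) → ∑ f < ∑ g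
  ∑-< {suc n} _ p = +-mono-<-≤ (p zero) (∑-mono (λ i → <⇒≤ (p (suc i))))

  term≤∑ : ∀ {n} (f : Fin n → ℕ) i → f i ≤ ∑ f
  term≤∑ f zero = m≤m+n _ _
  term≤∑ f (suc i) = ≤-trans (term≤∑ (f ∘ suc) i) (m≤n+m _ _)

  ∑-suc : ∀ {n} (f : Fin (suc n) → ℕ) → ∑ f ≡ f zero + ∑ (λ i → f (suc i))
  ∑-suc f = refl

  ∑-empty : (f : Fin 0 → ℕ) → ∑ f ≡ 0
  ∑-empty f = refl

opaque
  ∑-exists-≤ : ∀ {n} (f g : Fin n → ℕ) → 0 < n → ∑ f ≤ ∑ g → ∃ λ i → f i ≤ g i
  ∑-exists-≤ f g 0<n p with Finₚ.any? (λ i → f i ≤? g i)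
  ... | yes r = r
  ... | no ¬r = ⊥-elim (<⇒≱ (∑-< 0<n (λ i → ≰⇒> (λ q → ¬r (i , q)))) p)

  ∑-exists-< : ∀ {n} (f g : Fin n → ℕ) → ∑ f < ∑ g → ∃ λ i → f i < g i
  ∑-exists-< f g p with Finₚ.any? (λ i → f i <? g i)
  ... | yes r = r
  ... | no ¬r = ⊥-elim (<⇒≱ p (∑-mono (λ i → ≮⇒≥ (λ q → ¬r (i , q)))))

𝟙 : Bool → ℕ
𝟙 true = 1
𝟙 false = 0

𝟙≤1 : ∀ b → 𝟙 b ≤ 1
𝟙≤1 true = ≤-refl
𝟙≤1 false = z≤n

𝟙-mono : ∀ {a b} → (a ≡ true → b ≡ true) → 𝟙 a ≤ 𝟙 b
𝟙-mono {true} p rewrite p refl = ≤-refl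
𝟙-mono {false} p = z≤n

𝟙-∧ : ∀ a b → 𝟙 (a ∧ b) ≡ 𝟙 a * 𝟙 b
𝟙-∧ true b = sym (*-identityˡ (𝟙 b))
𝟙-∧ false b = refl

𝟙-true : ∀ {b} → b ≡ true → 𝟙 b ≡ 1
𝟙-true refl = refl

𝟙-false : ∀ {b} → b ≡ false → 𝟙 b ≡ 0
𝟙-false refl = refl

𝟙-pos : ∀ {b} → 0 < 𝟙 b → b ≡ true
𝟙-pos {true} _ = refl

#_ : ∀ {n} → Sub n → ℕ
# A = ∑ (𝟙 ∘ A)

infix 9 #_

#-mono : ∀ {n} {A B : Sub n} → A ⊆ B → # A ≤ # B
#-mono p = ∑-mono (λ i → 𝟙-mono (p i))

#-cong : ∀ {n} {A B : Sub n} → (∀ i → A i ≡ B i) → # A ≡ # B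
#-cong p = ∑-cong (λ i → cong 𝟙 (p i))

#≤n : ∀ {n} (A : Sub n) → # A ≤ n
#≤n {n} A = ≤-trans (∑-mono (λ i → 𝟙≤1 (A i))) (≤-reflexive (trans (∑-const n 1) (*-identityʳ n)))

#-full : ∀ n → # (λ (_ : Fin n) → true) ≡ n
#-full n = trans (∑-const n 1) (*-identityʳ n)

#-none : ∀ {n} {A : Sub n} → (∀ i → A i ≡ false) → # A ≡ 0
#-none {n} p = trans (∑-cong (λ i → 𝟙-false (p i))) (trans (∑-const n 0) (*-zeroʳ n))

opaque
  #-exists : ∀ {n} (A : Sub n) → 0 < # A → ∃ λ x → x ∈ A
  #-exists {n} A p with ∑-exists-< (λ (_ : Fin n) → 0) (𝟙 ∘ A) (subst (_< # A) (sym (trans (∑-const n 0) (*-zeroʳ n))) p)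
  ... | x , q = x , 𝟙-pos q

#-pos : ∀ {n} {A : Sub n} x → x ∈ A → 0 < # A
#-pos {A = A} x p = ≤-trans (≤-reflexive (sym (𝟙-true p))) (term≤∑ (𝟙 ∘ A) x)

#-split : ∀ {n} (A B : Sub n) → # A ≡ # (A ∩ B) + # (A ∖ B)
#-split A B = trans (∑-cong (λ i → pt (A i) (B i))) (∑-+ _ _)
  where
  pt : ∀ a b → 𝟙 a ≡ 𝟙 (a ∧ b) + 𝟙 (a ∧ not b)
  pt true true = refl
  pt true false = refl
  pt false b = refl

#-∖ : ∀ {n} (A B : Sub n) → # A ≤ # (A ∖ B) + # B
#-∖ A B = ≤-trans (≤-reflexive (trans (#-split A B) (+-comm (# (A ∩ B)) _))) (+-monoʳ-≤ _ (#-mono (λ x → ∧-elimʳ)))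

#-∪ : ∀ {n} (A B : Sub n) → # (λ x → A x ∨ B x) ≤ # A + # B
#-∪ A B = ≤-trans (∑-mono (λ i → pt (A i) (B i))) (≤-reflexive (∑-+ _ _))
  where
  pt : ∀ a b → 𝟙 (a ∨ b) ≤ 𝟙 a + 𝟙 b
  pt true b = s≤s z≤n
  pt false b = ≤-refl

opaque
  #-exists-∖ : ∀ {n} (A B : Sub n) → # B < # A → ∃ λ x → x ∈ A × B x ≡ false
  #-exists-∖ A B p with #-exists (A ∖ B) (+-cancelʳ-< (# B) 0 _ (<-≤-trans p (#-∖ A B)))
  ... | x , q = x , ∧-elimˡ q , not-elim (∧-elimʳ {A x} q)

#-singleton : ∀ {n} (x : Fin n) → # (x ≡ᶠ_) ≡ 1
#-singleton {suc n} zero = trans (∑-suc _) (cong suc (#-none {n} (λ i → refl)))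
#-singleton {suc n} (suc x) = trans (∑-suc _) (trans (∑-cong (λ i → cong 𝟙 (pt i))) (#-singleton x))
  where
  pt : ∀ i → (suc x ≡ᶠ suc i) ≡ (x ≡ᶠ i)
  pt i with x Finₚ.≟ i
  ... | yes p = refl
  ... | no p = refl

img : ∀ {n} → Sub n → (Fin n → Fin n) → Sub n
img dom φ x = any (λ w → dom w ∧ (φ w ≡ᶠ x))

img-intro : ∀ {n} {dom : Sub n} {φ : Fin n → Fin n} w → w ∈ dom → φ w ∈ img dom φ
img-intro {φ = φ} w p = any-intro w (∧-intro p (≡ᶠ-refl (φ w)))

-- Each point of the image in `Z` is charged to one of its preimages, and the sums are exchanged:
-- `w` can be charged only by `φ w`.
#-img : ∀ {n} (dom : Sub n) (φ : Fin n → Fin n) (Z : Sub n) → # (Z ∩ img dom φ) ≤ # (λ w → dom w ∧ Z (φ w))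
#-img dom φ Z = begin
  # (Z ∩ img dom φ)                                        ≤⟨ ∑-mono pt ⟩
  ∑ (λ x → ∑ (λ w → 𝟙 (dom w ∧ Z (φ w)) * 𝟙 (φ w ≡ᶠ x)))   ≡⟨ ∑-comm _ ⟩
  ∑ (λ w → ∑ (λ x → 𝟙 (dom w ∧ Z (φ w)) * 𝟙 (φ w ≡ᶠ x)))   ≡⟨ ∑-cong (λ w → trans (∑-*ˡ (𝟙 (dom w ∧ Z (φ w))) (λ x → 𝟙 (φ w ≡ᶠ x))) (trans (cong (𝟙 (dom w ∧ Z (φ w)) *_) (#-singleton (φ w))) (*-identityʳ _))) ⟩
  # (λ w → dom w ∧ Z (φ w))                                ∎
  where
  open ≤-Reasoning
  pt : ∀ x → 𝟙 (Z x ∧ img dom φ x) ≤ ∑ (λ w → 𝟙 (dom w ∧ Z (φ w)) * 𝟙 (φ w ≡ᶠ x))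
  pt x with true? (Z x ∧ img dom φ x)
  ... | no q = ≤-trans (≤-reflexive (𝟙-false (¬true q))) z≤n
  ... | yes q with any-elim {A = λ w → dom w ∧ (φ w ≡ᶠ x)} (∧-elimʳ {Z x} q)
  ... | w , r = ≤-trans (≤-reflexive (trans (𝟙-true q) (sym (cong₂ _*_ (𝟙-true e₁) (𝟙-true e₂))))) (term≤∑ (λ w → 𝟙 (dom w ∧ Z (φ w)) * 𝟙 (φ w ≡ᶠ x)) w)
    where
    e₂ : (φ w ≡ᶠ x) ≡ true
    e₂ = ∧-elimʳ {dom w} r
    e₁ : dom w ∧ Z (φ w) ≡ true
    e₁ = ∧-intro (∧-elimˡ r) (subst (_∈ Z) (sym (≡ᶠ-sound e₂)) (∧-elimˡ q))

#-img-≤ : ∀ {n} (dom : Sub n) (φ : Fin n → Fin n) → # (img dom φ) ≤ # dom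
#-img-≤ dom φ = ≤-trans (#-img dom φ (λ _ → true)) (#-mono (λ w → ∧-elimˡ))

∑ᵛ : ∀ {n} m → (Vec (Fin n) m → ℕ) → ℕ
∑ᵛ zero f = f []
∑ᵛ (suc m) f = ∑ (λ a → ∑ᵛ m (λ v → f (a ∷ v)))

∑ᵛ-mono : ∀ {n} m {f g : Vec (Fin n) m → ℕ} → (∀ v → f v ≤ g v) → ∑ᵛ m f ≤ ∑ᵛ m g
∑ᵛ-mono zero p = p []
∑ᵛ-mono (suc m) p = ∑-mono (λ a → ∑ᵛ-mono m (λ v → p (a ∷ v)))

∑ᵛ-cong : ∀ {n} m {f g : Vec (Fin n) m → ℕ} → (∀ v → f v ≡ g v) → ∑ᵛ m f ≡ ∑ᵛ m g
∑ᵛ-cong zero p = p []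
∑ᵛ-cong (suc m) p = ∑-cong (λ a → ∑ᵛ-cong m (λ v → p (a ∷ v)))

∑ᵛ-+ : ∀ {n} m (f g : Vec (Fin n) m → ℕ) → ∑ᵛ m (λ v → f v + g v) ≡ ∑ᵛ m f + ∑ᵛ m g
∑ᵛ-+ zero f g = refl
∑ᵛ-+ (suc m) f g = trans (∑-cong (λ a → ∑ᵛ-+ m _ _)) (∑-+ _ _)

∑ᵛ-*ˡ : ∀ {n} m c (f : Vec (Fin n) m → ℕ) → ∑ᵛ m (λ v → c * f v) ≡ c * ∑ᵛ m f
∑ᵛ-*ˡ zero c f = refl
∑ᵛ-*ˡ (suc m) c f = trans (∑-cong (λ a → ∑ᵛ-*ˡ m c _)) (∑-*ˡ c _)

∑ᵛ-*ʳ : ∀ {n} m c (f : Vec (Fin n) m → ℕ) → ∑ᵛ m (λ v → f v * c) ≡ ∑ᵛ m f * c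
∑ᵛ-*ʳ m c f = trans (∑ᵛ-cong m (λ v → *-comm (f v) c)) (trans (∑ᵛ-*ˡ m c f) (*-comm c _))

∑ᵛ-comm : ∀ {n p} m (f : Fin p → Vec (Fin n) m → ℕ) → ∑ᵛ m (λ v → ∑ (λ i → f i v)) ≡ ∑ (λ i → ∑ᵛ m (f i))
∑ᵛ-comm zero f = refl
∑ᵛ-comm (suc m) f = trans (∑-cong (λ a → ∑ᵛ-comm m _)) (∑-comm _)

∑ᵛ-++ : ∀ {n} m {p} (f : Vec (Fin n) (m + p) → ℕ) → ∑ᵛ (m + p) f ≡ ∑ᵛ m (λ u → ∑ᵛ p (λ v → f (u ++ v)))
∑ᵛ-++ zero f = refl
∑ᵛ-++ (suc m) f = ∑-cong (λ a → ∑ᵛ-++ m _)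

∑ᵛ-const : ∀ n m c → ∑ᵛ {n} m (λ _ → c) ≡ n ^ m * c
∑ᵛ-const n zero c = sym (*-identityˡ c)
∑ᵛ-const n (suc m) c = trans (∑-cong {n} (λ a → ∑ᵛ-const n m c)) (trans (∑-const n _) (sym (*-assoc n _ c)))

opaque
  ∑ᵛ-exists-≤ : ∀ {n} m (f g : Vec (Fin n) m → ℕ) → 0 < n → ∑ᵛ m f ≤ ∑ᵛ m g → ∃ λ v → f v ≤ g v
  ∑ᵛ-exists-≤ zero f g _ p = [] , p
  ∑ᵛ-exists-≤ (suc m) f g 0<n p with ∑-exists-≤ _ _ 0<n p
  ... | a , q with ∑ᵛ-exists-≤ m _ _ 0<n q
  ... | v , r = a ∷ v , r

-- Counting cliques

infix 4 _≤?ᵇ_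

_≤?ᵇ_ : ℕ → ℕ → Bool
a ≤?ᵇ b = does (a ≤? b)

≤?ᵇ-sound : ∀ {a b} → (a ≤?ᵇ b) ≡ true → a ≤ b
≤?ᵇ-sound {a} {b} = does-elim (a ≤? b)

≤?ᵇ-complete : ∀ {a b} → a ≤ b → (a ≤?ᵇ b) ≡ true
≤?ᵇ-complete {a} {b} = dec-true (a ≤? b)

≤?ᵇ-false : ∀ {a b} → (a ≤?ᵇ b) ≡ false → b < a
≤?ᵇ-false {a} {b} p = ≰⇒> (λ q → true≢false (≤?ᵇ-complete q) p)

-- Pointwise form of Markov's inequality, ready to be summed.
markov-pt : ∀ a f M Q → f ≤ M * 𝟙 a → 2 * Q * f ≤ 2 * Q * (M * 𝟙 (a ∧ (M ≤?ᵇ 2 * Q * f))) + M * 𝟙 a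
markov-pt a f M Q f≤ with true? (M ≤?ᵇ 2 * Q * f)
markov-pt false f M Q f≤ | _ = ≤-trans (*-monoʳ-≤ (2 * Q) (≤-trans f≤ (≤-reflexive (*-zeroʳ M)))) (≤-trans (≤-reflexive (*-zeroʳ (2 * Q))) z≤n)
markov-pt true f M Q f≤ | yes p rewrite p = ≤-trans (*-monoʳ-≤ (2 * Q) f≤) (m≤m+n _ _)
markov-pt true f M Q f≤ | no p = ≤-trans (<⇒≤ (≤?ᵇ-false {M} (¬true p))) (≤-trans (≤-reflexive (sym (*-identityʳ M))) (m≤n+m _ _))

-- A mass `s` is spread over `A` points of capacity `M`. The points below the threshold
-- `M / (2 * Q)` supply at most half of the guaranteed mass, so the `g` points above it supply the
-- rest.
markov-arith : ∀ {A g s M Q} → 0 < M → A * M ≤ Q * s → 2 * Q * s ≤ 2 * Q * (M * g) + M * A → A ≤ 2 * Q * g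
markov-arith {A} {g} {s} {M} {Q} 0<M h₁ h₂ = *-cancelˡ-≤ M {{>-nonZero 0<M}} (lin 0 (+-mono-≤ (+-mono-≤ h₁ h₁) h₂) (eq A g s M Q))
  where
  eq : ∀ A g s M Q → M * A + ((Q * s + Q * s) + (2 * Q * (M * g) + M * A)) + 0 ≡ M * (2 * Q * g) + ((A * M + A * M) + 2 * Q * s)
  eq = solve-∀

markov : ∀ {n} (A : Sub n) (f : Fin n → ℕ) M Q → 0 < M → (∀ v → f v ≤ M * 𝟙 (A v)) → # A * M ≤ Q * ∑ f → # A ≤ 2 * Q * # (λ v → A v ∧ (M ≤?ᵇ 2 * Q * f v))
markov A f M Q 0<M f≤ h = markov-arith {# A} {_} {∑ f} {M} {Q} 0<M h (begin
  2 * Q * ∑ f ≡⟨ sym (∑-*ˡ (2 * Q) f) ⟩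
  ∑ (λ v → 2 * Q * f v) ≤⟨ ∑-mono (λ v → markov-pt (A v) (f v) M Q (f≤ v)) ⟩
  ∑ (λ v → 2 * Q * (M * 𝟙 (A v ∧ (M ≤?ᵇ 2 * Q * f v))) + M * 𝟙 (A v)) ≡⟨ ∑-+ _ _ ⟩
  ∑ (λ v → 2 * Q * (M * 𝟙 (A v ∧ (M ≤?ᵇ 2 * Q * f v)))) + ∑ (λ v → M * 𝟙 (A v)) ≡⟨ cong₂ _+_ (trans (∑-*ˡ (2 * Q) (λ v → M * 𝟙 (A v ∧ (M ≤?ᵇ 2 * Q * f v)))) (cong (2 * Q *_) (∑-*ˡ M (λ v → 𝟙 (A v ∧ (M ≤?ᵇ 2 * Q * f v)))))) (∑-*ˡ M (λ v → 𝟙 (A v))) ⟩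
  2 * Q * (M * # (λ v → A v ∧ (M ≤?ᵇ 2 * Q * f v))) + M * # A ∎)
  where open ≤-Reasoning

*-^ : ∀ a b j → (a * b) ^ j ≡ a ^ j * b ^ j
*-^ a b zero = refl
*-^ a b (suc j) = trans (cong (a * b *_) (*-^ a b j)) (eq a b (a ^ j) (b ^ j))
  where
  eq : ∀ a b x y → a * b * (x * y) ≡ a * x * (b * y)
  eq = solve-∀

many-arith : ∀ {D S h gd x} → S ≤ 2 * D * h → h ≡ gd + x → 4 * D * x ≤ S → S ≤ 4 * D * gd
many-arith {D} {S} {_} {gd} {x} p refl r = lin 0 (+-mono-≤ (+-mono-≤ p p) r) (eq D S gd x)
  where
  eq : ∀ D S gd x → S + (2 * D * (gd + x) + 2 * D * (gd + x) + S) + 0 ≡ 4 * D * gd + (S + S + 4 * D * x)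
  eq = solve-∀

opaque
  -- The loss in counting cliques: at least one vertex in `4 * D` can start a clique, and passing to
  -- its neighbourhood shrinks the set by at most `2 * D` for each of the `j` remaining choices.
  Qc : ℕ → ℕ → ℕ
  Qc D zero = 1
  Qc D (suc j) = 4 * D * ((2 * D) ^ j * Qc D j)

  Qc-zero : ∀ D → Qc D 0 ≡ 1
  Qc-zero D = refl

  Qc-suc : ∀ D j → Qc D (suc j) ≡ 4 * D * ((2 * D) ^ j * Qc D j)
  Qc-suc D j = refl

module _ {n : ℕ} (g : Fin n → Sub n) where

  edges : Sub n → Sub n → ℕ
  edges A B = ∑ (λ v → 𝟙 (A v) * # (B ∩ g v))

  -- `edges A A` counts ordered pairs, so this is an edge density of at least about `1 / D` in every
  -- set of at least `n / σ` vertices.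
  LocallyDense : ℕ → ℕ → Set
  LocallyDense σ D = ∀ A → n ≤ σ * # A → # A * # A ≤ D * edges A A

  highDegree : ℕ → Sub n → Sub n
  highDegree D S v = S v ∧ (# S ≤?ᵇ 2 * D * (𝟙 (S v) * # (S ∩ g v)))

  highDegree-many : ∀ {σ D} → LocallyDense σ D → 0 < n → ∀ S → n ≤ σ * # S → # S ≤ 2 * D * # (highDegree D S)
  highDegree-many {σ} {D} ld 0<n S h = markov S (λ v → 𝟙 (S v) * # (S ∩ g v)) (# S) D (pos-factorʳ σ (# S) 0<n h) pt (ld S h)
    where
    pt : ∀ v → 𝟙 (S v) * # (S ∩ g v) ≤ # S * 𝟙 (S v)
    pt v = ≤-trans (*-monoʳ-≤ (𝟙 (S v)) (#-mono (λ x → ∧-elimˡ))) (≤-reflexive (*-comm (𝟙 (S v)) (# S)))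

  highDegree-deg : ∀ {D S v} → v ∈ highDegree D S → # S ≤ 2 * D * # (S ∩ g v)
  highDegree-deg {D} {S} {v} p = ≤-trans (≤?ᵇ-sound {# S} (∧-elimʳ {S v} p)) (≤-reflexive (cong (2 * D *_) (trans (cong (_* # (S ∩ g v)) (𝟙-true (∧-elimˡ {S v} p))) (*-identityˡ _))))

  CN : ∀ {j} → Vec (Fin n) j → Sub n
  CN [] x = true
  CN (v ∷ vs) x = g v x ∧ CN vs x

  CN-lookup : ∀ {j} (vs : Vec (Fin n) j) {x} → x ∈ CN vs → ∀ i → x ∈ g (lookup vs i)
  CN-lookup (v ∷ vs) p zero = ∧-elimˡ p
  CN-lookup (v ∷ vs) p (suc i) = CN-lookup vs (∧-elimʳ {g v _} p) i

  module _ (q : ℕ) {r : ℕ} where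

    typical : (Fin r → Sub n) → Sub n
    typical Bs v = all (λ c → # (Bs c) ≤?ᵇ q * # (Bs c ∩ g v))
    -- A clique built one vertex at a time, where each new vertex keeps a fraction `1 / q` of every
    -- set `Bs c` as left by the earlier choices. A clique of `j` vertices thus has a fraction
    -- `1 / q ^ j` of every `Bs c` as common neighbours.
    typClique : ∀ {j} → (Fin r → Sub n) → Sub n → Vec (Fin n) j → Bool
    typClique Bs S [] = true
    typClique Bs S (v ∷ vs) = (S v ∧ typical Bs v) ∧ typClique (λ c → Bs c ∩ g v) (S ∩ g v) vs

    -- Uniform over all subfamilies that are not too small, because the sets `Bs c` shrink while a
    -- clique grows.
    FewAtypical : ℕ → ℕ → Sub n → (Fin r → Sub n) → Set
    FewAtypical E κ B₀ Bs₀ = ∀ Bs → (∀ c → Bs c ⊆ Bs₀ c) → (∀ c → # (Bs₀ c) ≤ E * # (Bs c)) → κ * # (B₀ ∖ typical Bs) ≤ # B₀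

    -- `i` counts the vertices already chosen; `s₁` and `s₂` measure `S` against `n` and `B₀`.
    -- High-degree vertices make up a fraction `1 / (2 * D)` of `S`. At most half of them are
    -- atypical, because `S` is still a fixed fraction of `B₀` and `κ` is large against it.
    typClique-count : ∀ {σ D} → LocallyDense σ D → 0 < n → ∀ {E κ B₀ Bs₀} → FewAtypical E κ B₀ Bs₀ → 1 ≤ q →
      ∀ j {Bs S} i s₁ s₂ → S ⊆ B₀ → (∀ c → Bs c ⊆ Bs₀ c) → (∀ c → # (Bs₀ c) ≤ q ^ i * # (Bs c)) → q ^ (i + j) ≤ E →
      1 ≤ D → n ≤ s₁ * # S → s₁ * (2 * D) ^ j ≤ σ → # B₀ ≤ s₂ * # S → 4 * D * (s₂ * (2 * D) ^ j) ≤ κ →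
      # S ^ j ≤ Qc D j * ∑ᵛ j (λ vs → 𝟙 (typClique Bs S vs))
    typClique-count ld 0<n few 1≤q zero i s₁ s₂ _ _ _ _ _ _ _ _ _ = ≤-reflexive (sym (trans (*-identityʳ _) (Qc-zero _)))
    typClique-count {σ} {D} ld 0<n {E} {κ} {B₀} {Bs₀} few 1≤q (suc j) {Bs} {S} i s₁ s₂ S⊆ Bs⊆ Bs≥ qE 1≤D hs₁ hσ hs₂ hκ = begin
        # S * # S ^ j                                  ≤⟨ *-monoˡ-≤ (# S ^ j) many ⟩
        4 * D * # good * # S ^ j                        ≡⟨ *-assoc (4 * D) (# good) _ ⟩
        4 * D * (# good * # S ^ j)                      ≡⟨ cong (4 * D *_) (sym (∑-*ʳ (# S ^ j) (λ v → 𝟙 (good v)))) ⟩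
        4 * D * ∑ (λ v → 𝟙 (good v) * # S ^ j)          ≤⟨ *-monoʳ-≤ (4 * D) (∑-mono pt) ⟩
        4 * D * ∑ (λ v → c′ * ∑ᵛ j (λ vs → 𝟙 (typClique Bs S (v ∷ vs)))) ≡⟨ cong (4 * D *_) (∑-*ˡ c′ (λ v → ∑ᵛ j (λ vs → 𝟙 (typClique Bs S (v ∷ vs))))) ⟩
        4 * D * (c′ * ∑ (λ v → ∑ᵛ j (λ vs → 𝟙 (typClique Bs S (v ∷ vs))))) ≡⟨ sym (*-assoc (4 * D) c′ _) ⟩
        4 * D * c′ * ∑ (λ v → ∑ᵛ j (λ vs → 𝟙 (typClique Bs S (v ∷ vs)))) ≡⟨ cong (_* ∑ᵛ (suc j) (λ vs → 𝟙 (typClique Bs S vs))) (sym (Qc-suc D j)) ⟩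
        Qc D (suc j) * ∑ᵛ (suc j) (λ vs → 𝟙 (typClique Bs S vs)) ∎
      where
      open ≤-Reasoning
      c′ = (2 * D) ^ j * Qc D j
      good : Sub n
      good v = highDegree D S v ∧ typical Bs v
      1≤2D^ : 1 ≤ (2 * D) ^ suc j
      1≤2D^ = ^-≥1 (2 * D) (suc j) (1≤* {2} (s≤s z≤n) 1≤D)
      n≤σS : n ≤ σ * # S
      n≤σS = ≤-trans hs₁ (*-monoˡ-≤ (# S) (≤-trans (≤-*ʳ s₁ 1≤2D^) hσ))
      atyp : 4 * D * # (highDegree D S ∖ typical Bs) ≤ # S
      atyp = bound s₂ hs₂ hκ
        where
        bound : ∀ s → # B₀ ≤ s * # S → 4 * D * (s * (2 * D) ^ suc j) ≤ κ → 4 * D * # (highDegree D S ∖ typical Bs) ≤ # S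
        -- Here `B₀` is empty, and there is no factor `s₂` to cancel.
        bound zero hs₂ _ = ≤-trans (*-monoʳ-≤ (4 * D) (≤-trans (#-mono (λ x p → S⊆ x (∧-elimˡ (∧-elimˡ {highDegree D S x} p)))) hs₂)) (≤-trans (≤-reflexive (*-zeroʳ (4 * D))) z≤n)
        bound (suc s) hs₂ hκ = *-cancelˡ-≤ (suc s) (begin
          suc s * (4 * D * # (highDegree D S ∖ typical Bs)) ≡⟨ trans (sym (*-assoc (suc s) (4 * D) _)) (cong (_* # (highDegree D S ∖ typical Bs)) (*-comm (suc s) (4 * D))) ⟩
          4 * D * suc s * # (highDegree D S ∖ typical Bs) ≤⟨ *-mono-≤ (≤-trans (*-monoʳ-≤ (4 * D) (≤-*ʳ (suc s) 1≤2D^)) hκ) (#-mono sub) ⟩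
          κ * # (B₀ ∖ typical Bs) ≤⟨ few Bs Bs⊆ (λ c → ≤-trans (Bs≥ c) (*-monoˡ-≤ (# (Bs c)) (≤-trans (^-monoʳ q 1≤q (m≤m+n i (suc j))) qE))) ⟩
          # B₀ ≤⟨ hs₂ ⟩
          suc s * # S ∎)
          where
          sub : (highDegree D S ∖ typical Bs) ⊆ (B₀ ∖ typical Bs)
          sub x p = ∧-intro (S⊆ x (∧-elimˡ (∧-elimˡ {highDegree D S x} p))) (∧-elimʳ {highDegree D S x} p)
      many : # S ≤ 4 * D * # good
      many = many-arith {D = D} (highDegree-many {σ} {D} ld 0<n S n≤σS) (#-split (highDegree D S) (typical Bs)) atyp
      pt : ∀ v → 𝟙 (good v) * # S ^ j ≤ c′ * ∑ᵛ j (λ vs → 𝟙 (typClique Bs S (v ∷ vs)))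
      pt v with true? (good v)
      ... | no p = ≤-trans (≤-reflexive (cong (_* # S ^ j) (𝟙-false (¬true p)))) z≤n
      ... | yes p = begin
          𝟙 (good v) * # S ^ j        ≡⟨ trans (cong (_* # S ^ j) (𝟙-true p)) (*-identityˡ _) ⟩
          # S ^ j                     ≤⟨ ^-monoˡ-≤ j (highDegree-deg {D} (∧-elimˡ p)) ⟩
          (2 * D * # (S ∩ g v)) ^ j   ≡⟨ *-^ (2 * D) _ j ⟩
          (2 * D) ^ j * # (S ∩ g v) ^ j ≤⟨ *-monoʳ-≤ ((2 * D) ^ j) ih ⟩
          (2 * D) ^ j * (Qc D j * ∑ᵛ j (λ vs → 𝟙 (typClique (λ c → Bs c ∩ g v) (S ∩ g v) vs))) ≡⟨ sym (*-assoc ((2 * D) ^ j) (Qc D j) _) ⟩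
          c′ * ∑ᵛ j (λ vs → 𝟙 (typClique (λ c → Bs c ∩ g v) (S ∩ g v) vs)) ≤⟨ *-monoʳ-≤ c′ (∑ᵛ-mono j (λ vs → 𝟙-mono (∧-intro (∧-intro v∈S v-typ)))) ⟩
          c′ * ∑ᵛ j (λ vs → 𝟙 (typClique Bs S (v ∷ vs))) ∎
        where
        v∈S : v ∈ S
        v∈S = ∧-elimˡ (∧-elimˡ {highDegree D S v} p)
        v-typ : v ∈ typical Bs
        v-typ = ∧-elimʳ {highDegree D S v} p
        ih = typClique-count ld 0<n few 1≤q j {λ c → Bs c ∩ g v} {S ∩ g v} (suc i) (s₁ * (2 * D)) (s₂ * (2 * D))
          (λ x r → S⊆ x (∧-elimˡ r)) (λ c x r → Bs⊆ c x (∧-elimˡ r))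
          (λ c → ≤-trans (scale-trans (q ^ i) q (Bs≥ c) (≤?ᵇ-sound {# (Bs c)} (all-elim {A = λ c → # (Bs c) ≤?ᵇ q * # (Bs c ∩ g v)} v-typ c))) (≤-reflexive (cong (_* # (Bs c ∩ g v)) (*-comm (q ^ i) q))))
          (subst (λ e → q ^ e ≤ E) (+-suc i j) qE) 1≤D
          (scale-trans s₁ (2 * D) hs₁ (highDegree-deg {D} (∧-elimˡ p)))
          (≤-trans (≤-reflexive (*-assoc s₁ (2 * D) _)) hσ)
          (scale-trans s₂ (2 * D) hs₂ (highDegree-deg {D} (∧-elimˡ p)))
          (≤-trans (≤-reflexive (cong (4 * D *_) (*-assoc s₂ (2 * D) _))) hκ)

    typClique-∈ : ∀ {j} {Bs S} (vs : Vec (Fin n) j) → typClique Bs S vs ≡ true → ∀ i → lookup vs i ∈ S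
    typClique-∈ {S = S} (v ∷ vs) p zero = ∧-elimˡ (∧-elimˡ {S v ∧ _} p)
    typClique-∈ {Bs = Bs} {S} (v ∷ vs) p (suc i) = ∧-elimˡ (typClique-∈ vs (∧-elimʳ {S v ∧ typical Bs v} p) i)

    typClique-adj : (∀ x y → g x y ≡ g y x) → ∀ {j} {Bs S} (vs : Vec (Fin n) j) → typClique Bs S vs ≡ true → ∀ i l → ¬ i ≡ l → lookup vs l ∈ g (lookup vs i)
    typClique-adj gs (v ∷ vs) p zero zero i≢ = ⊥-elim (i≢ refl)
    typClique-adj gs {Bs = Bs} {S} (v ∷ vs) p zero (suc l) i≢ = ∧-elimʳ {S (lookup vs l)} (typClique-∈ vs (∧-elimʳ {S v ∧ typical Bs v} p) l)
    typClique-adj gs {Bs = Bs} {S} (v ∷ vs) p (suc i) zero i≢ = trans (gs _ _) (∧-elimʳ {S (lookup vs i)} (typClique-∈ vs (∧-elimʳ {S v ∧ typical Bs v} p) i))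
    typClique-adj gs {Bs = Bs} {S} (v ∷ vs) p (suc i) (suc l) i≢ = typClique-adj gs vs (∧-elimʳ {S v ∧ typical Bs v} p) i l (λ e → i≢ (cong suc e))

    typClique-CN : ∀ {j} {Bs S} (vs : Vec (Fin n) j) → typClique Bs S vs ≡ true → ∀ c → # (Bs c) ≤ q ^ j * # (Bs c ∩ CN vs)
    typClique-CN {Bs = Bs} [] p c = ≤-trans (#-mono (λ x r → ∧-intro r refl)) (≤-reflexive (sym (*-identityˡ _)))
    typClique-CN {suc j} {Bs} {S} (v ∷ vs) p c = scale-trans q (q ^ j)
      (≤?ᵇ-sound {# (Bs c)} (all-elim {A = λ c → # (Bs c) ≤?ᵇ q * # (Bs c ∩ g v)} (∧-elimʳ {S v} (∧-elimˡ {S v ∧ typical Bs v} p)) c))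
      (≤-trans (typClique-CN {Bs = λ c → Bs c ∩ g v} vs (∧-elimʳ {S v ∧ typical Bs v} p) c) (*-monoʳ-≤ (q ^ j) (#-mono (λ x r → ∧-intro {Bs c x} (∧-elimˡ {Bs c x} (∧-elimˡ {Bs c x ∧ g v x} r)) (∧-intro (∧-elimʳ {Bs c x} (∧-elimˡ {Bs c x ∧ g v x} r)) (∧-elimʳ {Bs c x ∧ g v x} r))))))

    typClique-mono : ∀ {j} {Bs S S′} (vs : Vec (Fin n) j) → S ⊆ S′ → typClique Bs S vs ≡ true → typClique Bs S′ vs ≡ true
    typClique-mono [] h p = refl
    typClique-mono {Bs = Bs} {S} (v ∷ vs) h p = ∧-intro (∧-intro (h v (∧-elimˡ (∧-elimˡ {S v ∧ typical Bs v} p))) (∧-elimʳ {S v} (∧-elimˡ {S v ∧ typical Bs v} p)))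
      (typClique-mono vs (λ x r → ∧-intro (h x (∧-elimˡ r)) (∧-elimʳ {S x} r)) (∧-elimʳ {S v ∧ typical Bs v} p))

-- Linking two sets through a third

-- `Q₁` is the loss for a middle clique inside a common neighbourhood of relative size `1 / e`. `Q₂`
-- is the loss for the clique in one end set after that set has shrunk by `2 * Q₁`. `Qlink` pays for
-- both ends and for the selection of good middle cliques.
Q₁ Q₂ Qlink : ℕ → ℕ → ℕ → ℕ
Q₁ D e k = e ^ k * Qc D k
Q₂ D e k = (2 * Q₁ D e k) ^ k * Qc D k
Qlink D e k = 2 * Q₁ D e k * (Q₂ D e k * Q₂ D e k)

Qc≥1 : ∀ D j → 1 ≤ D → 1 ≤ Qc D j
Qc≥1 D zero p = ≤-reflexive (sym (Qc-zero D))
Qc≥1 D (suc j) p = subst (1 ≤_) (sym (Qc-suc D j)) (1≤* (1≤* {4} (s≤s z≤n) p) (1≤* (^-≥1 (2 * D) j (1≤* {2} (s≤s z≤n) p)) (Qc≥1 D j p)))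

Q₁≥1 : ∀ D e k → 1 ≤ D → 1 ≤ e → 1 ≤ Q₁ D e k
Q₁≥1 D e k p r = 1≤* (^-≥1 e k r) (Qc≥1 D k p)

Qlink≥1 : ∀ D e k → 1 ≤ D → 1 ≤ e → 1 ≤ Qlink D e k
Qlink≥1 D e k p r = 1≤* (1≤* {2} (s≤s z≤n) 1≤q₁) (1≤* 1≤q₂ 1≤q₂)
  where
  1≤q₁ = Q₁≥1 D e k p r
  1≤q₂ : 1 ≤ Q₂ D e k
  1≤q₂ = 1≤* (^-≥1 (2 * Q₁ D e k) k (1≤* {2} (s≤s z≤n) 1≤q₁)) (Qc≥1 D k p)

cancel-factor : ∀ {a b x y c} → 0 < a * b → y ≤ b → a * b ≤ c * (x * y) → a ≤ c * x
cancel-factor {a} {zero} 0<ab _ _ = ⊥-elim (<⇒≱ 0<ab (≤-reflexive (*-zeroʳ a)))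
cancel-factor {a} {suc b} {x} {y} {c} 0<ab y≤b h = *-cancelʳ-≤ a (c * x) (suc b) (≤-trans h (≤-trans (≤-reflexive (sym (*-assoc c x y))) (*-monoʳ-≤ (c * x) y≤b)))

module _ {n : ℕ} (g : Fin n → Sub n) where

  typClique-count≤ : ∀ q {r} j {Bs : Fin r → Sub n} {S} → ∑ᵛ j (λ vs → 𝟙 (typClique g q Bs S vs)) ≤ # S ^ j
  typClique-count≤ q zero = ≤-refl
  typClique-count≤ q (suc j) {Bs} {S} = ≤-trans (∑-mono pt) (≤-reflexive (∑-*ʳ (# S ^ j) (λ a → 𝟙 (S a))))
    where
    pt : ∀ a → ∑ᵛ j (λ vs → 𝟙 (typClique g q Bs S (a ∷ vs))) ≤ 𝟙 (S a) * # S ^ j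
    pt a = begin
      ∑ᵛ j (λ vs → 𝟙 (typClique g q Bs S (a ∷ vs))) ≤⟨ ∑ᵛ-mono j (λ vs → ≤-trans (≤-reflexive (𝟙-∧ (S a ∧ typical g q Bs a) _)) (*-monoˡ-≤ _ (𝟙-mono {S a ∧ typical g q Bs a} {S a} (∧-elimˡ {S a})))) ⟩
      ∑ᵛ j (λ vs → 𝟙 (S a) * 𝟙 (typClique g q (λ c → Bs c ∩ g a) (S ∩ g a) vs)) ≡⟨ ∑ᵛ-*ˡ j (𝟙 (S a)) _ ⟩
      𝟙 (S a) * ∑ᵛ j (λ vs → 𝟙 (typClique g q (λ c → Bs c ∩ g a) (S ∩ g a) vs)) ≤⟨ *-monoʳ-≤ (𝟙 (S a)) (≤-trans (typClique-count≤ q j) (^-monoˡ-≤ j (#-mono (λ x → ∧-elimˡ)))) ⟩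
      𝟙 (S a) * # S ^ j ∎
      where open ≤-Reasoning

  -- With no sets to keep large every vertex is typical, so these are the ordinary cliques.
  clique : ∀ {j} → Sub n → Vec (Fin n) j → Bool
  clique = typClique g 1 {0} (λ ())

  clique-count : ∀ {σ D} → LocallyDense g σ D → 0 < n → 1 ≤ D → ∀ j {S} s → n ≤ s * # S → s * (2 * D) ^ j ≤ σ →
    # S ^ j ≤ Qc D j * ∑ᵛ j (λ vs → 𝟙 (clique S vs))
  clique-count {σ} {D} ld 0<n 1≤D j {S} s hs hσ =
    typClique-count g 1 ld 0<n {1 ^ j} {4 * D * (1 * (2 * D) ^ j)} {S} {λ ()} few ≤-refl j 0 s 1 (λ _ p → p) (λ ()) (λ ()) ≤-refl 1≤D hs hσ (≤-reflexive (sym (*-identityˡ _))) ≤-refl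
    where
    few : FewAtypical g 1 {0} (1 ^ j) (4 * D * (1 * (2 * D) ^ j)) S (λ ())
    few Bs _ _ = ≤-trans (≤-reflexive (trans (cong (4 * D * (1 * (2 * D) ^ j) *_) (#-none none)) (*-zeroʳ (4 * D * (1 * (2 * D) ^ j))))) z≤n
      where
      none : ∀ x → (S ∖ typical g 1 Bs) x ≡ false
      none x = ¬true (λ p → true≢false (all-intro {A = λ c → # (Bs c) ≤?ᵇ 1 * # (Bs c ∩ g x)} (λ ())) (not-elim (∧-elimʳ {S x} p)))

  CN-intro : (∀ x y → g x y ≡ g y x) → ∀ {q r j Bs S x} (vs : Vec (Fin n) j) → typClique g q {r} Bs S vs ≡ true → (∀ y → y ∈ S → y ∈ g x) → x ∈ CN g vs
  CN-intro gs [] _ _ = refl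
  CN-intro gs {q} {r} {Bs = Bs} {S} {x} (v ∷ vs) p h = ∧-intro (trans (gs v x) (h v (∧-elimˡ (∧-elimˡ {S v ∧ typical g q Bs v} p)))) (CN-intro gs {q} {r} {Bs = λ c → Bs c ∩ g v} {S ∩ g v} vs (∧-elimʳ {S v ∧ typical g q Bs v} p) (λ y r → h y (∧-elimˡ {S y} r)))

  -- A middle clique and one clique in each end set, both joined completely to the middle. Nothing
  -- is asked between the two ends. Only the end `B` looks after the sets `Bs`.
  link : ∀ q {r} (Bs : Fin r → Sub n) (R U B : Sub n) {k} → Vec (Fin n) k → Vec (Fin n) k → Vec (Fin n) k → Bool
  link q Bs R U B ms ts ds = clique U ms ∧ (clique (R ∩ CN g ms) ts ∧ typClique g q Bs (B ∩ CN g ms) ds)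

  module _ (gs : ∀ x y → g x y ≡ g y x) {σ D} (ld : LocallyDense g σ D) (0<n : 0 < n) (1≤D : 1 ≤ D)
           {q r : ℕ} (1≤q : 1 ≤ q) {E κ : ℕ} {B₀ : Sub n} {Bs : Fin r → Sub n} (few : FewAtypical g q E κ B₀ Bs)
           (R U B : Sub n) where

    -- Pairs `(t , b)` from the two ends are counted together with the middle cliques in their
    -- common neighbourhood. After exchanging the sums, a positive fraction of the cliques `ms` see
    -- linear parts of `R` and of `B` at once, and local density supplies the end cliques there.
    link-count : ∀ k e s s₀ → 1 ≤ e → n ≤ s * # R → n ≤ s * # U → n ≤ s * # B → B ⊆ B₀ → # B₀ ≤ s₀ * # B →
      (∀ t b → t ∈ R → b ∈ B → # U ≤ e * # (U ∩ g t ∩ g b)) →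
      s * (e * (2 * Q₁ D e k)) * (2 * D) ^ k ≤ σ → q ^ k ≤ E → 4 * D * (s₀ * (2 * Q₁ D e k) * (2 * D) ^ k) ≤ κ →
      # U ^ k * (# R ^ k * # B ^ k) ≤ Qlink D e k * ∑ᵛ k (λ ms → ∑ᵛ k (λ ts → ∑ᵛ k (λ ds → 𝟙 (link q Bs R U B ms ts ds))))
    link-count k e s s₀ 1≤e hR hU hB B⊆ hB₀ codeg hσ hE hκ = begin
        # U ^ k * (# R ^ k * # B ^ k)                                     ≤⟨ *-monoˡ-≤ _ step₂ ⟩
        2 * q₁ * G * (# R ^ k * # B ^ k)                                  ≡⟨ trans (*-assoc (2 * q₁) G _) (cong (2 * q₁ *_) (sym (∑ᵛ-*ʳ k (# R ^ k * # B ^ k) _))) ⟩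
        2 * q₁ * ∑ᵛ k (λ ms → 𝟙 (good ms) * (# R ^ k * # B ^ k))           ≤⟨ *-monoʳ-≤ (2 * q₁) (∑ᵛ-mono k step₃) ⟩
        2 * q₁ * ∑ᵛ k (λ ms → q₂ * q₂ * ∑ᵛ k (λ ts → ∑ᵛ k (λ ds → 𝟙 (link q Bs R U B ms ts ds)))) ≡⟨ trans (cong (2 * q₁ *_) (∑ᵛ-*ˡ k (q₂ * q₂) _)) (sym (*-assoc (2 * q₁) (q₂ * q₂) _)) ⟩
        Qlink D e k * ∑ᵛ k (λ ms → ∑ᵛ k (λ ts → ∑ᵛ k (λ ds → 𝟙 (link q Bs R U B ms ts ds)))) ∎
      where
      open ≤-Reasoning
      q₁ = Q₁ D e k
      q₂ = Q₂ D e k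
      1≤q₁ : 1 ≤ q₁
      1≤q₁ = Q₁≥1 D e k 1≤D 1≤e
      1≤2q₁ : 1 ≤ 2 * q₁
      1≤2q₁ = 1≤* {2} (s≤s z≤n) 1≤q₁
      M = # R * # B
      0<M : 0 < M
      0<M = 1≤* (pos-factorʳ s _ 0<n hR) (pos-factorʳ s _ 0<n hB)
      F : Vec (Fin n) k → ℕ
      F ms = 𝟙 (clique U ms) * (# (R ∩ CN g ms) * # (B ∩ CN g ms))
      good : Vec (Fin n) k → Bool
      good ms = clique U ms ∧ (M ≤?ᵇ 2 * q₁ * F ms)
      G = ∑ᵛ k (λ ms → 𝟙 (good ms))
      F-expand : ∀ ms → F ms ≡ ∑ (λ t → ∑ (λ b → 𝟙 (clique U ms) * (𝟙 ((R ∩ CN g ms) t) * 𝟙 ((B ∩ CN g ms) b))))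
      F-expand ms = sym (trans (∑-cong (λ t → trans (∑-*ˡ (𝟙 (clique U ms)) (λ b → 𝟙 ((R ∩ CN g ms) t) * 𝟙 ((B ∩ CN g ms) b))) (cong (𝟙 (clique U ms) *_) (∑-*ˡ (𝟙 ((R ∩ CN g ms) t)) (λ b → 𝟙 ((B ∩ CN g ms) b)))))) (trans (∑-*ˡ (𝟙 (clique U ms)) (λ t → 𝟙 ((R ∩ CN g ms) t) * # (B ∩ CN g ms))) (cong (𝟙 (clique U ms) *_) (∑-*ʳ (# (B ∩ CN g ms)) (λ t → 𝟙 ((R ∩ CN g ms) t))))))
      per-pair : ∀ t b → 𝟙 (R t) * 𝟙 (B b) * # U ^ k ≤ q₁ * ∑ᵛ k (λ ms → 𝟙 (clique U ms) * (𝟙 ((R ∩ CN g ms) t) * 𝟙 ((B ∩ CN g ms) b)))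
      per-pair t b with true? (R t) | true? (B b)
      ... | no p | _ = ≤-trans (≤-reflexive (cong (λ x → x * 𝟙 (B b) * # U ^ k) (𝟙-false (¬true p)))) z≤n
      ... | yes p | no p′ = ≤-trans (≤-reflexive (trans (cong (λ x → 𝟙 (R t) * x * # U ^ k) (𝟙-false (¬true p′))) (cong (_* # U ^ k) (*-zeroʳ (𝟙 (R t)))))) z≤n
      ... | yes p | yes p′ = begin
          𝟙 (R t) * 𝟙 (B b) * # U ^ k ≡⟨ trans (cong (_* # U ^ k) (cong₂ _*_ (𝟙-true p) (𝟙-true p′))) (*-identityˡ _) ⟩
          # U ^ k ≤⟨ ^-monoˡ-≤ k (codeg t b p p′) ⟩
          (e * # U′) ^ k ≡⟨ *-^ e _ k ⟩
          e ^ k * # U′ ^ k ≤⟨ *-monoʳ-≤ (e ^ k) (clique-count ld 0<n 1≤D k {U′} (s * e) (scale-trans s e hU (codeg t b p p′)) (≤-trans (*-monoˡ-≤ ((2 * D) ^ k) (≤-trans (*-monoʳ-≤ s (≤-*ʳ e 1≤2q₁)) ≤-refl)) hσ)) ⟩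
          e ^ k * (Qc D k * ∑ᵛ k (λ ms → 𝟙 (clique U′ ms))) ≡⟨ sym (*-assoc (e ^ k) _ _) ⟩
          q₁ * ∑ᵛ k (λ ms → 𝟙 (clique U′ ms)) ≤⟨ *-monoʳ-≤ q₁ (∑ᵛ-mono k (λ ms → pt ms)) ⟩
          q₁ * ∑ᵛ k (λ ms → 𝟙 (clique U ms) * (𝟙 ((R ∩ CN g ms) t) * 𝟙 ((B ∩ CN g ms) b))) ∎
        where
        U′ = U ∩ g t ∩ g b
        pt : ∀ ms → 𝟙 (clique U′ ms) ≤ 𝟙 (clique U ms) * (𝟙 ((R ∩ CN g ms) t) * 𝟙 ((B ∩ CN g ms) b))
        pt ms with true? (clique U′ ms)
        ... | no r = ≤-trans (≤-reflexive (𝟙-false (¬true r))) z≤n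
        ... | yes r = ≤-reflexive (trans (𝟙-true r) (sym (cong₂ _*_ (𝟙-true (typClique-mono g 1 ms (λ x z → ∧-elimˡ (∧-elimˡ {U x ∧ g t x} z)) r)) (cong₂ _*_ (𝟙-true (∧-intro p (CN-intro gs ms r (λ y z → ∧-elimʳ {U y} (∧-elimˡ {U y ∧ g t y} z))))) (𝟙-true (∧-intro p′ (CN-intro gs ms r (λ y z → ∧-elimʳ {U y ∧ g t y} z))))))))
      step₁ : # U ^ k * M ≤ q₁ * ∑ᵛ k F
      step₁ = begin
        # U ^ k * M ≡⟨ trans (*-comm (# U ^ k) M) (trans (cong (_* # U ^ k) (sym (trans (∑-cong (λ t → ∑-*ˡ (𝟙 (R t)) (λ b → 𝟙 (B b)))) (∑-*ʳ (# B) (λ t → 𝟙 (R t)))))) (sym (trans (∑-cong (λ t → ∑-*ʳ (# U ^ k) (λ b → 𝟙 (R t) * 𝟙 (B b)))) (∑-*ʳ (# U ^ k) (λ t → ∑ (λ b → 𝟙 (R t) * 𝟙 (B b))))))) ⟩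
        ∑ (λ t → ∑ (λ b → 𝟙 (R t) * 𝟙 (B b) * # U ^ k)) ≤⟨ ∑-mono (λ t → ∑-mono (λ b → per-pair t b)) ⟩
        ∑ (λ t → ∑ (λ b → q₁ * ∑ᵛ k (λ ms → H ms t b))) ≡⟨ trans (∑-cong (λ t → ∑-*ˡ q₁ (λ b → ∑ᵛ k (λ ms → H ms t b)))) (∑-*ˡ q₁ (λ t → ∑ (λ b → ∑ᵛ k (λ ms → H ms t b)))) ⟩
        q₁ * ∑ (λ t → ∑ (λ b → ∑ᵛ k (λ ms → H ms t b))) ≡⟨ cong (q₁ *_) (sym (trans (∑ᵛ-comm k (λ t ms → ∑ (λ b → H ms t b))) (∑-cong (λ t → ∑ᵛ-comm k (λ b ms → H ms t b))))) ⟩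
        q₁ * ∑ᵛ k (λ ms → ∑ (λ t → ∑ (λ b → H ms t b))) ≡⟨ cong (q₁ *_) (∑ᵛ-cong k (λ ms → sym (F-expand ms))) ⟩
        q₁ * ∑ᵛ k F ∎
        where
        H : Vec (Fin n) k → Fin n → Fin n → ℕ
        H ms t b = 𝟙 (clique U ms) * (𝟙 ((R ∩ CN g ms) t) * 𝟙 ((B ∩ CN g ms) b))
      F≤ : ∀ ms → F ms ≤ M * 𝟙 (clique U ms)
      F≤ ms = ≤-trans (*-monoʳ-≤ (𝟙 (clique U ms)) (*-mono-≤ {# (R ∩ CN g ms)} (#-mono (λ x → ∧-elimˡ)) (#-mono (λ x → ∧-elimˡ)))) (≤-reflexive (*-comm (𝟙 (clique U ms)) M))
      step₂ : # U ^ k ≤ 2 * q₁ * G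
      step₂ = markov-arith {# U ^ k} {G} {∑ᵛ k F} {M} {q₁} 0<M step₁ (begin
        2 * q₁ * ∑ᵛ k F ≡⟨ sym (∑ᵛ-*ˡ k (2 * q₁) F) ⟩
        ∑ᵛ k (λ ms → 2 * q₁ * F ms) ≤⟨ ∑ᵛ-mono k (λ ms → markov-pt (clique U ms) (F ms) M q₁ (F≤ ms)) ⟩
        ∑ᵛ k (λ ms → 2 * q₁ * (M * 𝟙 (good ms)) + M * 𝟙 (clique U ms)) ≡⟨ ∑ᵛ-+ k _ _ ⟩
        ∑ᵛ k (λ ms → 2 * q₁ * (M * 𝟙 (good ms))) + ∑ᵛ k (λ ms → M * 𝟙 (clique U ms)) ≡⟨ cong₂ _+_ (trans (∑ᵛ-*ˡ k (2 * q₁) _) (cong (2 * q₁ *_) (∑ᵛ-*ˡ k M _))) (∑ᵛ-*ˡ k M _) ⟩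
        2 * q₁ * (M * G) + M * ∑ᵛ k (λ ms → 𝟙 (clique U ms)) ≤⟨ +-monoʳ-≤ (2 * q₁ * (M * G)) (*-monoʳ-≤ M (typClique-count≤ 1 k)) ⟩
        2 * q₁ * (M * G) + M * # U ^ k ∎)
      step₃ : ∀ ms → 𝟙 (good ms) * (# R ^ k * # B ^ k) ≤ q₂ * q₂ * ∑ᵛ k (λ ts → ∑ᵛ k (λ ds → 𝟙 (link q Bs R U B ms ts ds)))
      step₃ ms with true? (good ms)
      ... | no p = ≤-trans (≤-reflexive (cong (_* (# R ^ k * # B ^ k)) (𝟙-false (¬true p)))) z≤n
      ... | yes p = begin
          𝟙 (good ms) * (# R ^ k * # B ^ k) ≡⟨ trans (cong (_* (# R ^ k * # B ^ k)) (𝟙-true p)) (*-identityˡ _) ⟩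
          # R ^ k * # B ^ k ≤⟨ *-mono-≤ R-part B-part ⟩
          q₂ * KR * (q₂ * KB) ≡⟨ mid q₂ KR KB ⟩
          q₂ * q₂ * (KR * KB) ≡⟨ cong (q₂ * q₂ *_) (sym (trans (∑ᵛ-cong k (λ ts → ∑ᵛ-*ˡ k (𝟙 (clique R′ ts)) _)) (∑ᵛ-*ʳ k KB _))) ⟩
          q₂ * q₂ * ∑ᵛ k (λ ts → ∑ᵛ k (λ ds → 𝟙 (clique R′ ts) * 𝟙 (typClique g q Bs B′ ds))) ≤⟨ *-monoʳ-≤ (q₂ * q₂) (∑ᵛ-mono k (λ ts → ∑ᵛ-mono k (λ ds → ≤-trans (≤-reflexive (sym (𝟙-∧ (clique R′ ts) _))) (𝟙-mono (∧-intro {clique U ms} (∧-elimˡ {clique U ms} p)))))) ⟩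
          q₂ * q₂ * ∑ᵛ k (λ ts → ∑ᵛ k (λ ds → 𝟙 (link q Bs R U B ms ts ds))) ∎
        where
        R′ = R ∩ CN g ms
        B′ = B ∩ CN g ms
        KR = ∑ᵛ k (λ ts → 𝟙 (clique R′ ts))
        KB = ∑ᵛ k (λ ds → 𝟙 (typClique g q Bs B′ ds))
        mid : ∀ a x y → a * x * (a * y) ≡ a * a * (x * y)
        mid = solve-∀
        both : M ≤ 2 * q₁ * (# R′ * # B′)
        both = ≤-trans (≤?ᵇ-sound {M} (∧-elimʳ {clique U ms} p)) (≤-reflexive (cong (2 * q₁ *_) (trans (cong (_* (# R′ * # B′)) (𝟙-true (∧-elimˡ {clique U ms} p))) (*-identityˡ _))))
        -- The product of the two fractions `# R′ / # R` and `# B′ / # B` is at least `1 / (2 * q₁)`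
        -- and neither exceeds 1, so each is at least that.
        R-big : # R ≤ 2 * q₁ * # R′
        R-big = cancel-factor {# R} {# B} {# R′} {# B′} {2 * q₁} 0<M (#-mono (λ x → ∧-elimˡ)) both
        B-big : # B ≤ 2 * q₁ * # B′
        B-big = cancel-factor {# B} {# R} {# B′} {# R′} {2 * q₁} (subst (0 <_) (*-comm (# R) (# B)) 0<M) (#-mono (λ x → ∧-elimˡ)) (≤-trans (≤-reflexive (*-comm (# B) (# R))) (≤-trans both (≤-reflexive (cong (2 * q₁ *_) (*-comm (# R′) (# B′))))))
        σ-ok : s * (2 * q₁) * (2 * D) ^ k ≤ σ
        σ-ok = ≤-trans (*-monoˡ-≤ ((2 * D) ^ k) (*-monoʳ-≤ s (≤-*ˡ (2 * q₁) 1≤e))) hσ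
        power : ∀ {X X′ K} → X ≤ 2 * q₁ * X′ → X′ ^ k ≤ Qc D k * K → X ^ k ≤ q₂ * K
        power {X} {X′} {K} h₁ h₂ = ≤-trans (^-monoˡ-≤ k h₁) (≤-trans (≤-reflexive (*-^ (2 * q₁) X′ k)) (scale-trans ((2 * q₁) ^ k) (Qc D k) ≤-refl h₂))
        R-part : # R ^ k ≤ q₂ * KR
        R-part = power R-big (clique-count ld 0<n 1≤D k {R′} (s * (2 * q₁)) (scale-trans s (2 * q₁) hR R-big) σ-ok)
        B-part : # B ^ k ≤ q₂ * KB
        B-part = power B-big (typClique-count g q ld 0<n few 1≤q k {Bs} {B′} 0 (s * (2 * q₁)) (s₀ * (2 * q₁)) (λ x z → B⊆ x (∧-elimˡ z)) (λ c x z → z) (λ c → ≤-reflexive (sym (*-identityˡ _))) hE 1≤D (scale-trans s (2 * q₁) hB B-big) σ-ok (scale-trans s₀ (2 * q₁) hB₀ B-big) hκ)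

-- Bi-dense tuples by density increment

module _ {n : ℕ} where

  -- Divided by `vol As` this is the density of `f` in the box with sides `As`, the quantity that
  -- will be incremented.
  cnt : ∀ {m} → Vec (Sub n) m → (Vec (Fin n) m → ℕ) → ℕ
  cnt [] f = f []
  cnt (A ∷ As) f = ∑ (λ a → 𝟙 (A a) * cnt As (λ v → f (a ∷ v)))

  vol : ∀ {m} → Vec (Sub n) m → ℕ
  vol [] = 1
  vol (A ∷ As) = # A * vol As

  cnt-mono : ∀ {m} (As : Vec (Sub n) m) {f h : Vec (Fin n) m → ℕ} → (∀ v → f v ≤ h v) → cnt As f ≤ cnt As h
  cnt-mono [] p = p []
  cnt-mono (A ∷ As) p = ∑-mono (λ a → *-monoʳ-≤ (𝟙 (A a)) (cnt-mono As (λ v → p (a ∷ v))))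

  cnt-const : ∀ {m} (As : Vec (Sub n) m) c → cnt As (λ _ → c) ≡ c * vol As
  cnt-const [] c = sym (*-identityʳ c)
  cnt-const (A ∷ As) c = trans (∑-cong (λ a → cong (𝟙 (A a) *_) (cnt-const As c))) (trans (∑-*ʳ (c * vol As) (λ a → 𝟙 (A a))) (eq (# A) c (vol As)))
    where
    eq : ∀ a c v → a * (c * v) ≡ c * (a * v)
    eq = solve-∀

  cnt≤vol : ∀ {m} (As : Vec (Sub n) m) {f} → (∀ v → f v ≤ 1) → cnt As f ≤ vol As
  cnt≤vol As p = ≤-trans (cnt-mono As p) (≤-reflexive (trans (cnt-const As 1) (*-identityˡ _)))

  cnt-split : ∀ {m} (As : Vec (Sub n) m) i (X : Sub n) f → cnt As f ≡ cnt (As [ i ]≔ (lookup As i ∩ X)) f + cnt (As [ i ]≔ (lookup As i ∖ X)) f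
  cnt-split (A ∷ As) zero X f = trans (∑-cong (λ a → pt (A a) (X a) _)) (∑-+ _ _)
    where
    pt : ∀ a b x → 𝟙 a * x ≡ 𝟙 (a ∧ b) * x + 𝟙 (a ∧ not b) * x
    pt true true x = sym (+-identityʳ _)
    pt true false x = refl
    pt false b x = refl
  cnt-split (A ∷ As) (suc i) X f = trans (∑-cong (λ a → trans (cong (𝟙 (A a) *_) (cnt-split As i X _)) (*-distribˡ-+ (𝟙 (A a)) _ _))) (∑-+ _ _)

  vol-split : ∀ {m} (As : Vec (Sub n) m) i (X : Sub n) → vol As ≡ vol (As [ i ]≔ (lookup As i ∩ X)) + vol (As [ i ]≔ (lookup As i ∖ X))
  vol-split (A ∷ As) zero X = trans (cong (_* vol As) (#-split A X)) (*-distribʳ-+ (vol As) (# (A ∩ X)) _)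
  vol-split (A ∷ As) (suc i) X = trans (cong (# A *_) (vol-split As i X)) (*-distribˡ-+ (# A) _ _)

  vol-update : ∀ {m} (As : Vec (Sub n) m) i X → vol (As [ i ]≔ X) * # (lookup As i) ≡ vol As * # X
  vol-update (A ∷ As) zero X = eq (# A) (# X) (vol As)
    where
    eq : ∀ a x v → x * v * a ≡ a * v * x
    eq = solve-∀
  vol-update (A ∷ As) (suc i) X = trans (*-assoc (# A) _ _) (trans (cong (# A *_) (vol-update As i X)) (sym (*-assoc (# A) _ _)))

  vol-pos : ∀ {m} (As : Vec (Sub n) m) → 0 < vol As → ∀ i → 0 < # (lookup As i)
  vol-pos (A ∷ As) p zero = pos-factorʳ (vol As) (# A) p (≤-reflexive (*-comm (# A) _))
  vol-pos (A ∷ As) p (suc i) = vol-pos As (pos-factorʳ (# A) (vol As) p ≤-refl) i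

  cnt-cyl₁ : ∀ {m} (As : Vec (Sub n) m) j (h : Fin n → ℕ) → # (lookup As j) * cnt As (λ v → h (lookup v j)) ≡ ∑ (λ b → 𝟙 (lookup As j b) * h b) * vol As
  cnt-cyl₁ (A ∷ As) zero h = trans (cong (# A *_) (trans (∑-cong (λ a → trans (cong (𝟙 (A a) *_) (cnt-const As (h a))) (sym (*-assoc (𝟙 (A a)) (h a) _)))) (∑-*ʳ (vol As) (λ a → 𝟙 (A a) * h a)))) (eq (# A) (∑ (λ a → 𝟙 (A a) * h a)) (vol As))
    where
    eq : ∀ a s v → a * (s * v) ≡ s * (a * v)
    eq = solve-∀
  cnt-cyl₁ (A ∷ As) (suc j) h = trans (cong (# (lookup As j) *_) (∑-*ʳ (cnt As (λ v → h (lookup v j))) (λ a → 𝟙 (A a)))) (trans (eq₁ (# (lookup As j)) (# A) _) (trans (cong (# A *_) (cnt-cyl₁ As j h)) (eq₁ (# A) (∑ (λ b → 𝟙 (lookup As j b) * h b)) (vol As))))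
    where
    eq₁ : ∀ a s v → a * (s * v) ≡ s * (a * v)
    eq₁ = solve-∀

  pairs : Sub n → Sub n → (Fin n → Fin n → ℕ) → ℕ
  pairs A B h = ∑ (λ x → 𝟙 (A x) * ∑ (λ y → 𝟙 (B y) * h x y))

  pairs-swap : ∀ A B h → pairs A B h ≡ pairs B A (λ x y → h y x)
  pairs-swap A B h = begin
    ∑ (λ x → 𝟙 (A x) * ∑ (λ y → 𝟙 (B y) * h x y)) ≡⟨ ∑-cong (λ x → sym (∑-*ˡ (𝟙 (A x)) (λ y → 𝟙 (B y) * h x y))) ⟩
    ∑ (λ x → ∑ (λ y → 𝟙 (A x) * (𝟙 (B y) * h x y))) ≡⟨ ∑-comm _ ⟩
    ∑ (λ y → ∑ (λ x → 𝟙 (A x) * (𝟙 (B y) * h x y))) ≡⟨ ∑-cong (λ y → trans (∑-cong (λ x → eq (𝟙 (A x)) (𝟙 (B y)) (h x y))) (∑-*ˡ (𝟙 (B y)) (λ x → 𝟙 (A x) * h x y))) ⟩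
    ∑ (λ y → 𝟙 (B y) * ∑ (λ x → 𝟙 (A x) * h x y)) ∎
    where
    open ≡-Reasoning
    eq : ∀ a b c → a * (b * c) ≡ b * (a * c)
    eq = solve-∀

  -- A function of two coordinates has the same average over the box as over its two sides. This
  -- turns the density of a box into the edge density of a pair.
  cnt-cyl₂ : ∀ {m} (As : Vec (Sub n) m) i j (h : Fin n → Fin n → ℕ) → ¬ i ≡ j →
    # (lookup As i) * # (lookup As j) * cnt As (λ v → h (lookup v i) (lookup v j)) ≡ pairs (lookup As i) (lookup As j) h * vol As
  cnt-cyl₂ (A ∷ As) zero zero h i≢j = ⊥-elim (i≢j refl)
  cnt-cyl₂ (A ∷ As) zero (suc j) h _ = begin
    # A * # B * ∑ (λ a → 𝟙 (A a) * c a) ≡⟨ trans (*-assoc (# A) (# B) _) (cong (# A *_) (sym (∑-*ˡ (# B) (λ a → 𝟙 (A a) * c a)))) ⟩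
    # A * ∑ (λ a → # B * (𝟙 (A a) * c a)) ≡⟨ cong (# A *_) (∑-cong (λ a → trans (eq (# B) (𝟙 (A a)) (c a)) (trans (cong (𝟙 (A a) *_) (cnt-cyl₁ As j (h a))) (sym (*-assoc (𝟙 (A a)) _ (vol As)))))) ⟩
    # A * ∑ (λ a → 𝟙 (A a) * ∑ (λ b → 𝟙 (B b) * h a b) * vol As) ≡⟨ cong (# A *_) (∑-*ʳ (vol As) (λ a → 𝟙 (A a) * ∑ (λ b → 𝟙 (B b) * h a b))) ⟩
    # A * (pairs A B h * vol As) ≡⟨ eq (# A) (pairs A B h) (vol As) ⟩
    pairs A B h * (# A * vol As) ∎
    where
    open ≡-Reasoning
    B = lookup As j
    c : Fin n → ℕ
    c a = cnt As (λ v → h a (lookup v j))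
    eq : ∀ a s v → a * (s * v) ≡ s * (a * v)
    eq = solve-∀
  cnt-cyl₂ (A ∷ As) (suc i) zero h _ = trans (cong (_* cnt (A ∷ As) (λ v → h (lookup v (suc i)) (lookup v zero))) (*-comm (# (lookup As i)) (# A))) (trans (cnt-cyl₂ (A ∷ As) zero (suc i) (λ x y → h y x) (λ ())) (cong (_* vol (A ∷ As)) (pairs-swap A (lookup As i) (λ x y → h y x))))
  cnt-cyl₂ (A ∷ As) (suc i) (suc j) h i≢j = trans (cong (# (lookup As i) * # (lookup As j) *_) (∑-*ʳ (cnt As (λ v → h (lookup v i) (lookup v j))) (λ a → 𝟙 (A a)))) (trans (eq (# (lookup As i) * # (lookup As j)) (# A) _) (trans (cong (# A *_) (cnt-cyl₂ As i j h (λ e → i≢j (cong suc e)))) (eq (# A) (pairs (lookup As i) (lookup As j) h) (vol As))))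
    where
    eq : ∀ a s v → a * (s * v) ≡ s * (a * v)
    eq = solve-∀

  edges-pairs : ∀ g X Y → edges g X Y ≡ pairs X Y (λ x y → 𝟙 (g x y))
  edges-pairs g X Y = ∑-cong (λ x → cong (𝟙 (X x) *_) (∑-cong (λ y → 𝟙-∧ (Y y) (g x y))))

  edges-cong : ∀ (g : Fin n → Sub n) {X X′ Y Y′ : Sub n} → (∀ x → X x ≡ X′ x) → (∀ x → Y x ≡ Y′ x) → edges g X Y ≡ edges g X′ Y′
  edges-cong g {X} {X′} {Y} {Y′} p r = ∑-cong (λ x → cong₂ _*_ (cong 𝟙 (p x)) (#-cong (λ y → cong (_∧ g x y) (r y))))

  -- Only the lower half of regularity: large subsets may be denser than the pair, but never sparser
  -- than `1 / q`.
  BiDense : (Fin n → Sub n) → ℕ → ℕ → Sub n → Sub n → Set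
  BiDense g E q A B = ∀ X Y → X ⊆ A → Y ⊆ B → # A ≤ E * # X → # B ≤ E * # Y → # X * # Y ≤ q * edges g X Y

-- A violation cuts the box into three, and `α / β` is the current density bound. Box 3 has at most
-- half of that density, and boxes 1 and 2 fail to raise it by the factor `1 + 1 / T`, up to an
-- error for boxes that are too small. In units of `α`, box 3 loses `2 * T * v₃`, which is at least
-- `8 * v`, while the others and the errors gain at most `6 * v`.
increment-arith : ∀ {α β T Q E v v₁ v₂ v₃ c c₁ c₂ c₃} → 0 < v → 0 < α → T ≡ 4 * (E * E) →
  v ≡ (v₃ + v₂) + v₁ → c ≡ (c₃ + c₂) + c₁ → α * v ≤ β * c → β ≤ α * Q → 2 * Q * c₃ ≤ v₃ →
  4 * (β * T * c₁) ≤ 4 * (α * suc T * v₁) + α * v → 4 * (β * T * c₂) ≤ 4 * (α * suc T * v₂) + α * v → v ≤ E * E * v₃ → ⊥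
increment-arith {α} {β} {T} {Q} {E} {v} {v₁} {v₂} {v₃} {c} {c₁} {c₂} {c₃} 0<v 0<α eT refl refl h β≤ h₃ h₁ h₂ hE =
  <⇒≱ (*-mono-< 0<α 0<v) (*-cancelˡ-≤ {α * v} {0} 2 (≤-trans (lin (4 * α * v₃) (+-mono-≤ (+-mono-≤ (+-mono-≤ (*-monoʳ-≤ (4 * T) h) h₁) h₂) (+-mono-≤ h₃′ E′)) (subst (λ T → 2 * (α * v) + (4 * T * (β * c) + (4 * (α * suc T * v₁) + α * v) + (4 * (α * suc T * v₂) + α * v) + (2 * (α * T * v₃) + 2 * (α * T * v₃))) + 4 * α * v₃ ≡ 0 + (4 * T * (α * v) + 4 * (β * T * c₁) + 4 * (β * T * c₂) + (4 * (β * T * c₃) + 8 * (α * v)))) (sym eT) (eq α β (4 * (E * E)) v₁ v₂ v₃ c₁ c₂ c₃))) z≤n))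
  where
  h₃′ : 4 * (β * T * c₃) ≤ 2 * (α * T * v₃)
  h₃′ = begin
    4 * (β * T * c₃) ≤⟨ *-monoʳ-≤ 4 (*-monoˡ-≤ c₃ (*-monoˡ-≤ T β≤)) ⟩
    4 * (α * Q * T * c₃) ≡⟨ e α Q T c₃ ⟩
    2 * (α * T * (2 * Q * c₃)) ≤⟨ *-monoʳ-≤ 2 (*-monoʳ-≤ (α * T) h₃) ⟩
    2 * (α * T * v₃) ∎
    where
    open ≤-Reasoning
    e : ∀ α Q T c → 4 * (α * Q * T * c) ≡ 2 * (α * T * (2 * Q * c))
    e = solve-∀
  E′ : 8 * (α * v) ≤ 2 * (α * T * v₃)
  E′ = ≤-trans (*-monoʳ-≤ 8 (*-monoʳ-≤ α hE)) (≤-reflexive (trans (e α (E * E) v₃) (cong (λ T → 2 * (α * T * v₃)) (sym eT))))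
    where
    e : ∀ α E v → 8 * (α * (E * v)) ≡ 2 * (α * (4 * E) * v)
    e = solve-∀
  eq : ∀ α β T v₁ v₂ v₃ c₁ c₂ c₃ → 2 * (α * (v₃ + v₂ + v₁)) + (4 * T * (β * (c₃ + c₂ + c₁)) + (4 * (α * suc T * v₁) + α * (v₃ + v₂ + v₁)) + (4 * (α * suc T * v₂) + α * (v₃ + v₂ + v₁)) + (2 * (α * T * v₃) + 2 * (α * T * v₃))) + 4 * α * v₃ ≡ 0 + (4 * T * (α * (v₃ + v₂ + v₁)) + 4 * (β * T * c₁) + 4 * (β * T * c₂) + (4 * (β * T * c₃) + 8 * (α * (v₃ + v₂ + v₁))))
  eq = solve-∀

-- Bernoulli's inequality for `(1 + 1 / T) ^ t`, multiplied by `T ^ suc t`.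
bernoulli : ∀ T t → T ^ t * (T + t) ≤ T * suc T ^ t
bernoulli T zero = ≤-reflexive (eq T)
  where
  eq : ∀ T → 1 * (T + 0) ≡ T * 1
  eq = solve-∀
bernoulli T (suc t) = ≤-trans (≤-trans (m≤m+n _ (T ^ t * t)) (≤-reflexive (eq₁ T (T ^ t) t))) (≤-trans (*-monoʳ-≤ (suc T) (bernoulli T t)) (≤-reflexive (eq₂ T (suc T ^ t))))
  where
  eq₁ : ∀ T x t → T * x * (T + suc t) + x * t ≡ suc T * (x * (T + t))
  eq₁ = solve-∀
  eq₂ : ∀ T y → suc T * (T * y) ≡ T * (suc T * y)
  eq₂ = solve-∀

-- A density that starts at `1 / Q` and grows by the factor `1 + 1 / T` each time would exceed 1
-- after `T * Q` steps. This bounds the number of increments.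
growth-contra : ∀ T Q → 0 < T → suc T ^ (T * Q) ≤ Q * T ^ (T * Q) → ⊥
growth-contra T Q 0<T h = <⇒≱ {Q * x} {suc Q * x} (*-monoˡ-< x {{>-nonZero (^-≥1 T (T * Q) 0<T)}} (n<1+n Q)) (≤-trans (*-cancelˡ-≤ T {{>-nonZero 0<T}} (≤-trans (≤-reflexive (eq T Q x)) (bernoulli T (T * Q)))) h)
  where
  x = T ^ (T * Q)
  eq : ∀ T Q x → T * (suc Q * x) ≡ x * (T + T * Q)
  eq = solve-∀

module _ {n : ℕ} where

  vol-large : ∀ {m} (As : Vec (Sub n) m) i X E → 0 < # (lookup As i) → # (lookup As i) ≤ E * # X → vol As ≤ E * vol (As [ i ]≔ X)
  vol-large As i X E 0<a h = *-cancelʳ-≤ _ _ (# (lookup As i)) {{>-nonZero 0<a}} (≤-trans (*-monoʳ-≤ (vol As) h) (≤-reflexive (trans (eq (vol As) E (# X)) (trans (cong (E *_) (sym (vol-update As i X))) (sym (*-assoc E _ _))))))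
    where
    eq : ∀ v E x → v * (E * x) ≡ E * (v * x)
    eq = solve-∀

  vol-small : ∀ {m} (As : Vec (Sub n) m) i X K → 0 < # (lookup As i) → K * # X ≤ # (lookup As i) → K * vol (As [ i ]≔ X) ≤ vol As
  vol-small As i X K 0<a h = *-cancelʳ-≤ _ _ (# (lookup As i)) {{>-nonZero 0<a}} (≤-trans (≤-reflexive (trans (*-assoc K _ _) (trans (cong (K *_) (vol-update As i X)) (eq K (vol As) (# X))))) (*-monoʳ-≤ (vol As) h))
    where
    eq : ∀ K v x → K * (v * x) ≡ v * (K * x)
    eq = solve-∀

  update-⊆ : ∀ {m} (As : Vec (Sub n) m) i X → X ⊆ lookup As i → ∀ l → lookup (As [ i ]≔ X) l ⊆ lookup As l
  update-⊆ As i X h l with l Finₚ.≟ i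
  ... | yes refl = λ x p → h x (subst (x ∈_) (lookup∘update l As X) p)
  ... | no l≢i = λ x p → subst (x ∈_) (lookup∘update′ l≢i As X) p

  update-size : ∀ {m} (As : Vec (Sub n) m) i X K → 1 ≤ K → # (lookup As i) ≤ K * # X → ∀ l → # (lookup As l) ≤ K * # (lookup (As [ i ]≔ X) l)
  update-size As i X K 1≤K h l with l Finₚ.≟ i
  ... | yes refl = ≤-trans h (≤-reflexive (cong (λ Z → K * # Z) (sym (lookup∘update l As X))))
  ... | no l≢i = ≤-trans (≤-*ˡ _ 1≤K) (≤-reflexive (cong (λ Z → K * # Z) (sym (lookup∘update′ l≢i As X))))

  module DensityIncrement {m : ℕ} (E Q : ℕ) (1≤E : 1 ≤ E) (1≤Q : 1 ≤ Q) (f : Vec (Fin n) m → ℕ) (f≤1 : ∀ v → f v ≤ 1) where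

    -- A violating box has relative volume at least `1 / (E * E)`, which fixes the gain `1 / T`. A
    -- side cut down below the fraction `1 / K` leaves too few tuples to matter and is never kept.
    -- One increment shrinks a side by at most `L`.
    T K L : ℕ
    T = 4 * (E * E)
    K = 4 * T * Q
    L = K * E

    1≤T : 1 ≤ T
    1≤T = 1≤* {4} (s≤s z≤n) (1≤* 1≤E 1≤E)

    1≤K : 1 ≤ K
    1≤K = 1≤* (1≤* {4} (s≤s z≤n) 1≤T) 1≤Q

    1≤L : 1 ≤ L
    1≤L = 1≤* 1≤K 1≤E

    -- The subsets are bit vectors, so that the existence of a violation is decided by exhaustive
    -- search.
    Violation : Vec (Sub n) m → Set
    Violation As = ∃ λ i → ∃ λ j → Σ (Subset n) λ X → Σ (Subset n) λ Y →
      let A = lookup As i ; As′ = As [ i ]≔ (A ∩ lookup X) ; B = lookup As′ j ; As₃ = As′ [ j ]≔ (B ∩ lookup Y) in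
      (¬ i ≡ j) × (# A ≤ E * # (A ∩ lookup X)) × (# B ≤ E * # (B ∩ lookup Y)) × (2 * Q * cnt As₃ f < vol As₃)

    violation? : ∀ As → Dec (Violation As)
    violation? As = Finₚ.any? λ i → Finₚ.any? λ j → anySubset? λ X → anySubset? λ Y →
      ¬? (i Finₚ.≟ j) ×-dec (_ ≤? _) ×-dec (_ ≤? _) ×-dec (_ <? _)

    -- Density at least `(1 + 1 / T) ^ t / Q`, cleared of denominators.
    Inv : ℕ → Vec (Sub n) m → Set
    Inv t As = (0 < vol As) × (suc T ^ t * vol As ≤ Q * T ^ t * cnt As f)

    Refines : ℕ → Vec (Sub n) m → Vec (Sub n) m → Set
    Refines c As As′ = (∀ l → lookup As′ l ⊆ lookup As l) × (∀ l → # (lookup As l) ≤ c * # (lookup As′ l))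

    improve : ∀ t As → Inv t As → Violation As → ∃ λ As′ → Inv (suc t) As′ × Refines L As As′
    improve t As (0<v , dens) (i , j , X , Y , i≢j , hX , hY , viol)
      with (# A ≤? K * # (A ∖ lookup X)) ×-dec (suc T ^ suc t * vol As₁ ≤? Q * T ^ suc t * cnt As₁ f)
         | (# B ≤? K * # (B ∖ lookup Y)) ×-dec (suc T ^ suc t * vol As₂ ≤? Q * T ^ suc t * cnt As₂ f)
      where
      A = lookup As i
      As₁ = As [ i ]≔ (A ∖ lookup X)
      As′ = As [ i ]≔ (A ∩ lookup X)
      B = lookup As′ j
      As₂ = As′ [ j ]≔ (B ∖ lookup Y)
    ... | yes (size , dens′) | _ = As [ i ]≔ (lookup As i ∖ lookup X) , (pos-factorʳ K _ 0<v (vol-large As i _ K (vol-pos As 0<v i) size) , dens′) ,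
          update-⊆ As i (lookup As i ∖ lookup X) (λ x → ∧-elimˡ) , λ l → ≤-trans (update-size As i _ K 1≤K size l) (*-monoˡ-≤ (# (lookup (As [ i ]≔ (lookup As i ∖ lookup X)) l)) (≤-*ʳ K 1≤E))
    ... | no _ | yes (size , dens′) = As₂ , (pos-factorʳ K _ 0<v′ (vol-large As′ j _ K (vol-pos As′ 0<v′ j) size) , dens′) ,
          (λ l x p → update-⊆ As i _ (λ x → ∧-elimˡ) l x (update-⊆ As′ j (B ∖ lookup Y) (λ x → ∧-elimˡ) l x p)) ,
          λ l → ≤-trans (scale-trans E K (update-size As i _ E 1≤E hX l) (update-size As′ j _ K 1≤K size l)) (≤-reflexive (cong (_* # (lookup As₂ l)) (*-comm E K)))
          where
          As′ = As [ i ]≔ (lookup As i ∩ lookup X)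
          B = lookup As′ j
          As₂ = As′ [ j ]≔ (B ∖ lookup Y)
          0<v′ : 0 < vol As′
          0<v′ = pos-factorʳ E _ 0<v (vol-large As i _ E (vol-pos As 0<v i) hX)
    ... | no fail₁ | no fail₂ = ⊥-elim (increment-arith {α} {β} {T} {Q} {E} 0<v 0<α refl
            (trans (vol-split As i (lookup X)) (cong (_+ vol As₁) (vol-split As′ j (lookup Y))))
            (trans (cnt-split As i (lookup X) f) (cong (_+ cnt As₁ f) (cnt-split As′ j (lookup Y) f)))
            dens β≤ (<⇒≤ viol) (bound As₁ (λ p → vol-small As i _ K (vol-pos As 0<v i) p) fail₁)
            (bound As₂ (λ p → ≤-trans (vol-small As′ j _ K (vol-pos As′ 0<v′ j) p) v′≤v) fail₂)
            (≤-trans (vol-large As i _ E (vol-pos As 0<v i) hX) (≤-trans (*-monoʳ-≤ E (vol-large As′ j _ E (vol-pos As′ 0<v′ j) hY)) (≤-reflexive (sym (*-assoc E E _))))))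
          where
          A = lookup As i
          As₁ = As [ i ]≔ (A ∖ lookup X)
          As′ = As [ i ]≔ (A ∩ lookup X)
          B = lookup As′ j
          As₂ = As′ [ j ]≔ (B ∖ lookup Y)
          α = suc T ^ t
          β = Q * T ^ t
          0<α : 0 < α
          0<α = ^-≥1 (suc T) t (s≤s z≤n)
          0<v′ : 0 < vol As′
          0<v′ = pos-factorʳ E _ 0<v (vol-large As i _ E (vol-pos As 0<v i) hX)
          v′≤v : vol As′ ≤ vol As
          v′≤v = ≤-trans (m≤m+n _ _) (≤-reflexive (sym (vol-split As i (lookup X))))
          β≤ : β ≤ α * Q
          β≤ = ≤-trans (*-monoʳ-≤ Q (^-monoˡ-≤ t (n≤1+n T))) (≤-reflexive (*-comm Q α))
          -- A box of admissible size fails by its density. A smaller one has at most `1 / K` of the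
          -- volume, so even with density 1 its count stays within the error term.
          bound : ∀ As₁ {a a′} → (K * a′ ≤ a → K * vol As₁ ≤ vol As) → ¬ ((a ≤ K * a′) × (suc T ^ suc t * vol As₁ ≤ Q * T ^ suc t * cnt As₁ f)) → 4 * (β * T * cnt As₁ f) ≤ 4 * (α * suc T * vol As₁) + α * vol As
          bound As₁ {a} {a′} small fail with a ≤? K * a′
          ... | yes p = ≤-trans (*-monoʳ-≤ 4 (≤-trans (≤-reflexive (cong (_* cnt As₁ f) (eq₁ Q (T ^ t) T))) (≤-trans (<⇒≤ (≰⇒> (λ d → fail (p , d)))) (≤-reflexive (cong (_* vol As₁) (*-comm (suc T) α)))))) (m≤m+n _ _)
            where
            eq₁ : ∀ Q x T → Q * x * T ≡ Q * (T * x)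
            eq₁ = solve-∀
          ... | no p = ≤-trans (begin
              4 * (β * T * cnt As₁ f) ≤⟨ *-monoʳ-≤ 4 (*-mono-≤ (*-monoˡ-≤ T β≤) (cnt≤vol As₁ f≤1)) ⟩
              4 * (α * Q * T * vol As₁) ≡⟨ eq₂ α Q T (vol As₁) ⟩
              α * (K * vol As₁) ≤⟨ *-monoʳ-≤ α (small (<⇒≤ (≰⇒> p))) ⟩
              α * vol As ∎) (m≤n+m _ _)
            where
            open ≤-Reasoning
            eq₂ : ∀ α Q T v → 4 * (α * Q * T * v) ≡ α * (4 * T * Q * v)
            eq₂ = solve-∀

    loop : ∀ u t As → t + u ≡ T * Q → Inv t As → ∃ λ As′ → Refines (L ^ u) As As′ × (0 < vol As′) × ¬ Violation As′
    loop zero t As eq (0<v , dens) = ⊥-elim (growth-contra T Q 1≤T (*-cancelʳ-≤ _ _ (vol As) {{>-nonZero 0<v}}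
      (≤-trans (subst (λ t → suc T ^ t * vol As ≤ Q * T ^ t * cnt As f) (trans (sym (+-identityʳ t)) eq) dens) (*-monoʳ-≤ (Q * T ^ (T * Q)) (cnt≤vol As f≤1)))))
    loop (suc u) t As eq inv with violation? As
    ... | no ¬v = As , ((λ l x p → p) , λ l → ≤-*ˡ _ (^-≥1 L (suc u) 1≤L)) , proj₁ inv , ¬v
    ... | yes v with improve t As inv v
    ... | As₁ , inv₁ , sub₁ , size₁ with loop u (suc t) As₁ (trans (sym (+-suc t u)) eq) inv₁
    ... | As₂ , (sub₂ , size₂) , 0<v₂ , ¬v₂ = As₂ , ((λ l x p → sub₁ l x (sub₂ l x p)) , λ l → scale-trans L (L ^ u) (size₁ l) (size₂ l)) , 0<v₂ , ¬v₂

opaque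
  -- The shrinking `L` of one increment, raised to the maximal number `T * Q` of increments.
  ν : ℕ → ℕ → ℕ
  ν E Q = (4 * (4 * (E * E)) * Q * E) ^ (4 * (E * E) * Q)

  ν-def : ∀ E Q → ν E Q ≡ (4 * (4 * (E * E)) * Q * E) ^ (4 * (E * E) * Q)
  ν-def E Q = refl

  ν≥1 : ∀ E Q → 1 ≤ E → 1 ≤ Q → 1 ≤ ν E Q
  ν≥1 E Q p r = ^-≥1 _ (4 * (E * E) * Q) (1≤* (1≤* (1≤* {4} (s≤s z≤n) (1≤* {4} (s≤s z≤n) (1≤* p p))) r) p)

-- Once no violation is left, every large box obtained by shrinking two sides still has density at
-- least `1 / (2 * Q)`. If `f` forces the two coordinates to be adjacent, this bounds the edge
-- density between the two sides from below.
regularize : ∀ {n m} (g : Fin n → Sub n) E Q → 1 ≤ E → 1 ≤ Q → (As : Vec (Sub n) m) (f : Vec (Fin n) m → ℕ) → (∀ v → f v ≤ 1) →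
  0 < vol As → vol As ≤ Q * cnt As f →
  Σ (Vec (Sub n) m) λ As′ → (∀ l → lookup As′ l ⊆ lookup As l) × (∀ l → # (lookup As l) ≤ ν E Q * # (lookup As′ l)) ×
    (∀ i j → ¬ i ≡ j → (∀ v → f v ≤ 𝟙 (g (lookup v i) (lookup v j))) → BiDense g E (2 * Q) (lookup As′ i) (lookup As′ j))
regularize {n} {m} g E Q 1≤E 1≤Q As f f≤1 0<v dens with DensityIncrement.loop E Q 1≤E 1≤Q f f≤1 (4 * (E * E) * Q) 0 As refl (0<v , ≤-trans (≤-reflexive (*-identityˡ _)) (≤-trans dens (≤-reflexive (cong (_* cnt As f) (sym (*-identityʳ Q))))))
... | As′ , (sub , size) , 0<v′ , ¬viol = As′ , sub , (λ l → ≤-trans (size l) (≤-reflexive (cong (_* # (lookup As′ l)) (sym (ν-def E Q))))) , bd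
  where
  bd : ∀ i j → ¬ i ≡ j → (∀ v → f v ≤ 𝟙 (g (lookup v i) (lookup v j))) → BiDense g E (2 * Q) (lookup As′ i) (lookup As′ j)
  bd i j i≢j hf X Y X⊆ Y⊆ hX hY = final
    where
    X′ = tabulate X
    Y′ = tabulate Y
    A = lookup As′ i
    B₀ = lookup As′ j
    As₁ = As′ [ i ]≔ (A ∩ lookup X′)
    B = lookup As₁ j
    As₃ = As₁ [ j ]≔ (B ∩ lookup Y′)
    B≡ : B ≡ B₀
    B≡ = lookup∘update′ (λ e → i≢j (sym e)) As′ (A ∩ lookup X′)
    -- A predicate turned into a bit vector and back agrees with itself only pointwise, so sizes and
    -- edge counts are transported along pointwise equalities.
    ∩-id : ∀ {A X : Sub n} → X ⊆ A → ∀ x → (A ∩ lookup (tabulate X)) x ≡ X x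
    ∩-id {A} {X} h x rewrite lookup∘tabulate X x with true? (X x)
    ... | yes p = trans (cong₂ _∧_ (h x p) p) (sym p)
    ... | no p = trans (cong (A x ∧_) (¬true p)) (trans (∧-zeroʳ (A x)) (sym (¬true p)))
      where
      ∧-zeroʳ : ∀ b → b ∧ false ≡ false
      ∧-zeroʳ true = refl
      ∧-zeroʳ false = refl
    X≗ : ∀ x → (A ∩ lookup X′) x ≡ X x
    X≗ = ∩-id X⊆
    Y≗ : ∀ x → (B ∩ lookup Y′) x ≡ Y x
    Y≗ = ∩-id (subst (Y ⊆_) (sym B≡) Y⊆)
    hX′ : # A ≤ E * # (A ∩ lookup X′)
    hX′ = ≤-trans hX (≤-reflexive (cong (E *_) (sym (#-cong X≗))))
    hY′ : # B ≤ E * # (B ∩ lookup Y′)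
    hY′ = ≤-trans (≤-reflexive (cong #_ B≡)) (≤-trans hY (≤-reflexive (cong (E *_) (sym (#-cong Y≗)))))
    dense₃ : vol As₃ ≤ 2 * Q * cnt As₃ f
    dense₃ = ≮⇒≥ (λ lt → ¬viol (i , j , X′ , Y′ , i≢j , hX′ , hY′ , lt))
    0<v₁ : 0 < vol As₁
    0<v₁ = pos-factorʳ E _ 0<v′ (vol-large As′ i _ E (vol-pos As′ 0<v′ i) hX′)
    0<v₃ : 0 < vol As₃
    0<v₃ = pos-factorʳ E _ 0<v₁ (vol-large As₁ j _ E (vol-pos As₁ 0<v₁ j) hY′)
    Ai : lookup As₃ i ≡ A ∩ lookup X′
    Ai = trans (lookup∘update′ i≢j As₁ _) (lookup∘update i As′ _)
    Aj : lookup As₃ j ≡ B ∩ lookup Y′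
    Aj = lookup∘update j As₁ _
    e = pairs (lookup As₃ i) (lookup As₃ j) (λ x y → 𝟙 (g x y))
    xy = # (lookup As₃ i) * # (lookup As₃ j)
    key : xy * vol As₃ ≤ 2 * Q * e * vol As₃
    key = begin
      xy * vol As₃ ≤⟨ *-monoʳ-≤ xy dense₃ ⟩
      xy * (2 * Q * cnt As₃ f) ≤⟨ *-monoʳ-≤ xy (*-monoʳ-≤ (2 * Q) (cnt-mono As₃ hf)) ⟩
      xy * (2 * Q * cnt As₃ (λ v → 𝟙 (g (lookup v i) (lookup v j)))) ≡⟨ eq xy (2 * Q) _ ⟩
      2 * Q * (xy * cnt As₃ (λ v → 𝟙 (g (lookup v i) (lookup v j)))) ≡⟨ cong (2 * Q *_) (cnt-cyl₂ As₃ i j (λ x y → 𝟙 (g x y)) i≢j) ⟩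
      2 * Q * (e * vol As₃) ≡⟨ sym (*-assoc (2 * Q) e _) ⟩
      2 * Q * e * vol As₃ ∎
      where
      open ≤-Reasoning
      eq : ∀ a b c → a * (b * c) ≡ b * (a * c)
      eq = solve-∀
    final : # X * # Y ≤ 2 * Q * edges g X Y
    final = begin
      # X * # Y ≡⟨ cong₂ _*_ (sym (trans (cong #_ Ai) (#-cong X≗))) (sym (trans (cong #_ Aj) (#-cong Y≗))) ⟩
      xy ≤⟨ *-cancelʳ-≤ _ _ (vol As₃) {{>-nonZero 0<v₃}} key ⟩
      2 * Q * e ≡⟨ cong (2 * Q *_) (trans (cong₂ (λ P R → pairs P R (λ x y → 𝟙 (g x y))) Ai Aj) (trans (sym (edges-pairs g (A ∩ lookup X′) (B ∩ lookup Y′))) (edges-cong g X≗ Y≗))) ⟩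
      2 * Q * edges g X Y ∎
      where open ≤-Reasoning

-- Hubs and links

-- The exceptional vertices and `Y` form a pair of density below `1 / q`, so bi-density forbids that
-- they exceed the fraction `1 / E` of `A`.
bd-few-bad : ∀ {n} {g : Fin n → Sub n} {E q A B Y} → BiDense g E q A B → Y ⊆ B → # B ≤ E * # Y →
  E * # (A ∖ (λ x → # Y ≤?ᵇ q * # (Y ∩ g x))) ≤ # A
bd-few-bad {n} {g} {E} {q} {A} {B} {Y} bd Y⊆ hY = ≮⇒≥ λ lt → absurd lt
  where
  ok : Sub n
  ok x = # Y ≤?ᵇ q * # (Y ∩ g x)
  X = A ∖ ok
  absurd : # A < E * # X → ⊥
  absurd lt = <⇒≱ strict (bd X Y (λ x → ∧-elimˡ) Y⊆ (<⇒≤ lt) hY)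
    where
    0<X : 0 < # X
    0<X = pos-factorʳ E (# X) (≤-<-trans z≤n lt) ≤-refl
    pt : ∀ x → q * (𝟙 (X x) * # (Y ∩ g x)) + 𝟙 (X x) ≤ 𝟙 (X x) * # Y
    pt x with true? (X x)
    ... | no p = ≤-reflexive (trans (cong (λ b → q * (b * # (Y ∩ g x)) + b) (𝟙-false (¬true p))) (trans (+-identityʳ _) (trans (*-zeroʳ q) (cong (_* # Y) (sym (𝟙-false (¬true p)))))))
    ... | yes p = ≤-trans (≤-reflexive (trans (cong (λ b → q * (b * # (Y ∩ g x)) + b) (𝟙-true p)) (trans (cong (λ z → q * z + 1) (*-identityˡ _)) (+-comm _ 1)))) (≤-trans (≤?ᵇ-false {# Y} (not-elim (∧-elimʳ {A x} p))) (≤-reflexive (sym (trans (cong (_* # Y) (𝟙-true p)) (*-identityˡ _)))))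
    strict : q * edges g X Y < # X * # Y
    strict = begin-strict
      q * edges g X Y <⟨ m<m+n _ 0<X ⟩
      q * edges g X Y + # X ≡⟨ cong (_+ # X) (sym (∑-*ˡ q (λ x → 𝟙 (X x) * # (Y ∩ g x)))) ⟩
      ∑ (λ x → q * (𝟙 (X x) * # (Y ∩ g x))) + # X ≡⟨ sym (∑-+ _ _) ⟩
      ∑ (λ x → q * (𝟙 (X x) * # (Y ∩ g x)) + 𝟙 (X x)) ≤⟨ ∑-mono pt ⟩
      ∑ (λ x → 𝟙 (X x) * # Y) ≡⟨ ∑-*ʳ (# Y) (λ x → 𝟙 (X x)) ⟩
      # X * # Y ∎
      where open ≤-Reasoning

BiDense-⊆ : ∀ {n} {g : Fin n → Sub n} {E E′ q q′ A A′ B B′} a b → BiDense g E q A B → A′ ⊆ A → B′ ⊆ B → # A ≤ a * # A′ → # B ≤ b * # B′ →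
  a * E′ ≤ E → b * E′ ≤ E → q ≤ q′ → BiDense g E′ q′ A′ B′
BiDense-⊆ {E′ = E′} a b bd A⊆ B⊆ hA hB ha hb q≤ X Y X⊆ Y⊆ hX hY = ≤-trans
  (bd X Y (λ x p → A⊆ x (X⊆ x p)) (λ x p → B⊆ x (Y⊆ x p)) (≤-trans (scale-trans a E′ hA hX) (*-monoˡ-≤ (# X) ha)) (≤-trans (scale-trans b E′ hB hY) (*-monoˡ-≤ (# Y) hb)))
  (*-monoˡ-≤ _ q≤)

-- One part more than there are colours: part `suc c` receives vertices of colour `c`, and part
-- `zero` is kept for entering and leaving the hub.
record Hub {n} (g : Fin n → Sub n) (k E q : ℕ) : Set where
  field
    part : Fin (suc k) → Sub n
    bd   : ∀ i j → ¬ i ≡ j → BiDense g E q (part i) (part j)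

-- Union bound over the `k` colours, for each of which at most the fraction `1 / E` of part `zero`
-- is exceptional.
hub-fewAtypical : ∀ {n} {g : Fin n → Sub n} {k E q} (P : Hub g k E q) E′ κ → E′ ≤ E → κ * k ≤ E → (let open Hub P) →
  FewAtypical g q E′ κ (part zero) (λ c → part (suc c))
hub-fewAtypical {n} {g} {k} {E} {q} P E′ κ E′≤E κk≤E Bs Bs⊆ hBs = cancel-k k refl
  where
  open Hub P
  bad : Fin k → Sub n
  bad c = part zero ∖ (λ x → # (Bs c) ≤?ᵇ q * # (Bs c ∩ g x))
  each : ∀ c → E * # (bad c) ≤ # (part zero)
  each c = bd-few-bad {E = E} {q} {part zero} {part (suc c)} {Bs c} (bd zero (suc c) (λ ())) (Bs⊆ c) (≤-trans (hBs c) (*-monoˡ-≤ (# (Bs c)) E′≤E))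
  union : # (part zero ∖ typical g q Bs) ≤ ∑ (λ c → # (bad c))
  union = ≤-trans (∑-mono pt) (≤-reflexive (∑-comm (λ x c → 𝟙 (bad c x))))
    where
    pt : ∀ x → 𝟙 ((part zero ∖ typical g q Bs) x) ≤ ∑ (λ c → 𝟙 (bad c x))
    pt x with true? ((part zero ∖ typical g q Bs) x)
    ... | no p = ≤-trans (≤-reflexive (𝟙-false (¬true p))) z≤n
    ... | yes p with Finₚ.¬∀⟶∃¬ k (λ c → (# (Bs c) ≤?ᵇ q * # (Bs c ∩ g x)) ≡ true) (λ c → true? _) (λ h → true≢false (all-intro {A = λ c → # (Bs c) ≤?ᵇ q * # (Bs c ∩ g x)} h) (not-elim (∧-elimʳ {part zero x} p)))
    ... | c , ¬h = ≤-trans (𝟙≤1 _) (≤-trans (≤-reflexive (sym (𝟙-true (∧-intro (∧-elimˡ p) (not-intro (¬true ¬h)))))) (term≤∑ (λ c → 𝟙 (bad c x)) c))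
  cancel-k : ∀ k′ → k′ ≡ k → κ * # (part zero ∖ typical g q Bs) ≤ # (part zero)
  cancel-k zero refl = ≤-trans (*-monoʳ-≤ κ (≤-trans union (≤-reflexive (∑-empty _)))) (≤-trans (≤-reflexive (*-zeroʳ κ)) z≤n)
  cancel-k (suc k′) refl = *-cancelˡ-≤ (suc k′) (begin
    suc k′ * (κ * # (part zero ∖ typical g q Bs)) ≡⟨ eq (suc k′) κ _ ⟩
    κ * suc k′ * # (part zero ∖ typical g q Bs) ≤⟨ *-mono-≤ κk≤E union ⟩
    E * ∑ (λ c → # (bad c)) ≡⟨ sym (∑-*ˡ E (λ c → # (bad c))) ⟩
    ∑ (λ c → E * # (bad c)) ≤⟨ ∑-mono each ⟩
    ∑ (λ c → # (part zero)) ≡⟨ ∑-const (suc k′) _ ⟩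
    suc k′ * # (part zero) ∎)
    where
    open ≤-Reasoning
    eq : ∀ k κ x → k * (κ * x) ≡ κ * k * x
    eq = solve-∀

∑ᵛ≤cnt : ∀ {n m} (As : Vec (Sub n) m) {f : Vec (Fin n) m → ℕ} → (∀ v → 0 < f v → ∀ i → lookup v i ∈ lookup As i) → ∑ᵛ m f ≤ cnt As f
∑ᵛ≤cnt [] h = ≤-refl
∑ᵛ≤cnt {n} {suc m} (A ∷ As) {f} h = ∑-mono pt
  where
  pt : ∀ a → ∑ᵛ m (λ v → f (a ∷ v)) ≤ 𝟙 (A a) * cnt As (λ v → f (a ∷ v))
  pt a with true? (A a)
  ... | yes p = ≤-trans (∑ᵛ≤cnt As (λ v q i → h (a ∷ v) q (suc i))) (≤-reflexive (sym (trans (cong (_* cnt As (λ v → f (a ∷ v))) (𝟙-true p)) (*-identityˡ _))))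
  ... | no p = ≤-trans (∑ᵛ-mono m (λ v → ≮⇒≥ (λ q → p (h (a ∷ v) q zero)))) (≤-trans (≤-reflexive (trans (∑ᵛ-const n m 0) (*-zeroʳ (n ^ m)))) z≤n)

vol-++ : ∀ {n m p} (As : Vec (Sub n) m) (Bs : Vec (Sub n) p) → vol (As ++ Bs) ≡ vol As * vol Bs
vol-++ [] Bs = sym (*-identityˡ _)
vol-++ (A ∷ As) Bs = trans (cong (# A *_) (vol-++ As Bs)) (sym (*-assoc (# A) _ _))

vol-replicate : ∀ {n} m (A : Sub n) → vol (replicate m A) ≡ # A ^ m
vol-replicate zero A = refl
vol-replicate (suc m) A = cong (# A *_) (vol-replicate m A)

-- Cliques on `suc k` vertices are a positive fraction of all tuples in `R`. Any two of their
-- vertices are adjacent, so regularising their indicator makes every pair of sides bi-dense.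
hub-exists : ∀ {n} {g : Fin n → Sub n} → (∀ x y → g x y ≡ g y x) → ∀ {σ D} → LocallyDense g σ D → 0 < n → 1 ≤ D → ∀ k E → 1 ≤ E → ∀ R s → n ≤ s * # R → s * (2 * D) ^ suc k ≤ σ →
  Σ (Hub g k E (2 * Qc D (suc k))) λ P → (∀ i → Hub.part P i ⊆ R) × (∀ i → # R ≤ ν E (Qc D (suc k)) * # (Hub.part P i))
hub-exists {n} {g} gs {σ} {D} ld 0<n 1≤D k E 1≤E R s hs hσ = record { part = lookup As ; bd = λ i j i≢j → bd i j i≢j (λ v → adj v i j i≢j) } ,
      (λ i x p → subst (x ∈_) (lookup-replicate i R) (sub i x p)) , λ i → ≤-trans (≤-reflexive (cong #_ (sym (lookup-replicate i R)))) (size i)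
  where
  adj : ∀ (v : Vec (Fin n) (suc k)) i j → ¬ i ≡ j → 𝟙 (clique g R v) ≤ 𝟙 (g (lookup v i) (lookup v j))
  adj v i j i≢j = 𝟙-mono (λ p → typClique-adj g 1 gs v p i j i≢j)
  member : ∀ (v : Vec (Fin n) (suc k)) → 0 < 𝟙 (clique g R v) → ∀ i → lookup v i ∈ lookup (replicate (suc k) R) i
  member v p i = subst (lookup v i ∈_) (sym (lookup-replicate i R)) (typClique-∈ g 1 v (𝟙-pos p) i)
  result = regularize g E (Qc D (suc k)) 1≤E (Qc≥1 D (suc k) 1≤D) (replicate (suc k) R) (λ v → 𝟙 (clique g R v)) (λ v → 𝟙≤1 _)
    (subst (0 <_) (sym (vol-replicate (suc k) R)) (^-≥1 (# R) (suc k) (pos-factorʳ s _ 0<n hs)))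
    (≤-trans (≤-reflexive (vol-replicate (suc k) R)) (≤-trans (clique-count g ld 0<n 1≤D (suc k) {R} s hs hσ) (*-monoʳ-≤ (Qc D (suc k)) (∑ᵛ≤cnt (replicate (suc k) R) member))))
  As = proj₁ result
  sub = proj₁ (proj₂ result)
  size = proj₁ (proj₂ (proj₂ result))
  bd = proj₂ (proj₂ (proj₂ result))

take-++ : ∀ {A : Set} m {p} (u : Vec A m) (v : Vec A p) → take m (u ++ v) ≡ u
take-++ zero [] v = refl
take-++ (suc m) (x ∷ u) v = cong (x ∷_) (take-++ m u v)

drop-++ : ∀ {A : Set} m {p} (u : Vec A m) (v : Vec A p) → drop m (u ++ v) ≡ v
drop-++ zero [] v = refl
drop-++ (suc m) (x ∷ u) v = drop-++ m u v

lookup-take : ∀ {A : Set} m {p} (v : Vec A (m + p)) i → lookup v (i ↑ˡ p) ≡ lookup (take m v) i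
lookup-take m {p} v i = trans (cong (λ w → lookup w (i ↑ˡ p)) (sym (take++drop≡id m v))) (lookup-++ˡ (take m v) (drop m v) i)

lookup-drop : ∀ {A : Set} m {p} (v : Vec A (m + p)) i → lookup v (m ↑ʳ i) ≡ lookup (drop m v) i
lookup-drop m v i = trans (cong (λ w → lookup w (m ↑ʳ i)) (sym (take++drop≡id m v))) (lookup-++ʳ (take m v) (drop m v) i)

↑ˡ≢↑ʳ : ∀ m {p} (i : Fin m) (j : Fin p) → ¬ i ↑ˡ p ≡ m ↑ʳ j
↑ˡ≢↑ʳ (suc m) (suc i) j e = ↑ˡ≢↑ʳ m i j (Finₚ.suc-injective e)

few₀ : ∀ {n} (g : Fin n → Sub n) E κ S → FewAtypical g 1 {0} E κ S (λ ())
few₀ g E κ S Bs _ _ = ≤-trans (≤-reflexive (trans (cong (κ *_) (#-none none)) (*-zeroʳ κ))) z≤n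
  where
  none : ∀ x → (S ∖ typical g 1 Bs) x ≡ false
  none x = ¬true (λ p → true≢false (all-intro {A = λ c → # (Bs c) ≤?ᵇ 1 * # (Bs c ∩ g x)} (λ ())) (not-elim (∧-elimʳ {S x} p)))

-- Between consecutive layers equal indices are included. No condition binds `rs` to `bs`, because
-- an edge of `H` will never skip the layer `us`.
record Links {n} (g : Fin n → Sub n) (k E q c : ℕ) (R U B : Sub n) : Set where
  field
    rs us bs : Fin k → Sub n
    rs⊆ : ∀ i → rs i ⊆ R
    us⊆ : ∀ i → us i ⊆ U
    bs⊆ : ∀ i → bs i ⊆ B
    rs-size : ∀ i → # R ≤ c * # (rs i)
    us-size : ∀ i → # U ≤ c * # (us i)
    bs-size : ∀ i → # B ≤ c * # (bs i)
    rr : ∀ i j → ¬ i ≡ j → BiDense g E q (rs i) (rs j)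
    ru : ∀ i j → BiDense g E q (rs i) (us j)
    ur : ∀ i j → BiDense g E q (us i) (rs j)
    uu : ∀ i j → ¬ i ≡ j → BiDense g E q (us i) (us j)
    ub : ∀ i j → BiDense g E q (us i) (bs j)
    bu : ∀ i j → BiDense g E q (bs i) (us j)
    bb : ∀ i j → ¬ i ≡ j → BiDense g E q (bs i) (bs j)

-- No family has to stay large here, so `link` is used with an empty family `Bs`. A link is
-- regularised as a single tuple of `k + (k + k)` vertices, the middle first, then the old end, then
-- the new end.
links-exist : ∀ {n} {g : Fin n → Sub n} → (∀ x y → g x y ≡ g y x) → ∀ {σ D} → LocallyDense g σ D → 0 < n → 1 ≤ D → ∀ k E → 1 ≤ E →
  ∀ R U B e s → 1 ≤ e → n ≤ s * # R → n ≤ s * # U → n ≤ s * # B → (∀ t b → t ∈ R → b ∈ B → # U ≤ e * # (U ∩ g t ∩ g b)) →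
  s * (e * (2 * Q₁ D e k)) * (2 * D) ^ k ≤ σ → Links g k E (2 * Qlink D e k) (ν E (Qlink D e k)) R U B
links-exist {n} {g} gs {σ} {D} ld 0<n 1≤D k E 1≤E R U B e s 1≤e hR hU hB codeg hσ = record
    { rs = λ i → lookup As′ (ri i) ; us = λ i → lookup As′ (ui i) ; bs = λ i → lookup As′ (bi i)
    ; rs⊆ = λ i x p → subst (x ∈_) (As-r i) (sub (ri i) x p)
    ; us⊆ = λ i x p → subst (x ∈_) (As-u i) (sub (ui i) x p)
    ; bs⊆ = λ i x p → subst (x ∈_) (As-b i) (sub (bi i) x p)
    ; rs-size = λ i → ≤-trans (≤-reflexive (cong #_ (sym (As-r i)))) (size (ri i))
    ; us-size = λ i → ≤-trans (≤-reflexive (cong #_ (sym (As-u i)))) (size (ui i))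
    ; bs-size = λ i → ≤-trans (≤-reflexive (cong #_ (sym (As-b i)))) (size (bi i))
    ; rr = λ i j i≢j → bd (ri i) (ri j) (λ e → i≢j (Finₚ.↑ˡ-injective k i j (Finₚ.↑ʳ-injective k _ _ e))) (λ v → adj v (ts-at v i) (ts-at v j) (λ p → typClique-adj g 1 gs (ts v) (t-clique v p) i j i≢j))
    ; ru = λ i j → bd (ri i) (ui j) (λ e → ↑ˡ≢↑ʳ k j (i ↑ˡ k) (sym e)) (λ v → adj v (ts-at v i) (ms-at v j) (λ p → trans (gs _ _) (t-m v p i j)))
    ; ur = λ i j → bd (ui i) (ri j) (↑ˡ≢↑ʳ k i (j ↑ˡ k)) (λ v → adj v (ms-at v i) (ts-at v j) (λ p → t-m v p j i))
    ; uu = λ i j i≢j → bd (ui i) (ui j) (λ e → i≢j (Finₚ.↑ˡ-injective (k + k) i j e)) (λ v → adj v (ms-at v i) (ms-at v j) (λ p → typClique-adj g 1 gs (ms v) (∧-elimˡ p) i j i≢j))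
    ; ub = λ i j → bd (ui i) (bi j) (↑ˡ≢↑ʳ k i (k ↑ʳ j)) (λ v → adj v (ms-at v i) (ds-at v j) (λ p → d-m v p j i))
    ; bu = λ i j → bd (bi i) (ui j) (λ e → ↑ˡ≢↑ʳ k j (k ↑ʳ i) (sym e)) (λ v → adj v (ds-at v i) (ms-at v j) (λ p → trans (gs _ _) (d-m v p i j)))
    ; bb = λ i j i≢j → bd (bi i) (bi j) (λ e → i≢j (Finₚ.↑ʳ-injective k i j (Finₚ.↑ʳ-injective k _ _ e))) (λ v → adj v (ds-at v i) (ds-at v j) (λ p → typClique-adj g 1 gs (ds v) (d-clique v p) i j i≢j))
    }
  where
  ri ui bi : Fin k → Fin (k + (k + k))
  ri i = k ↑ʳ (i ↑ˡ k)
  ui i = i ↑ˡ (k + k)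
  bi i = k ↑ʳ (k ↑ʳ i)
  ms ts ds : Vec (Fin n) (k + (k + k)) → Vec (Fin n) k
  ms v = take k v
  ts v = take k (drop k v)
  ds v = drop k (drop k v)
  ms-at : ∀ v i → lookup v (ui i) ≡ lookup (ms v) i
  ms-at v i = lookup-take k v i
  ts-at : ∀ v i → lookup v (ri i) ≡ lookup (ts v) i
  ts-at v i = trans (lookup-drop k v (i ↑ˡ k)) (lookup-take k (drop k v) i)
  ds-at : ∀ v i → lookup v (bi i) ≡ lookup (ds v) i
  ds-at v i = trans (lookup-drop k v (k ↑ʳ i)) (lookup-drop k (drop k v) i)
  few : FewAtypical g 1 {0} (1 ^ k) (4 * D * (1 * (2 * Q₁ D e k) * (2 * D) ^ k)) B (λ ())
  few = few₀ g (1 ^ k) (4 * D * (1 * (2 * Q₁ D e k) * (2 * D) ^ k)) B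
  lnk : Vec (Fin n) k → Vec (Fin n) k → Vec (Fin n) k → Bool
  lnk = link g 1 {0} (λ ()) R U B
  rel : Vec (Fin n) (k + (k + k)) → Bool
  rel v = lnk (ms v) (ts v) (ds v)
  t-clique : ∀ v → rel v ≡ true → clique g (R ∩ CN g (ms v)) (ts v) ≡ true
  t-clique v p = ∧-elimˡ (∧-elimʳ {clique g U (ms v)} p)
  d-clique : ∀ v → rel v ≡ true → clique g (B ∩ CN g (ms v)) (ds v) ≡ true
  d-clique v p = ∧-elimʳ {clique g (R ∩ CN g (ms v)) (ts v)} (∧-elimʳ {clique g U (ms v)} p)
  t-m : ∀ v → rel v ≡ true → ∀ i j → lookup (ts v) i ∈ g (lookup (ms v) j)
  t-m v p i j = CN-lookup g (ms v) (∧-elimʳ {R _} (typClique-∈ g 1 (ts v) (t-clique v p) i)) j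
  d-m : ∀ v → rel v ≡ true → ∀ i j → lookup (ds v) i ∈ g (lookup (ms v) j)
  d-m v p i j = CN-lookup g (ms v) (∧-elimʳ {B _} (typClique-∈ g 1 (ds v) (d-clique v p) i)) j
  adj : ∀ v {x y x′ y′} → x ≡ x′ → y ≡ y′ → (rel v ≡ true → y′ ∈ g x′) → 𝟙 (rel v) ≤ 𝟙 (g x y)
  adj v refl refl h = 𝟙-mono h
  As : Vec (Sub n) (k + (k + k))
  As = replicate k U ++ (replicate k R ++ replicate k B)
  As-u : ∀ i → lookup As (ui i) ≡ U
  As-u i = trans (lookup-++ˡ (replicate k U) _ i) (lookup-replicate i U)
  As-r : ∀ i → lookup As (ri i) ≡ R
  As-r i = trans (lookup-++ʳ (replicate k U) _ (i ↑ˡ k)) (trans (lookup-++ˡ (replicate k R) _ i) (lookup-replicate i R))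
  As-b : ∀ i → lookup As (bi i) ≡ B
  As-b i = trans (lookup-++ʳ (replicate k U) _ (k ↑ʳ i)) (trans (lookup-++ʳ (replicate k R) _ i) (lookup-replicate i B))
  vol-As : vol As ≡ # U ^ k * (# R ^ k * # B ^ k)
  vol-As = trans (vol-++ (replicate k U) _) (cong₂ _*_ (vol-replicate k U) (trans (vol-++ (replicate k R) _) (cong₂ _*_ (vol-replicate k R) (vol-replicate k B))))
  0<vol : 0 < vol As
  0<vol = subst (0 <_) (sym vol-As) (1≤* (^-≥1 _ k (pos-factorʳ s _ 0<n hU)) (1≤* (^-≥1 _ k (pos-factorʳ s _ 0<n hR)) (^-≥1 _ k (pos-factorʳ s _ 0<n hB))))
  member : ∀ v → 0 < 𝟙 (rel v) → ∀ i → lookup v i ∈ lookup As i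
  member v p′ i with Data.Fin.splitAt k i in eq
  ... | inj₁ a rewrite sym (Finₚ.splitAt⁻¹-↑ˡ eq) = subst₂ (λ x A → x ∈ A) (sym (ms-at v a)) (sym (As-u a)) (typClique-∈ g 1 (ms v) (∧-elimˡ (𝟙-pos p′)) a)
  ... | inj₂ b with Data.Fin.splitAt k b in eq′
  ... | inj₁ a rewrite sym (Finₚ.splitAt⁻¹-↑ʳ {m = k} eq) | sym (Finₚ.splitAt⁻¹-↑ˡ eq′) = subst₂ (λ x A → x ∈ A) (sym (ts-at v a)) (sym (As-r a)) (∧-elimˡ (typClique-∈ g 1 (ts v) (t-clique v (𝟙-pos p′)) a))
  ... | inj₂ a rewrite sym (Finₚ.splitAt⁻¹-↑ʳ {m = k} eq) | sym (Finₚ.splitAt⁻¹-↑ʳ {m = k} eq′) = subst₂ (λ x A → x ∈ A) (sym (ds-at v a)) (sym (As-b a)) (∧-elimˡ (typClique-∈ g 1 (ds v) (d-clique v (𝟙-pos p′)) a))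
  count-eq : ∑ᵛ (k + (k + k)) (λ v → 𝟙 (rel v)) ≡ ∑ᵛ k (λ a → ∑ᵛ k (λ b → ∑ᵛ k (λ c → 𝟙 (lnk a b c))))
  count-eq = trans (∑ᵛ-++ k _) (∑ᵛ-cong k (λ a → trans (∑ᵛ-++ k _) (∑ᵛ-cong k (λ b → ∑ᵛ-cong k (λ c → cong 𝟙 (pt a b c))))))
    where
    pt : ∀ a b c → rel (a ++ (b ++ c)) ≡ lnk a b c
    pt a b c rewrite take-++ k a (b ++ c) | drop-++ k a (b ++ c) | take-++ k b c | drop-++ k b c = refl
  dens : vol As ≤ Qlink D e k * cnt As (λ v → 𝟙 (rel v))
  dens = ≤-trans (≤-reflexive vol-As) (≤-trans (link-count g gs {σ} {D} ld 0<n 1≤D {1} {0} ≤-refl {1 ^ k} {4 * D * (1 * (2 * Q₁ D e k) * (2 * D) ^ k)} {B} {λ ()} few R U B k e s 1 1≤e hR hU hB (λ _ p → p) (≤-reflexive (sym (*-identityˡ _))) codeg hσ ≤-refl ≤-refl)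
    (*-monoʳ-≤ (Qlink D e k) (≤-trans (≤-reflexive (sym count-eq)) (∑ᵛ≤cnt As member))))
  result = regularize g E (Qlink D e k) 1≤E (Qlink≥1 D e k 1≤D 1≤e) As (λ v → 𝟙 (rel v)) (λ v → 𝟙≤1 _) 0<vol dens
  As′ = proj₁ result
  sub = proj₁ (proj₂ result)
  size = proj₁ (proj₂ (proj₂ result))
  bd = proj₂ (proj₂ (proj₂ result))

-- Selection by an exponential potential

∑∑ : ∀ {n} → (Fin n → Fin n → ℕ) → ℕ
∑∑ w = ∑ (λ u → ∑ (λ y → w u y))

∑∑-mono : ∀ {n} {w w′ : Fin n → Fin n → ℕ} → (∀ u y → w u y ≤ w′ u y) → ∑∑ w ≤ ∑∑ w′
∑∑-mono h = ∑-mono (λ u → ∑-mono (h u))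

∑∑-cong : ∀ {n} {w w′ : Fin n → Fin n → ℕ} → (∀ u y → w u y ≡ w′ u y) → ∑∑ w ≡ ∑∑ w′
∑∑-cong h = ∑-cong (λ u → ∑-cong (h u))

∑∑-+ : ∀ {n} (w w′ : Fin n → Fin n → ℕ) → ∑∑ (λ u y → w u y + w′ u y) ≡ ∑∑ w + ∑∑ w′
∑∑-+ w w′ = trans (∑-cong (λ u → ∑-+ (w u) (w′ u))) (∑-+ _ _)

∑∑-*ˡ : ∀ {n} c (w : Fin n → Fin n → ℕ) → ∑∑ (λ u y → c * w u y) ≡ c * ∑∑ w
∑∑-*ˡ c w = trans (∑-cong (λ u → ∑-*ˡ c (w u))) (∑-*ˡ c (λ u → ∑ (w u)))

∑∑-const : ∀ n c → ∑∑ {n} (λ _ _ → c) ≡ n * (n * c)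
∑∑-const n c = trans (∑-cong {n} (λ _ → ∑-const n c)) (∑-const n _)

term≤∑∑ : ∀ {n} (w : Fin n → Fin n → ℕ) u y → w u y ≤ ∑∑ w
term≤∑∑ w u y = ≤-trans (term≤∑ (w u) y) (term≤∑ (λ u → ∑ (w u)) u)

-- By Bernoulli `(1 + 1 / T) ^ T` is at least 2. This is used `t` times, and the remaining factors
-- are at least 1.
power-gap : ∀ T s t → 0 < T → T * t ≤ s → 2 ^ t * T ^ s ≤ suc T ^ s
power-gap T s t 0<T h = begin
  2 ^ t * T ^ s ≡⟨ cong (λ x → 2 ^ t * T ^ x) (sym (m+[n∸m]≡n h)) ⟩
  2 ^ t * T ^ (T * t + r) ≡⟨ cong (2 ^ t *_) (^-distribˡ-+-* T (T * t) r) ⟩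
  2 ^ t * (T ^ (T * t) * T ^ r) ≡⟨ sym (*-assoc (2 ^ t) _ _) ⟩
  2 ^ t * T ^ (T * t) * T ^ r ≡⟨ cong (λ x → 2 ^ t * x * T ^ r) (sym (^-*-assoc T T t)) ⟩
  2 ^ t * (T ^ T) ^ t * T ^ r ≡⟨ cong (_* T ^ r) (sym (*-^ 2 (T ^ T) t)) ⟩
  (2 * T ^ T) ^ t * T ^ r ≤⟨ *-mono-≤ (^-monoˡ-≤ t base) (^-monoˡ-≤ r (n≤1+n T)) ⟩
  (suc T ^ T) ^ t * suc T ^ r ≡⟨ cong (_* suc T ^ r) (^-*-assoc (suc T) T t) ⟩
  suc T ^ (T * t) * suc T ^ r ≡⟨ sym (^-distribˡ-+-* (suc T) (T * t) r) ⟩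
  suc T ^ (T * t + r) ≡⟨ cong (suc T ^_) (m+[n∸m]≡n h) ⟩
  suc T ^ s ∎
  where
  open ≤-Reasoning
  r = s ∸ T * t
  base : 2 * T ^ T ≤ suc T ^ T
  base = *-cancelˡ-≤ T {{>-nonZero 0<T}} (≤-trans (≤-reflexive (eq T (T ^ T))) (bernoulli T T))
    where
    eq : ∀ T x → T * (2 * x) ≡ x * (T + T)
    eq = solve-∀

2^-cancel : ∀ a b → 2 ^ a ≤ 2 ^ b → a ≤ b
2^-cancel a b h = ≮⇒≥ (λ lt → <⇒≱ (^-monoʳ-< 2 (s≤s (s≤s z≤n)) lt) h)

-- `P r c` is to be read as a partial construction with `r` moves left in which each test `(u , y)`
-- has been hit `c u y` times. `step` is the averaging hypothesis: for any weights on the tests,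
-- some move hits at least the fraction `1 / suc p₀` of the total weight.
module Selection {n : ℕ} (0<n : 0 < n) (p₀ : ℕ) (P : ℕ → (Fin n → Fin n → ℕ) → Set)
  (step : ∀ r c → P (suc r) c → (w : Fin n → Fin n → ℕ) → 0 < ∑∑ w →
    Σ (Fin n → Fin n → Bool) λ h → P r (λ u y → c u y + 𝟙 (h u y)) × (∑∑ w ≤ suc p₀ * ∑∑ (λ u y → 𝟙 (h u y) * w u y))) where

  -- Tests that are hit keep their weight and the others double it, so the total grows by at most
  -- `2 - 1 / p`, which is `T / p`. A test that is never hit grows by 2 each time.
  p T : ℕ
  p = suc p₀
  T = p₀ + p

  -- The weight 2 ^ (i ∸ c u y) after i steps, c u y of which hit the test (u , y).
  run : ∀ r i c w → P r c → (∀ u y → w u y * 2 ^ c u y ≡ 2 ^ i) → 0 < ∑∑ w → p ^ i * ∑∑ w ≤ T ^ i * (n * n) →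
    ∃ λ c′ → P 0 c′ × (∀ u y → p ^ (r + i) * 2 ^ (r + i) ≤ 2 ^ c′ u y * (T ^ (r + i) * (n * n)))
  run zero i c w st weight 0<w pot = c , st , λ u y → begin
    p ^ i * 2 ^ i ≡⟨ cong (p ^ i *_) (sym (weight u y)) ⟩
    p ^ i * (w u y * 2 ^ c u y) ≤⟨ *-monoʳ-≤ (p ^ i) (*-monoˡ-≤ (2 ^ c u y) (term≤∑∑ w u y)) ⟩
    p ^ i * (∑∑ w * 2 ^ c u y) ≡⟨ sym (*-assoc (p ^ i) (∑∑ w) (2 ^ c u y)) ⟩
    p ^ i * ∑∑ w * 2 ^ c u y ≤⟨ *-monoˡ-≤ (2 ^ c u y) pot ⟩
    T ^ i * (n * n) * 2 ^ c u y ≡⟨ *-comm _ (2 ^ c u y) ⟩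
    2 ^ c u y * (T ^ i * (n * n)) ∎
    where open ≤-Reasoning
  run (suc r) i c w st weight 0<w pot with step r c st w 0<w
  ... | h , st′ , hit = subst (λ j → ∃ λ c′ → P 0 c′ × (∀ u y → p ^ j * 2 ^ j ≤ 2 ^ c′ u y * (T ^ j * (n * n)))) (+-suc r i)
      (run r (suc i) _ w′ st′ weight′ (≤-trans 0<w (∑∑-mono (λ u y → w≤ (h u y) (w u y)))) pot′)
    where
    up : Bool → ℕ → ℕ
    up true x = x
    up false x = 2 * x
    w′ : Fin n → Fin n → ℕ
    w′ u y = up (h u y) (w u y)
    w≤ : ∀ b x → x ≤ up b x
    w≤ true x = ≤-refl
    w≤ false x = m≤m+n x _
    up-weight : ∀ b x c → x * 2 ^ c ≡ 2 ^ i → up b x * 2 ^ (c + 𝟙 b) ≡ 2 ^ suc i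
    up-weight true x c e = trans (cong (λ z → x * 2 ^ z) (+-comm c 1)) (trans (eq x (2 ^ c)) (cong (2 *_) e))
      where
      eq : ∀ x y → x * (2 * y) ≡ 2 * (x * y)
      eq = solve-∀
    up-weight false x c e = trans (cong (λ z → 2 * x * 2 ^ z) (+-identityʳ c)) (trans (*-assoc 2 x _) (cong (2 *_) e))
    weight′ : ∀ u y → w′ u y * 2 ^ (c u y + 𝟙 (h u y)) ≡ 2 ^ suc i
    weight′ u y = up-weight (h u y) (w u y) (c u y) (weight u y)
    total : ∑∑ w′ + ∑∑ (λ u y → 𝟙 (h u y) * w u y) ≡ 2 * ∑∑ w
    total = trans (sym (∑∑-+ w′ _)) (trans (∑∑-cong (λ u y → pt (h u y) (w u y))) (∑∑-*ˡ 2 w))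
      where
      pt : ∀ b x → up b x + 𝟙 b * x ≡ 2 * x
      pt true x = refl
      pt false x = +-identityʳ _
    shrink : p * ∑∑ w′ ≤ T * ∑∑ w
    shrink = lin 0 hit (trans (eq p₀ (∑∑ w′) (∑∑ (λ u y → 𝟙 (h u y) * w u y))) (trans (cong (p *_) total) (eq′ p₀ (∑∑ w))))
      where
      eq : ∀ p a b → suc p * a + suc p * b + 0 ≡ suc p * (a + b)
      eq = solve-∀
      eq′ : ∀ p a → suc p * (2 * a) ≡ (p + suc p) * a + a
      eq′ = solve-∀
    pot′ : p ^ suc i * ∑∑ w′ ≤ T ^ suc i * (n * n)
    pot′ = begin
      p * p ^ i * ∑∑ w′ ≡⟨ eq p (p ^ i) (∑∑ w′) ⟩
      p ^ i * (p * ∑∑ w′) ≤⟨ *-monoʳ-≤ (p ^ i) shrink ⟩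
      p ^ i * (T * ∑∑ w) ≡⟨ sym (trans (cong (T *_) refl) (eq₂ T (p ^ i) (∑∑ w))) ⟩
      T * (p ^ i * ∑∑ w) ≤⟨ *-monoʳ-≤ T pot ⟩
      T * (T ^ i * (n * n)) ≡⟨ sym (*-assoc T _ _) ⟩
      T ^ suc i * (n * n) ∎
      where
      open ≤-Reasoning
      eq : ∀ p x y → p * x * y ≡ x * (p * y)
      eq = solve-∀
      eq₂ : ∀ t x y → t * (x * y) ≡ x * (t * y)
      eq₂ = solve-∀

  -- A single weight `2 ^ (s - c)` is at most the total `(T / p) ^ s * n * n`. As `2 * p` is
  -- `suc T`, this makes `2 ^ c * n * n` at least `(suc T / T) ^ s`, hence at least `2 ^ t`. The
  -- number of tests costs only its logarithm `h`.
  selection : ∀ s t h → P s (λ _ _ → 0) → T * t ≤ s → n * n ≤ 2 ^ h → ∃ λ c → P 0 c × (∀ u y → t ≤ c u y + h)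
  selection s t h st Tt≤s n²≤ with run s 0 (λ _ _ → 0) (λ _ _ → 1) st (λ _ _ → refl) (subst (0 <_) (sym (∑∑-const n 1)) (1≤* 0<n (1≤* 0<n ≤-refl))) (≤-reflexive (trans (*-identityˡ _) (trans (∑∑-const n 1) (trans (cong (n *_) (*-identityʳ n)) (sym (*-identityˡ _))))))
  ... | c , st′ , bound = c , st′ , λ u y → 2^-cancel t (c u y + h) (*-cancelʳ-≤ _ _ (T ^ s) {{>-nonZero 0<T^s}} (begin
    2 ^ t * T ^ s ≤⟨ power-gap T s t 0<T Tt≤s ⟩
    suc T ^ s ≡⟨ cong (_^ s) eqT ⟩
    (p * 2) ^ s ≡⟨ *-^ p 2 s ⟩
    p ^ s * 2 ^ s ≤⟨ subst (λ j → p ^ j * 2 ^ j ≤ 2 ^ c u y * (T ^ j * (n * n))) (+-identityʳ s) (bound u y) ⟩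
    2 ^ c u y * (T ^ s * (n * n)) ≤⟨ *-monoʳ-≤ (2 ^ c u y) (*-monoʳ-≤ (T ^ s) n²≤) ⟩
    2 ^ c u y * (T ^ s * 2 ^ h) ≡⟨ eq (2 ^ c u y) (T ^ s) (2 ^ h) ⟩
    2 ^ c u y * 2 ^ h * T ^ s ≡⟨ cong (_* T ^ s) (sym (^-distribˡ-+-* 2 (c u y) h)) ⟩
    2 ^ (c u y + h) * T ^ s ∎))
    where
    open ≤-Reasoning
    0<T : 0 < T
    0<T = subst (0 <_) (sym (+-suc p₀ p₀)) (s≤s z≤n)
    0<T^s : 0 < T ^ s
    0<T^s = ^-≥1 T s 0<T
    eqT : suc T ≡ p * 2
    eqT = e p₀
      where
      e : ∀ p → suc (p + suc p) ≡ suc p * 2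
      e = solve-∀
    eq : ∀ a b c → a * (b * c) ≡ a * c * b
    eq = solve-∀

m≤2^m : ∀ m → m ≤ 2 ^ m
m≤2^m zero = z≤n
m≤2^m (suc m) = ≤-trans (+-mono-≤ (^-≥1 2 m (s≤s z≤n)) (m≤2^m m)) (≤-reflexive (cong (2 ^ m +_) (sym (+-identityʳ (2 ^ m)))))

-- `n` is at most `a * a`, and `a` is at most `2 ^ a`. In this way a small linear number of extra
-- hits pays for all pairs of vertices.
square≤2^ : ∀ n C a → n ≤ C * a → C ≤ a → n * n ≤ 2 ^ (4 * a)
square≤2^ n C a h C≤a = begin
  n * n ≤⟨ *-mono-≤ n≤ n≤ ⟩
  2 ^ a * 2 ^ a * (2 ^ a * 2 ^ a) ≡⟨ cong₂ _*_ (sym (^-distribˡ-+-* 2 a a)) (sym (^-distribˡ-+-* 2 a a)) ⟩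
  2 ^ (a + a) * 2 ^ (a + a) ≡⟨ sym (^-distribˡ-+-* 2 (a + a) (a + a)) ⟩
  2 ^ (a + a + (a + a)) ≡⟨ cong (2 ^_) (eq a) ⟩
  2 ^ (4 * a) ∎
  where
  open ≤-Reasoning
  eq : ∀ a → a + a + (a + a) ≡ 4 * a
  eq = solve-∀
  n≤ : n ≤ 2 ^ a * 2 ^ a
  n≤ = ≤-trans h (≤-trans (*-monoˡ-≤ a C≤a) (*-mono-≤ (m≤2^m a) (m≤2^m a)))

-- Union bounds and intervals of positions

#-any : ∀ {m n} (K : Sub m) (B : Fin m → Sub n) → # (λ x → any (λ w → K w ∧ B w x)) ≤ ∑ (λ w → 𝟙 (K w) * # (B w))
#-any K B = ≤-trans (∑-mono pt) (≤-reflexive (trans (∑-comm (λ x w → 𝟙 (K w) * 𝟙 (B w x))) (∑-cong (λ w → ∑-*ˡ (𝟙 (K w)) (λ x → 𝟙 (B w x))))))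
  where
  pt : ∀ x → 𝟙 (any (λ w → K w ∧ B w x)) ≤ ∑ (λ w → 𝟙 (K w) * 𝟙 (B w x))
  pt x with true? (any (λ w → K w ∧ B w x))
  ... | no p = ≤-trans (≤-reflexive (𝟙-false (¬true p))) z≤n
  ... | yes p with any-elim {A = λ w → K w ∧ B w x} p
  ... | w , r = ≤-trans (𝟙≤1 _) (≤-trans (≤-reflexive (sym (trans (sym (𝟙-∧ (K w) (B w x))) (𝟙-true r)))) (term≤∑ (λ w → 𝟙 (K w) * 𝟙 (B w x)) w))

#-⊂ : ∀ {n} {A B : Sub n} v → B ⊆ A → v ∈ A → B v ≡ false → suc (# B) ≤ # A
#-⊂ {n} {A} {B} v B⊆A v∈A v∉B = ≤-trans (+-monoˡ-≤ (# B) (#-pos {A = A ∖ B} v (∧-intro v∈A (not-intro v∉B)))) (≤-trans (+-monoʳ-≤ (# (A ∖ B)) (#-mono (λ x p → ∧-intro (B⊆A x p) p))) (≤-reflexive (trans (+-comm (# (A ∖ B)) _) (sym (#-split A B)))))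

below : ∀ {n} → ℕ → Sub n
below m v = suc (toℕ v) ≤?ᵇ m

#-below : ∀ {n} m → m ≤ n → # (below {n} m) ≡ m
#-below {n} zero _ = #-none {n} (λ v → ¬true (λ p → n≮0 (≤?ᵇ-sound {suc (toℕ v)} {0} p)))
#-below {suc n} (suc m) (s≤s h) = trans (∑-suc _) (cong suc (trans (#-cong pt) (#-below {n} m h)))
  where
  pt : ∀ v → below (suc m) (suc v) ≡ below m v
  pt v = refl

#-below≤ : ∀ {n} m → # (below {n} m) ≤ m
#-below≤ {n} m with m ≤? n
... | yes p = ≤-reflexive (#-below m p)
... | no p = ≤-trans (#≤n _) (<⇒≤ (≰⇒> p))

range : ∀ {n} → ℕ → ℕ → Sub n
range a ℓ = below (a + ℓ) ∖ below a

range-intro : ∀ {n} a ℓ (v : Fin n) → a ≤ toℕ v → toℕ v < a + ℓ → v ∈ range a ℓ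
range-intro a ℓ v p q = ∧-intro (≤?ᵇ-complete q) (not-intro (¬true (λ r → <⇒≱ (≤?ᵇ-sound {suc (toℕ v)} r) p)))

range-lo : ∀ {n} a ℓ (v : Fin n) → v ∈ range a ℓ → a ≤ toℕ v
range-lo a ℓ v p = ≤-pred (≤?ᵇ-false {suc (toℕ v)} {a} (not-elim (∧-elimʳ {below (a + ℓ) v} p)))

range-hi : ∀ {n} a ℓ (v : Fin n) → v ∈ range a ℓ → toℕ v < a + ℓ
range-hi a ℓ v p = ≤?ᵇ-sound {suc (toℕ v)} {a + ℓ} (∧-elimˡ p)

range-wider : ∀ {n} a ℓ (v : Fin n) → v ∈ range (suc a) ℓ → v ∈ range a (suc ℓ)
range-wider a ℓ v p = range-intro a (suc ℓ) v (≤-trans (n≤1+n a) (range-lo (suc a) ℓ v p)) (≤-trans (range-hi (suc a) ℓ v p) (≤-reflexive (sym (+-suc a ℓ))))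

#-range-split : ∀ {n} a ℓ → # (below {n} (a + ℓ)) ≡ # (below {n} a) + # (range {n} a ℓ)
#-range-split {n} a ℓ = trans (#-split (below (a + ℓ)) (below a)) (cong (_+ # (range {n} a ℓ)) (#-cong pt))
  where
  pt : ∀ v → (below (a + ℓ) ∩ below {n} a) v ≡ below a v
  pt v with true? (below a v)
  ... | yes p = trans (∧-intro (≤?ᵇ-complete (≤-trans (≤?ᵇ-sound {suc (toℕ v)} {a} p) (m≤m+n a ℓ))) p) (sym p)
  ... | no p = trans (¬true (λ r → p (∧-elimʳ {below (a + ℓ) v} r))) (sym (¬true p))

#-range : ∀ {n} a ℓ → a + ℓ ≤ n → # (range {n} a ℓ) ≡ ℓ
#-range {n} a ℓ h = +-cancelˡ-≡ a _ _ (trans (cong (_+ # (range {n} a ℓ)) (sym (#-below {n} a (≤-trans (m≤m+n a ℓ) h)))) (trans (sym (#-range-split a ℓ)) (#-below (a + ℓ) h)))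

#-range≤ : ∀ {n} a ℓ → # (range {n} a ℓ) ≤ ℓ
#-range≤ {n} a ℓ with a ≤? n
... | yes p = +-cancelˡ-≤ a _ _ (≤-trans (≤-reflexive (trans (cong (_+ # (range {n} a ℓ)) (sym (#-below {n} a p))) (sym (#-range-split a ℓ)))) (#-below≤ (a + ℓ)))
... | no p = ≤-trans (≤-reflexive (#-none {n} {range a ℓ} (λ v → ¬true (λ r → p (≤-trans (range-lo a ℓ v r) (<⇒≤ (Finₚ.toℕ<n v))))))) z≤n

if-true : ∀ {A : Set} {b} {x y : A} → b ≡ true → (if b then x else y) ≡ x
if-true refl = refl

if-false : ∀ {A : Set} {b} {x y : A} → b ≡ false → (if b then x else y) ≡ y
if-false refl = refl

-- Colourings and distances

-- Greedy colouring. `r` may be reflexive, hence the conclusion `v ≡ w`. Vertices not yet reached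
-- carry a default colour, and the new colour avoids those on all of `r v₀`, so the whole of `r v₀`
-- must be smaller than `k`.
colour-exists : ∀ {n} (r : Fin n → Sub n) → (∀ x y → r x y ≡ r y x) → ∀ k → 0 < k → (∀ v → # (r v) < k) →
  Σ (Fin n → Fin k) λ χ → ∀ v w → w ∈ r v → χ v ≡ χ w → v ≡ w
colour-exists {n} r rs k 0<k deg with go n ≤-refl
  where
  Good : ℕ → (Fin n → Fin k) → Set
  Good m χ = ∀ v w → toℕ v < m → toℕ w < m → w ∈ r v → χ v ≡ χ w → v ≡ w
  go : ∀ m → m ≤ n → Σ (Fin n → Fin k) (Good m)
  go zero _ = (λ _ → fromℕ< 0<k) , λ v w ()
  go (suc m) m<n with go m (<⇒≤ m<n)
  ... | χ , good = χ′ , good′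
    where
    v₀ = fromℕ< m<n
    taken : Sub k
    taken c = any (λ w → r v₀ w ∧ (χ w ≡ᶠ c))
    few : # taken < k
    few = ≤-<-trans (≤-trans (#-any (r v₀) (λ w c → χ w ≡ᶠ c)) (≤-reflexive (∑-cong (λ w → trans (cong (𝟙 (r v₀ w) *_) (#-singleton (χ w))) (*-identityʳ _))))) (deg v₀)
    free = #-exists-∖ (λ _ → true) taken (<-≤-trans few (≤-reflexive (sym (#-full k))))
    c₀ = proj₁ free
    c₀-free : ∀ w → w ∈ r v₀ → ¬ χ w ≡ c₀
    c₀-free w p e = true≢false (any-intro {A = λ w → r v₀ w ∧ (χ w ≡ᶠ c₀)} w (∧-intro p (subst (λ c → (χ w ≡ᶠ c) ≡ true) e (≡ᶠ-refl (χ w))))) (proj₂ (proj₂ free))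
    χ′ : Fin n → Fin k
    χ′ v = if v₀ ≡ᶠ v then c₀ else χ v
    view : ∀ v → toℕ v < suc m → v ≡ v₀ ⊎ (toℕ v < m × χ′ v ≡ χ v)
    view v p with v₀ Finₚ.≟ v
    ... | yes e = inj₁ (sym e)
    ... | no ne = inj₂ (≤∧≢⇒< (≤-pred p) (λ e → ne (Finₚ.toℕ-injective (trans (Finₚ.toℕ-fromℕ< m<n) (sym e)))) , refl)
    χ′₀ : χ′ v₀ ≡ c₀
    χ′₀ = if-true (≡ᶠ-refl v₀)
    good′ : Good (suc m) χ′
    good′ v w p q e c with view v p | view w q
    ... | inj₁ refl | inj₁ refl = refl
    ... | inj₁ refl | inj₂ (_ , cw) = ⊥-elim (c₀-free w e (trans (sym cw) (trans (sym c) χ′₀)))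
    ... | inj₂ (_ , cv) | inj₁ refl = ⊥-elim (c₀-free v (trans (rs v₀ v) e) (trans (sym cv) (trans c χ′₀)))
    ... | inj₂ (p′ , cv) | inj₂ (q′ , cw) = good v w p′ q′ e (trans (sym cv) (trans c cw))
... | χ , good = χ , λ v w → good v w (Finₚ.toℕ<n v) (Finₚ.toℕ<n w)

popular : ∀ {n k} → 0 < k → (χ : Fin n → Fin k) (A : Sub n) → ∃ λ c → # A ≤ k * # (A ∩ (λ v → χ v ≡ᶠ c))
popular {n} {k} 0<k χ A = ∑-exists-≤ (λ _ → # A) (λ c → k * # (A ∩ (λ v → χ v ≡ᶠ c))) 0<k (≤-reflexive (begin
    ∑ (λ (_ : Fin k) → # A) ≡⟨ ∑-const k (# A) ⟩
    k * # A ≡⟨ cong (k *_) (∑-cong pt) ⟩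
    k * ∑ (λ v → ∑ (λ c → 𝟙 (A v ∧ (χ v ≡ᶠ c)))) ≡⟨ cong (k *_) (∑-comm _) ⟩
    k * ∑ (λ c → # (A ∩ (λ v → χ v ≡ᶠ c))) ≡⟨ sym (∑-*ˡ k _) ⟩
    ∑ (λ c → k * # (A ∩ (λ v → χ v ≡ᶠ c))) ∎))
  where
  open ≡-Reasoning
  pt : ∀ v → 𝟙 (A v) ≡ ∑ (λ c → 𝟙 (A v ∧ (χ v ≡ᶠ c)))
  pt v = sym (trans (∑-cong (λ c → 𝟙-∧ (A v) (χ v ≡ᶠ c))) (trans (∑-*ˡ (𝟙 (A v)) (λ c → 𝟙 (χ v ≡ᶠ c))) (trans (cong (𝟙 (A v) *_) (#-singleton (χ v))) (*-identityʳ _))))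

module Near {n : ℕ} (h : Fin n → Sub n) (hs : ∀ x y → h x y ≡ h y x) where

  opaque
    near : ℕ → Fin n → Sub n
    near zero x v = x ≡ᶠ v
    near (suc j) x v = near j x v ∨ any (λ w → near j x w ∧ h w v)

    near-0 : ∀ x v → v ∈ near 0 x → x ≡ v
    near-0 x v = ≡ᶠ-sound

    near-suc : ∀ j x v → v ∈ near j x → v ∈ near (suc j) x
    near-suc j x v p = ∨-introˡ _ p

    near-mono : ∀ {i j} x v → i ≤ j → v ∈ near i x → v ∈ near j x
    near-mono {j = zero} x v z≤n p = p
    near-mono {j = suc j} x v z≤n p = near-suc j x v (near-mono {0} {j} x v z≤n p)
    near-mono {suc i} {suc j} x v (s≤s q) p with ∨-elim {near i x v} p
    ... | inj₁ r = near-suc j x v (near-mono x v q r)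
    ... | inj₂ r with any-elim {A = λ w → near i x w ∧ h w v} r
    ... | w , z = ∨-introʳ (near j x v) (any-intro {A = λ w → near j x w ∧ h w v} w (∧-intro (near-mono x w q (∧-elimˡ z)) (∧-elimʳ {near i x w} z)))

    near-refl : ∀ j x → x ∈ near j x
    near-refl j x = near-mono {0} {j} x x z≤n (≡ᶠ-refl x)

    near-step : ∀ j x w v → w ∈ near j x → v ∈ h w → v ∈ near (suc j) x
    near-step j x w v p r = ∨-introʳ (near j x v) (any-intro {A = λ w → near j x w ∧ h w v} w (∧-intro p r))

    near-elim : ∀ j x v → v ∈ near (suc j) x → v ∈ near j x ⊎ (∃ λ w → w ∈ near j x × v ∈ h w)
    near-elim j x v p with ∨-elim {near j x v} p
    ... | inj₁ r = inj₁ r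
    ... | inj₂ r with any-elim {A = λ w → near j x w ∧ h w v} r
    ... | w , z = inj₂ (w , ∧-elimˡ z , ∧-elimʳ {near j x w} z)

    near-trans : ∀ i j x w v → w ∈ near i x → v ∈ near j w → v ∈ near (j + i) x
    near-trans i zero x w v p r = subst (_∈ near i x) (≡ᶠ-sound r) p
    near-trans i (suc j) x w v p r with near-elim j w v r
    ... | inj₁ z = near-suc (j + i) x v (near-trans i j x w v p z)
    ... | inj₂ (y , z , e) = near-step (j + i) x y v (near-trans i j x w y p z) e

    near-sym′ : ∀ j x v → v ∈ near j x → x ∈ near j v
    near-sym′ zero x v p = subst (λ z → z ∈ near 0 v) (sym (≡ᶠ-sound p)) (≡ᶠ-refl v)
    near-sym′ (suc j) x v p with near-elim j x v p
    ... | inj₁ r = near-suc j v x (near-sym′ j x v r)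
    ... | inj₂ (w , r , e) = subst (λ i → x ∈ near i v) (+-comm j 1) (near-trans 1 j v w x (near-step 0 v v w (≡ᶠ-refl v) (trans (hs v w) e)) (near-sym′ j x w r))

    near-sym : ∀ j x y → near j x y ≡ near j y x
    near-sym j x y with true? (near j x y)
    ... | yes p = trans p (sym (near-sym′ j x y p))
    ... | no p = trans (¬true p) (sym (¬true (λ r → p (near-sym′ j y x r))))

    near-count : ∀ Δ → (∀ v → # (h v) ≤ Δ) → ∀ j x → # (near j x) ≤ suc Δ ^ j
    near-count Δ deg zero x = ≤-reflexive (#-singleton x)
    near-count Δ deg (suc j) x = begin
      # (near (suc j) x) ≤⟨ ≤-trans (#-∪ _ _) (+-monoʳ-≤ (# (near j x)) (#-any (near j x) h)) ⟩
      # (near j x) + ∑ (λ w → 𝟙 (near j x w) * # (h w)) ≤⟨ +-monoʳ-≤ (# (near j x)) (∑-mono (λ w → *-monoʳ-≤ (𝟙 (near j x w)) (deg w))) ⟩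
      # (near j x) + ∑ (λ w → 𝟙 (near j x w) * Δ) ≡⟨ cong (# (near j x) +_) (trans (∑-*ʳ Δ (λ w → 𝟙 (near j x w))) (*-comm _ Δ)) ⟩
      suc Δ * # (near j x) ≤⟨ *-monoʳ-≤ (suc Δ) (near-count Δ deg j x) ⟩
      suc Δ * suc Δ ^ j ∎
      where open ≤-Reasoning

    near-band : ∀ b → (∀ x v → v ∈ h x → toℕ v ≤ toℕ x + b) → ∀ j x v → v ∈ near j x → toℕ v ≤ toℕ x + j * b
    near-band b band zero x v p = ≤-reflexive (trans (cong toℕ (sym (≡ᶠ-sound p))) (sym (+-identityʳ _)))
    near-band b band (suc j) x v p with near-elim j x v p
    ... | inj₁ r = ≤-trans (near-band b band j x v r) (+-monoʳ-≤ (toℕ x) (m≤n+m (j * b) b))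
    ... | inj₂ (w , r , e) = ≤-trans (band w v e) (≤-trans (+-monoˡ-≤ b (near-band b band j x w r)) (≤-reflexive (trans (+-assoc (toℕ x) (j * b) b) (cong (toℕ x +_) (+-comm (j * b) b)))))

-- Placements of balls

-- The distance from a centre truncated at 3, computed from the truth values of being within
-- distance 0, 1 and 2.
lev′ : Bool → Bool → Bool → ℕ
lev′ true _ _ = 0
lev′ false true _ = 1
lev′ false false true = 2
lev′ false false false = 3

lev′-elim : ∀ a b c (Q : ℕ → Set) → (a ≡ true → Q 0) → (b ≡ true → Q 1) → (c ≡ true → Q 2) → Q 3 → Q (lev′ a b c)
lev′-elim true b c Q q₀ q₁ q₂ q₃ = q₀ refl
lev′-elim false true c Q q₀ q₁ q₂ q₃ = q₁ refl
lev′-elim false false true Q q₀ q₁ q₂ q₃ = q₂ refl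
lev′-elim false false false Q q₀ q₁ q₂ q₃ = q₃

lev′≤1 : ∀ a b c → b ≡ true → lev′ a b c ≤ 1
lev′≤1 true b c p = z≤n
lev′≤1 false true c p = ≤-refl

lev′≤2 : ∀ a b c → c ≡ true → lev′ a b c ≤ 2
lev′≤2 true b c p = z≤n
lev′≤2 false true c p = s≤s z≤n
lev′≤2 false false true p = ≤-refl

lev′≤3 : ∀ a b c → lev′ a b c ≤ 3
lev′≤3 true b c = z≤n
lev′≤3 false true c = s≤s z≤n
lev′≤3 false false true = s≤s (s≤s z≤n)
lev′≤3 false false false = ≤-refl

-- A placement of a ball of radius 3: the vertex of colour `c` at distance `l` from the centre goes
-- to `cell l c`. Colours do not repeat within a ball, so one vertex per layer and colour is enough.
record Option (n k : ℕ) : Set where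
  constructor option
  field
    z : Fin n
    ms ts ds : Vec (Fin n) k

  cell : ℕ → Fin k → Fin n
  cell 0 c = z
  cell 1 c = lookup ts c
  cell 2 c = lookup ms c
  cell (suc (suc (suc _))) c = lookup ds c

∑-pos : ∀ {n} (f : Fin n → ℕ) → 0 < ∑ f → ∃ λ i → 0 < f i
∑-pos {n} f p = ∑-exists-< (λ _ → 0) f (subst (_< ∑ f) (sym (trans (∑-const n 0) (*-zeroʳ n))) p)

opaque
  ∑∑-pos : ∀ {n} (f : Fin n → Fin n → ℕ) → 0 < ∑∑ f → ∃ λ u → ∃ λ y → 0 < f u y
  ∑∑-pos f p with ∑-pos _ p
  ... | u , r with ∑-pos _ r
  ... | y , s = u , y , s

#-remove : ∀ {n} (A : Sub n) x → x ∈ A → # A ≡ suc (# (A ∖ (x ≡ᶠ_)))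
#-remove A x p = trans (#-split A (x ≡ᶠ_)) (cong (_+ # (A ∖ (x ≡ᶠ_))) (trans (#-cong pt) (#-singleton x)))
  where
  pt : ∀ i → (A ∩ (x ≡ᶠ_)) i ≡ (x ≡ᶠ i)
  pt i with true? (x ≡ᶠ i)
  ... | yes r = trans (∧-intro (subst (_∈ A) (≡ᶠ-sound r) p) r) (sym r)
  ... | no r = trans (¬true (λ s → r (∧-elimʳ {A i} s))) (sym (¬true r))

module _ {n k : ℕ} where

  ∑Ω : (Option n k → ℕ) → ℕ
  ∑Ω f = ∑ (λ z → ∑ᵛ k (λ ms → ∑ᵛ k (λ ts → ∑ᵛ k (λ ds → f (option z ms ts ds)))))

  Ω-size : ℕ
  Ω-size = n * (n ^ k * (n ^ k * n ^ k))

  ∑Ω-const : ∀ c → ∑Ω (λ _ → c) ≡ Ω-size * c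
  ∑Ω-const c = trans (∑-cong (λ z → trans (∑ᵛ-cong k (λ ms → trans (∑ᵛ-cong k (λ ts → ∑ᵛ-const n k c)) (∑ᵛ-const n k _))) (∑ᵛ-const n k _))) (trans (∑-const n _) (eq n (n ^ k) c))
    where
    eq : ∀ n a c → n * (a * (a * (a * c))) ≡ n * (a * (a * a)) * c
    eq = solve-∀

  ∑Ω-*ˡ : ∀ c f → ∑Ω (λ o → c * f o) ≡ c * ∑Ω f
  ∑Ω-*ˡ c f = trans (∑-cong (λ z → trans (∑ᵛ-cong k (λ ms → trans (∑ᵛ-cong k (λ ts → ∑ᵛ-*ˡ k c _)) (∑ᵛ-*ˡ k c _))) (∑ᵛ-*ˡ k c _))) (∑-*ˡ c _)

  ∑Ω-∑ : ∀ {m} (f : Fin m → Option n k → ℕ) → ∑Ω (λ o → ∑ (λ i → f i o)) ≡ ∑ (λ i → ∑Ω (f i))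
  ∑Ω-∑ f = trans (∑-cong (λ z → trans (∑ᵛ-cong k (λ ms → trans (∑ᵛ-cong k (λ ts → ∑ᵛ-comm k _)) (∑ᵛ-comm k _))) (∑ᵛ-comm k _))) (∑-comm _)

  ∑Ω-exists-≤ : ∀ f f′ → 0 < n → ∑Ω f ≤ ∑Ω f′ → ∃ λ o → f o ≤ f′ o
  ∑Ω-exists-≤ f f′ 0<n p with ∑-exists-≤ _ _ 0<n p
  ... | z , p₁ with ∑ᵛ-exists-≤ k _ _ 0<n p₁
  ... | ms , p₂ with ∑ᵛ-exists-≤ k _ _ 0<n p₂
  ... | ts , p₃ with ∑ᵛ-exists-≤ k _ _ 0<n p₃
  ... | ds , p₄ = option z ms ts ds , p₄
  opaque
    -- Exchange of sums: if every test accepts the fraction `1 / p` of all options, an average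
    -- option is accepted by the fraction `1 / p` of the weight.
    weighted-choice : ∀ p (accepts : Fin n → Fin n → Option n k → Bool) → 0 < n → (∀ u y → Ω-size ≤ p * ∑Ω (λ o → 𝟙 (accepts u y o))) →
      (w : Fin n → Fin n → ℕ) → ∃ λ o → ∑∑ w ≤ p * ∑∑ (λ u y → 𝟙 (accepts u y o) * w u y)
    weighted-choice p accepts 0<n many w = ∑Ω-exists-≤ (λ _ → ∑∑ w) (λ o → p * ∑∑ (λ u y → 𝟙 (accepts u y o) * w u y)) 0<n (begin
      ∑Ω (λ _ → ∑∑ w) ≡⟨ trans (∑Ω-const (∑∑ w)) (sym (∑∑-*ˡ Ω-size w)) ⟩
      ∑∑ (λ u y → Ω-size * w u y) ≤⟨ ∑∑-mono (λ u y → *-monoˡ-≤ (w u y) (many u y)) ⟩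
      ∑∑ (λ u y → p * ∑Ω (λ o → 𝟙 (accepts u y o)) * w u y) ≡⟨ trans (∑∑-cong (λ u y → *-assoc p _ (w u y))) (∑∑-*ˡ p (λ u y → ∑Ω (λ o → 𝟙 (accepts u y o)) * w u y)) ⟩
      p * ∑∑ (λ u y → ∑Ω (λ o → 𝟙 (accepts u y o)) * w u y) ≡⟨ cong (p *_) (∑∑-cong (λ u y → sym (trans (cong-Ω (λ o → *-comm (𝟙 (accepts u y o)) (w u y))) (trans (∑Ω-*ˡ (w u y) (λ o → 𝟙 (accepts u y o))) (*-comm (w u y) _))))) ⟩
      p * ∑∑ (λ u y → ∑Ω (λ o → 𝟙 (accepts u y o) * w u y)) ≡⟨ cong (p *_) (sym (trans (∑Ω-∑ (λ u o → ∑ (λ y → 𝟙 (accepts u y o) * w u y))) (∑-cong (λ u → ∑Ω-∑ (λ y o → 𝟙 (accepts u y o) * w u y))))) ⟩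
      p * ∑Ω (λ o → ∑∑ (λ u y → 𝟙 (accepts u y o) * w u y)) ≡⟨ sym (∑Ω-*ˡ p (λ o → ∑∑ (λ u y → 𝟙 (accepts u y o) * w u y))) ⟩
      ∑Ω (λ o → p * ∑∑ (λ u y → 𝟙 (accepts u y o) * w u y)) ∎)
      where
      open ≤-Reasoning
      cong-Ω : ∀ {f f′ : Option n k → ℕ} → (∀ o → f o ≡ f′ o) → ∑Ω f ≡ ∑Ω f′
      cong-Ω e = ∑-cong (λ z → ∑ᵛ-cong k (λ ms → ∑ᵛ-cong k (λ ts → ∑ᵛ-cong k (λ ds → e (option z ms ts ds)))))

-- The reservoir

module _ {n : ℕ} (g : Fin n → Sub n) (0<n : 0 < n) (e : ℕ) (1≤e : 1 ≤ e) (codeg : ∀ u v → n ≤ e * # (g u ∩ g v)) where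

  private
    Res : ℕ → ℕ → (Fin n → Fin n → ℕ) → Set
    Res s r c = Σ (Sub n) λ U → (# U + r ≡ s) × (∀ u v → c u v ≤ # (U ∩ g u ∩ g v))

    res-extend : ∀ s r c (R : Res s (suc r) c) (m : Fin n) → proj₁ R m ≡ false → (b : Fin n → Fin n → Bool) → (∀ u v → b u v ≡ true → m ∈ g u × m ∈ g v) →
      Res s r (λ u v → c u v + 𝟙 (b u v))
    res-extend s r c (U , size , hits) m m∉U b b-adj = U′ , size′ , hits′
      where
      U′ : Sub n
      U′ x = U x ∨ (m ≡ᶠ x)
      m∈U′ : m ∈ U′
      m∈U′ = ∨-introʳ (U m) (≡ᶠ-refl m)
      size′ : # U′ + r ≡ s
      size′ = trans (cong (_+ r) (≤-antisym (≤-trans (#-∪ U (m ≡ᶠ_)) (≤-reflexive (trans (cong (# U +_) (#-singleton m)) (+-comm (# U) 1)))) (#-⊂ m (λ x p → ∨-introˡ (m ≡ᶠ x) p) m∈U′ m∉U))) (trans (sym (+-suc (# U) r)) size)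
      hits′ : ∀ u v → c u v + 𝟙 (b u v) ≤ # (U′ ∩ g u ∩ g v)
      hits′ u v with true? (b u v)
      ... | no p = ≤-trans (≤-reflexive (trans (cong (c u v +_) (𝟙-false (¬true p))) (+-identityʳ _))) (≤-trans (hits u v) (#-mono (λ x z → ∧-intro (∧-intro (∨-introˡ (m ≡ᶠ x) (∧-elimˡ {U x} (∧-elimˡ {U x ∧ g u x} z))) (∧-elimʳ {U x} (∧-elimˡ {U x ∧ g u x} z))) (∧-elimʳ {U x ∧ g u x} z))))
      ... | yes p = ≤-trans (≤-reflexive (trans (cong (c u v +_) (𝟙-true p)) (+-comm (c u v) 1))) (≤-trans (s≤s (hits u v)) (#-⊂ {A = U′ ∩ g u ∩ g v} {U ∩ g u ∩ g v} m (λ x z → ∧-intro (∧-intro (∨-introˡ (m ≡ᶠ x) (∧-elimˡ {U x} (∧-elimˡ {U x ∧ g u x} z))) (∧-elimʳ {U x} (∧-elimˡ {U x ∧ g u x} z))) (∧-elimʳ {U x ∧ g u x} z)) (∧-intro (∧-intro m∈U′ (proj₁ (b-adj u v p))) (proj₂ (b-adj u v p))) (¬true (λ z → true≢false (∧-elimˡ {U m} (∧-elimˡ {U m ∧ g u m} z)) m∉U))))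

    -- `U` covers at most half of each `g u ∩ g v`, so a random vertex is a new common neighbour of
    -- `u` and `v` with probability at least `1 / (2 * e)`.
    res-step : ∀ s → 2 * e * s ≤ n → ∀ r c → Res s (suc r) c → (w : Fin n → Fin n → ℕ) → 0 < ∑∑ w →
      Σ (Fin n → Fin n → Bool) λ b → Res s r (λ u v → c u v + 𝟙 (b u v)) × (∑∑ w ≤ suc (2 * e) * ∑∑ (λ u v → 𝟙 (b u v) * w u v))
    res-step s hs r c (U , size , hits) w 0<w = b , res-extend s r c (U , size , hits) m m∉U b (λ u v p → ∧-elimˡ {g u m} (∧-elimˡ {g u m ∧ g v m} p) , ∧-elimʳ {g u m} (∧-elimˡ {g u m ∧ g v m} p)) , ≤-trans heavy (*-monoˡ-≤ (∑∑ (λ u v → 𝟙 (b u v) * w u v)) (n≤1+n (2 * e)))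
      where
      A : Fin n → Fin n → Sub n
      A u v = (g u ∩ g v) ∖ U
      A-large : ∀ u v → n ≤ 2 * e * # (A u v)
      A-large u v = arith {n} {e} {# (A u v)} {# U} (≤-trans (codeg u v) (*-monoʳ-≤ e (#-∖ (g u ∩ g v) U))) (≤-trans (*-monoʳ-≤ (2 * e) (≤-trans (m≤m+n (# U) (suc r)) (≤-reflexive size))) hs)
        where
        arith : ∀ {n e a f} → n ≤ e * (a + f) → 2 * e * f ≤ n → n ≤ 2 * e * a
        arith {n} {e} {a} {f} p r = lin 0 (+-mono-≤ (*-monoʳ-≤ 2 p) r) (eq n e a f)
          where
          eq : ∀ n e a f → n + (2 * (e * (a + f)) + n) + 0 ≡ 2 * e * a + (2 * n + 2 * e * f)
          eq = solve-∀
      chosen : ∃ λ m → ∑∑ w ≤ 2 * e * ∑∑ (λ u v → 𝟙 (A u v m) * w u v)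
      chosen = ∑-exists-≤ (λ _ → ∑∑ w) (λ m → 2 * e * ∑∑ (λ u v → 𝟙 (A u v m) * w u v)) 0<n (begin
        ∑ (λ _ → ∑∑ w) ≡⟨ trans (∑-const n (∑∑ w)) (sym (∑∑-*ˡ n w)) ⟩
        ∑∑ (λ u v → n * w u v) ≤⟨ ∑∑-mono (λ u v → *-monoˡ-≤ (w u v) (A-large u v)) ⟩
        ∑∑ (λ u v → 2 * e * # (A u v) * w u v) ≡⟨ trans (∑∑-cong (λ u v → trans (*-assoc (2 * e) (# (A u v)) (w u v)) (cong (2 * e *_) (sym (∑-*ʳ (w u v) (λ m → 𝟙 (A u v m))))))) (∑∑-*ˡ (2 * e) _) ⟩
        2 * e * ∑∑ (λ u v → ∑ (λ m → 𝟙 (A u v m) * w u v)) ≡⟨ cong (2 * e *_) (trans (∑-cong (λ u → ∑-comm (λ v m → 𝟙 (A u v m) * w u v))) (∑-comm (λ u m → ∑ (λ v → 𝟙 (A u v m) * w u v)))) ⟩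
        2 * e * ∑ (λ m → ∑∑ (λ u v → 𝟙 (A u v m) * w u v)) ≡⟨ sym (∑-*ˡ (2 * e) _) ⟩
        ∑ (λ m → 2 * e * ∑∑ (λ u v → 𝟙 (A u v m) * w u v)) ∎)
        where open ≤-Reasoning
      m : Fin n
      m = proj₁ chosen
      heavy = proj₂ chosen
      b : Fin n → Fin n → Bool
      b u v = A u v m
      -- The total weight is positive, so `m` hits some pair. Hits lie outside `U`, and therefore
      -- `m` is new.
      some = ∑∑-pos _ (pos-factorʳ (2 * e) _ 0<w heavy)
      m∉U : U m ≡ false
      m∉U = not-elim (∧-elimʳ {(g (proj₁ some) ∩ g (proj₁ (proj₂ some))) m} (𝟙-pos (pos-factorʳ (w (proj₁ some) (proj₁ (proj₂ some))) _ (proj₂ (proj₂ some)) (≤-reflexive (*-comm (𝟙 (b (proj₁ some) (proj₁ (proj₂ some)))) _)))))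

  opaque
    -- The tests are the pairs of vertices of `G`. `t + l` hits are asked for, of which `l` are
    -- given up for the number of pairs.
    reservoir : ∀ s t l → 2 * e * s ≤ n → (2 * e + suc (2 * e)) * (t + l) ≤ s → n * n ≤ 2 ^ l →
      Σ (Sub n) λ U → (# U ≡ s) × (∀ u v → t ≤ # (U ∩ g u ∩ g v))
    reservoir s t l hs ht hl = finish (Selection.selection 0<n (2 * e) (Res s) (res-step s hs) s (t + l) l ((λ _ → false) , cong (_+ s) (#-none {n} (λ _ → refl)) , λ u v → z≤n) ht hl)
      where
      finish : (∃ λ c → Res s 0 c × (∀ u v → t + l ≤ c u v + l)) → Σ (Sub n) λ U → (# U ≡ s) × (∀ u v → t ≤ # (U ∩ g u ∩ g v))
      finish (c , (U , size , hits) , bound) = U , trans (sym (+-identityʳ _)) size , λ u v → ≤-trans (+-cancelʳ-≤ l t (c u v) (bound u v)) (hits u v)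

Hub-weaken : ∀ {n} {g : Fin n → Sub n} {k E q q′} → q ≤ q′ → Hub g k E q → Hub g k E q′
Hub-weaken {q = q} {q′} h P = record { part = Hub.part P ; bd = λ i j ne X Y a b c d → ≤-trans (Hub.bd P i j ne X Y a b c d) (*-monoˡ-≤ _ h) }

Links-weaken : ∀ {n} {g : Fin n → Sub n} {k E q q′ c R U B} → q ≤ q′ → Links g k E q c R U B → Links g k E q′ c R U B
Links-weaken {n} {g} {k} {E} {q} {q′} h L = record
  { rs = rs ; us = us ; bs = bs ; rs⊆ = rs⊆ ; us⊆ = us⊆ ; bs⊆ = bs⊆ ; rs-size = rs-size ; us-size = us-size ; bs-size = bs-size
  ; rr = λ i j ne → weaken (rr i j ne) ; ru = λ i j → weaken (ru i j) ; ur = λ i j → weaken (ur i j) ; uu = λ i j ne → weaken (uu i j ne)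
  ; ub = λ i j → weaken (ub i j) ; bu = λ i j → weaken (bu i j) ; bb = λ i j ne → weaken (bb i j ne) }
  where
  open Links L
  weaken : ∀ {A B} → BiDense g E q A B → BiDense g E q′ A B
  weaken bd X Y a b c d = ≤-trans (bd X Y a b c d) (*-monoˡ-≤ _ h)

zone-step : ∀ x y w .{{_ : NonZero w}} → x ≤ y + w → x / w ≤ suc (y / w)
zone-step x y w h = ≤-trans (/-monoˡ-≤ w h) (≤-reflexive (trans (m/n≡1+[m∸n]/n (m≤n+m w y)) (cong (λ z → suc (z / w)) (m+n∸n≡m y w))))

zone-lo : ∀ x w .{{_ : NonZero w}} → x / w * w ≤ x
zone-lo x w = m/n*n≤m x w

zone-hi : ∀ x w .{{_ : NonZero w}} → x < suc (x / w) * w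
zone-hi x w = ≤-<-trans (≤-reflexive (m≡m%n+[m/n]*n x w)) (+-monoˡ-< (x / w * w) (m%n<n x w))

-- Absorption

-- A leftover vertex u takes the place of an absorber x, whose old image becomes the image of y.
module Absorb {n : ℕ} (g h : Fin n → Sub n) (gs : ∀ x y → g x y ≡ g y x) (hs : ∀ x y → h x y ≡ h y x) (hi : ∀ x → h x x ≡ false)
  (φ : Fin n → Fin n) (X Y : Sub n)
  (inj : ∀ v w → Y v ≡ false → Y w ≡ false → φ v ≡ φ w → v ≡ w) (hom : ∀ v w → Y v ≡ false → Y w ≡ false → w ∈ h v → φ w ∈ g (φ v))
  (X-Y : ∀ x → x ∈ X → Y x ≡ false) (X-nbr : ∀ x v → x ∈ X → v ∈ h x → X v ≡ false × Y v ≡ false) (Y-nbr : ∀ y v → y ∈ Y → v ∈ h y → X v ≡ false × Y v ≡ false)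
  (hit : Fin n → Fin n → Sub n) (hit-X : ∀ u y x → x ∈ hit u y → x ∈ X)
  (hit-y : ∀ u y x v → y ∈ Y → x ∈ hit u y → v ∈ h y → φ x ∈ g (φ v)) (hit-u : ∀ u y x v → x ∈ hit u y → v ∈ h x → φ v ∈ g u)
  (many : ∀ u y → # Y ≤ # (hit u y)) where

  -- `Z` holds the vertices of `H` still without an image. Every swap spends one absorber, so while
  -- `Z` is nonempty fewer than `# Y` absorbers are spent, and `many` leaves an unspent one.
  record Swapped (Z : Sub n) : Set where
    field
      ψ : Fin n → Fin n
      moved : Sub n
      Z⊆Y : Z ⊆ Y
      moved⊆X : moved ⊆ X
      size : # moved + # Z ≡ # Y
      same : ∀ v → Y v ≡ false → moved v ≡ false → ψ v ≡ φ v
      ψ-inj : ∀ v w → Z v ≡ false → Z w ≡ false → ψ v ≡ ψ w → v ≡ w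
      ψ-hom : ∀ v w → Z v ≡ false → Z w ≡ false → w ∈ h v → ψ w ∈ g (ψ v)

  -- No neighbour of `x` or `y` lies in `X` or `Y`, so all these neighbours still have their images
  -- under `φ`. The new edges at `x` and `y` therefore come directly from `hit-u` and `hit-y`.
  swap : ∀ {Z} (s : Swapped Z) y u x → y ∈ Z → (∀ v → Z v ≡ false → ¬ Swapped.ψ s v ≡ u) → x ∈ hit u y → Swapped.moved s x ≡ false → Swapped (Z ∖ (y ≡ᶠ_))
  swap {Z} s y u x y∈Z fresh x∈hit x-new = record
      { ψ = ψ′ ; moved = moved′ ; Z⊆Y = λ v p → Z⊆Y v (∧-elimˡ p) ; moved⊆X = moved′⊆X ; size = size′ ; same = same′ ; ψ-inj = inj′ ; ψ-hom = hom′ }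
    where
    open Swapped s
    y∈Y : y ∈ Y
    y∈Y = Z⊆Y y y∈Z
    x∈X : x ∈ X
    x∈X = hit-X u y x x∈hit
    x∉Y : Y x ≡ false
    x∉Y = X-Y x x∈X
    x∉Z : Z x ≡ false
    x∉Z = ¬true (λ p → true≢false (Z⊆Y x p) x∉Y)
    x≢y : ¬ x ≡ y
    x≢y e = true≢false (subst (_∈ Y) (sym e) y∈Y) x∉Y
    ψ′ : Fin n → Fin n
    ψ′ v = if x ≡ᶠ v then u else (if y ≡ᶠ v then φ x else ψ v)
    moved′ : Sub n
    moved′ v = moved v ∨ (x ≡ᶠ v)
    ψ-x : ψ′ x ≡ u
    ψ-x = if-true (≡ᶠ-refl x)
    neq : ∀ {a b : Fin n} → ¬ a ≡ b → (a ≡ᶠ b) ≡ false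
    neq ne = ¬true (λ p → ne (≡ᶠ-sound p))
    ψ-y : ψ′ y ≡ φ x
    ψ-y = trans (if-false (neq x≢y)) (if-true (≡ᶠ-refl y))
    ψ-other : ∀ v → ¬ x ≡ v → ¬ y ≡ v → ψ′ v ≡ ψ v
    ψ-other v p q = trans (if-false (neq p)) (if-false (neq q))
    ψx≡φx : ψ x ≡ φ x
    ψx≡φx = same x x∉Y x-new
    moved′⊆X : moved′ ⊆ X
    moved′⊆X v p with ∨-elim {moved v} p
    ... | inj₁ r = moved⊆X v r
    ... | inj₂ r = subst (_∈ X) (≡ᶠ-sound r) x∈X
    size′ : # moved′ + # (Z ∖ (y ≡ᶠ_)) ≡ # Y
    size′ = trans (cong (_+ # (Z ∖ (y ≡ᶠ_))) #moved′) (trans (sym (+-suc (# moved) _)) (trans (cong (# moved +_) (sym (#-remove Z y y∈Z))) size))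
      where
      #moved′ : # moved′ ≡ suc (# moved)
      #moved′ = ≤-antisym (≤-trans (#-∪ moved (x ≡ᶠ_)) (≤-reflexive (trans (cong (# moved +_) (#-singleton x)) (+-comm (# moved) 1)))) (#-⊂ {A = moved′} {moved} x (λ v p → ∨-introˡ (x ≡ᶠ v) p) (∨-introʳ (moved x) (≡ᶠ-refl x)) x-new)
    same′ : ∀ v → Y v ≡ false → moved′ v ≡ false → ψ′ v ≡ φ v
    same′ v p r = trans (ψ-other v (λ e → true≢false (subst (λ v → (x ≡ᶠ v) ≡ true) e (≡ᶠ-refl x)) (∨-falseʳ {moved v} r)) (λ e → true≢false (subst (_∈ Y) e y∈Y) p)) (same v p (∨-falseˡ r))
    data View (v : Fin n) : Set where
      is-x : x ≡ v → View v
      is-y : y ≡ v → View v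
      old : Z v ≡ false → ψ′ v ≡ ψ v → ¬ x ≡ v → View v
    view : ∀ v → (Z ∖ (y ≡ᶠ_)) v ≡ false → View v
    view v p with x Finₚ.≟ v | y Finₚ.≟ v
    ... | yes e | _ = is-x e
    ... | no _ | yes e = is-y e
    ... | no ne | no ne′ = old (¬true (λ z → true≢false (∧-intro z refl) p)) (ψ-other v ne ne′) ne
    plain : ∀ v → X v ≡ false → Y v ≡ false → ψ′ v ≡ φ v
    plain v p r = same′ v r (∨-false (¬true (λ m → true≢false (moved⊆X v m) p)) (neq (λ e → true≢false (subst (_∈ X) e x∈X) p)))
    inj′ : ∀ v w → (Z ∖ (y ≡ᶠ_)) v ≡ false → (Z ∖ (y ≡ᶠ_)) w ≡ false → ψ′ v ≡ ψ′ w → v ≡ w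
    inj′ v w p r e with view v p | view w r
    ... | is-x refl | is-x refl = refl
    ... | is-x refl | is-y refl = ⊥-elim (fresh x x∉Z (trans ψx≡φx (trans (sym ψ-y) (trans (sym e) ψ-x))))
    ... | is-x refl | old z q _ = ⊥-elim (fresh w z (trans (sym q) (trans (sym e) ψ-x)))
    ... | is-y refl | is-x refl = ⊥-elim (fresh x x∉Z (trans ψx≡φx (trans (sym ψ-y) (trans e ψ-x))))
    ... | is-y refl | is-y refl = refl
    ... | is-y refl | old z q ne = ⊥-elim (ne (ψ-inj x w x∉Z z (trans ψx≡φx (trans (sym ψ-y) (trans e q)))))
    ... | old z q _ | is-x refl = ⊥-elim (fresh v z (trans (sym q) (trans e ψ-x)))
    ... | old z q ne | is-y refl = ⊥-elim (ne (ψ-inj x v x∉Z z (trans ψx≡φx (trans (sym ψ-y) (trans (sym e) q)))))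
    ... | old z q _ | old z′ q′ _ = ψ-inj v w z z′ (trans (sym q) (trans e q′))
    x-edge : ∀ w → w ∈ h x → ψ′ w ∈ g (ψ′ x)
    x-edge w e = subst₂ (λ a b → a ∈ g b) (sym (plain w (proj₁ (X-nbr x w x∈X e)) (proj₂ (X-nbr x w x∈X e)))) (sym ψ-x) (hit-u u y x w x∈hit e)
    y-edge : ∀ w → w ∈ h y → ψ′ w ∈ g (ψ′ y)
    y-edge w e = subst₂ (λ a b → a ∈ g b) (sym (plain w (proj₁ (Y-nbr y w y∈Y e)) (proj₂ (Y-nbr y w y∈Y e)))) (sym ψ-y) (trans (gs _ _) (hit-y u y x w y∈Y x∈hit e))
    hom′ : ∀ v w → (Z ∖ (y ≡ᶠ_)) v ≡ false → (Z ∖ (y ≡ᶠ_)) w ≡ false → w ∈ h v → ψ′ w ∈ g (ψ′ v)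
    hom′ v w p r e with view v p | view w r
    ... | is-x refl | _ = x-edge w e
    ... | is-y refl | _ = y-edge w e
    ... | old _ _ _ | is-x refl = trans (gs _ _) (x-edge v (trans (hs x v) e))
    ... | old _ _ _ | is-y refl = trans (gs _ _) (y-edge v (trans (hs y v) e))
    ... | old z q _ | old z′ q′ _ = subst₂ (λ a b → a ∈ g b) (sym q′) (sym q) (ψ-hom v w z z′ e)

  all-swaps : ∀ m Z → # Z ≡ m → Swapped Z → Σ (Fin n → Fin n) λ f → (∀ v w → f v ≡ f w → v ≡ w) × (∀ v w → w ∈ h v → f w ∈ g (f v))
  all-swaps zero Z e s = ψ , (λ v w → ψ-inj v w (empty v) (empty w)) , λ v w → ψ-hom v w (empty v) (empty w)
    where
    open Swapped s
    empty : ∀ v → Z v ≡ false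
    empty v = ¬true (λ p → <⇒≱ (#-pos {A = Z} v p) (≤-reflexive e))
  all-swaps (suc m) Z e s = all-swaps m (Z ∖ (y ≡ᶠ_)) (suc-injective (trans (sym (#-remove Z y y∈Z)) e)) (swap s y u x y∈Z fresh x∈hit x-new)
    where
    open Swapped s
    y-ex : ∃ λ y → y ∈ Z
    y-ex = #-exists Z (subst (0 <_) (sym e) (s≤s z≤n))
    y = proj₁ y-ex
    y∈Z = proj₂ y-ex
    I : Sub n
    I = img (λ v → not (Z v)) ψ
    u-ex : ∃ λ u → true ≡ true × I u ≡ false
    u-ex = #-exists-∖ (λ _ → true) I (≤-<-trans (#-img-≤ (λ v → not (Z v)) ψ) (<-≤-trans (subst (# (λ v → not (Z v)) <_) (sym (#-split (λ _ → true) Z)) (m<n+m (# (λ v → not (Z v))) (subst (0 <_) (sym e) (s≤s z≤n)))) ≤-refl))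
    u = proj₁ u-ex
    fresh : ∀ v → Z v ≡ false → ¬ ψ v ≡ u
    fresh v p eq = true≢false (subst (_∈ I) eq (img-intro {dom = λ v → not (Z v)} {ψ} v (not-intro p))) (proj₂ (proj₂ u-ex))
    x-ex : ∃ λ x → x ∈ hit u y × moved x ≡ false
    x-ex = #-exists-∖ (hit u y) moved (<-≤-trans (subst (# moved <_) size (m<m+n (# moved) (subst (0 <_) (sym e) (s≤s z≤n)))) (many u y))
    x = proj₁ x-ex
    x∈hit = proj₁ (proj₂ x-ex)
    x-new = proj₂ (proj₂ x-ex)

  opaque
    absorbed : Σ (Fin n → Fin n) λ f → (∀ v w → f v ≡ f w → v ≡ w) × (∀ v w → w ∈ h v → f w ∈ g (f v))
    absorbed = all-swaps (# Y) Y refl (record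
      { ψ = φ ; moved = λ _ → false ; Z⊆Y = λ _ p → p ; moved⊆X = λ _ () ; size = cong (_+ # Y) (#-none {n} (λ _ → refl)) ; same = λ _ _ _ → refl ; ψ-inj = inj ; ψ-hom = hom })

-- Constants

-- Absorber balls lie in an interval of length about n / x₀ and Y in one of length about n / y₀; all codegrees into the reservoir are about
-- n / u₀, and each move to a fresh hub covers about n / L₀ vertices.  The parts of the first hub have size at least n / h₁, those of
-- the later ones at least n / s₂.  The bandwidth is at most n / b₀.
record Constants (Δ D e k q E : ℕ) : Set where
  field
    TU νl νh κ Eh h₁ γ x₀ p y₀ τ u₀ s₂ L₀ b₀ σ n₀ : ℕ
  e₁ : ℕ
  e₁ = 2 * TU
  field
    1≤D : 1 ≤ D
    1≤e : 1 ≤ e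
    -- A ball of radius 8 in `H` has at most `suc Δ ^ 8` vertices, so `k` colours can distinguish
    -- all of them.
    hk : suc Δ ^ 8 < k
    -- The value of `T` in `Selection` when a move hits `1 / suc (2 * e)` of the weight. Asking for
    -- `t₀` hits and `t₀` more for the number of pairs gives a reservoir of `2 * TU * t₀` vertices,
    -- that is `e₁ * t₀`.
    TU-def : TU ≡ 2 * e + suc (2 * e)
    1≤q : 1 ≤ q
    hq₁ : 2 * Qc D (suc k) ≤ q
    hq₂ : 2 * Qlink D (2 * e₁) k ≤ q
    -- `q ^ (k + Δ)` bounds the total shrinking of a candidate set. The factor `2 + Δ` leaves a
    -- choice after the used vertices and those exceptional for up to `Δ` neighbours are removed.
    hE : (2 + Δ) * q ^ (k + Δ) ≤ E
    νl-def : νl ≡ ν E (Qlink D (2 * e₁) k)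
    νh-def : νh ≡ ν Eh (Qc D (suc k))
    1≤νl : 1 ≤ νl
    -- Hubs are bi-dense at a finer scale than links: a link set, smaller than part `zero` by up to
    -- `2 * νl`, must still be bi-dense to the other parts of its hub.
    hEh : 2 * νl * E ≤ Eh
    E≤Eh : E ≤ Eh
    hκEh : κ * k ≤ Eh
    hκ : 4 * D * (2 * (2 * Q₁ D (2 * e₁) k) * (2 * D) ^ k) ≤ κ
    h₁-def : h₁ ≡ 16 * e * νh
    1≤h₁ : 1 ≤ h₁
    4e≤h₁ : 4 * e ≤ h₁
    -- A candidate set within the first hub has at least `n / γ` elements.
    γ-def : γ ≡ h₁ * q ^ (k + Δ)
    h₁≤γ : h₁ ≤ γ
    hx₁ : 16 * γ ≤ x₀
    hx₂ : 4 * h₁ * E ≤ x₀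
    -- The reciprocal of the fraction of all options for a ball that every pair `(u , y)` accepts.
    p-def : p ≡ 2 * γ * ((2 * e * h₁) ^ k * ((2 * e * h₁) ^ k * (2 * e * h₁) ^ k) * Qlink D (2 * e₁) k)
    hy : 2 * x₀ * (4 * k * (p + suc p)) ≤ y₀
    hy′ : 2 * x₀ * 1 ≤ y₀
    τ-def : τ ≡ 4 * k * y₀
    hu₁ : 2 * y₀ * (8 * k * TU) ≤ u₀
    hu₂ : 2 * (4 * e) * (4 * TU) ≤ u₀
    hu₃ : 2 * x₀ * (2 * TU) ≤ u₀
    hu₄ : 2 * e * (2 * TU) ≤ u₀
    s₂-def : s₂ ≡ 2 * τ * νh
    h₁≤s₂ : h₁ ≤ s₂
    hL₁ : s₂ * (2 * u₀) * νl * (2 * E) ≤ L₀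
    hL₂ : 2 * x₀ * 1 ≤ L₀
    hb₁ : 2 * u₀ * (4 * L₀) ≤ b₀
    hb₂ : 2 * L₀ * 4 ≤ b₀
    hb₃ : 2 * x₀ * 20 ≤ b₀
    hb₄ : 2 * y₀ * 2 ≤ b₀
    hσ₀ : 16 * e * (2 * D) ^ suc k ≤ σ
    hσB : 2 * e * h₁ * (2 * e₁ * (2 * Q₁ D (2 * e₁) k)) * (2 * D) ^ k ≤ σ
    hσ₁ : 2 * τ * (2 * D) ^ suc k ≤ σ
    hσ₂ : 2 * s₂ * (2 * u₀) * (2 * e₁ * (2 * Q₁ D (2 * e₁) k)) * (2 * D) ^ k ≤ σ
    1≤x₀ : 1 ≤ x₀
    1≤y₀ : 1 ≤ y₀
    1≤u₀ : 1 ≤ u₀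
    1≤L₀ : 1 ≤ L₀
    hn₁ : 4 * e ≤ n₀
    hn₂ : x₀ ≤ n₀
    hn₃ : y₀ ≤ n₀
    hn₄ : 8 * u₀ * (8 * u₀) ≤ n₀
    hn₅ : L₀ ≤ n₀
-- The integer part of `n / c`, with the rounding absorbed into a factor 2.
fraction : ∀ c n → 1 ≤ c → c ≤ n → ∃ λ L → c * L ≤ n × n ≤ 2 * c * L × 1 ≤ L
fraction (suc c) n _ c≤n = n / suc c , ≤-trans (≤-reflexive (*-comm (suc c) (n / suc c))) (m/n*n≤m n (suc c)) , upper , 1≤L
  where
  1≤L : 1 ≤ n / suc c
  1≤L = m≥n⇒m/n>0 c≤n
  upper : n ≤ 2 * suc c * (n / suc c)
  upper = ≤-trans (<⇒≤ (zone-hi n (suc c))) (≤-trans (*-monoˡ-≤ (suc c) (≤-trans (+-monoˡ-≤ (n / suc c) 1≤L) (≤-reflexive (cong (n / suc c +_) (sym (+-identityʳ _)))))) (≤-reflexive (eq (n / suc c) (suc c))))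
    where
    eq : ∀ l c → 2 * l * c ≡ 2 * c * l
    eq = solve-∀

-- Turns a gap between two constants into a comparison of lengths, `x` about `n / c` and `y` about
-- `n / d`. The factor 2 is the rounding loss of `fraction`.
ratio : ∀ {c x y n} d m → 0 < d → 2 * d * m ≤ c → c * x ≤ n → n ≤ 2 * d * y → m * x ≤ y
ratio {c} {x} {y} (suc d) m _ h p r = *-cancelˡ-≤ (2 * suc d) (≤-trans (≤-reflexive (sym (*-assoc (2 * suc d) m x))) (≤-trans (*-monoˡ-≤ x h) (≤-trans p r)))

half-∸ : ∀ {x y} → 2 * y ≤ x → x ≤ 2 * (x ∸ y)
half-∸ {x} {y} h = lin 0 h (trans (+-identityʳ _) (trans (+-comm x x) (trans (cong (λ z → z + z) (sym (m∸n+n≡m (≤-trans (m≤m+n y _) h)))) (eq (x ∸ y) y))))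
  where
  eq : ∀ a y → a + y + (a + y) ≡ 2 * a + 2 * y
  eq = solve-∀

-- Every constant is a variable tied to its formula by an equation, so each inequality is derived
-- from the few equations that matter and not from fully expanded formulas.
constants-from : ∀ Δ D e {k′ TU q E νl νh κ Eh h₁ γ x₀ p y₀ τ u₀ s₂ L₀ b₀ σ n₀ : ℕ} → 1 ≤ D → 1 ≤ e → (let k = suc k′ ; e′ = 2 * (2 * TU)) →
  k′ ≡ suc Δ ^ 8 → TU ≡ 2 * e + suc (2 * e) → q ≡ 2 * Qc D (suc k) + 2 * Qlink D e′ k → E ≡ (2 + Δ) * q ^ (k + Δ) → νl ≡ ν E (Qlink D e′ k) →
  κ ≡ 4 * D * (2 * (2 * Q₁ D e′ k) * (2 * D) ^ k) → Eh ≡ 2 * νl * E + (E + κ * k) → νh ≡ ν Eh (Qc D (suc k)) → h₁ ≡ 16 * e * νh → γ ≡ h₁ * q ^ (k + Δ) → x₀ ≡ 16 * γ * E →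
  p ≡ 2 * γ * ((2 * e * h₁) ^ k * ((2 * e * h₁) ^ k * (2 * e * h₁) ^ k) * Qlink D e′ k) → y₀ ≡ 2 * x₀ * (4 * k * (p + suc p)) → τ ≡ 4 * k * y₀ → u₀ ≡ 2 * y₀ * (8 * k * TU) →
  s₂ ≡ 2 * τ * νh → L₀ ≡ s₂ * (2 * u₀) * νl * (2 * E) → b₀ ≡ 40 * u₀ * L₀ →
  σ ≡ 16 * e * (2 * D) ^ suc k + (2 * e * h₁ * (e′ * (2 * Q₁ D e′ k)) * (2 * D) ^ k + (2 * τ * (2 * D) ^ suc k + 2 * s₂ * (2 * u₀) * (e′ * (2 * Q₁ D e′ k)) * (2 * D) ^ k)) →
  n₀ ≡ 4 * e + (x₀ + (y₀ + (8 * u₀ * (8 * u₀) + L₀))) → Constants Δ D e (suc k′) q E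
constants-from Δ D e {k′} {TU} {q} {E} {νl} {νh} {κ} {Eh} {h₁} {γ} {x₀} {p} {y₀} {τ} {u₀} {s₂} {L₀} {b₀} {σ} {n₀} 1≤D 1≤e
  k-eq TU-eq q-eq E-eq νl-eq κ-eq Eh-eq νh-eq h₁-eq γ-eq x₀-eq p-eq y₀-eq τ-eq u₀-eq s₂-eq L₀-eq b₀-eq σ-eq n₀-eq = record
    { TU = TU ; νl = νl ; νh = νh ; κ = κ ; Eh = Eh ; h₁ = h₁ ; γ = γ ; x₀ = x₀ ; p = p ; y₀ = y₀ ; τ = τ ; u₀ = u₀ ; s₂ = s₂ ; L₀ = L₀ ; b₀ = b₀ ; σ = σ ; n₀ = n₀
    ; 1≤D = 1≤D ; 1≤e = 1≤e ; hk = s≤s (≤-reflexive (sym k-eq)) ; TU-def = TU-eq ; 1≤q = 1≤q ; hq₁ = hq₁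
    ; hq₂ = ≤-trans (m≤n+m _ (2 * Qc D (suc k))) (≤-reflexive (sym q-eq))
    ; hE = ≤-reflexive (sym E-eq) ; νl-def = νl-eq ; νh-def = νh-eq ; 1≤νl = 1≤νl
    ; hEh = ≤-trans (m≤m+n (2 * νl * E) _) (≤-reflexive (sym Eh-eq)) ; E≤Eh = E≤Eh
    ; hκEh = ≤-trans (≤-trans (m≤n+m (κ * k) E) (m≤n+m (E + κ * k) (2 * νl * E))) (≤-reflexive (sym Eh-eq))
    ; hκ = ≤-reflexive (sym κ-eq) ; h₁-def = h₁-eq ; 1≤h₁ = 1≤h₁ ; 4e≤h₁ = 4e≤h₁ ; γ-def = γ-eq ; h₁≤γ = h₁≤γ
    ; hx₁ = ≤-trans (≤-*ʳ (16 * γ) 1≤E) (≤-reflexive (sym x₀-eq))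
    ; hx₂ = ≤-trans (*-monoˡ-≤ E (*-mono-≤ {4} {16} (m≤m+n 4 12) h₁≤γ)) (≤-reflexive (sym x₀-eq))
    ; p-def = p-eq ; hy = ≤-reflexive (sym y₀-eq) ; hy′ = hy′ ; τ-def = τ-eq ; hu₁ = ≤-reflexive (sym u₀-eq)
    ; hu₂ = u-bound (4 * TU) (*-mono-≤ {2} ≤-refl (≤-trans 4e≤h₁ (≤-trans h₁≤x₀ x₀≤y₀))) (*-monoˡ-≤ TU (≤-trans (m≤m+n 4 4) (≤-*ʳ {k} 8 (s≤s z≤n))))
    ; hu₃ = u-bound (2 * TU) (*-monoʳ-≤ 2 x₀≤y₀) (*-monoˡ-≤ TU (≤-trans (m≤m+n 2 6) (≤-*ʳ {k} 8 (s≤s z≤n))))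
    ; hu₄ = u-bound (2 * TU) (*-monoʳ-≤ 2 (≤-trans (≤-trans (≤-*ˡ {4} e (s≤s z≤n)) 4e≤h₁) (≤-trans h₁≤x₀ x₀≤y₀))) (*-monoˡ-≤ TU (≤-trans (m≤m+n 2 6) (≤-*ʳ {k} 8 (s≤s z≤n))))
    ; s₂-def = s₂-eq ; h₁≤s₂ = h₁≤s₂ ; hL₁ = ≤-reflexive (sym L₀-eq)
    ; hL₂ = ≤-trans (≤-reflexive (*-identityʳ (2 * x₀))) (≤-trans (*-monoʳ-≤ 2 x₀≤u₀) 2u₀≤L₀)
    ; hb₁ = ≤-trans (≤-reflexive (eq₁ u₀ L₀)) (≤-trans (*-monoˡ-≤ L₀ (*-monoˡ-≤ u₀ {8} {40} (m≤m+n 8 32))) (≤-reflexive (sym b₀-eq)))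
    ; hb₂ = ≤-trans (≤-reflexive (eq₂ L₀)) (≤-trans (*-monoˡ-≤ L₀ (*-mono-≤ {8} {40} (m≤m+n 8 32) 1≤u₀)) (≤-reflexive (sym b₀-eq)))
    ; hb₃ = ≤-trans (≤-reflexive (eq₃ x₀)) (≤-trans (*-mono-≤ (*-monoʳ-≤ 40 x₀≤u₀) 1≤L₀) (≤-reflexive (sym b₀-eq)))
    ; hb₄ = ≤-trans (≤-reflexive (eq₄ y₀)) (≤-trans (*-mono-≤ (*-mono-≤ {4} {40} (m≤m+n 4 36) y₀≤u₀) 1≤L₀) (≤-reflexive (sym b₀-eq)))
    ; hσ₀ = ≤-trans (m≤m+n _ _) (≤-reflexive (sym σ-eq))
    ; hσB = ≤-trans (≤-trans (m≤m+n _ _) (m≤n+m _ (16 * e * (2 * D) ^ suc k))) (≤-reflexive (sym σ-eq))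
    ; hσ₁ = ≤-trans (≤-trans (≤-trans (m≤m+n _ _) (m≤n+m _ (2 * e * h₁ * (e′ * (2 * Q₁ D e′ k)) * (2 * D) ^ k))) (m≤n+m _ (16 * e * (2 * D) ^ suc k))) (≤-reflexive (sym σ-eq))
    ; hσ₂ = ≤-trans (≤-trans (≤-trans (m≤n+m _ (2 * τ * (2 * D) ^ suc k)) (m≤n+m _ (2 * e * h₁ * (e′ * (2 * Q₁ D e′ k)) * (2 * D) ^ k))) (m≤n+m _ (16 * e * (2 * D) ^ suc k))) (≤-reflexive (sym σ-eq))
    ; 1≤x₀ = 1≤x₀ ; 1≤y₀ = 1≤y₀ ; 1≤u₀ = 1≤u₀ ; 1≤L₀ = 1≤L₀
    ; hn₁ = ≤-trans (m≤m+n (4 * e) _) (≤-reflexive (sym n₀-eq))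
    ; hn₂ = ≤-trans (≤-trans (m≤m+n x₀ _) (m≤n+m _ (4 * e))) (≤-reflexive (sym n₀-eq))
    ; hn₃ = ≤-trans (≤-trans (≤-trans (m≤m+n y₀ _) (m≤n+m _ x₀)) (m≤n+m _ (4 * e))) (≤-reflexive (sym n₀-eq))
    ; hn₄ = ≤-trans (≤-trans (≤-trans (≤-trans (m≤m+n _ L₀) (m≤n+m _ y₀)) (m≤n+m _ x₀)) (m≤n+m _ (4 * e))) (≤-reflexive (sym n₀-eq))
    ; hn₅ = ≤-trans (≤-trans (≤-trans (≤-trans (m≤n+m L₀ (8 * u₀ * (8 * u₀))) (m≤n+m _ y₀)) (m≤n+m _ x₀)) (m≤n+m _ (4 * e))) (≤-reflexive (sym n₀-eq))
    }
  where
  k = suc k′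
  e′ = 2 * (2 * TU)
  1≤TU : 1 ≤ TU
  1≤TU = subst (1 ≤_) (sym TU-eq) (≤-trans (s≤s z≤n) (m≤n+m (suc (2 * e)) (2 * e)))
  1≤e′ : 1 ≤ e′
  1≤e′ = 1≤* {2} (s≤s z≤n) (1≤* {2} (s≤s z≤n) 1≤TU)
  hq₁ : 2 * Qc D (suc k) ≤ q
  hq₁ = ≤-trans (m≤m+n (2 * Qc D (suc k)) _) (≤-reflexive (sym q-eq))
  1≤q : 1 ≤ q
  1≤q = ≤-trans (1≤* {2} (s≤s z≤n) (Qc≥1 D (suc k) 1≤D)) hq₁
  1≤E : 1 ≤ E
  1≤E = ≤-trans (1≤* {2 + Δ} (s≤s z≤n) (^-≥1 q (k + Δ) 1≤q)) (≤-reflexive (sym E-eq))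
  1≤νl : 1 ≤ νl
  1≤νl = subst (1 ≤_) (sym νl-eq) (ν≥1 E (Qlink D e′ k) 1≤E (Qlink≥1 D e′ k 1≤D 1≤e′))
  E≤Eh : E ≤ Eh
  E≤Eh = ≤-trans (≤-trans (m≤m+n E (κ * k)) (m≤n+m (E + κ * k) (2 * νl * E))) (≤-reflexive (sym Eh-eq))
  1≤νh : 1 ≤ νh
  1≤νh = subst (1 ≤_) (sym νh-eq) (ν≥1 Eh (Qc D (suc k)) (≤-trans 1≤E E≤Eh) (Qc≥1 D (suc k) 1≤D))
  4e≤h₁ : 4 * e ≤ h₁
  4e≤h₁ = ≤-trans (≤-trans (*-monoˡ-≤ e {4} {16} (m≤m+n 4 12)) (≤-*ʳ (16 * e) 1≤νh)) (≤-reflexive (sym h₁-eq))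
  1≤h₁ : 1 ≤ h₁
  1≤h₁ = ≤-trans (1≤* {4} (s≤s z≤n) 1≤e) 4e≤h₁
  h₁≤γ : h₁ ≤ γ
  h₁≤γ = ≤-trans (≤-*ʳ h₁ (^-≥1 q (k + Δ) 1≤q)) (≤-reflexive (sym γ-eq))
  h₁≤x₀ : h₁ ≤ x₀
  h₁≤x₀ = ≤-trans (≤-trans h₁≤γ (≤-trans (≤-*ˡ {16} γ (s≤s z≤n)) (≤-*ʳ (16 * γ) 1≤E))) (≤-reflexive (sym x₀-eq))
  1≤x₀ : 1 ≤ x₀
  1≤x₀ = ≤-trans 1≤h₁ h₁≤x₀
  hy′ : 2 * x₀ * 1 ≤ y₀
  hy′ = ≤-trans (*-monoʳ-≤ (2 * x₀) (1≤* {4 * k} (1≤* {4} (s≤s z≤n) (s≤s z≤n)) (≤-trans (s≤s z≤n) (m≤n+m (suc p) p)))) (≤-reflexive (sym y₀-eq))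
  x₀≤y₀ : x₀ ≤ y₀
  x₀≤y₀ = ≤-trans (≤-trans (≤-*ˡ {2} x₀ (s≤s z≤n)) (≤-reflexive (sym (*-identityʳ (2 * x₀))))) hy′
  1≤y₀ : 1 ≤ y₀
  1≤y₀ = ≤-trans 1≤x₀ x₀≤y₀
  u-bound : ∀ {a} c → a ≤ 2 * y₀ → c ≤ 8 * k * TU → a * c ≤ u₀
  u-bound c p r = ≤-trans (*-mono-≤ p r) (≤-reflexive (sym u₀-eq))
  y₀≤u₀ : y₀ ≤ u₀
  y₀≤u₀ = ≤-trans (≤-reflexive (sym (*-identityʳ y₀))) (u-bound 1 (≤-*ˡ {2} y₀ (s≤s z≤n)) (1≤* {8 * k} (1≤* {8} (s≤s z≤n) (s≤s z≤n)) 1≤TU))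
  x₀≤u₀ : x₀ ≤ u₀
  x₀≤u₀ = ≤-trans x₀≤y₀ y₀≤u₀
  1≤u₀ : 1 ≤ u₀
  1≤u₀ = ≤-trans 1≤y₀ y₀≤u₀
  h₁≤s₂ : h₁ ≤ s₂
  h₁≤s₂ = ≤-trans (≤-trans h₁≤x₀ x₀≤y₀) (≤-trans (≤-*ˡ {4 * k} y₀ (1≤* {4} (s≤s z≤n) (s≤s z≤n))) (≤-trans (≤-reflexive (sym τ-eq)) (≤-trans (≤-*ˡ {2} τ (s≤s z≤n)) (≤-trans (≤-*ʳ (2 * τ) 1≤νh) (≤-reflexive (sym s₂-eq))))))
  2u₀≤L₀ : 2 * u₀ ≤ L₀
  2u₀≤L₀ = ≤-trans (≤-*ˡ (2 * u₀) (≤-trans 1≤h₁ h₁≤s₂)) (≤-trans (≤-*ʳ (s₂ * (2 * u₀)) 1≤νl) (≤-trans (≤-*ʳ (s₂ * (2 * u₀) * νl) (1≤* {2} (s≤s z≤n) 1≤E)) (≤-reflexive (sym L₀-eq))))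
  1≤L₀ : 1 ≤ L₀
  1≤L₀ = ≤-trans (1≤* {2} (s≤s z≤n) 1≤u₀) 2u₀≤L₀
  eq₁ : ∀ u l → 2 * u * (4 * l) ≡ 8 * u * l
  eq₁ = solve-∀
  eq₂ : ∀ l → 2 * l * 4 ≡ 8 * 1 * l
  eq₂ = solve-∀
  eq₃ : ∀ x → 2 * x * 20 ≡ 40 * x * 1
  eq₃ = solve-∀
  eq₄ : ∀ y → 2 * y * 2 ≡ 4 * y * 1
  eq₄ = solve-∀

opaque
  constants : ∀ Δ D e → 1 ≤ D → 1 ≤ e → ∃ λ k → ∃ λ q → ∃ λ E → Constants Δ D e k q E
  constants Δ D e 1≤D 1≤e = _ , _ , _ , constants-from Δ D e 1≤D 1≤e refl refl refl refl refl refl refl refl refl refl refl refl refl refl refl refl refl refl refl refl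

≤∸⇒+≤ : ∀ {b v a} → 0 < b → b ≤ v ∸ a → a + b ≤ v
≤∸⇒+≤ {b} {v} {a} 0<b p with a ≤? v
... | yes q = ≤-trans (+-monoʳ-≤ a p) (≤-reflexive (m+[n∸m]≡n q))
... | no q = ⊥-elim (<⇒≱ 0<b (≤-trans p (≤-reflexive (m≤n⇒m∸n≡0 (<⇒≤ (≰⇒> q))))))

room-of : ∀ {n c r x} → 0 < n → n ≤ c * x → c * r ≤ n → r ≤ x
room-of {n} {zero} 0<n p _ = ⊥-elim (<⇒≱ 0<n p)
room-of {n} {suc c} 0<n p r = *-cancelˡ-≤ (suc c) (≤-trans r p)

-- The embedding

record Setup (n : ℕ) : Set where
  no-eta-equality
  field
    g h : Fin n → Sub n
    gs : ∀ x y → g x y ≡ g y x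
    gi : ∀ x → g x x ≡ false
    hs : ∀ x y → h x y ≡ h y x
    hi : ∀ x → h x x ≡ false
    Δ q k E : ℕ
    deg : ∀ v → # (h v) ≤ Δ
    1≤q : 1 ≤ q
    hE : (2 + Δ) * q ^ (k + Δ) ≤ E

module Core {n : ℕ} (setup : Setup n) where

  open Setup setup

  -- The candidate sets C v of the vertices not yet embedded are tracked as data; only soundness and size matter.
  record State (S : Fin n → Sub n) : Set where
    field
      dom : Sub n
      φ   : Fin n → Fin n
      C   : Fin n → Sub n
      inj : ∀ v w → v ∈ dom → w ∈ dom → φ v ≡ φ w → v ≡ w
      hom : ∀ v w → v ∈ dom → w ∈ dom → w ∈ h v → φ w ∈ g (φ v)
      C⊆  : ∀ v → dom v ≡ false → C v ⊆ S v
      C-adj : ∀ v x w → dom v ≡ false → x ∈ C v → w ∈ dom → w ∈ h v → x ∈ g (φ w)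
      -- One factor `q` for every embedded neighbour. The extra `k` factors pay for a ball placed
      -- next to `v`, whose outer layer of up to `k` images acts at once.
      C-big : ∀ v → dom v ≡ false → # (S v) ≤ q ^ (k + # (h v ∩ dom)) * # (C v)

    used : Sub n → ℕ
    used Z = # (λ w → dom w ∧ Z (φ w))

  open State

  record _⟶_ {S S′} (st : State S) (st′ : State S′) : Set where
    field
      dom⊆ : dom st ⊆ dom st′
      φ≡   : ∀ v → v ∈ dom st → φ st′ v ≡ φ st v

  open _⟶_ public

  ⟶-refl : ∀ {S} {st : State S} → st ⟶ st
  ⟶-refl = record { dom⊆ = λ x p → p ; φ≡ = λ v p → refl }

  ⟶-trans : ∀ {S S′ S″} {st : State S} {st′ : State S′} {st″ : State S″} → st ⟶ st′ → st′ ⟶ st″ → st ⟶ st″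
  ⟶-trans a b = record { dom⊆ = λ x p → dom⊆ b x (dom⊆ a x p) ; φ≡ = λ v p → trans (φ≡ b v (dom⊆ a v p)) (φ≡ a v p) }

  C-large : ∀ {S} (st : State S) v → dom st v ≡ false → (2 + Δ) * # (S v) ≤ E * # (C st v)
  C-large {S} st v p = begin
    (2 + Δ) * # (S v) ≤⟨ *-monoʳ-≤ (2 + Δ) (C-big st v p) ⟩
    (2 + Δ) * (q ^ (k + # (h v ∩ dom st)) * # (C st v)) ≤⟨ *-monoʳ-≤ (2 + Δ) (*-monoˡ-≤ (# (C st v)) (^-monoʳ q 1≤q (+-monoʳ-≤ k (≤-trans (#-mono (λ x → ∧-elimˡ)) (deg v))))) ⟩
    (2 + Δ) * (q ^ (k + Δ) * # (C st v)) ≡⟨ sym (*-assoc (2 + Δ) (q ^ (k + Δ)) (# (C st v))) ⟩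
    (2 + Δ) * q ^ (k + Δ) * # (C st v) ≤⟨ *-monoˡ-≤ (# (C st v)) hE ⟩
    E * # (C st v) ∎
    where open ≤-Reasoning

  C-large′ : ∀ {S} (st : State S) v → dom st v ≡ false → # (S v) ≤ E * # (C st v)
  C-large′ {S} st v p = ≤-trans (m≤m+n (# (S v)) _) (C-large st v p)

  Inserted : ∀ {S} → State S → Fin n → Set
  Inserted {S} st v = Σ (State S) λ st′ → (st ⟶ st′) × (∀ w → w ∈ dom st′ → w ∈ dom st ⊎ w ≡ v) × v ∈ dom st′ × φ st′ v ∈ S v

  module _ {S} (st : State S) (v : Fin n) (v∉ : dom st v ≡ false)
    (bdv : ∀ w → dom st w ≡ false → w ∈ h v → BiDense g E q (S v) (S w)) (0<Sv : 0 < # (S v)) (room : E * used st (S v) ≤ # (S v)) where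

    bad : Sub n
    bad x = (S v x ∧ img (dom st) (φ st) x) ∨ any (λ w → (h v w ∧ not (dom st w)) ∧ (S v ∖ (λ x → # (C st w) ≤?ᵇ q * # (C st w ∩ g x))) x)

    -- The used vertices and, for each of at most `Δ` unembedded neighbours, its exceptional
    -- vertices each make up at most the fraction `1 / E` of `S v`. By `C-large` the candidate set
    -- exceeds `1 + Δ` such fractions.
    bad-few : E * # bad ≤ (1 + Δ) * # (S v)
    bad-few = begin
      E * # bad ≤⟨ *-monoʳ-≤ E (≤-trans (#-∪ _ _) (+-mono-≤ (#-img (dom st) (φ st) (S v)) (#-any K B))) ⟩
      E * (used st (S v) + ∑ (λ w → 𝟙 (K w) * # (B w))) ≡⟨ *-distribˡ-+ E (used st (S v)) (∑ (λ w → 𝟙 (K w) * # (B w))) ⟩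
      E * used st (S v) + E * ∑ (λ w → 𝟙 (K w) * # (B w)) ≤⟨ +-mono-≤ room (≤-trans (≤-reflexive (sym (∑-*ˡ E (λ w → 𝟙 (K w) * # (B w))))) (∑-mono pt)) ⟩
      # (S v) + ∑ (λ w → 𝟙 (h v w) * # (S v)) ≡⟨ cong (# (S v) +_) (∑-*ʳ (# (S v)) (λ w → 𝟙 (h v w))) ⟩
      # (S v) + # (h v) * # (S v) ≤⟨ +-monoʳ-≤ (# (S v)) (*-monoˡ-≤ (# (S v)) (deg v)) ⟩
      (1 + Δ) * # (S v) ∎
      where
      open ≤-Reasoning
      K : Sub n
      K w = h v w ∧ not (dom st w)
      B : Fin n → Sub n
      B w = S v ∖ (λ x → # (C st w) ≤?ᵇ q * # (C st w ∩ g x))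
      pt : ∀ w → E * (𝟙 (K w) * # (B w)) ≤ 𝟙 (h v w) * # (S v)
      pt w with true? (K w)
      ... | no p = ≤-trans (≤-reflexive (trans (cong (λ b → E * (b * # (B w))) (𝟙-false (¬true p))) (*-zeroʳ E))) z≤n
      ... | yes p = ≤-trans (≤-reflexive (cong (E *_) (trans (cong (_* # (B w)) (𝟙-true p)) (*-identityˡ _)))) (≤-trans (bd-few-bad {g = g} {E} {q} {S v} {S w} {C st w} (bdv w w∉ (∧-elimˡ {h v w} p)) (C⊆ st w w∉) (C-large′ st w w∉)) (≤-reflexive (sym (trans (cong (_* # (S v)) (𝟙-true (∧-elimˡ {h v w} p))) (*-identityˡ _)))))
        where
        w∉ : dom st w ≡ false
        w∉ = not-elim (∧-elimʳ {h v w} p)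

    choice : ∃ λ x → x ∈ C st v × bad x ≡ false
    choice = #-exists-∖ (C st v) bad (*-cancelˡ-< E (# bad) (# (C st v)) (≤-<-trans bad-few (<-≤-trans (*-monoˡ-< (# (S v)) {{>-nonZero 0<Sv}} (n<1+n (1 + Δ))) (C-large st v v∉))))

    opaque
      embed-one : Inserted st v
      embed-one with choice
      ... | x , x∈C , x-ok = st′ , record { dom⊆ = λ w p → ∨-introˡ _ p ; φ≡ = λ w p → φ-old w p } , (λ w p → dom-elim w p) , ∨-introʳ (dom st v) (≡ᶠ-refl v) , subst (_∈ S v) (sym φ-v) x∈S
        where
        x∈S : x ∈ S v
        x∈S = C⊆ st v v∉ x x∈C
        dom′ : Sub n
        dom′ w = dom st w ∨ (v ≡ᶠ w)
        φ′ : Fin n → Fin n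
        φ′ w = if v ≡ᶠ w then x else φ st w
        C′ : Fin n → Sub n
        C′ w = if h v w then C st w ∩ g x else C st w
        φ-v : φ′ v ≡ x
        φ-v = if-true (≡ᶠ-refl v)
        v≢ : ∀ w → w ∈ dom st → (v ≡ᶠ w) ≡ false
        v≢ w p = ¬true (λ r → true≢false p (subst (λ z → dom st z ≡ false) (≡ᶠ-sound r) v∉))
        φ-old : ∀ w → w ∈ dom st → φ′ w ≡ φ st w
        φ-old w p = if-false (v≢ w p)
        dom-elim : ∀ w → w ∈ dom′ → w ∈ dom st ⊎ w ≡ v
        dom-elim w p with ∨-elim {dom st w} p
        ... | inj₁ r = inj₁ r
        ... | inj₂ r = inj₂ (sym (≡ᶠ-sound r))
        dom-old : ∀ w → dom′ w ≡ false → dom st w ≡ false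
        dom-old w p = ∨-falseˡ p
        fresh : ∀ w → w ∈ dom st → ¬ φ st w ≡ x
        fresh w p e = true≢false (∧-intro x∈S (subst (_∈ img (dom st) (φ st)) e (img-intro {dom = dom st} {φ st} w p))) (∨-falseˡ x-ok)
        C-keeps : ∀ w → dom st w ≡ false → w ∈ h v → # (C st w) ≤ q * # (C st w ∩ g x)
        C-keeps w p r with true? (# (C st w) ≤?ᵇ q * # (C st w ∩ g x))
        ... | yes z = ≤?ᵇ-sound {# (C st w)} z
        ... | no z = ⊥-elim (true≢false (any-intro {A = λ w → (h v w ∧ not (dom st w)) ∧ (S v ∖ (λ x → # (C st w) ≤?ᵇ q * # (C st w ∩ g x))) x} w (∧-intro (∧-intro r (not-intro p)) (∧-intro x∈S (not-intro (¬true z))))) (∨-falseʳ {S v x ∧ img (dom st) (φ st) x} x-ok))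
        st′ : State S
        st′ = record
          { dom = dom′ ; φ = φ′ ; C = C′
          ; inj = inj′ ; hom = hom′
          ; C⊆ = λ w p y r → C⊆ st w (dom-old w p) y (C′⊆ w y r)
          ; C-adj = C-adj′
          ; C-big = C-big′ }
          where
          C′⊆ : ∀ w y → y ∈ C′ w → y ∈ C st w
          C′⊆ w y r with h v w
          ... | true = ∧-elimˡ r
          ... | false = r
          inj′ : ∀ a b → a ∈ dom′ → b ∈ dom′ → φ′ a ≡ φ′ b → a ≡ b
          inj′ a b p r e with dom-elim a p | dom-elim b r
          ... | inj₁ p′ | inj₁ r′ = inj st a b p′ r′ (trans (sym (φ-old a p′)) (trans e (φ-old b r′)))
          ... | inj₁ p′ | inj₂ refl = ⊥-elim (fresh a p′ (trans (sym (φ-old a p′)) (trans e φ-v)))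
          ... | inj₂ refl | inj₁ r′ = ⊥-elim (fresh b r′ (trans (sym (φ-old b r′)) (trans (sym e) φ-v)))
          ... | inj₂ refl | inj₂ refl = refl
          hom′ : ∀ a b → a ∈ dom′ → b ∈ dom′ → b ∈ h a → φ′ b ∈ g (φ′ a)
          hom′ a b p r e with dom-elim a p | dom-elim b r
          ... | inj₁ p′ | inj₁ r′ = subst₂ (λ y z → y ∈ g z) (sym (φ-old b r′)) (sym (φ-old a p′)) (hom st a b p′ r′ e)
          ... | inj₁ p′ | inj₂ refl = subst₂ (λ y z → y ∈ g z) (sym φ-v) (sym (φ-old a p′)) (C-adj st v x a v∉ x∈C p′ (trans (hs v a) e))
          ... | inj₂ refl | inj₁ r′ = subst₂ (λ y z → y ∈ g z) (sym (φ-old b r′)) (sym φ-v) (trans (gs x (φ st b)) (C-adj st v x b v∉ x∈C r′ e))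
          ... | inj₂ refl | inj₂ refl = ⊥-elim (true≢false e (hi v))
          C-adj′ : ∀ w y b → dom′ w ≡ false → y ∈ C′ w → b ∈ dom′ → b ∈ h w → y ∈ g (φ′ b)
          C-adj′ w y b p r s e with dom-elim b s
          ... | inj₁ s′ = subst (λ z → y ∈ g z) (sym (φ-old b s′)) (C-adj st w y b (dom-old w p) (C′⊆ w y r) s′ e)
          ... | inj₂ refl = subst (λ z → y ∈ g z) (sym φ-v) (∧-elimʳ {C st w y} (subst (λ Z → y ∈ Z) (if-true (trans (hs v w) e)) r))
          C-big′ : ∀ w → dom′ w ≡ false → # (S w) ≤ q ^ (k + # (h w ∩ dom′)) * # (C′ w)
          C-big′ w p with true? (h v w)
          ... | yes r = begin
              # (S w) ≤⟨ C-big st w (dom-old w p) ⟩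
              q ^ (k + # (h w ∩ dom st)) * # (C st w) ≤⟨ scale-trans (q ^ (k + # (h w ∩ dom st))) q ≤-refl (C-keeps w (dom-old w p) r) ⟩
              q ^ (k + # (h w ∩ dom st)) * q * # (C st w ∩ g x) ≡⟨ cong (_* # (C st w ∩ g x)) (*-comm _ q) ⟩
              q ^ suc (k + # (h w ∩ dom st)) * # (C st w ∩ g x) ≤⟨ *-monoˡ-≤ (# (C st w ∩ g x)) (^-monoʳ q 1≤q (≤-trans (≤-reflexive (sym (+-suc k _))) (+-monoʳ-≤ k more))) ⟩
              q ^ (k + # (h w ∩ dom′)) * # (C st w ∩ g x) ≡⟨ cong (λ Z → q ^ (k + # (h w ∩ dom′)) * # Z) (sym (if-true r)) ⟩
              q ^ (k + # (h w ∩ dom′)) * # (C′ w) ∎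
            where
            open ≤-Reasoning
            more : suc (# (h w ∩ dom st)) ≤ # (h w ∩ dom′)
            more = #-⊂ v (λ y z → ∧-intro (∧-elimˡ z) (∨-introˡ _ (∧-elimʳ {h w y} z))) (∧-intro (trans (hs w v) r) (∨-introʳ (dom st v) (≡ᶠ-refl v))) (trans (cong (h w v ∧_) v∉) (∧-f (h w v)))
              where
              ∧-f : ∀ b → b ∧ false ≡ false
              ∧-f true = refl
              ∧-f false = refl
          ... | no r = ≤-trans (C-big st w (dom-old w p)) (≤-trans (*-monoˡ-≤ (# (C st w)) (^-monoʳ q 1≤q (+-monoʳ-≤ k (#-mono (λ y z → ∧-intro (∧-elimˡ z) (∨-introˡ (v ≡ᶠ y) (∧-elimʳ {h w y} z))))))) (≤-reflexive (cong (λ Z → q ^ (k + # (h w ∩ dom′)) * # Z) (sym (if-false (¬true r))))))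

  record Embedded {S} (Y : Sub n) (a ℓ : ℕ) (st : State S) : Set where
    field
      st′ : State S
      ext : st ⟶ st′
      new : ∀ v → v ∈ dom st′ → v ∈ dom st ⊎ (v ∈ range a ℓ × Y v ≡ false × dom st v ≡ false × φ st′ v ∈ S v)
      done : ∀ v → v ∈ range a ℓ → Y v ≡ false → v ∈ dom st′

  module _ {S : Fin n → Sub n} (Y : Sub n) (a ℓ : ℕ) where

    private
      wider : ∀ (v : Fin n) → v ∈ range (suc a) ℓ → v ∈ range a (suc ℓ)
      wider v = range-wider a ℓ v
      narrower : ∀ (v : Fin n) → v ∈ range a (suc ℓ) → ¬ toℕ v ≡ a → v ∈ range (suc a) ℓ
      narrower v p ne = range-intro (suc a) ℓ v (≤∧≢⇒< (range-lo a (suc ℓ) v p) (λ e → ne (sym e))) (≤-trans (range-hi a (suc ℓ) v p) (≤-reflexive (+-suc a ℓ)))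

    skip-first : (st : State S) → (∀ v → toℕ v ≡ a → Y v ≡ false → v ∈ dom st) → Embedded Y (suc a) ℓ st → Embedded Y a (suc ℓ) st
    skip-first st at-a rest = record { st′ = st′ ; ext = ext ; new = λ v p → widen (new v p) ; done = done′ }
      where
      open Embedded rest
      widen : ∀ {v : Fin n} {A B : Set} → A ⊎ (v ∈ range (suc a) ℓ × B) → A ⊎ (v ∈ range a (suc ℓ) × B)
      widen (inj₁ p) = inj₁ p
      widen (inj₂ (p , b)) = inj₂ (wider _ p , b)
      done′ : ∀ v → v ∈ range a (suc ℓ) → Y v ≡ false → v ∈ dom st′
      done′ v p y with toℕ v ≟ a
      ... | yes e = dom⊆ ext v (at-a v e y)
      ... | no e = done v (narrower v p e) y

    embed-first : (st st₁ : State S) (v₀ : Fin n) → toℕ v₀ ≡ a → Y v₀ ≡ false → dom st v₀ ≡ false →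
      st ⟶ st₁ → (∀ w → w ∈ dom st₁ → w ∈ dom st ⊎ w ≡ v₀) → v₀ ∈ dom st₁ → φ st₁ v₀ ∈ S v₀ → Embedded Y (suc a) ℓ st₁ → Embedded Y a (suc ℓ) st
    embed-first st st₁ v₀ v₀≡ y₀ d₀ ext₁ new₁ v₀∈₁ φ₁ rest = record { st′ = st′ ; ext = ⟶-trans ext₁ ext ; new = new′ ; done = done′ }
      where
      open Embedded rest
      v₀∈ : v₀ ∈ range a (suc ℓ)
      v₀∈ = range-intro a (suc ℓ) v₀ (≤-reflexive (sym v₀≡)) (≤-trans (≤-reflexive (cong suc v₀≡)) (≤-trans (s≤s (m≤m+n a ℓ)) (≤-reflexive (sym (+-suc a ℓ)))))
      back : ∀ w → dom st₁ w ≡ false → dom st w ≡ false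
      back w p = ¬true (λ r → true≢false (dom⊆ ext₁ w r) p)
      new′ : ∀ v → v ∈ dom st′ → v ∈ dom st ⊎ (v ∈ range a (suc ℓ) × Y v ≡ false × dom st v ≡ false × φ st′ v ∈ S v)
      new′ v p with new v p
      ... | inj₂ (r , y , d , f) = inj₂ (wider v r , y , back v d , f)
      ... | inj₁ r with new₁ v r
      ... | inj₁ z = inj₁ z
      ... | inj₂ refl = inj₂ (v₀∈ , y₀ , d₀ , subst (_∈ S v₀) (sym (φ≡ ext v₀ v₀∈₁)) φ₁)
      done′ : ∀ v → v ∈ range a (suc ℓ) → Y v ≡ false → v ∈ dom st′
      done′ v p y with toℕ v ≟ a
      ... | yes e = dom⊆ ext v (subst (_∈ dom st₁) (Finₚ.toℕ-injective (trans v₀≡ (sym e))) v₀∈₁)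
      ... | no e = done v (narrower v p e) y

  used-insert : ∀ {S} (st st₁ : State S) v₀ → st ⟶ st₁ → (∀ w → w ∈ dom st₁ → w ∈ dom st ⊎ w ≡ v₀) → ∀ Z → used st₁ Z ≤ used st Z + 1
  used-insert st st₁ v₀ ext₁ new₁ Z = ≤-trans (#-mono sub) (≤-trans (#-∪ (λ w → dom st w ∧ Z (φ st w)) (v₀ ≡ᶠ_)) (+-monoʳ-≤ (used st Z) (≤-reflexive (#-singleton v₀))))
    where
    sub : (λ w → dom st₁ w ∧ Z (φ st₁ w)) ⊆ (λ w → (dom st w ∧ Z (φ st w)) ∨ (v₀ ≡ᶠ w))
    sub w p with new₁ w (∧-elimˡ p)
    ... | inj₁ r = ∨-introˡ _ (∧-intro r (subst (_∈ Z) (φ≡ ext₁ w r) (∧-elimʳ {dom st₁ w} p)))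
    ... | inj₂ refl = ∨-introʳ (dom st w ∧ Z (φ st w)) (≡ᶠ-refl v₀)

  -- `ℓ` bounds the number of insertions still to come. Room for `used + ℓ` at the start is
  -- therefore passed on from each insertion to the next.
  embed-range : ∀ {S} (Y : Sub n) ℓ a (st : State S) →
    (∀ v w → v ∈ range a ℓ → Y v ≡ false → dom st v ≡ false → dom st w ≡ false → w ∈ h v → BiDense g E q (S v) (S w)) →
    (∀ v → v ∈ range a ℓ → Y v ≡ false → dom st v ≡ false → E * (used st (S v) + ℓ) ≤ # (S v)) → 1 ≤ E → Embedded Y a ℓ st
  embed-range Y zero a st bd room 1≤E = record { st′ = st ; ext = ⟶-refl ; new = λ v p → inj₁ p
    ; done = λ v p → ⊥-elim (<⇒≱ (range-hi a 0 v p) (≤-trans (≤-reflexive (+-identityʳ a)) (range-lo a 0 v p))) }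
  embed-range {S} Y (suc ℓ) a st bd room 1≤E = go (a <? n)
    where
    wider : ∀ (v : Fin n) → v ∈ range (suc a) ℓ → v ∈ range a (suc ℓ)
    wider v = range-wider a ℓ v
    skip : (∀ v → toℕ v ≡ a → Y v ≡ false → v ∈ dom st) → Embedded Y a (suc ℓ) st
    skip at-a = skip-first Y a ℓ st at-a (embed-range Y ℓ (suc a) st (λ v w p → bd v w (wider v p)) (λ v p y d → ≤-trans (*-monoʳ-≤ E (+-monoʳ-≤ _ (n≤1+n ℓ))) (room v (wider v p) y d)) 1≤E)
    insert : ∀ v₀ → toℕ v₀ ≡ a → Y v₀ ≡ false → dom st v₀ ≡ false → Embedded Y a (suc ℓ) st
    insert v₀ v₀≡ y₀ d₀ = continue (embed-one st v₀ d₀ (λ w p r → bd v₀ w v₀∈ y₀ d₀ p r)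
        (≤-trans (1≤* 1≤E (≤-trans (s≤s z≤n) (m≤n+m (suc ℓ) (used st (S v₀))))) room₀)
        (≤-trans (*-monoʳ-≤ E (m≤m+n _ (suc ℓ))) room₀))
      where
      v₀∈ : v₀ ∈ range a (suc ℓ)
      v₀∈ = range-intro a (suc ℓ) v₀ (≤-reflexive (sym v₀≡)) (≤-trans (≤-reflexive (cong suc v₀≡)) (≤-trans (s≤s (m≤m+n a ℓ)) (≤-reflexive (sym (+-suc a ℓ)))))
      room₀ : E * (used st (S v₀) + suc ℓ) ≤ # (S v₀)
      room₀ = room v₀ v₀∈ y₀ d₀
      continue : Inserted st v₀ → Embedded Y a (suc ℓ) st
      continue (st₁ , ext₁ , new₁ , v₀∈₁ , φ₁) = embed-first Y a ℓ st st₁ v₀ v₀≡ y₀ d₀ ext₁ new₁ v₀∈₁ φ₁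
          (embed-range Y ℓ (suc a) st₁ (λ v w p y d d′ → bd v w (wider v p) y (back v d) (back w d′))
            (λ v p y d → ≤-trans (*-monoʳ-≤ E (≤-trans (+-monoˡ-≤ ℓ (used-insert st st₁ v₀ ext₁ new₁ (S v))) (≤-reflexive (+-assoc (used st (S v)) 1 ℓ)))) (room v (wider v p) y (back v d))) 1≤E)
        where
        back : ∀ w → dom st₁ w ≡ false → dom st w ≡ false
        back w p = ¬true (λ r → true≢false (dom⊆ ext₁ w r) p)
    go : Dec (a < n) → Embedded Y a (suc ℓ) st
    -- An interval may run past the last vertex of `H`; such positions are skipped.
    go (no a≮n) = skip (λ v e → ⊥-elim (a≮n (subst (_< n) e (Finₚ.toℕ<n v))))
    go (yes a<n) = decide (true? (Y (fromℕ< a<n))) (true? (dom st (fromℕ< a<n)))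
      where
      decide : Dec (Y (fromℕ< a<n) ≡ true) → Dec (dom st (fromℕ< a<n) ≡ true) → Embedded Y a (suc ℓ) st
      decide (yes y) _ = skip (λ v e y′ → ⊥-elim (true≢false y (subst (λ z → Y z ≡ false) (Finₚ.toℕ-injective (trans e (sym (Finₚ.toℕ-fromℕ< a<n)))) y′)))
      decide (no _) (yes d) = skip (λ v e _ → subst (_∈ dom st) (Finₚ.toℕ-injective (trans (Finₚ.toℕ-fromℕ< a<n) (sym e))) d)
      decide (no y) (no d) = insert (fromℕ< a<n) (Finₚ.toℕ-fromℕ< a<n) (¬true y) (¬true d)

  open Near h hs

  -- Embedding the balls around absorbers

  module Balls (χ : Fin n → Fin k) (χ-dist : ∀ v w → w ∈ near 8 v → χ v ≡ χ w → v ≡ w) (Bs : Fin k → Sub n) (B₀ : Sub n) where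

    open Option

    lev : Fin n → Fin n → ℕ
    lev x v = lev′ (near 0 x v) (near 1 x v) (near 2 x v)

    lev-near : ∀ x v → v ∈ near 3 x → v ∈ near (lev x v) x
    lev-near x v p = lev′-elim (near 0 x v) (near 1 x v) (near 2 x v) (λ l → v ∈ near l x) (λ r → r) (λ r → r) (λ r → r) p

    lev-min : ∀ j x v → v ∈ near j x → lev x v ≤ j
    lev-min 0 x v p = ≤-reflexive (cong (λ a → lev′ a (near 1 x v) (near 2 x v)) p)
    lev-min 1 x v p = lev′≤1 (near 0 x v) (near 1 x v) (near 2 x v) p
    lev-min 2 x v p = lev′≤2 (near 0 x v) (near 1 x v) (near 2 x v) p
    lev-min (suc (suc (suc j))) x v p = ≤-trans (lev′≤3 (near 0 x v) (near 1 x v) (near 2 x v)) (s≤s (s≤s (s≤s z≤n)))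

    -- Layer 0 is the single vertex `z` for every colour, hence the exclusion of two cells of layer
    -- 0. Adjacency is asked of layers at most one apart, since an edge of `H` changes the distance
    -- from the centre by at most one.
    record Valid (F : Sub n) (o : Option n k) : Set where
      field
        avoid : ∀ l c → F (cell o l c) ≡ false
        adj   : ∀ l l′ c c′ → l ≤ suc l′ → l′ ≤ suc l → ¬ c ≡ c′ → ¬ (l ≡ 0 × l′ ≡ 0) → cell o l′ c′ ∈ g (cell o l c)
        neq   : ∀ l l′ c c′ → ¬ c ≡ c′ → ¬ (l ≡ 0 × l′ ≡ 0) → ¬ cell o l c ≡ cell o l′ c′
        large : ∀ c → # (Bs c) ≤ q ^ k * # (Bs c ∩ CN g (ds o))

    S₁ : Fin n → Sub n
    S₁ v = Bs (χ v)

    record BallAdded (st : State S₁) (x : Fin n) (o : Option n k) : Set where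
      field
        st′ : State S₁
        ext : st ⟶ st′
        new : ∀ v → v ∈ dom st′ → v ∈ dom st ⊎ v ∈ near 3 x
        ball : ∀ v → v ∈ near 3 x → v ∈ dom st′
        centre : φ st′ x ≡ z o
        nbrs : ∀ v → v ∈ h x → φ st′ v ≡ lookup (ts o) (χ v)
        cells : ∀ v → v ∈ near 3 x → ∃ λ l → ∃ λ c → φ st′ v ≡ cell o l c

    opaque
      -- The whole ball is placed at once, because its cells are already joined as required.
      -- Vertices at distance 4 get a fresh candidate set, the common neighbours of the outer layer
      -- in their class. This is sound since nothing within distance 5 was embedded before.
      add-ball : (st : State S₁) (x : Fin n) (F : Sub n) (o : Option n k) → Valid F o → (∀ v → v ∈ near 5 x → dom st v ≡ false) →
        (∀ w → w ∈ dom st → φ st w ∈ F) → BallAdded st x o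
      add-ball st x F o valid free F-img = record { st′ = st′ ; ext = record { dom⊆ = λ v p → ∨-introˡ _ p ; φ≡ = λ v p → φ-old v p }
          ; new = λ v p → ∨-elim p ; ball = λ v p → ∨-introʳ (dom st v) p
          ; centre = trans (φ-ball x (near-refl 3 x)) (cong (λ l → cell o l (χ x)) (n≤0⇒n≡0 (lev-min 0 x x (near-refl 0 x)))) ; nbrs = nbrs′ ; cells = λ v p → lev x v , χ v , φ-ball v p }
        where
        open Valid valid
        dom′ : Sub n
        dom′ v = dom st v ∨ near 3 x v
        φ′ : Fin n → Fin n
        φ′ v = if near 3 x v then cell o (lev x v) (χ v) else φ st v
        C′ : Fin n → Sub n
        C′ v = if near 4 x v then Bs (χ v) ∩ CN g (ds o) else C st v
        old-far : ∀ j v → j ≤ 5 → v ∈ dom st → near j x v ≡ false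
        old-far j v j≤5 p = ¬true (λ r → true≢false p (free v (near-mono x v j≤5 r)))
        3≤5 : 3 ≤ 5
        3≤5 = s≤s (s≤s (s≤s z≤n))
        φ-old : ∀ v → v ∈ dom st → φ′ v ≡ φ st v
        φ-old v p = if-false (old-far 3 v 3≤5 p)
        φ-ball : ∀ v → v ∈ near 3 x → φ′ v ≡ cell o (lev x v) (χ v)
        φ-ball v p = if-true p
        centre-unique : ∀ v → lev x v ≡ 0 → v ∈ near 3 x → x ≡ v
        centre-unique v e p = near-0 x v (subst (λ l → v ∈ near l x) e (lev-near x v p))
        χ-ball : ∀ a b → a ∈ near 3 x → b ∈ near 3 x → ¬ a ≡ b → ¬ χ a ≡ χ b
        χ-ball a b p r a≢b e = a≢b (χ-dist a b (near-mono {6} {8} a b (s≤s (s≤s (s≤s (s≤s (s≤s (s≤s z≤n)))))) (near-trans 3 3 a x b (near-sym′ 3 x a p) r)) e)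
        not-both : ∀ a b → a ∈ near 3 x → b ∈ near 3 x → ¬ a ≡ b → ¬ (lev x a ≡ 0 × lev x b ≡ 0)
        not-both a b p r a≢b (e , e′) = a≢b (trans (sym (centre-unique a e p)) (centre-unique b e′ r))
        fresh : ∀ v w → v ∈ dom st → w ∈ near 3 x → ¬ φ′ v ≡ φ′ w
        fresh v w p r e = true≢false (subst (_∈ F) (trans (sym (φ-old v p)) (trans e (φ-ball w r))) (F-img v p)) (avoid (lev x w) (χ w))
        no-edge : ∀ v w → v ∈ dom st → w ∈ near 3 x → v ∈ h w → ⊥
        no-edge v w p r e = true≢false (near-step 3 x w v r e) (old-far 4 v (s≤s (s≤s (s≤s (s≤s z≤n)))) p)
        lev-step : ∀ a b → a ∈ near 3 x → b ∈ h a → lev x b ≤ suc (lev x a)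
        lev-step a b p e = lev-min (suc (lev x a)) x b (near-step (lev x a) x a b (lev-near x a p) e)
        nbrs′ : ∀ v → v ∈ h x → φ′ v ≡ lookup (ts o) (χ v)
        nbrs′ v e = trans (φ-ball v (near-mono {1} {3} x v (s≤s z≤n) near₁)) (cong (λ l → cell o l (χ v)) lev≡1)
          where
          near₁ : v ∈ near 1 x
          near₁ = near-step 0 x x v (near-refl 0 x) e
          lev≡1 : lev x v ≡ 1
          lev≡1 = ≤-antisym (lev-min 1 x v near₁) (n≢0⇒n>0 (λ e₀ → true≢false (subst (_∈ h x) (sym (centre-unique v e₀ (near-mono {1} {3} x v (s≤s z≤n) near₁))) e) (hi x)))
        inj′ : ∀ a b → a ∈ dom′ → b ∈ dom′ → φ′ a ≡ φ′ b → a ≡ b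
        inj′ a b p r e with ∨-elim {dom st a} p | ∨-elim {dom st b} r
        ... | inj₁ p′ | inj₁ r′ = inj st a b p′ r′ (trans (sym (φ-old a p′)) (trans e (φ-old b r′)))
        ... | inj₁ p′ | inj₂ r′ = ⊥-elim (fresh a b p′ r′ e)
        ... | inj₂ p′ | inj₁ r′ = ⊥-elim (fresh b a r′ p′ (sym e))
        ... | inj₂ p′ | inj₂ r′ with a Finₚ.≟ b
        ... | yes a≡b = a≡b
        ... | no a≢b = ⊥-elim (neq (lev x a) (lev x b) (χ a) (χ b) (χ-ball a b p′ r′ a≢b) (not-both a b p′ r′ a≢b) (trans (sym (φ-ball a p′)) (trans e (φ-ball b r′))))
        hom′ : ∀ a b → a ∈ dom′ → b ∈ dom′ → b ∈ h a → φ′ b ∈ g (φ′ a)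
        hom′ a b p r e with ∨-elim {dom st a} p | ∨-elim {dom st b} r
        ... | inj₁ p′ | inj₁ r′ = subst₂ (λ y z → y ∈ g z) (sym (φ-old b r′)) (sym (φ-old a p′)) (hom st a b p′ r′ e)
        ... | inj₁ p′ | inj₂ r′ = ⊥-elim (no-edge a b p′ r′ (trans (hs b a) e))
        ... | inj₂ p′ | inj₁ r′ = ⊥-elim (no-edge b a r′ p′ e)
        ... | inj₂ p′ | inj₂ r′ = subst₂ (λ y z → y ∈ g z) (sym (φ-ball b r′)) (sym (φ-ball a p′)) (adj (lev x a) (lev x b) (χ a) (χ b) (lev-step b a r′ (trans (hs b a) e)) (lev-step a b p′ e) (χ-ball a b p′ r′ a≢b) (not-both a b p′ r′ a≢b))
          where
          a≢b : ¬ a ≡ b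
          a≢b refl = true≢false e (hi a)
        C⊆′ : ∀ v → dom′ v ≡ false → C′ v ⊆ S₁ v
        C⊆′ v p with true? (near 4 x v)
        ... | yes r = λ y s → ∧-elimˡ {Bs (χ v) y} (subst (λ Z → y ∈ Z) (if-true r) s)
        ... | no r = λ y s → C⊆ st v (∨-falseˡ p) y (subst (λ Z → y ∈ Z) (if-false (¬true r)) s)
        C-adj′ : ∀ v y w → dom′ v ≡ false → y ∈ C′ v → w ∈ dom′ → w ∈ h v → y ∈ g (φ′ w)
        C-adj′ v y w p r s e with true? (near 4 x v) | ∨-elim {dom st w} s
        ... | yes near₄ | inj₁ s′ = ⊥-elim (true≢false (near-step 4 x v w near₄ e) (old-far 5 w ≤-refl s′))
        ... | yes near₄ | inj₂ s′ = subst (λ u → y ∈ g u) (sym (trans (φ-ball w s′) (cong (λ l → cell o l (χ w)) lev≡3))) (CN-lookup g (ds o) (∧-elimʳ {Bs (χ v) y} (subst (λ Z → y ∈ Z) (if-true near₄) r)) (χ w))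
          where
          -- Only the outermost layer has neighbours outside the ball, so its image in `ds` is the
          -- one that constrains `y`.
          lev≡3 : lev x w ≡ 3
          lev≡3 = ≤-antisym (lev-min 3 x w s′) (≮⇒≥ (λ lt → true≢false (near-mono x v lt (near-step (lev x w) x w v (lev-near x w s′) (trans (hs w v) e))) (∨-falseʳ {dom st v} p)))
        ... | no far | inj₁ s′ = subst (λ u → y ∈ g u) (sym (φ-old w s′)) (C-adj st v y w (∨-falseˡ p) (subst (λ Z → y ∈ Z) (if-false (¬true far)) r) s′ e)
        ... | no far | inj₂ s′ = ⊥-elim (far (near-step 3 x w v s′ (trans (hs w v) e)))
        C-big′ : ∀ v → dom′ v ≡ false → # (S₁ v) ≤ q ^ (k + # (h v ∩ dom′)) * # (C′ v)
        C-big′ v p with true? (near 4 x v)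
        ... | yes r = ≤-trans (large (χ v)) (≤-trans (*-monoˡ-≤ (# (Bs (χ v) ∩ CN g (ds o))) (^-monoʳ q 1≤q (m≤m+n k _))) (≤-reflexive (cong (λ Z → q ^ (k + # (h v ∩ dom′)) * # Z) (sym (if-true r)))))
        ... | no r = ≤-trans (C-big st v (∨-falseˡ p)) (≤-trans (*-monoˡ-≤ (# (C st v)) (^-monoʳ q 1≤q (+-monoʳ-≤ k (#-mono (λ y s → ∧-intro (∧-elimˡ s) (∨-introˡ (near 3 x y) (∧-elimʳ {h v y} s))))))) (≤-reflexive (cong (λ Z → q ^ (k + # (h v ∩ dom′)) * # Z) (sym (if-false (¬true r))))))
        st′ : State S₁
        st′ = record { dom = dom′ ; φ = φ′ ; C = C′ ; inj = inj′ ; hom = hom′ ; C⊆ = C⊆′ ; C-adj = C-adj′ ; C-big = C-big′ }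

    module Options (F : Sub n) (W : Fin n → Sub n) where

      Fz Uz Bz : Fin n → Sub n
      Fz z y = F y ∨ (z ≡ᶠ y)
      Uz z y = not (Fz z y)
      Bz z = B₀ ∖ Fz z
      -- Places for the neighbours of an absorber: in `g u`, so that the absorber can move to `u`,
      -- and in `g z`, where it lies now. `B₀` is removed because layers 1 and 3 are not joined and
      -- disjointness must come from elsewhere.
      Rz : Fin n → Fin n → Sub n
      Rz u z = ((g u ∩ g z) ∖ Fz z) ∖ B₀

      accepts : Fin n → Fin n → Option n k → Bool
      accepts u y (option z ms ts ds) = (W y z ∧ not (F z)) ∧ link g q Bs (Rz u z) (Uz z) (Bz z) ms ts ds

      module _ {u y} (o : Option n k) (acc : accepts u y o ≡ true) where
        private
          Wz : W y (z o) ∧ not (F (z o)) ≡ true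
          Wz = ∧-elimˡ acc
          lk : link g q Bs (Rz u (z o)) (Uz (z o)) (Bz (z o)) (ms o) (ts o) (ds o) ≡ true
          lk = ∧-elimʳ {W y (z o) ∧ not (F (z o))} acc
          m-clique : clique g (Uz (z o)) (ms o) ≡ true
          m-clique = ∧-elimˡ lk
          t-clique : clique g (Rz u (z o) ∩ CN g (ms o)) (ts o) ≡ true
          t-clique = ∧-elimˡ (∧-elimʳ {clique g (Uz (z o)) (ms o)} lk)
          d-clique : typClique g q Bs (Bz (z o) ∩ CN g (ms o)) (ds o) ≡ true
          d-clique = ∧-elimʳ {clique g (Rz u (z o) ∩ CN g (ms o)) (ts o)} (∧-elimʳ {clique g (Uz (z o)) (ms o)} lk)
          m∈ : ∀ c → Fz (z o) (lookup (ms o) c) ≡ false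
          m∈ c = not-elim (typClique-∈ g 1 (ms o) m-clique c)
          t∈ : ∀ c → lookup (ts o) c ∈ Rz u (z o)
          t∈ c = ∧-elimˡ (typClique-∈ g 1 (ts o) t-clique c)
          t∈₁ : ∀ c → lookup (ts o) c ∈ (g u ∩ g (z o)) ∖ Fz (z o)
          t∈₁ c = ∧-elimˡ (t∈ c)
          d∈ : ∀ c → lookup (ds o) c ∈ Bz (z o)
          d∈ c = ∧-elimˡ (typClique-∈ g q (ds o) d-clique c)
          t-m : ∀ c c′ → lookup (ts o) c ∈ g (lookup (ms o) c′)
          t-m c c′ = CN-lookup g (ms o) (∧-elimʳ {Rz u (z o) (lookup (ts o) c)} (typClique-∈ g 1 (ts o) t-clique c)) c′
          d-m : ∀ c c′ → lookup (ds o) c ∈ g (lookup (ms o) c′)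
          d-m c c′ = CN-lookup g (ms o) (∧-elimʳ {Bz (z o) (lookup (ds o) c)} (typClique-∈ g q (ds o) d-clique c)) c′
          z-t : ∀ c → lookup (ts o) c ∈ g (z o)
          z-t c = ∧-elimʳ {g u (lookup (ts o) c)} (∧-elimˡ {(g u ∩ g (z o)) (lookup (ts o) c)} (t∈₁ c))
          d-Fz : ∀ c → Fz (z o) (lookup (ds o) c) ≡ false
          d-Fz c = not-elim (∧-elimʳ {B₀ (lookup (ds o) c)} (d∈ c))
          z≢ : ∀ {y} → Fz (z o) y ≡ false → ¬ z o ≡ y
          z≢ {y} p e = true≢false (subst (λ y → (z o ≡ᶠ y) ≡ true) e (≡ᶠ-refl (z o))) (∨-falseʳ {F y} p)
          t≢d : ∀ c c′ → ¬ lookup (ts o) c ≡ lookup (ds o) c′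
          t≢d c c′ e = true≢false (∧-elimˡ {B₀ (lookup (ds o) c′)} (d∈ c′)) (subst (λ y → B₀ y ≡ false) e (not-elim (∧-elimʳ {((g u ∩ g (z o)) ∖ Fz (z o)) (lookup (ts o) c)} (t∈ c))))
          irr : ∀ {x y} → y ∈ g x → ¬ x ≡ y
          irr {x} p e = true≢false (subst (λ y → y ∈ g x) (sym e) p) (gi x)
        accepted-centre : z o ∈ W y
        accepted-centre = ∧-elimˡ Wz
        accepted-nbrs : ∀ c → lookup (ts o) c ∈ g u
        accepted-nbrs c = ∧-elimˡ {g u (lookup (ts o) c)} (∧-elimˡ {(g u ∩ g (z o)) (lookup (ts o) c)} (t∈₁ c))
        accepted-valid : Valid F o
        accepted-valid = record { avoid = avoid ; adj = adj ; neq = neq ; large = λ c → typClique-CN g q (ds o) d-clique c }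
          where
          avoid : ∀ l c → F (cell o l c) ≡ false
          avoid 0 c = not-elim (∧-elimʳ {W y (z o)} Wz)
          avoid 1 c = ∨-falseˡ (not-elim (∧-elimʳ {(g u ∩ g (z o)) (lookup (ts o) c)} (t∈₁ c)))
          avoid 2 c = ∨-falseˡ (m∈ c)
          avoid (suc (suc (suc _))) c = ∨-falseˡ (d-Fz c)
          adj : ∀ l l′ c c′ → l ≤ suc l′ → l′ ≤ suc l → ¬ c ≡ c′ → ¬ (l ≡ 0 × l′ ≡ 0) → cell o l′ c′ ∈ g (cell o l c)
          adj 0 0 c c′ _ _ _ p = ⊥-elim (p (refl , refl))
          adj 0 1 c c′ _ _ _ _ = z-t c′
          adj 0 (suc (suc _)) c c′ _ (s≤s ()) _ _
          adj 1 0 c c′ _ _ _ _ = trans (gs _ _) (z-t c)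
          adj 1 1 c c′ _ _ c≢ _ = typClique-adj g 1 gs (ts o) t-clique c c′ c≢
          adj 1 2 c c′ _ _ _ _ = trans (gs _ _) (t-m c c′)
          adj 1 (suc (suc (suc _))) c c′ _ (s≤s (s≤s ())) _ _
          adj 2 0 c c′ (s≤s ()) _ _ _
          adj 2 1 c c′ _ _ _ _ = t-m c′ c
          adj 2 2 c c′ _ _ c≢ _ = typClique-adj g 1 gs (ms o) m-clique c c′ c≢
          adj 2 (suc (suc (suc _))) c c′ _ _ _ _ = d-m c′ c
          adj (suc (suc (suc _))) 0 c c′ (s≤s ()) _ _ _
          adj (suc (suc (suc _))) 1 c c′ (s≤s (s≤s ())) _ _ _
          adj (suc (suc (suc _))) 2 c c′ _ _ _ _ = trans (gs _ _) (d-m c c′)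
          adj (suc (suc (suc _))) (suc (suc (suc _))) c c′ _ _ c≢ _ = typClique-adj g q gs (ds o) d-clique c c′ c≢
          neq : ∀ l l′ c c′ → ¬ c ≡ c′ → ¬ (l ≡ 0 × l′ ≡ 0) → ¬ cell o l c ≡ cell o l′ c′
          neq 0 0 c c′ _ p = ⊥-elim (p (refl , refl))
          neq 0 1 c c′ _ _ = irr (z-t c′)
          neq 0 2 c c′ _ _ = z≢ (m∈ c′)
          neq 0 (suc (suc (suc _))) c c′ _ _ = z≢ (d-Fz c′)
          neq 1 0 c c′ _ _ e = irr (z-t c) (sym e)
          neq 1 1 c c′ c≢ _ = irr (typClique-adj g 1 gs (ts o) t-clique c c′ c≢)
          neq 1 2 c c′ _ _ e = irr (t-m c c′) (sym e)
          neq 1 (suc (suc (suc _))) c c′ _ _ = t≢d c c′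
          neq 2 0 c c′ _ _ e = z≢ (m∈ c) (sym e)
          neq 2 1 c c′ _ _ = irr (t-m c′ c)
          neq 2 2 c c′ c≢ _ = irr (typClique-adj g 1 gs (ms o) m-clique c c′ c≢)
          neq 2 (suc (suc (suc _))) c c′ _ _ = irr (d-m c′ c)
          neq (suc (suc (suc _))) 0 c c′ _ _ e = z≢ (d-Fz c) (sym e)
          neq (suc (suc (suc _))) 1 c c′ _ _ e = t≢d c′ c (sym e)
          neq (suc (suc (suc _))) 2 c c′ _ _ e = irr (d-m c c′) (sym e)
          neq (suc (suc (suc _))) (suc (suc (suc _))) c c′ c≢ _ = irr (typClique-adj g q gs (ds o) d-clique c c′ c≢)
      record Ample : Set where
        no-eta-equality
        field
          σ D : ℕ
          ld : LocallyDense g σ D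
          0<n : 0 < n
          1≤D : 1 ≤ D
          E₁ κ : ℕ
          few : FewAtypical g q E₁ κ B₀ Bs
          e e′ sB sW : ℕ
          1≤e : 1 ≤ e
          1≤sB : 1 ≤ sB
          2e≤e′ : 2 * e ≤ e′
          codeg : ∀ u v → n ≤ e * # (g u ∩ g v)
          hF : 4 * e * suc (# F) ≤ n
          hB : 4 * e * # B₀ ≤ n
          hFB : 2 * suc (# F) ≤ # B₀
          hsB : n ≤ sB * # B₀
          hW : ∀ y → n ≤ sW * # (W y ∖ F)
          hσ : 2 * e * sB * (e′ * (2 * Q₁ D e′ k)) * (2 * D) ^ k ≤ σ
          hE₁ : q ^ k ≤ E₁
          hκ : 4 * D * (2 * (2 * Q₁ D e′ k) * (2 * D) ^ k) ≤ κ

      module Count (ample : Ample) where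

        open Ample ample

        s p : ℕ
        s = 2 * e * sB
        p = sW * (s ^ k * (s ^ k * s ^ k) * Qlink D e′ k)

        #Fz : ∀ z → # (Fz z) ≤ suc (# F)
        #Fz z = ≤-trans (#-∪ F (z ≡ᶠ_)) (≤-reflexive (trans (cong (# F +_) (#-singleton z)) (+-comm (# F) 1)))

        half : ∀ A z → n ≤ e * # A → n ≤ 2 * e * # (A ∖ Fz z)
        half A z h = half-arith {n} {e} {# (A ∖ Fz z)} {suc (# F)} (≤-trans h (*-monoʳ-≤ e (≤-trans (#-∖ A (Fz z)) (+-monoʳ-≤ (# (A ∖ Fz z)) (#Fz z))))) hF
          where
          half-arith : ∀ {n e a f} → n ≤ e * (a + f) → 4 * e * f ≤ n → n ≤ 2 * e * a
          half-arith {n} {e} {a} {f} p r = *-cancelˡ-≤ 2 (lin n (+-mono-≤ (*-monoʳ-≤ 4 p) r) (eq n e a f))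
            where
            eq : ∀ n e a f → 2 * n + (4 * (e * (a + f)) + n) + n ≡ 2 * (2 * e * a) + (4 * n + 4 * e * f)
            eq = solve-∀

        R-large : ∀ u z → n ≤ 2 * e * # (Rz u z)
        R-large u z = arith {n} {e} {# (Rz u z)} {# B₀} {suc (# F)} (≤-trans (codeg u z) (*-monoʳ-≤ e (≤-trans (#-∖ (g u ∩ g z) (Fz z)) (+-mono-≤ (#-∖ _ B₀) (#Fz z))))) hF hB
          where
          arith : ∀ {n e a b f} → n ≤ e * (a + b + f) → 4 * e * f ≤ n → 4 * e * b ≤ n → n ≤ 2 * e * a
          arith {n} {e} {a} {b} {f} p r t = *-cancelˡ-≤ 2 (lin 0 (+-mono-≤ (*-monoʳ-≤ 4 p) (+-mono-≤ r t)) (eq n e a b f))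
            where
            eq : ∀ n e a b f → 2 * n + (4 * (e * (a + b + f)) + (n + n)) + 0 ≡ 2 * (2 * e * a) + (4 * n + (4 * e * f + 4 * e * b))
            eq = solve-∀

        U-codeg : ∀ z t b → # (Uz z) ≤ e′ * # (Uz z ∩ g t ∩ g b)
        U-codeg z t b = ≤-trans (#≤n (Uz z)) (≤-trans (half (g t ∩ g b) z (codeg t b)) (*-mono-≤ 2e≤e′ (#-mono (λ x r → ∧-intro (∧-intro (∧-elimʳ {(g t ∩ g b) x} r) (∧-elimˡ {g t x} (∧-elimˡ {(g t ∩ g b) x} r))) (∧-elimʳ {g t x} (∧-elimˡ {(g t ∩ g b) x} r))))))

        U-large : ∀ z → n ≤ 2 * e * # (Uz z)
        U-large z = ≤-trans (half (λ _ → true) z (≤-trans (≤-*ˡ n 1≤e) (≤-reflexive (cong (e *_) (sym (#-full n)))))) (*-monoʳ-≤ (2 * e) (#-mono (λ x r → r)))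

        B-large : ∀ z → # B₀ ≤ 2 * # (Bz z)
        B-large z = arith {# B₀} {# (Bz z)} {suc (# F)} (≤-trans (#-∖ B₀ (Fz z)) (+-monoʳ-≤ (# (Bz z)) (#Fz z))) hFB
          where
          arith : ∀ {b a f} → b ≤ a + f → 2 * f ≤ b → b ≤ 2 * a
          arith {b} {a} {f} p r = lin 0 (+-mono-≤ (*-monoʳ-≤ 2 p) r) (eq b a f)
            where
            eq : ∀ b a f → b + (2 * (a + f) + b) + 0 ≡ 2 * a + (2 * b + 2 * f)
            eq = solve-∀

        count-z : ∀ u z → n ^ k * (n ^ k * n ^ k) ≤ s ^ k * (s ^ k * s ^ k) * Qlink D e′ k * ∑ᵛ k (λ ms → ∑ᵛ k (λ ts → ∑ᵛ k (λ ds → 𝟙 (link g q Bs (Rz u z) (Uz z) (Bz z) ms ts ds))))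
        count-z u z = begin
          n ^ k * (n ^ k * n ^ k) ≤⟨ *-mono-≤ (pow U≥) (*-mono-≤ (pow R≥) (pow B≥)) ⟩
          s ^ k * # (Uz z) ^ k * (s ^ k * # (Rz u z) ^ k * (s ^ k * # (Bz z) ^ k)) ≡⟨ eq (s ^ k) (# (Uz z) ^ k) (# (Rz u z) ^ k) (# (Bz z) ^ k) ⟩
          s ^ k * (s ^ k * s ^ k) * (# (Uz z) ^ k * (# (Rz u z) ^ k * # (Bz z) ^ k)) ≤⟨ scale-trans (s ^ k * (s ^ k * s ^ k)) (Qlink D e′ k) ≤-refl lc ⟩
          s ^ k * (s ^ k * s ^ k) * Qlink D e′ k * ∑ᵛ k (λ ms → ∑ᵛ k (λ ts → ∑ᵛ k (λ ds → 𝟙 (link g q Bs (Rz u z) (Uz z) (Bz z) ms ts ds)))) ∎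
          where
          open ≤-Reasoning
          eq : ∀ s a b c → s * a * (s * b * (s * c)) ≡ s * (s * s) * (a * (b * c))
          eq = solve-∀
          pow : ∀ {A} → n ≤ s * A → n ^ k ≤ s ^ k * A ^ k
          pow {A} p = ≤-trans (^-monoˡ-≤ k p) (≤-reflexive (*-^ s A k))
          widen : ∀ {A} → n ≤ 2 * e * A → n ≤ s * A
          widen {A} p = ≤-trans p (*-monoˡ-≤ A (≤-*ʳ (2 * e) 1≤sB))
          U≥ : n ≤ s * # (Uz z)
          U≥ = widen (U-large z)
          R≥ : n ≤ s * # (Rz u z)
          R≥ = widen (R-large u z)
          B≥ : n ≤ s * # (Bz z)
          B≥ = ≤-trans hsB (≤-trans (*-monoʳ-≤ sB (B-large z)) (≤-trans (≤-reflexive (eq′ sB (# (Bz z)))) (≤-trans (≤-*ˡ (2 * sB * # (Bz z)) 1≤e) (≤-reflexive (eq″ e sB (# (Bz z)))))))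
            where
            eq′ : ∀ s b → s * (2 * b) ≡ 2 * s * b
            eq′ = solve-∀
            eq″ : ∀ e s b → e * (2 * s * b) ≡ 2 * e * s * b
            eq″ = solve-∀
          lc = link-count g gs {σ} {D} ld 0<n 1≤D {q} {k} 1≤q {E₁} {κ} {B₀} {Bs} few (Rz u z) (Uz z) (Bz z) k e′ s 2 (≤-trans (1≤* {2} (s≤s z≤n) 1≤e) 2e≤e′) R≥ U≥ B≥ (λ x → ∧-elimˡ) (B-large z) (λ t b _ _ → U-codeg z t b) hσ hE₁ hκ

        -- Every admissible centre `z` leaves linear sets `Rz`, `Uz` and `Bz`, so a positive
        -- fraction of the tuples completes it to an accepted option. The admissible centres are
        -- themselves the fraction `1 / sW`.
        many : ∀ u y → Ω-size {n} {k} ≤ p * ∑Ω (λ o → 𝟙 (accepts u y o))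
        many u y = begin
          n * N ≤⟨ *-monoˡ-≤ N (hW y) ⟩
          sW * # (W y ∖ F) * N ≡⟨ trans (*-assoc sW _ N) (cong (sW *_) (sym (∑-*ʳ N (λ z → 𝟙 ((W y ∖ F) z))))) ⟩
          sW * ∑ (λ z → 𝟙 ((W y ∖ F) z) * N) ≤⟨ *-monoʳ-≤ sW (∑-mono pt) ⟩
          sW * ∑ (λ z → c * ∑ᵛ k (λ ms → ∑ᵛ k (λ ts → ∑ᵛ k (λ ds → 𝟙 (accepts u y (option z ms ts ds)))))) ≡⟨ cong (sW *_) (∑-*ˡ c _) ⟩
          sW * (c * ∑Ω (λ o → 𝟙 (accepts u y o))) ≡⟨ sym (*-assoc sW c _) ⟩
          p * ∑Ω (λ o → 𝟙 (accepts u y o)) ∎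
          where
          open ≤-Reasoning
          N = n ^ k * (n ^ k * n ^ k)
          c = s ^ k * (s ^ k * s ^ k) * Qlink D e′ k
          pt : ∀ z → 𝟙 ((W y ∖ F) z) * N ≤ c * ∑ᵛ k (λ ms → ∑ᵛ k (λ ts → ∑ᵛ k (λ ds → 𝟙 (accepts u y (option z ms ts ds)))))
          pt z with true? ((W y ∖ F) z)
          ... | no r = ≤-trans (≤-reflexive (cong (_* N) (𝟙-false (¬true r)))) z≤n
          ... | yes r = ≤-trans (≤-reflexive (trans (cong (_* N) (𝟙-true r)) (*-identityˡ N))) (≤-trans (count-z u z) (*-monoʳ-≤ c (∑ᵛ-mono k (λ ms → ∑ᵛ-mono k (λ ts → ∑ᵛ-mono k (λ ds → 𝟙-mono (∧-intro {(W y ∖ F) z} r)))))))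

    record Absorbers (st₀ : State S₁) (X Res : Sub n) (W : Fin n → Sub n) (t : ℕ) : Set where
      field
        st : State S₁
        ext : st₀ ⟶ st
        dom-new : ∀ v → v ∈ dom st → v ∈ dom st₀ ⊎ (∃ λ x → x ∈ X × v ∈ near 3 x)
        avoid : ∀ v → v ∈ dom st → v ∈ dom st₀ ⊎ Res (φ st v) ≡ false
        hit : Fin n → Fin n → Sub n
        hit-X : ∀ u y x → x ∈ hit u y → x ∈ X
        hit-dom : ∀ u y x v → x ∈ hit u y → v ∈ near 3 x → v ∈ dom st
        hit-centre : ∀ u y x → x ∈ hit u y → φ st x ∈ W y
        hit-nbrs : ∀ u y x v → x ∈ hit u y → v ∈ h x → φ st v ∈ g u
        hit-many : ∀ u y → t ≤ # (hit u y)

    module Partials (st₀ : State S₁) (X Res : Sub n) (W : Fin n → Sub n) where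

      -- The construction handed to `Selection`: `rest` holds the centres still to be placed, and
      -- `c u y` is a lower bound for the absorbers gained for `(u , y)`.
      record Partial (r : ℕ) (c : Fin n → Fin n → ℕ) : Set where
        field
          st : State S₁
          rest : Sub n
          rest-size : # rest ≡ r
          rest⊆ : rest ⊆ X
          ext : st₀ ⟶ st
          dom-new : ∀ v → v ∈ dom st → v ∈ dom st₀ ⊎ (∃ λ x → x ∈ X × rest x ≡ false × v ∈ near 3 x)
          avoid : ∀ v → v ∈ dom st → v ∈ dom st₀ ⊎ Res (φ st v) ≡ false
          hit : Fin n → Fin n → Sub n
          hit-X : ∀ u y x → x ∈ hit u y → x ∈ X × rest x ≡ false
          hit-dom : ∀ u y x v → x ∈ hit u y → v ∈ near 3 x → v ∈ dom st
          hit-centre : ∀ u y x → x ∈ hit u y → φ st x ∈ W y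
          hit-nbrs : ∀ u y x v → x ∈ hit u y → v ∈ h x → φ st v ∈ g u
          hit-many : ∀ u y → c u y ≤ # (hit u y)

      opaque
        extend : ∀ r c (P : Partial (suc r) c) (x : Fin n) → x ∈ Partial.rest P → (o : Option n k) → BallAdded (Partial.st P) x o → (b : Fin n → Fin n → Bool) →
          (∀ u y → b u y ≡ true → z o ∈ W y) → (∀ u y → b u y ≡ true → ∀ c → lookup (ts o) c ∈ g u) → (∀ l c → Res (cell o l c) ≡ false) → Partial r (λ u y → c u y + 𝟙 (b u y))
        extend r c P x x∈rest o added b b-centre b-nbrs b-avoid = P′
          where
          open Partial P
          x∈X : x ∈ X
          x∈X = rest⊆ x x∈rest
          module A = BallAdded added
          rest′ : Sub n
          rest′ = rest ∖ (x ≡ᶠ_)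
          hit′ : Fin n → Fin n → Sub n
          hit′ u y x′ = hit u y x′ ∨ ((x ≡ᶠ x′) ∧ b u y)
          rest-false : ∀ x′ → rest x′ ≡ false → rest′ x′ ≡ false
          rest-false x′ e = ¬true (λ z → true≢false (∧-elimˡ z) e)
          x∉rest′ : rest′ x ≡ false
          x∉rest′ = ¬true (λ z → true≢false (≡ᶠ-refl x) (not-elim (∧-elimʳ {rest x} z)))
          P′ : Partial r (λ u y → c u y + 𝟙 (b u y))
          P′ = record
            { st = A.st′ ; rest = rest′ ; rest-size = suc-injective (trans (sym (#-remove rest x x∈rest)) rest-size)
            ; rest⊆ = λ x′ z → rest⊆ x′ (∧-elimˡ z) ; ext = ⟶-trans ext A.ext ; dom-new = dom-new′ ; avoid = avoid′ ; hit = hit′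
            ; hit-X = hit-X′ ; hit-dom = hit-dom′ ; hit-centre = hit-centre′ ; hit-nbrs = hit-nbrs′ ; hit-many = hit-many′ }
            where
            dom-new′ : ∀ v → v ∈ dom A.st′ → v ∈ dom st₀ ⊎ (∃ λ x → x ∈ X × rest′ x ≡ false × v ∈ near 3 x)
            dom-new′ v d with A.new v d
            ... | inj₂ near₃ = inj₂ (x , x∈X , x∉rest′ , near₃)
            ... | inj₁ d′ with dom-new v d′
            ... | inj₁ d″ = inj₁ d″
            ... | inj₂ (x′ , x′∈ , used , near₃) = inj₂ (x′ , x′∈ , rest-false x′ used , near₃)
            avoid′ : ∀ v → v ∈ dom A.st′ → v ∈ dom st₀ ⊎ Res (φ A.st′ v) ≡ false
            avoid′ v d with A.new v d
            ... | inj₂ near₃ = inj₂ (trans (cong Res (proj₂ (proj₂ (A.cells v near₃)))) (b-avoid (proj₁ (A.cells v near₃)) (proj₁ (proj₂ (A.cells v near₃)))))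
            ... | inj₁ d′ with avoid v d′
            ... | inj₁ d″ = inj₁ d″
            ... | inj₂ r = inj₂ (trans (cong Res (φ≡ A.ext v d′)) r)
            view : ∀ u y x′ → x′ ∈ hit′ u y → x′ ∈ hit u y ⊎ (x ≡ x′ × b u y ≡ true)
            view u y x′ z with ∨-elim {hit u y x′} z
            ... | inj₁ r = inj₁ r
            ... | inj₂ r = inj₂ (≡ᶠ-sound (∧-elimˡ r) , ∧-elimʳ {x ≡ᶠ x′} r)
            hit-X′ : ∀ u y x′ → x′ ∈ hit′ u y → x′ ∈ X × rest′ x′ ≡ false
            hit-X′ u y x′ z with view u y x′ z
            ... | inj₁ r = proj₁ (hit-X u y x′ r) , rest-false x′ (proj₂ (hit-X u y x′ r))
            ... | inj₂ (refl , _) = x∈X , x∉rest′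
            hit-dom′ : ∀ u y x′ v → x′ ∈ hit′ u y → v ∈ near 3 x′ → v ∈ dom A.st′
            hit-dom′ u y x′ v z near₃ with view u y x′ z
            ... | inj₁ r = dom⊆ A.ext v (hit-dom u y x′ v r near₃)
            ... | inj₂ (refl , _) = A.ball v near₃
            hit-centre′ : ∀ u y x′ → x′ ∈ hit′ u y → φ A.st′ x′ ∈ W y
            hit-centre′ u y x′ z with view u y x′ z
            ... | inj₁ r = subst (_∈ W y) (sym (φ≡ A.ext x′ (hit-dom u y x′ x′ r (near-refl 3 x′)))) (hit-centre u y x′ r)
            ... | inj₂ (refl , acc) = subst (_∈ W y) (sym A.centre) (b-centre u y acc)
            hit-nbrs′ : ∀ u y x′ v → x′ ∈ hit′ u y → v ∈ h x′ → φ A.st′ v ∈ g u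
            hit-nbrs′ u y x′ v z e with view u y x′ z
            ... | inj₁ r = subst (_∈ g u) (sym (φ≡ A.ext v (hit-dom u y x′ v r (near-mono {1} {3} x′ v (s≤s z≤n) (near-step 0 x′ x′ v (near-refl 0 x′) e))))) (hit-nbrs u y x′ v r e)
            ... | inj₂ (refl , acc) = subst (_∈ g u) (sym (A.nbrs v e)) (b-nbrs u y acc (χ v))
            hit-many′ : ∀ u y → c u y + 𝟙 (b u y) ≤ # (hit′ u y)
            hit-many′ u y with true? (b u y)
            ... | no r = ≤-trans (≤-reflexive (trans (cong (c u y +_) (𝟙-false (¬true r))) (+-identityʳ _))) (≤-trans (hit-many u y) (#-mono (λ x′ z → ∨-introˡ ((x ≡ᶠ x′) ∧ b u y) z)))
            ... | yes r = ≤-trans (≤-reflexive (trans (cong (c u y +_) (𝟙-true r)) (+-comm (c u y) 1))) (≤-trans (s≤s (hit-many u y)) (#-⊂ x (λ x′ z → ∨-introˡ ((x ≡ᶠ x′) ∧ b u y) z) (∨-introʳ (hit u y x) (∧-intro (≡ᶠ-refl x) r)) (¬true (λ z → true≢false x∈rest (proj₂ (hit-X u y x z))))))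

    record BallData : Set where
      no-eta-equality
      field
        st₀ : State S₁
        X D₀ Res : Sub n
        W : Fin n → Sub n
        c₀ : Fin k
        X-colour : ∀ x → x ∈ X → χ x ≡ c₀
        X-free : ∀ x v → x ∈ X → v ∈ near 5 x → dom st₀ v ≡ false
        dom⊆D₀ : dom st₀ ⊆ D₀
        X⊆D₀ : ∀ x v → x ∈ X → v ∈ near 3 x → v ∈ D₀
        f : ℕ
        hf : # D₀ + # Res ≤ f
        σ D : ℕ
        ld : LocallyDense g σ D
        0<n : 0 < n
        1≤D : 1 ≤ D
        E₁ κ : ℕ
        few : FewAtypical g q E₁ κ B₀ Bs
        e e′ sB sW : ℕ
        1≤e : 1 ≤ e
        1≤sB : 1 ≤ sB
        2e≤e′ : 2 * e ≤ e′
        codeg : ∀ u v → n ≤ e * # (g u ∩ g v)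
        hF : 4 * e * suc f ≤ n
        hB : 4 * e * # B₀ ≤ n
        hFB : 2 * suc f ≤ # B₀
        hsB : n ≤ sB * # B₀
        -- `f` bounds the vertices that are ever forbidden, so removing them from `W y` still leaves
        -- `n / sW`.
        hW : ∀ y → n + sW * f ≤ sW * # (W y)
        hσ : 2 * e * sB * (e′ * (2 * Q₁ D e′ k)) * (2 * D) ^ k ≤ σ
        hE₁ : q ^ k ≤ E₁
        hκ : 4 * D * (2 * (2 * Q₁ D e′ k) * (2 * D) ^ k) ≤ κ

    module BallStage (balldata : BallData) where

      open BallData balldata

      p : ℕ
      p = sW * ((2 * e * sB) ^ k * ((2 * e * sB) ^ k * (2 * e * sB) ^ k) * Qlink D e′ k)

      step : ∀ r c → Partials.Partial st₀ X Res W (suc r) c → (w : Fin n → Fin n → ℕ) → 0 < ∑∑ w →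
        Σ (Fin n → Fin n → Bool) λ b → Partials.Partial st₀ X Res W r (λ u y → c u y + 𝟙 (b u y)) × (∑∑ w ≤ suc p * ∑∑ (λ u y → 𝟙 (b u y) * w u y))
      step r c P w 0<w = b , Partials.extend st₀ X Res W r c P x x∈rest o added b (λ u y → Options.accepted-centre F W {u} {y} o) (λ u y → Options.accepted-nbrs F W {u} {y} o) (λ l c → ∨-falseʳ {img (dom st) (φ st) (cell o l c)} (Valid.avoid valid l c)) , ≤-trans heavy (*-monoˡ-≤ (∑∑ (λ u y → 𝟙 (b u y) * w u y)) (n≤1+n p))
        where
        open Partials.Partial P
        picked = #-exists rest (subst (0 <_) (sym rest-size) (s≤s z≤n))
        x : Fin n
        x = proj₁ picked
        x∈rest : x ∈ rest
        x∈rest = proj₂ picked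
        x∈X : x ∈ X
        x∈X = rest⊆ x x∈rest
        F : Sub n
        F y = img (dom st) (φ st) y ∨ Res y
        #F≤ : # F ≤ f
        #F≤ = ≤-trans (#-∪ (img (dom st) (φ st)) Res) (≤-trans (+-monoˡ-≤ (# Res) (≤-trans (#-img-≤ (dom st) (φ st)) (#-mono sub))) hf)
          where
          sub : dom st ⊆ D₀
          sub v p with dom-new v p
          ... | inj₁ d = dom⊆D₀ v d
          ... | inj₂ (x , x∈ , _ , near₃) = X⊆D₀ x v x∈ near₃
        hW′ : ∀ y → n ≤ sW * # (W y ∖ F)
        hW′ y = +-cancelʳ-≤ (sW * f) n _ (≤-trans (hW y) (≤-trans (*-monoʳ-≤ sW (≤-trans (#-∖ (W y) F) (+-monoʳ-≤ (# (W y ∖ F)) #F≤))) (≤-reflexive (*-distribˡ-+ sW (# (W y ∖ F)) f))))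
        ample : Options.Ample F W
        ample = record
          { σ = σ ; D = D ; ld = ld ; 0<n = 0<n ; 1≤D = 1≤D ; E₁ = E₁ ; κ = κ ; few = few ; e = e ; e′ = e′ ; sB = sB ; sW = sW ; 1≤e = 1≤e ; 1≤sB = 1≤sB ; 2e≤e′ = 2e≤e′
          ; codeg = codeg ; hF = ≤-trans (*-monoʳ-≤ (4 * e) (s≤s #F≤)) hF ; hB = hB ; hFB = ≤-trans (*-monoʳ-≤ 2 (s≤s #F≤)) hFB ; hsB = hsB ; hW = hW′ ; hσ = hσ ; hE₁ = hE₁ ; hκ = hκ }
        chosen = weighted-choice p (Options.accepts F W) 0<n (Options.Count.many F W ample) w
        o : Option n k
        o = proj₁ chosen
        b : Fin n → Fin n → Bool
        b u y = Options.accepts F W u y o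
        heavy : ∑∑ w ≤ p * ∑∑ (λ u y → 𝟙 (b u y) * w u y)
        heavy = proj₂ chosen
        some = ∑∑-pos _ (pos-factorʳ p _ 0<w heavy)
        valid : Valid F o
        valid = Options.accepted-valid F W {proj₁ some} {proj₁ (proj₂ some)} o (𝟙-pos (pos-factorʳ (w (proj₁ some) (proj₁ (proj₂ some))) _ (proj₂ (proj₂ some)) (≤-reflexive (*-comm (𝟙 (b (proj₁ some) (proj₁ (proj₂ some)))) _))))
        free : ∀ v → v ∈ near 5 x → dom st v ≡ false
        free v near₅ = ¬true λ d → absurd (dom-new v d)
          where
          absurd : v ∈ dom st₀ ⊎ (∃ λ x → x ∈ X × rest x ≡ false × v ∈ near 3 x) → ⊥
          absurd (inj₁ d) = true≢false d (X-free x v x∈X near₅)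
          absurd (inj₂ (x′ , x′∈X , used , near₃)) = true≢false (subst (_∈ rest) x≡x′ x∈rest) used
            where
            -- The origin of distance 8: a vertex within 5 of one centre and within 3 of another of
            -- the same colour forces the two centres to coincide.
            x≡x′ : x ≡ x′
            x≡x′ = χ-dist x x′ (near-trans 5 3 x v x′ near₅ (near-sym′ 3 x′ v near₃)) (trans (X-colour x x∈X) (sym (X-colour x′ x′∈X)))
        added = add-ball st x F o valid free (λ v d → ∨-introˡ (Res (φ st v)) (img-intro {dom = dom st} {φ st} v d))
      opaque
        absorbers : ∀ t l → (p + suc p) * (t + l) ≤ # X → n * n ≤ 2 ^ l → Absorbers st₀ X Res W t
        absorbers t l hX hl = finish (Selection.selection 0<n p (Partials.Partial st₀ X Res W) step (# X) (t + l) l start hX hl)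
          where
          start : Partials.Partial st₀ X Res W (# X) (λ _ _ → 0)
          start = record
            { st = st₀ ; rest = X ; rest-size = refl ; rest⊆ = λ _ z → z ; ext = ⟶-refl ; dom-new = λ v d → inj₁ d ; avoid = λ v d → inj₁ d ; hit = λ _ _ _ → false
            ; hit-X = λ u y x () ; hit-dom = λ u y x v () ; hit-centre = λ u y x () ; hit-nbrs = λ u y x v () ; hit-many = λ u y → z≤n }
          finish : (∃ λ c → Partials.Partial st₀ X Res W 0 c × (∀ u y → t + l ≤ c u y + l)) → Absorbers st₀ X Res W t
          finish (c , P , bound) = record
            { st = st ; ext = ext ; dom-new = λ v d → forget (dom-new v d) ; avoid = avoid ; hit = hit ; hit-X = λ u y x z → proj₁ (hit-X u y x z)
            ; hit-dom = hit-dom ; hit-centre = hit-centre ; hit-nbrs = hit-nbrs ; hit-many = λ u y → ≤-trans (+-cancelʳ-≤ l t (c u y) (bound u y)) (hit-many u y) }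
            where
            open Partials.Partial P
            forget : ∀ {v} {A : Set} {R : Sub n} → A ⊎ (∃ λ x → x ∈ X × R x ≡ false × v ∈ near 3 x) → A ⊎ (∃ λ x → x ∈ X × v ∈ near 3 x)
            forget (inj₁ d) = inj₁ d
            forget (inj₂ (x , x∈ , _ , near₃)) = inj₂ (x , x∈ , near₃)

  -- Moving the embedding from one hub to the next

  module Travel (χ : Fin n → Fin k) (χ-proper : ∀ v w → w ∈ h v → ¬ χ v ≡ χ w) (b : ℕ) {{b≢0 : NonZero b}} (band : ∀ x v → v ∈ h x → toℕ v ≤ toℕ x + b)
    (Eh : ℕ) (E≤Eh : E ≤ Eh) where

    record Travelled {S} (st : State S) (Y : Sub n) (a ℓ : ℕ) (Q : Hub g k Eh q) (Z : Sub n) : Set where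
      field
        S′ : Fin n → Sub n
        st′ : State S′
        ext : st ⟶ st′
        new : ∀ v → v ∈ dom st′ → v ∈ dom st ⊎ (v ∈ range a ℓ × Y v ≡ false × φ st′ v ∈ S′ v)
        done : ∀ v → v ∈ range a ℓ → Y v ≡ false → v ∈ dom st′
        -- Only a window of `b` positions is sent into `Z`, which will be the reservoir; so each
        -- move spends at most `b` of its vertices.
        through : ∀ v x → a ≤ toℕ v → x ∈ S′ v → x ∈ Z → v ∈ range (a + 2 * b) b
        arrived : ∀ v → a + ℓ ≤ toℕ v → S′ v ≡ Hub.part Q (suc (χ v))

    module Route (P Q : Hub g k Eh q) {c : ℕ} {R U B : Sub n} (L : Links g k E q c R U B)
      (r₁ : ℕ) (R⊆ : R ⊆ Hub.part P zero) (B⊆ : B ⊆ Hub.part Q zero) (hR : # (Hub.part P zero) ≤ r₁ * # R) (hB : # (Hub.part Q zero) ≤ r₁ * # B) (hEh : r₁ * c * E ≤ Eh) where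

      open Links L

      -- Successive zones of `b` positions go to the colours of the old hub, to its part `zero`, to
      -- the reservoir, to part `zero` of the new hub, and finally to the colours of the new hub. An
      -- edge of `H` changes the zone by at most one, so bi-density is required for equal and
      -- consecutive zones.
      cls : ℕ → Fin k → Sub n
      cls 0 i = Hub.part P (suc i)
      cls 1 i = rs i
      cls 2 i = us i
      cls 3 i = bs i
      cls (suc (suc (suc (suc _)))) i = Hub.part Q (suc i)

      private
        same : ∀ {A : Sub n} → # A ≤ 1 * # A
        same = ≤-reflexive (sym (*-identityˡ _))
        1E : 1 * E ≤ Eh
        1E = ≤-trans (≤-reflexive (*-identityˡ E)) E≤Eh

      cls-bd : ∀ z z′ i j → z ≤ suc z′ → z′ ≤ suc z → ¬ i ≡ j → BiDense g E q (cls z i) (cls z′ j)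
      cls-bd 0 0 i j _ _ ne = BiDense-⊆ {g = g} {Eh} {E} {q} {q} 1 1 (Hub.bd P (suc i) (suc j) (λ e → ne (Finₚ.suc-injective e))) (λ _ p → p) (λ _ p → p) same same 1E 1E ≤-refl
      cls-bd 0 1 i j _ _ ne = BiDense-⊆ {g = g} {Eh} {E} {q} {q} 1 (r₁ * c) (Hub.bd P (suc i) zero (λ ())) (λ _ p → p) (λ x p → R⊆ x (rs⊆ j x p)) same (scale-trans r₁ c hR (rs-size j)) 1E hEh ≤-refl
      cls-bd 0 (suc (suc _)) i j _ (s≤s ()) ne
      cls-bd 1 0 i j _ _ ne = BiDense-⊆ {g = g} {Eh} {E} {q} {q} (r₁ * c) 1 (Hub.bd P zero (suc j) (λ ())) (λ x p → R⊆ x (rs⊆ i x p)) (λ _ p → p) (scale-trans r₁ c hR (rs-size i)) same hEh 1E ≤-refl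
      cls-bd 1 1 i j _ _ ne = rr i j ne
      cls-bd 1 2 i j _ _ ne = ru i j
      cls-bd 1 (suc (suc (suc _))) i j _ (s≤s (s≤s ())) ne
      cls-bd 2 0 i j (s≤s ()) _ ne
      cls-bd 2 1 i j _ _ ne = ur i j
      cls-bd 2 2 i j _ _ ne = uu i j ne
      cls-bd 2 3 i j _ _ ne = ub i j
      cls-bd 2 (suc (suc (suc (suc _)))) i j _ (s≤s (s≤s (s≤s ()))) ne
      cls-bd 3 0 i j (s≤s ()) _ ne
      cls-bd 3 1 i j (s≤s (s≤s ())) _ ne
      cls-bd 3 2 i j _ _ ne = bu i j
      cls-bd 3 3 i j _ _ ne = bb i j ne
      cls-bd 3 (suc (suc (suc (suc _)))) i j _ _ ne = BiDense-⊆ {g = g} {Eh} {E} {q} {q} (r₁ * c) 1 (Hub.bd Q zero (suc j) (λ ())) (λ x p → B⊆ x (bs⊆ i x p)) (λ _ p → p) (scale-trans r₁ c hB (bs-size i)) same hEh 1E ≤-refl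
      cls-bd (suc (suc (suc (suc _)))) 0 i j (s≤s ()) _ ne
      cls-bd (suc (suc (suc (suc _)))) 1 i j (s≤s (s≤s ())) _ ne
      cls-bd (suc (suc (suc (suc _)))) 2 i j (s≤s (s≤s (s≤s ()))) _ ne
      cls-bd (suc (suc (suc (suc _)))) 3 i j _ _ ne = BiDense-⊆ {g = g} {Eh} {E} {q} {q} 1 (r₁ * c) (Hub.bd Q (suc i) zero (λ ())) (λ _ p → p) (λ x p → B⊆ x (bs⊆ j x p)) same (scale-trans r₁ c hB (bs-size j)) 1E hEh ≤-refl
      cls-bd (suc (suc (suc (suc _)))) (suc (suc (suc (suc _)))) i j _ _ ne = BiDense-⊆ {g = g} {Eh} {E} {q} {q} 1 1 (Hub.bd Q (suc i) (suc j) (λ e → ne (Finₚ.suc-injective e))) (λ _ p → p) (λ _ p → p) same same 1E 1E ≤-refl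

      module _ {S : Fin n → Sub n} (st : State S) (a : ℕ) where

        -- Truncated subtraction puts everything before `a + b` into zone 0, also the leftover
        -- vertices before `a`.
        zone : Fin n → ℕ
        zone v = (toℕ v ∸ a) / b

        newS : ℕ → Fin n → Sub n
        newS 0 v = S v
        newS (suc z) v = cls (suc z) (χ v)

        S′ : Fin n → Sub n
        S′ v = newS (zone v) v

        zone-bounds : ∀ v z → zone v ≡ suc z → (a + suc z * b ≤ toℕ v) × (toℕ v < a + suc (suc z) * b)
        zone-bounds v z e = lower , upper
          where
          lower : a + suc z * b ≤ toℕ v
          lower = ≤∸⇒+≤ {suc z * b} {toℕ v} {a} (≤-trans (>-nonZero⁻¹ b) (m≤m+n b (z * b))) (≤-trans (≤-reflexive (cong (_* b) (sym e))) (zone-lo (toℕ v ∸ a) b))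
          upper : toℕ v < a + suc (suc z) * b
          upper = ≤-<-trans (m≤n+m∸n (toℕ v) a) (+-monoʳ-< a (<-≤-trans (zone-hi (toℕ v ∸ a) b) (≤-reflexive (cong (λ z → suc z * b) e))))

        S′-cls : (∀ v → a ≤ toℕ v → S v ≡ Hub.part P (suc (χ v))) → ∀ v → a ≤ toℕ v → S′ v ≡ cls (zone v) (χ v)
        S′-cls S-hub v p with zone v
        ... | zero = S-hub v p
        ... | suc z = refl

        cls-through : ∀ Z → (∀ i x → x ∈ Hub.part P i → Z x ≡ false) → (∀ i x → x ∈ Hub.part Q i → Z x ≡ false) →
          ∀ v z x → zone v ≡ z → x ∈ cls z (χ v) → x ∈ Z → v ∈ range (a + 2 * b) b
        cls-through Z PZ QZ v 0 x _ p u = ⊥-elim (true≢false u (PZ (suc (χ v)) x p))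
        cls-through Z PZ QZ v 1 x _ p u = ⊥-elim (true≢false u (PZ zero x (R⊆ x (rs⊆ (χ v) x p))))
        cls-through Z PZ QZ v 2 x ez p u = range-intro (a + 2 * b) b v (proj₁ (zone-bounds v 1 ez)) (<-≤-trans (proj₂ (zone-bounds v 1 ez)) (≤-reflexive (eq a b)))
          where
          eq : ∀ a b → a + 3 * b ≡ a + 2 * b + b
          eq = solve-∀
        cls-through Z PZ QZ v 3 x _ p u = ⊥-elim (true≢false u (QZ zero x (B⊆ x (bs⊆ (χ v) x p))))
        cls-through Z PZ QZ v (suc (suc (suc (suc z)))) x _ p u = ⊥-elim (true≢false u (QZ (suc (χ v)) x p))

        cls-arrived : ∀ ℓ → 4 * b ≤ ℓ → ∀ v → a + ℓ ≤ toℕ v → ∀ z → zone v ≡ z → cls z (χ v) ≡ Hub.part Q (suc (χ v))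
        cls-arrived ℓ long v p = deep
          where
          shallow : ∀ z → zone v ≡ z → z < 4 → ⊥
          shallow z ez z<4 = <⇒≱ (<-≤-trans (zone-hi (toℕ v ∸ a) b) (≤-trans (*-monoˡ-≤ b (subst (λ z → suc z ≤ 4) (sym ez) z<4)) long)) (≤-trans (≤-reflexive (sym (m+n∸m≡n a ℓ))) (∸-monoˡ-≤ a p))
          deep : ∀ z → zone v ≡ z → cls z (χ v) ≡ Hub.part Q (suc (χ v))
          deep 0 ez = ⊥-elim (shallow 0 ez (s≤s z≤n))
          deep 1 ez = ⊥-elim (shallow 1 ez (s≤s (s≤s z≤n)))
          deep 2 ez = ⊥-elim (shallow 2 ez (s≤s (s≤s (s≤s z≤n))))
          deep 3 ez = ⊥-elim (shallow 3 ez ≤-refl)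
          deep (suc (suc (suc (suc z)))) ez = refl

        module _ (dom-in : ∀ v → v ∈ dom st → toℕ v < a) where

          far : ∀ v z u → zone v ≡ suc z → u ∈ dom st → u ∈ h v → ⊥
          far v z u e d uv = <⇒≱ (<-≤-trans (≤-<-trans (band u v (trans (hs u v) uv)) (+-monoˡ-< b (dom-in u d))) (≤-trans (+-monoʳ-≤ a (m≤m+n b (z * b))) (proj₁ (zone-bounds v z e)))) ≤-refl

          -- By the bandwidth a vertex beyond zone 0 has no embedded neighbour yet, so its class can
          -- be exchanged and its candidate set is the whole new class. Zone 0 keeps both.
          reassign : State S′
          reassign = record { dom = dom st ; φ = φ st ; C = λ v → newC (zone v) v ; inj = inj st ; hom = hom st ; C⊆ = C⊆′ ; C-adj = C-adj′ ; C-big = C-big′ }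
            where
            newC : ℕ → Fin n → Sub n
            newC 0 v = C st v
            newC (suc z) v = cls (suc z) (χ v)
            C⊆′ : ∀ v → dom st v ≡ false → newC (zone v) v ⊆ S′ v
            C⊆′ v p with zone v
            ... | zero = C⊆ st v p
            ... | suc z = λ x r → r
            C-adj′ : ∀ v x u → dom st v ≡ false → x ∈ newC (zone v) v → u ∈ dom st → u ∈ h v → x ∈ g (φ st u)
            C-adj′ v x u p r d uv with zone v in eq
            ... | zero = C-adj st v x u p r d uv
            ... | suc z = ⊥-elim (far v z u eq d uv)
            C-big′ : ∀ v → dom st v ≡ false → # (S′ v) ≤ q ^ (k + # (h v ∩ dom st)) * # (newC (zone v) v)
            C-big′ v p with zone v
            ... | zero = C-big st v p
            ... | suc z = ≤-*ˡ _ (^-≥1 q (k + # (h v ∩ dom st)) 1≤q)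

          module _ (S-hub : ∀ v → a ≤ toℕ v → S v ≡ Hub.part P (suc (χ v))) (out : ∀ v → dom st v ≡ false → a ≤ toℕ v ⊎ toℕ v + b < a)
            (ℓ : ℕ) (1≤E : 1 ≤ E) (Y : Sub n)
            (roomP : ∀ i → E * (used st (Hub.part P (suc i)) + ℓ) ≤ # (Hub.part P (suc i)))
            (avoidR : ∀ x → x ∈ R → img (dom st) (φ st) x ≡ false) (avoidU : ∀ x → x ∈ U → img (dom st) (φ st) x ≡ false)
            (avoidB : ∀ x → x ∈ B → img (dom st) (φ st) x ≡ false) (avoidQ : ∀ i x → x ∈ Hub.part Q i → img (dom st) (φ st) x ≡ false)
            (roomR : ∀ i → E * ℓ ≤ # (rs i)) (roomU : ∀ i → E * ℓ ≤ # (us i)) (roomB : ∀ i → E * ℓ ≤ # (bs i)) (roomQ : ∀ i → E * ℓ ≤ # (Hub.part Q (suc i))) where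

            unused : ∀ Z → (∀ x → x ∈ Z → img (dom st) (φ st) x ≡ false) → used st Z ≡ 0
            unused Z h = #-none (λ v → ¬true (λ p → true≢false (img-intro {dom = dom st} {φ st} v (∧-elimˡ p)) (h (φ st v) (∧-elimʳ {dom st v} p))))

            cls-room : ∀ z i → E * (used st (cls z i) + ℓ) ≤ # (cls z i)
            cls-room 0 i = roomP i
            cls-room 1 i = ≤-trans (≤-reflexive (cong (λ z → E * (z + ℓ)) (unused (rs i) (λ x p → avoidR x (rs⊆ i x p))))) (roomR i)
            cls-room 2 i = ≤-trans (≤-reflexive (cong (λ z → E * (z + ℓ)) (unused (us i) (λ x p → avoidU x (us⊆ i x p))))) (roomU i)
            cls-room 3 i = ≤-trans (≤-reflexive (cong (λ z → E * (z + ℓ)) (unused (bs i) (λ x p → avoidB x (bs⊆ i x p))))) (roomB i)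
            cls-room (suc (suc (suc (suc _)))) i = ≤-trans (≤-reflexive (cong (λ z → E * (z + ℓ)) (unused (Hub.part Q (suc i)) (avoidQ (suc i))))) (roomQ i)

            travel : Embedded Y a ℓ reassign
            travel = embed-range Y ℓ a reassign bd room 1≤E
              where
              zone-near : ∀ v u → a ≤ toℕ u → u ∈ h v → zone v ≤ suc (zone u)
              zone-near v u a≤u uv = zone-step (toℕ v ∸ a) (toℕ u ∸ a) b (≤-trans (∸-monoˡ-≤ a (band u v (trans (hs u v) uv))) (≤-reflexive (+-∸-comm b a≤u)))
              bd : ∀ v u → v ∈ range a ℓ → Y v ≡ false → dom st v ≡ false → dom st u ≡ false → u ∈ h v → BiDense g E q (S′ v) (S′ u)
              bd v u v∈ _ _ du uv with out u du
              ... | inj₂ u<a = ⊥-elim (<⇒≱ u<a (≤-trans (range-lo a ℓ v v∈) (band u v (trans (hs u v) uv))))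
              ... | inj₁ a≤u = subst₂ (BiDense g E q) (sym (S′-cls S-hub v a≤v)) (sym (S′-cls S-hub u a≤u)) (cls-bd (zone v) (zone u) (χ v) (χ u) (zone-near v u a≤u uv) (zone-near u v a≤v (trans (hs u v) uv)) (χ-proper v u uv))
                where
                a≤v : a ≤ toℕ v
                a≤v = range-lo a ℓ v v∈
              room : ∀ v → v ∈ range a ℓ → Y v ≡ false → dom st v ≡ false → E * (used reassign (S′ v) + ℓ) ≤ # (S′ v)
              room v v∈ _ _ = subst (λ Z → E * (used st Z + ℓ) ≤ # Z) (sym (S′-cls S-hub v (range-lo a ℓ v v∈))) (cls-room (zone v) (χ v))

            opaque
              travelled : ∀ Z → (∀ i x → x ∈ Hub.part P i → Z x ≡ false) → (∀ i x → x ∈ Hub.part Q i → Z x ≡ false) → 4 * b ≤ ℓ → Travelled st Y a ℓ Q Z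
              travelled Z PZ QZ long = record
                { S′ = S′ ; st′ = TR.st′ ; ext = record { dom⊆ = λ x p → dom⊆ TR.ext x p ; φ≡ = λ x p → φ≡ TR.ext x p }
                ; new = λ v p → forget v (TR.new v p) ; done = TR.done
                ; through = λ v x a≤v p → cls-through Z PZ QZ v (zone v) x refl (subst (x ∈_) (S′-cls S-hub v a≤v) p)
                ; arrived = λ v p → trans (S′-cls S-hub v (≤-trans (m≤m+n a ℓ) p)) (cls-arrived ℓ long v p (zone v) refl) }
                where
                module TR = Embedded travel
                forget : ∀ v → v ∈ dom st ⊎ (v ∈ range a ℓ × Y v ≡ false × dom st v ≡ false × φ TR.st′ v ∈ S′ v) → v ∈ dom st ⊎ (v ∈ range a ℓ × Y v ≡ false × φ TR.st′ v ∈ S′ v)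
                forget v (inj₁ d) = inj₁ d
                forget v (inj₂ (p , y , _ , f)) = inj₂ (p , y , f)

    record Supply : Set where
      field
        {σ D} : ℕ
        ld : LocallyDense g σ D
        0<n : 0 < n
        1≤D : 1 ≤ D
        1≤E : 1 ≤ E
        Y : Sub n
        aY : ℕ
        Y-low : ∀ y → y ∈ Y → toℕ y + b < aY
        U : Sub n
        t₀ e₁ : ℕ
        U-codeg : ∀ u v → t₀ ≤ # (U ∩ g u ∩ g v)
        1≤e₁ : 1 ≤ e₁
        U≤ : # U ≤ e₁ * t₀
        τ sU νl νh s₂ ℓ N : ℕ
        νl-def : νl ≡ ν E (Qlink D (2 * e₁) k)
        νh-def : νh ≡ ν Eh (Qc D (suc k))
        s₂-def : s₂ ≡ 2 * τ * νh
        hq₁ : 2 * Qc D (suc k) ≤ q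
        hq₂ : 2 * Qlink D (2 * e₁) k ≤ q
        hEh : 2 * νl * E ≤ Eh
        hτ : n ≤ τ * # Y
        2U≤Y : 2 * # U ≤ # Y
        hsU : n ≤ sU * # U
        1≤sU : 1 ≤ sU
        1≤s₂ : 1 ≤ s₂
        1≤νl : 1 ≤ νl
        hℓ : s₂ * sU * νl * (E * (ℓ + ℓ)) ≤ n
        hσ₁ : 2 * τ * (2 * D) ^ suc k ≤ σ
        hσ₂ : 2 * s₂ * sU * (2 * e₁ * (2 * Q₁ D (2 * e₁) k)) * (2 * D) ^ k ≤ σ
        hN : 2 * (N * b) ≤ t₀

    module Stages (supply : Supply) {S₀ : Fin n → Sub n} (st₀ : State S₀) where

      open Supply supply

      record Stage (j a : ℕ) : Set where
        field
          S : Fin n → Sub n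
          st : State S
          P : Hub g k Eh q
        open Hub P public
        field
          part-size : ∀ i → n ≤ s₂ * # (part i)
          part-avoid : ∀ i x → x ∈ part i → U x ≡ false
          S-hub : ∀ v → a ≤ toℕ v → S v ≡ part (suc (χ v))
          dom-in : ∀ v → v ∈ dom st → toℕ v < a × Y v ≡ false
          dom-all : ∀ v → toℕ v < a → Y v ≡ false → v ∈ dom st
          roomP : ∀ i → E * (used st (part i) + ℓ) ≤ # (part i)
          usedU : used st U ≤ j * b
          origin : st₀ ⟶ st
          aY≤a : aY ≤ a

      room-le : ∀ {c x} r → n ≤ c * x → c ≤ s₂ * sU * νl → r ≤ E * (ℓ + ℓ) → r ≤ x
      room-le {c} r p hc hr = room-of {n} {c} 0<n p (≤-trans (*-mono-≤ hc hr) hℓ)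

      halve : ∀ {x y z} → x ≤ y + z → 2 * z ≤ x → x ≤ 2 * y
      halve {x} {y} {z} p r = lin 0 (+-mono-≤ (*-monoʳ-≤ 2 p) r) (eq x y z)
        where
        eq : ∀ x y z → x + (2 * (y + z) + x) + 0 ≡ 2 * y + (2 * x + 2 * z)
        eq = solve-∀

      s₂≤ : s₂ ≤ s₂ * sU * νl
      s₂≤ = ≤-trans (≤-*ʳ s₂ 1≤sU) (≤-*ʳ (s₂ * sU) 1≤νl)

      2≤E : 2 ≤ E
      2≤E = ≤-trans (≤-trans (m≤m+n 2 Δ) (≤-*ʳ (2 + Δ) (^-≥1 q (k + Δ) 1≤q))) hE

      Eℓ≤ : E * ℓ ≤ E * (ℓ + ℓ)
      Eℓ≤ = *-monoʳ-≤ E (m≤m+n ℓ ℓ)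

      module Next (j a : ℕ) (j≤N : j ≤ N) (now : Stage j a) where

        open Stage now

        I : Sub n
        I = img (dom st) (φ st)

        F : Sub n
        F x = not (U x ∨ I x)

        Y-fresh : # Y + # (dom st) ≤ n
        Y-fresh = ≤-trans (+-monoˡ-≤ (# (dom st)) (#-mono {A = Y} {B = (λ _ → true) ∖ dom st} (λ y p → not-intro (¬true (λ d → true≢false p (proj₂ (dom-in y d)))))))
          (≤-reflexive (trans (+-comm (# ((λ _ → true) ∖ dom st)) (# (dom st))) (trans (sym (#-split (λ _ → true) (dom st))) (#-full n))))

        F-size : n ≤ 2 * τ * # F
        F-size = ≤-trans hτ (≤-trans (*-monoʳ-≤ τ (halve {# Y} {# F} {# U} Y≤ 2U≤Y)) (≤-reflexive (eq τ (# F))))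
          where
          eq : ∀ t f → t * (2 * f) ≡ 2 * t * f
          eq = solve-∀
          Y≤ : # Y ≤ # F + # U
          Y≤ = +-cancelʳ-≤ (# (dom st)) (# Y) (# F + # U) (begin
            # Y + # (dom st) ≤⟨ Y-fresh ⟩
            n ≡⟨ sym (#-full n) ⟩
            # (λ (_ : Fin n) → true) ≤⟨ #-∖ (λ _ → true) (λ x → U x ∨ I x) ⟩
            # F + # (λ x → U x ∨ I x) ≤⟨ +-monoʳ-≤ (# F) (≤-trans (#-∪ U I) (+-monoʳ-≤ (# U) (#-img-≤ (dom st) (φ st)))) ⟩
            # F + (# U + # (dom st)) ≡⟨ sym (+-assoc (# F) (# U) _) ⟩
            # F + # U + # (dom st) ∎)
            where open ≤-Reasoning

        found : Σ (Hub g k Eh (2 * Qc D (suc k))) λ P → (∀ i → Hub.part P i ⊆ F) × (∀ i → # F ≤ ν Eh (Qc D (suc k)) * # (Hub.part P i))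
        found = hub-exists gs ld 0<n 1≤D k Eh (≤-trans 1≤E E≤Eh) F (2 * τ) F-size hσ₁

        module WithHub (Q : Hub g k Eh q) (Q⊆F : ∀ i → Hub.part Q i ⊆ F) (Q-size : ∀ i → # F ≤ νh * # (Hub.part Q i)) where

          Q-U : ∀ i x → x ∈ Hub.part Q i → U x ≡ false
          Q-U i x p = ∨-falseˡ (not-elim (Q⊆F i x p))

          Q-I : ∀ i x → x ∈ Hub.part Q i → I x ≡ false
          Q-I i x p = ∨-falseʳ {U x} (not-elim (Q⊆F i x p))

          Q-large : ∀ i → n ≤ s₂ * # (Hub.part Q i)
          Q-large i = ≤-trans (scale-trans (2 * τ) νh F-size (Q-size i)) (≤-reflexive (cong (_* # (Hub.part Q i)) (sym s₂-def)))

          R′ U′ : Sub n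
          R′ = part zero ∖ I
          U′ = U ∖ I

          ∖-used : ∀ A → # A ≤ # (A ∖ I) + used st A
          ∖-used A = ≤-trans (≤-reflexive (trans (#-split A I) (+-comm (# (A ∩ I)) _))) (+-monoʳ-≤ (# (A ∖ I)) (#-img (dom st) (φ st) A))

          R′-half : # (part zero) ≤ 2 * # R′
          R′-half = halve {# (part zero)} {# R′} (∖-used (part zero)) (≤-trans (*-mono-≤ 2≤E (m≤m+n (used st (part zero)) ℓ)) (roomP zero))

          usedU≤ : 2 * used st U ≤ t₀
          usedU≤ = ≤-trans (*-monoʳ-≤ 2 (≤-trans usedU (*-monoˡ-≤ b j≤N))) hN

          -- At most `t₀ / 2` reservoir vertices are spent in all stages together, so half of every
          -- codegree into the reservoir survives.
          U′-codeg : ∀ u v → # U′ ≤ 2 * e₁ * # (U′ ∩ g u ∩ g v)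
          U′-codeg u v = ≤-trans (#-mono (λ x → ∧-elimˡ)) (≤-trans U≤ (≤-trans (*-monoʳ-≤ e₁ half) (≤-reflexive (eq e₁ (# (U′ ∩ g u ∩ g v))))))
            where
            eq : ∀ e x → e * (2 * x) ≡ 2 * e * x
            eq = solve-∀
            half : t₀ ≤ 2 * # (U′ ∩ g u ∩ g v)
            half = halve {t₀} {# (U′ ∩ g u ∩ g v)} {used st U} (≤-trans (U-codeg u v) (≤-trans (≤-reflexive (trans (#-split (U ∩ g u ∩ g v) I) (+-comm (# ((U ∩ g u ∩ g v) ∩ I)) _)))
              (+-mono-≤ (#-mono move) (≤-trans (#-mono {A = (U ∩ g u ∩ g v) ∩ I} {B = U ∩ I} (λ x p → ∧-intro (∧-elimˡ {U x} (∧-elimˡ {U x ∧ g u x} (∧-elimˡ {(U x ∧ g u x) ∧ g v x} p))) (∧-elimʳ {(U x ∧ g u x) ∧ g v x} p))) (#-img (dom st) (φ st) U))))) usedU≤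
              where
              move : ((U ∩ g u ∩ g v) ∖ I) ⊆ (U′ ∩ g u ∩ g v)
              move x p = ∧-intro (∧-intro (∧-intro (∧-elimˡ {U x} (∧-elimˡ {U x ∧ g u x} p₁)) (∧-elimʳ {(U x ∧ g u x) ∧ g v x} p)) (∧-elimʳ {U x} (∧-elimˡ {U x ∧ g u x} p₁))) (∧-elimʳ {U x ∧ g u x} p₁)
                where
                p₁ : (U x ∧ g u x) ∧ g v x ≡ true
                p₁ = ∧-elimˡ p

          U′-half : # U ≤ 2 * # U′
          U′-half = halve {# U} {# U′} (∖-used U) (≤-trans usedU≤ t₀≤U)
            where
            t₀≤U : t₀ ≤ # U
            t₀≤U = ≤-trans (U-codeg v₀ v₀) (#-mono (λ x p → ∧-elimˡ {U x} (∧-elimˡ {U x ∧ g v₀ x} p)))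
              where
              v₀ : Fin n
              v₀ = Data.Fin.fromℕ< 0<n

          nR : n ≤ s₂ * 2 * # R′
          nR = scale-trans s₂ 2 (part-size zero) R′-half

          nU : n ≤ sU * 2 * # U′
          nU = scale-trans sU 2 hsU U′-half

          sL : ℕ
          sL = 2 * s₂ * sU

          s₂2≤ : s₂ * 2 ≤ sL
          s₂2≤ = ≤-trans (≤-reflexive (*-comm s₂ 2)) (≤-*ʳ (2 * s₂) 1≤sU)

          sU2≤ : sU * 2 ≤ sL
          sU2≤ = ≤-trans (≤-*ˡ (sU * 2) 1≤s₂) (≤-reflexive (eq s₂ sU))
            where
            eq : ∀ a b → a * (b * 2) ≡ 2 * a * b
            eq = solve-∀

          links : Links g k E (2 * Qlink D (2 * e₁) k) (ν E (Qlink D (2 * e₁) k)) R′ U′ (Hub.part Q zero)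
          links = links-exist gs ld 0<n 1≤D k E 1≤E R′ U′ (Hub.part Q zero) (2 * e₁) sL (1≤* {2} (s≤s z≤n) 1≤e₁)
            (≤-trans nR (*-monoˡ-≤ (# R′) s₂2≤)) (≤-trans nU (*-monoˡ-≤ (# U′) sU2≤)) (≤-trans (Q-large zero) (*-monoˡ-≤ (# (Hub.part Q zero)) (≤-trans (≤-*ʳ {2} s₂ (s≤s z≤n)) s₂2≤)))
            (λ t v _ _ → U′-codeg t v) hσ₂

          module WithLinks (L : Links g k E q νl R′ U′ (Hub.part Q zero)) where

            open Links L

            two-Eℓ : ∀ {c x} → n ≤ c * 2 * x → c ≤ s₂ * sU * νl → E * ℓ ≤ x
            two-Eℓ {c} {x} p hc = *-cancelˡ-≤ 2 (≤-trans (≤-reflexive (eq E ℓ)) (room-le {c} (E * (ℓ + ℓ)) (≤-trans p (≤-reflexive (*-assoc c 2 x))) hc ≤-refl))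
              where
              eq : ∀ E l → 2 * (E * l) ≡ E * (l + l)
              eq = solve-∀

            s₂ν : s₂ * νl ≤ s₂ * sU * νl
            s₂ν = *-monoˡ-≤ νl (≤-*ʳ s₂ 1≤sU)

            sUν : sU * νl ≤ s₂ * sU * νl
            sUν = *-monoˡ-≤ νl (≤-*ˡ sU 1≤s₂)

            swap₂ : ∀ {s x y} → n ≤ s * 2 * x → x ≤ νl * y → n ≤ s * νl * 2 * y
            swap₂ {s} {x} {y} p r = ≤-trans (scale-trans (s * 2) νl p r) (≤-reflexive (eq s νl y))
              where
              eq : ∀ s v y → s * 2 * v * y ≡ s * v * 2 * y
              eq = solve-∀

            roomR : ∀ i → E * ℓ ≤ # (rs i)
            roomR i = two-Eℓ {s₂ * νl} (swap₂ {s₂} {# R′} nR (rs-size i)) s₂ν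

            roomU : ∀ i → E * ℓ ≤ # (us i)
            roomU i = two-Eℓ {sU * νl} (swap₂ {sU} {# U′} nU (us-size i)) sUν

            roomB : ∀ i → E * ℓ ≤ # (bs i)
            roomB i = room-le {s₂ * νl} (E * ℓ) (scale-trans s₂ νl (Q-large zero) (bs-size i)) s₂ν Eℓ≤

            roomQ : ∀ i → E * ℓ ≤ # (Hub.part Q (suc i))
            roomQ i = room-le {s₂} (E * ℓ) (Q-large (suc i)) s₂≤ Eℓ≤

            dom<a : ∀ v → v ∈ dom st → toℕ v < a
            dom<a v p = proj₁ (dom-in v p)

            -- An unembedded vertex before `a` belongs to `Y`, which ends more than `b` positions
            -- before `aY`. Hence it has no neighbour in the interval to be embedded.
            out : ∀ v → dom st v ≡ false → a ≤ toℕ v ⊎ toℕ v + b < a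
            out v p with a ≤? toℕ v
            ... | yes r = inj₁ r
            ... | no r with true? (Y v)
            ... | yes y = inj₂ (≤-trans (Y-low v y) aY≤a)
            ... | no y = ⊥-elim (true≢false (dom-all v (≰⇒> r) (¬true y)) p)

            travels : 4 * b ≤ ℓ → Travelled st Y a ℓ Q U
            travels long = Route.travelled P Q L 2 (λ x → ∧-elimˡ) (λ x p → p) R′-half (m≤m+n (# (Hub.part Q zero)) _) hEh st a dom<a S-hub out ℓ 1≤E Y (λ i → roomP (suc i))
              (λ x p → not-elim (∧-elimʳ {part zero x} p)) (λ x p → not-elim (∧-elimʳ {U x} p)) (λ x p → Q-I zero x p) Q-I roomR roomU roomB roomQ U part-avoid Q-U long

        module Finish (Q : Hub g k Eh q) (Q-U : ∀ i x → x ∈ Hub.part Q i → U x ≡ false) (Q-I : ∀ i x → x ∈ Hub.part Q i → I x ≡ false)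
          (Q-large : ∀ i → n ≤ s₂ * # (Hub.part Q i)) (tr : Travelled st Y a ℓ Q U) where

          open Travelled tr

          used′ : ∀ Z → used st′ Z ≤ used st Z + ℓ
          used′ Z = ≤-trans (#-mono sub) (≤-trans (#-∪ (λ v → dom st v ∧ Z (φ st v)) (range a ℓ)) (+-monoʳ-≤ (used st Z) (#-range≤ a ℓ)))
            where
            sub : (λ v → dom st′ v ∧ Z (φ st′ v)) ⊆ (λ v → (dom st v ∧ Z (φ st v)) ∨ range a ℓ v)
            sub v p with new v (∧-elimˡ p)
            ... | inj₁ d = ∨-introˡ _ (∧-intro d (subst (_∈ Z) (φ≡ ext v d) (∧-elimʳ {dom st′ v} p)))
            ... | inj₂ (v∈ , _) = ∨-introʳ (dom st v ∧ Z (φ st v)) v∈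

          usedU′ : used st′ U ≤ suc j * b
          usedU′ = ≤-trans (#-mono sub) (≤-trans (#-∪ (λ v → dom st v ∧ U (φ st v)) (range (a + 2 * b) b)) (≤-trans (+-mono-≤ usedU (#-range≤ (a + 2 * b) b)) (≤-reflexive (+-comm (j * b) b))))
            where
            sub : (λ v → dom st′ v ∧ U (φ st′ v)) ⊆ (λ v → (dom st v ∧ U (φ st v)) ∨ range (a + 2 * b) b v)
            sub v p with new v (∧-elimˡ p)
            ... | inj₁ d = ∨-introˡ _ (∧-intro d (subst (_∈ U) (φ≡ ext v d) (∧-elimʳ {dom st′ v} p)))
            ... | inj₂ (v∈ , _ , inS) = ∨-introʳ (dom st v ∧ U (φ st v)) (through v (φ st′ v) (range-lo a ℓ v v∈) inS (∧-elimʳ {dom st′ v} p))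

          unusedQ : ∀ i → used st (Hub.part Q i) ≡ 0
          unusedQ i = #-none (λ v → ¬true (λ p → true≢false (img-intro {dom = dom st} {φ st} v (∧-elimˡ p)) (Q-I i (φ st v) (∧-elimʳ {dom st v} p))))

          dom-in′ : ∀ v → v ∈ dom st′ → toℕ v < a + ℓ × Y v ≡ false
          dom-in′ v p with new v p
          ... | inj₁ d = ≤-trans (proj₁ (dom-in v d)) (m≤m+n a ℓ) , proj₂ (dom-in v d)
          ... | inj₂ (v∈ , y , _) = range-hi a ℓ v v∈ , y

          dom-all′ : ∀ v → toℕ v < a + ℓ → Y v ≡ false → v ∈ dom st′
          dom-all′ v p y with a ≤? toℕ v
          ... | yes r = done v (range-intro a ℓ v r p) y
          ... | no r = dom⊆ ext v (dom-all v (≰⇒> r) y)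

          next : Stage (suc j) (a + ℓ)
          next = record
            { S = S′ ; st = st′ ; P = Q ; part-size = Q-large ; part-avoid = Q-U ; S-hub = arrived ; dom-in = dom-in′ ; dom-all = dom-all′
            -- At most `ℓ` vertices enter the new hub during this stage, and room for `ℓ` more is
            -- kept for the next one. This is the origin of `ℓ + ℓ` in `hℓ`.
            ; roomP = λ i → ≤-trans (*-monoʳ-≤ E (+-monoˡ-≤ ℓ (≤-trans (used′ (Hub.part Q i)) (≤-reflexive (cong (_+ ℓ) (unusedQ i)))))) (room-le {s₂} (E * (ℓ + ℓ)) (Q-large i) s₂≤ ≤-refl)
            ; usedU = usedU′ ; origin = ⟶-trans origin ext ; aY≤a = ≤-trans aY≤a (m≤m+n a ℓ) }

      module _ (long : 4 * b ≤ ℓ) where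

        opaque
          next-stage : ∀ j a → j ≤ N → Stage j a → Stage (suc j) (a + ℓ)
          next-stage j a j≤N now = Next.Finish.next j a j≤N now Q (Next.WithHub.Q-U j a j≤N now Q Q⊆F Q-size) (Next.WithHub.Q-I j a j≤N now Q Q⊆F Q-size)
              (Next.WithHub.Q-large j a j≤N now Q Q⊆F Q-size) (Next.WithHub.WithLinks.travels j a j≤N now Q Q⊆F Q-size L long)
            where
            found : Σ (Hub g k Eh (2 * Qc D (suc k))) λ P → (∀ i → Hub.part P i ⊆ Next.F j a j≤N now) × (∀ i → # (Next.F j a j≤N now) ≤ ν Eh (Qc D (suc k)) * # (Hub.part P i))
            found = Next.found j a j≤N now
            Q : Hub g k Eh q
            Q = Hub-weaken hq₁ (proj₁ found)
            Q⊆F : ∀ i → Hub.part Q i ⊆ Next.F j a j≤N now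
            Q⊆F = proj₁ (proj₂ found)
            Q-size : ∀ i → # (Next.F j a j≤N now) ≤ νh * # (Hub.part Q i)
            Q-size i = subst (λ ν → # (Next.F j a j≤N now) ≤ ν * # (Hub.part Q i)) (sym νh-def) (proj₂ (proj₂ found) i)
            L : Links g k E q νl (Next.WithHub.R′ j a j≤N now Q Q⊆F Q-size) (Next.WithHub.U′ j a j≤N now Q Q⊆F Q-size) (Hub.part Q zero)
            L = subst (λ ν → Links g k E q ν (Next.WithHub.R′ j a j≤N now Q Q⊆F Q-size) (Next.WithHub.U′ j a j≤N now Q Q⊆F Q-size) (Hub.part Q zero)) (sym νl-def) (Links-weaken hq₂ (Next.WithHub.links j a j≤N now Q Q⊆F Q-size))

        run-stages : ∀ m j a → j + m ≤ suc N → Stage j a → Stage (j + m) (a + m * ℓ)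
        run-stages zero j a _ now = subst₂ Stage (sym (+-identityʳ j)) (sym (+-identityʳ a)) now
        run-stages (suc m) j a h now = subst₂ Stage (sym (+-suc j m)) (+-assoc a ℓ (m * ℓ)) (run-stages m (suc j) (a + ℓ) (≤-trans (≤-reflexive (sym (+-suc j m))) h) (next-stage j a (≤-pred (≤-trans (≤-trans (s≤s (m≤m+n j m)) (≤-reflexive (sym (+-suc j m)))) h)) now))

  -- Lengths, choices and the complete embedding

  record Input : Set where
    no-eta-equality
    field
      D e : ℕ
      K : Constants Δ D e k q E
      ld : LocallyDense g (Constants.σ K) D
      codeg : ∀ u v → n ≤ e * # (g u ∩ g v)
      b : ℕ
      b≢0 : NonZero b
      band : ∀ x v → v ∈ h x → toℕ v ≤ toℕ x + b
      b-small : Constants.b₀ K * b ≤ n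
      0<n : 0 < n
      n₀≤n : Constants.n₀ K ≤ n

  module Assembly (input : Input) where

    open Input input

    open Constants K using (TU; νl; νh; κ; Eh; h₁; γ; x₀; p; y₀; τ; u₀; s₂; L₀; e₁; 1≤D; 1≤e; hk; TU-def; hq₁; hq₂; νl-def; νh-def; 1≤νl; hEh; E≤Eh; hκEh; hκ; h₁-def; 1≤h₁; 4e≤h₁; γ-def; h₁≤γ; hx₁; hx₂; p-def; hy; hy′; τ-def; hu₁; hu₂; hu₃; hu₄; s₂-def; h₁≤s₂; hL₁; hL₂; hb₁; hb₂; hb₃; hb₄; hσ₀; hσB; hσ₁; hσ₂; 1≤x₀; 1≤y₀; 1≤u₀; 1≤L₀; hn₁; hn₂; hn₃; hn₄; hn₅)

    Copy : Set
    Copy = Σ (Fin n → Fin n) λ f → (∀ v w → f v ≡ f w → v ≡ w) × (∀ v w → w ∈ h v → f w ∈ g (f v))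

    1≤k : 1 ≤ k
    1≤k = ≤-trans (s≤s z≤n) hk

    1≤E : 1 ≤ E
    1≤E = ≤-trans (1≤* {2 + Δ} (s≤s z≤n) (^-≥1 q (k + Δ) 1≤q)) hE

    -- `L₁` is the size of the region of `G` that contains the first hub, `LY` and `LX` are the
    -- lengths of the intervals of `H` for `Y` and for the absorbers, `t₀` is the codegree into the
    -- reservoir, and `ℓ` is the length of a stage.
    record Sizes : Set where
      no-eta-equality
      field
        L₁ LX LY t₀ ℓ : ℕ
        L₁-lo : 4 * e * L₁ ≤ n
        L₁-hi : n ≤ 2 * (4 * e) * L₁
        LX-lo : x₀ * LX ≤ n
        LX-hi : n ≤ 2 * x₀ * LX
        1≤LX : 1 ≤ LX
        LY-lo : y₀ * LY ≤ n
        LY-hi : n ≤ 2 * y₀ * LY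
        t₀-lo : u₀ * t₀ ≤ n
        t₀-hi : n ≤ 2 * u₀ * t₀
        t₀-exp : n * n ≤ 2 ^ t₀
        ℓ-lo : L₀ * ℓ ≤ n
        ℓ-hi : n ≤ 2 * L₀ * ℓ

    module Lengths (sizes : Sizes) where

      open Sizes sizes

      one : ∀ {x y} → 1 * x ≤ y → x ≤ y
      one {x} p = ≤-trans (≤-reflexive (sym (*-identityˡ x))) p

      LY≤LX : LY ≤ LX
      LY≤LX = one (ratio x₀ 1 1≤x₀ hy′ LY-lo LX-hi)

      ℓ≤LX : ℓ ≤ LX
      ℓ≤LX = one (ratio x₀ 1 1≤x₀ hL₂ ℓ-lo LX-hi)

      UX : 2 * TU * t₀ ≤ LX
      UX = ratio x₀ (2 * TU) 1≤x₀ hu₃ t₀-lo LX-hi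

      UY : 8 * k * TU * t₀ ≤ LY
      UY = ratio y₀ (8 * k * TU) 1≤y₀ hu₁ t₀-lo LY-hi

      UL₁ : 4 * TU * t₀ ≤ L₁
      UL₁ = ratio (4 * e) (4 * TU) (1≤* {4} (s≤s z≤n) 1≤e) hu₂ t₀-lo L₁-hi

      XY : 4 * k * (p + suc p) * LY ≤ LX
      XY = ratio x₀ (4 * k * (p + suc p)) 1≤x₀ hy LY-lo LX-hi

      bt : 4 * L₀ * b ≤ t₀
      bt = ratio u₀ (4 * L₀) 1≤u₀ hb₁ b-small t₀-hi

      bℓ : 4 * b ≤ ℓ
      bℓ = ratio L₀ 4 1≤L₀ hb₂ b-small ℓ-hi

      bX : 20 * b ≤ LX
      bX = ratio x₀ 20 1≤x₀ hb₃ b-small LX-hi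

      bY : 2 * b ≤ LY
      bY = ratio y₀ 2 1≤y₀ hb₄ b-small LY-hi

      1≤TU : 1 ≤ TU
      1≤TU = subst (1 ≤_) (sym TU-def) (≤-trans (s≤s z≤n) (m≤n+m (suc (2 * e)) (2 * e)))

      t₀≤LY : t₀ ≤ LY
      t₀≤LY = ≤-trans (≤-*ˡ {8 * k * TU} t₀ (1≤* {8 * k} {TU} (1≤* {8} {k} (s≤s z≤n) 1≤k) 1≤TU)) UY

      -- The vertices occupied while balls are placed, at most `LY + LX`, and the reservoir, which
      -- the balls must avoid.
      f : ℕ
      f = LY + LX + 2 * TU * t₀

      f-small : 4 * γ * suc f ≤ n
      f-small = ≤-trans (*-monoʳ-≤ (4 * γ) (≤-trans (+-mono-≤ 1≤LX (+-mono-≤ (+-monoˡ-≤ LX LY≤LX) UX)) (≤-reflexive (eq LX)))) (≤-trans (≤-reflexive (eq′ γ LX)) (≤-trans (*-monoˡ-≤ LX hx₁) LX-lo))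
        where
        eq : ∀ x → x + (x + x + x) ≡ 4 * x
        eq = solve-∀
        eq′ : ∀ c x → 4 * c * (4 * x) ≡ 16 * c * x
        eq′ = solve-∀
      hub-room : ∀ {x} r → n ≤ h₁ * x → r ≤ LX + LX + LX → E * r ≤ x
      hub-room {x} r p hr = room-of {n} {h₁} 0<n p (≤-trans (*-monoʳ-≤ h₁ (*-monoʳ-≤ E (≤-trans hr (≤-trans (m≤m+n _ LX) (≤-reflexive (eq LX)))))) (≤-trans (≤-reflexive (eq′ h₁ E LX)) (≤-trans (*-monoˡ-≤ LX hx₂) LX-lo)))
        where
        eq : ∀ x → x + x + x + x ≡ 4 * x
        eq = solve-∀
        eq′ : ∀ h E x → h * (E * (4 * x)) ≡ 4 * h * E * x
        eq′ = solve-∀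

      record Choice : Set where
        no-eta-equality
        field
          χ : Fin n → Fin k
          χ-dist : ∀ v w → w ∈ near 8 v → χ v ≡ χ w → v ≡ w
          U : Sub n
          #U : # U ≡ 2 * TU * t₀
          U-codeg : ∀ u v → t₀ ≤ # (U ∩ g u ∩ g v)
          P : Hub g k Eh q
          P⊆ : ∀ i → Hub.part P i ⊆ (below L₁ ∖ U)
          P-large : ∀ i → n ≤ h₁ * # (Hub.part P i)
          c₁ c₂ : Fin k
          popY : # (range {n} 0 (LY ∸ b)) ≤ k * # (range 0 (LY ∸ b) ∩ (λ v → χ v ≡ᶠ c₁))
          popX : # (range {n} (LY + 5 * b) (LX ∸ 10 * b)) ≤ k * # (range (LY + 5 * b) (LX ∸ 10 * b) ∩ (λ v → χ v ≡ᶠ c₂))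
          LX+LY≤n : LY + LX ≤ n

      module Choices (choice : Choice) where

        open Choice choice

        open Hub P

        S₁ : Fin n → Sub n
        S₁ v = part (suc (χ v))

        -- The margins keep the neighbours of `Y` before position `LY`, and everything within
        -- distance 5 of `X` inside the interval of length `LX` after it. A single colour class
        -- makes the vertices pairwise far apart, and the most popular colour keeps the sets linear.
        X Y : Sub n
        Y = range 0 (LY ∸ b) ∩ (λ v → χ v ≡ᶠ c₁)
        X = range (LY + 5 * b) (LX ∸ 10 * b) ∩ (λ v → χ v ≡ᶠ c₂)

        χ-proper : ∀ v w → w ∈ h v → ¬ χ v ≡ χ w
        χ-proper v w e c = true≢false (subst (λ w → w ∈ h v) (sym (χ-dist v w (near-mono {1} {8} v w (s≤s z≤n) (near-step 0 v v w (near-refl 0 v) e)) c)) e) (hi v)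

        Y-colour : ∀ y → y ∈ Y → χ y ≡ c₁
        Y-colour y p = ≡ᶠ-sound (∧-elimʳ {range 0 (LY ∸ b) y} p)

        X-colour : ∀ x → x ∈ X → χ x ≡ c₂
        X-colour x p = ≡ᶠ-sound (∧-elimʳ {range (LY + 5 * b) (LX ∸ 10 * b) x} p)

        Y-low : ∀ y → y ∈ Y → toℕ y + b < LY
        Y-low y p = <-≤-trans (+-monoˡ-< b (range-hi 0 (LY ∸ b) y (∧-elimˡ {range 0 (LY ∸ b) y} p))) (≤-reflexive (m∸n+n≡m (≤-trans (m≤m+n b _) bY)))

        X-lo : ∀ x → x ∈ X → LY + 5 * b ≤ toℕ x
        X-lo x p = range-lo (LY + 5 * b) (LX ∸ 10 * b) x (∧-elimˡ {range (LY + 5 * b) (LX ∸ 10 * b) x} p)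

        10b≤LX : 10 * b ≤ LX
        10b≤LX = ≤-trans (*-monoˡ-≤ b {10} {20} (m≤m+n 10 10)) bX

        X-hi : ∀ x → x ∈ X → toℕ x + 5 * b < LY + LX
        X-hi x p = <-≤-trans (+-monoˡ-< (5 * b) (range-hi (LY + 5 * b) (LX ∸ 10 * b) x (∧-elimˡ {range (LY + 5 * b) (LX ∸ 10 * b) x} p))) (≤-reflexive (trans (eq LY b (LX ∸ 10 * b)) (cong (LY +_) (m∸n+n≡m 10b≤LX))))
          where
          eq : ∀ l b x → l + 5 * b + x + 5 * b ≡ l + (x + 10 * b)
          eq = solve-∀

        ¬Y : ∀ v → LY ≤ toℕ v → Y v ≡ false
        ¬Y v p = ¬true (λ y → <⇒≱ (≤-<-trans (m≤m+n (toℕ v) b) (Y-low v y)) p)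

        near-X-lo : ∀ x v → x ∈ X → v ∈ near 5 x → LY ≤ toℕ v
        near-X-lo x v p r = +-cancelʳ-≤ (5 * b) LY (toℕ v) (≤-trans (X-lo x p) (near-band b band 5 v x (near-sym′ 5 x v r)))

        near-X-hi : ∀ x v → x ∈ X → v ∈ near 5 x → toℕ v < LY + LX
        near-X-hi x v p r = ≤-<-trans (near-band b band 5 x v r) (X-hi x p)

        3⇒5 : ∀ x v → v ∈ near 3 x → v ∈ near 5 x
        3⇒5 x v = near-mono {3} {5} x v (s≤s (s≤s (s≤s z≤n)))

        X-nbr : ∀ x v → x ∈ X → v ∈ h x → X v ≡ false × Y v ≡ false
        X-nbr x v p e = ¬true (λ r → χ-proper x v e (trans (X-colour x p) (sym (X-colour v r)))) , ¬Y v (near-X-lo x v p (near-mono {1} {5} x v (s≤s z≤n) (near-step 0 x x v (near-refl 0 x) e)))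

        Y-nbr-low : ∀ y v → y ∈ Y → v ∈ h y → toℕ v < LY
        Y-nbr-low y v p e = ≤-<-trans (band y v e) (Y-low y p)

        Y-nbr : ∀ y v → y ∈ Y → v ∈ h y → X v ≡ false × Y v ≡ false
        Y-nbr y v p e = ¬true (λ r → <⇒≱ (Y-nbr-low y v p e) (≤-trans (m≤m+n LY (5 * b)) (X-lo v r))) , ¬true (λ r → χ-proper y v e (trans (Y-colour y p) (sym (Y-colour v r))))

        X-Y : ∀ x → x ∈ X → Y x ≡ false
        X-Y x p = ¬Y x (≤-trans (m≤m+n LY (5 * b)) (X-lo x p))

        #Y≤ : # Y ≤ LY
        #Y≤ = ≤-trans (#-mono {A = Y} {B = range 0 (LY ∸ b)} (λ x → ∧-elimˡ)) (≤-trans (#-range≤ 0 (LY ∸ b)) (m∸n≤m LY b))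

        Y-large : LY ≤ 2 * k * # Y
        Y-large = ≤-trans (half-∸ {LY} {b} bY) (≤-trans (*-monoʳ-≤ 2 (≤-trans (≤-reflexive (sym (#-range 0 (LY ∸ b) (≤-trans (m∸n≤m LY b) (≤-trans (m≤m+n LY LX) LX+LY≤n))))) popY)) (≤-reflexive (sym (*-assoc 2 k (# Y)))))

        X-large : LX ≤ 2 * k * # X
        X-large = ≤-trans (half-∸ {LX} {10 * b} (≤-trans (≤-reflexive (eq b)) bX)) (≤-trans (*-monoʳ-≤ 2 (≤-trans (≤-reflexive (sym (#-range (LY + 5 * b) (LX ∸ 10 * b) fits))) popX)) (≤-reflexive (sym (*-assoc 2 k (# X)))))
          where
          eq : ∀ b → 2 * (10 * b) ≡ 20 * b
          eq = solve-∀
          eq′ : ∀ l b x → l + 5 * b + x + 5 * b ≡ l + (x + 10 * b)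
          eq′ = solve-∀
          fits : LY + 5 * b + (LX ∸ 10 * b) ≤ n
          fits = ≤-trans (m≤m+n _ (5 * b)) (≤-trans (≤-reflexive (trans (eq′ LY b (LX ∸ 10 * b)) (cong (LY +_) (m∸n+n≡m 10b≤LX)))) LX+LY≤n)

        hτ : n ≤ τ * # Y
        hτ = ≤-trans (scale-trans (2 * y₀) (2 * k) LY-hi Y-large) (≤-reflexive (cong (_* # Y) (trans (eq y₀ k) (sym τ-def))))
          where
          eq : ∀ y k → 2 * y * (2 * k) ≡ 4 * k * y
          eq = solve-∀

        2U≤Y : 2 * # U ≤ # Y
        2U≤Y = *-cancelˡ-≤ (2 * k) {{>-nonZero (1≤* {2} (s≤s z≤n) 1≤k)}} (≤-trans (≤-reflexive (trans (cong (λ u → 2 * k * (2 * u)) #U) (eq k TU t₀))) (≤-trans UY Y-large))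
          where
          eq : ∀ k T t → 2 * k * (2 * (2 * T * t)) ≡ 8 * k * T * t
          eq = solve-∀

        X-enough : (p + suc p) * (LY + t₀) ≤ # X
        X-enough = *-cancelˡ-≤ (2 * k) {{>-nonZero (1≤* {2} (s≤s z≤n) 1≤k)}} (≤-trans (*-monoʳ-≤ (2 * k) (*-monoʳ-≤ (p + suc p) (+-monoʳ-≤ LY t₀≤LY))) (≤-trans (≤-reflexive (eq k (p + suc p) LY)) (≤-trans XY X-large)))
          where
          eq : ∀ k T y → 2 * k * (T * (y + y)) ≡ 4 * k * T * y
          eq = solve-∀

        part-U : ∀ i x → x ∈ part i → U x ≡ false
        part-U i x r = not-elim (∧-elimʳ {below L₁ x} (P⊆ i x r))

        S₁-bd : ∀ v w → w ∈ h v → BiDense g E q (S₁ v) (S₁ w)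
        S₁-bd v w e = BiDense-⊆ {g = g} {Eh} {E} {q} {q} 1 1 (bd (suc (χ v)) (suc (χ w)) (λ c → χ-proper v w e (Finₚ.suc-injective c))) (λ _ r → r) (λ _ r → r) same same 1E 1E ≤-refl
          where
          same : ∀ {A : Sub n} → # A ≤ 1 * # A
          same = ≤-reflexive (sym (*-identityˡ _))
          1E : 1 * E ≤ Eh
          1E = ≤-trans (≤-reflexive (*-identityˡ E)) E≤Eh

        start : State S₁
        start = record { dom = λ _ → false ; φ = λ v → v ; C = S₁ ; inj = λ _ _ () ; hom = λ _ _ () ; C⊆ = λ _ _ _ r → r ; C-adj = λ _ _ _ _ _ () ; C-big = λ v _ → ≤-*ˡ _ (^-≥1 q (k + # (h v ∩ (λ _ → false))) 1≤q) }

        embed-Y : Embedded Y 0 LY start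
        embed-Y = embed-range Y LY 0 start (λ v w _ _ _ _ e → S₁-bd v w e) (λ v _ _ _ → hub-room (used start (S₁ v) + LY) (P-large (suc (χ v))) (≤-trans (≤-reflexive (cong (_+ LY) (#-none {n} (λ _ → refl)))) (≤-trans LY≤LX (≤-trans (m≤m+n LX LX) (m≤m+n (LX + LX) LX))))) 1≤E

        module AfterY (eY : Embedded Y 0 LY start) where

          module EY = Embedded eY

          stY : State S₁
          stY = EY.st′

          domY-low : ∀ v → v ∈ dom stY → toℕ v < LY × Y v ≡ false × φ stY v ∈ S₁ v
          domY-low v d with EY.new v d
          ... | inj₂ (r , y , _ , s) = range-hi 0 LY v r , y , s

          domY-all : ∀ v → toℕ v < LY → Y v ≡ false → v ∈ dom stY
          domY-all v r y = EY.done v (range-intro 0 LY v z≤n r) y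

          y∉ : ∀ y → y ∈ Y → dom stY y ≡ false
          y∉ y r = ¬true (λ d → true≢false r (proj₁ (proj₂ (domY-low y d))))

          -- Selection serves all pairs of vertices, so for `y` outside `Y` the condition on the
          -- centre is made void. For `y` in `Y` the set `C stY y` is final, since all neighbours of
          -- `y` are embedded by now.
          W : Fin n → Sub n
          W y = if Y y then C stY y else (λ _ → true)

          sW = 2 * γ

          γf : 2 * γ * f ≤ n
          γf = ≤-trans (*-mono-≤ (*-monoˡ-≤ γ {2} {4} (s≤s (s≤s z≤n))) (n≤1+n f)) f-small

          1≤γ : 1 ≤ γ
          1≤γ = ≤-trans 1≤h₁ h₁≤γ

          W-arith : ∀ {w} → n ≤ γ * w → n + sW * f ≤ sW * w
          W-arith {w} r = ≤-trans (+-mono-≤ r (≤-trans γf r)) (≤-reflexive (eq γ w))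
            where
            eq : ∀ c w → c * w + c * w ≡ 2 * c * w
            eq = solve-∀

          hW : ∀ y → n + sW * f ≤ sW * # (W y)
          hW y with true? (Y y)
          ... | yes r = W-arith {# (W y)} (≤-trans (P-large (suc (χ y))) (≤-trans (*-monoʳ-≤ h₁ big) (≤-reflexive (trans (sym (*-assoc h₁ (q ^ (k + Δ)) _)) (cong₂ (λ c A → c * # A) (sym γ-def) (sym (if-true r)))))))
            where
            big : # (S₁ y) ≤ q ^ (k + Δ) * # (C stY y)
            big = ≤-trans (C-big stY y (y∉ y r)) (*-monoˡ-≤ (# (C stY y)) (^-monoʳ q 1≤q (+-monoʳ-≤ k (≤-trans (#-mono (λ x → ∧-elimˡ)) (deg y)))))
          ... | no r = W-arith {# (W y)} (≤-trans (≤-*ˡ n 1≤γ) (≤-reflexive (cong (γ *_) (trans (sym (#-full n)) (cong #_ (sym (if-false (¬true r))))))))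

          few : FewAtypical g q E κ (part zero) (λ c → part (suc c))
          few = hub-fewAtypical P E κ E≤Eh hκEh

          2e≤ : 2 * e ≤ 2 * e₁
          2e≤ = *-monoʳ-≤ 2 (≤-trans (≤-trans (m≤m+n e _) (≤-trans (m≤m+n (2 * e) _) (≤-reflexive (sym TU-def)))) (m≤m+n TU _))

          hF : 4 * e * suc f ≤ n
          hF = ≤-trans (*-monoˡ-≤ (suc f) (≤-trans 4e≤h₁ (≤-trans h₁≤γ (≤-*ˡ {4} γ (s≤s z≤n))))) f-small

          hFB : 2 * suc f ≤ # (part zero)
          hFB = room-of {n} {h₁} 0<n (P-large zero) (≤-trans (≤-reflexive (eq h₁ (suc f))) (≤-trans (*-monoˡ-≤ (suc f) (*-mono-≤ {2} {4} (s≤s (s≤s z≤n)) h₁≤γ)) f-small))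
            where
            eq : ∀ h f → h * (2 * f) ≡ 2 * h * f
            eq = solve-∀

          hB : 4 * e * # (part zero) ≤ n
          hB = ≤-trans (*-monoʳ-≤ (4 * e) (≤-trans (#-mono (λ x r → ∧-elimˡ {below L₁ x} (P⊆ zero x r))) (#-below≤ L₁))) L₁-lo

          D₀ : Sub n
          D₀ = below (LY + LX)

          D₀-intro : ∀ v → toℕ v < LY + LX → v ∈ D₀
          D₀-intro v = ≤?ᵇ-complete

          Abs : Set
          Abs = Balls.Absorbers χ χ-dist (λ c → part (suc c)) (part zero) stY X U W LY

          ball-data : Balls.BallData χ χ-dist (λ c → part (suc c)) (part zero)
          ball-data = record
            { st₀ = stY ; X = X ; D₀ = D₀ ; Res = U ; W = W ; c₀ = c₂ ; X-colour = X-colour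
            ; X-free = λ x v p r → ¬true (λ d → <⇒≱ (proj₁ (domY-low v d)) (near-X-lo x v p r))
            ; dom⊆D₀ = λ v d → D₀-intro v (≤-trans (proj₁ (domY-low v d)) (m≤m+n LY LX))
            ; X⊆D₀ = λ x v p r → D₀-intro v (near-X-hi x v p (3⇒5 x v r))
            ; f = f ; hf = +-mono-≤ (#-below≤ (LY + LX)) (≤-reflexive #U) ; σ = Constants.σ K ; D = D ; ld = ld ; 0<n = 0<n ; 1≤D = 1≤D ; E₁ = E ; κ = κ ; few = few
            ; e = e ; e′ = 2 * e₁ ; sB = h₁ ; sW = sW ; 1≤e = 1≤e ; 1≤sB = 1≤h₁ ; 2e≤e′ = 2e≤ ; codeg = codeg ; hF = hF ; hB = hB ; hFB = hFB ; hsB = P-large zero ; hW = hW ; hσ = hσB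
            ; hE₁ = ≤-trans (≤-trans (^-monoʳ q 1≤q (m≤m+n k Δ)) (≤-*ˡ {2 + Δ} _ (s≤s z≤n))) hE ; hκ = hκ }

          -- `LY` absorbers for each pair suffice, because `# Y` is at most `LY`; another `t₀` hits
          -- pay for the number of pairs.
          absorbers-exist : Abs
          absorbers-exist = Balls.BallStage.absorbers χ χ-dist (λ c → part (suc c)) (part zero) ball-data LY t₀ (subst (λ p → (p + suc p) * (LY + t₀) ≤ # X) p-def X-enough) t₀-exp

          module AfterX (ab : Abs) where

            module AB = Balls.Absorbers ab

            stA : State S₁
            stA = AB.st

            domA-low : ∀ v → v ∈ dom stA → toℕ v < LY + LX × Y v ≡ false
            domA-low v d with AB.dom-new v d
            ... | inj₁ r = ≤-trans (proj₁ (domY-low v r)) (m≤m+n LY LX) , proj₁ (proj₂ (domY-low v r))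
            ... | inj₂ (x , p , r) = near-X-hi x v p (3⇒5 x v r) , ¬Y v (near-X-lo x v p (3⇒5 x v r))

            used-le : ∀ {S} (st : State S) → (∀ v → v ∈ dom st → toℕ v < LY + LX) → ∀ Z → used st Z ≤ LY + LX
            used-le st low Z = ≤-trans (#-mono {B = D₀} (λ v r → D₀-intro v (low v (∧-elimˡ r)))) (#-below≤ (LY + LX))

            embed-X : Embedded Y LY LX stA
            embed-X = embed-range Y LX LY stA (λ v w _ _ _ _ e → S₁-bd v w e)
              (λ v _ _ _ → hub-room (used stA (S₁ v) + LX) (P-large (suc (χ v))) (+-monoˡ-≤ LX (≤-trans (used-le stA (λ v d → proj₁ (domA-low v d)) (S₁ v)) (+-monoˡ-≤ LX LY≤LX)))) 1≤E

            module AfterAll (eX : Embedded Y LY LX stA) where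

              module EX = Embedded eX

              stX : State S₁
              stX = EX.st′

              domX-in : ∀ v → v ∈ dom stX → toℕ v < LY + LX × Y v ≡ false
              domX-in v d with EX.new v d
              ... | inj₁ r = domA-low v r
              ... | inj₂ (r , y , _) = range-hi LY LX v r , y

              domX-all : ∀ v → toℕ v < LY + LX → Y v ≡ false → v ∈ dom stX
              domX-all v r y with LY ≤? toℕ v
              ... | yes z = EX.done v (range-intro LY LX v z r) y
              ... | no z = dom⊆ EX.ext v (dom⊆ AB.ext v (domY-all v (≰⇒> z) y))

              avoids : ∀ v → v ∈ dom stX → U (φ stX v) ≡ false
              avoids v d with EX.new v d
              ... | inj₂ (_ , _ , _ , s) = part-U (suc (χ v)) _ s
              ... | inj₁ r with AB.avoid v r
              ... | inj₂ u = trans (cong U (φ≡ EX.ext v r)) u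
              ... | inj₁ y = trans (cong U (trans (φ≡ EX.ext v r) (φ≡ AB.ext v y))) (part-U (suc (χ v)) _ (proj₂ (proj₂ (domY-low v y))))

              hU : # U ≤ e₁ * t₀
              hU = ≤-reflexive #U

              hsU : n ≤ 2 * u₀ * # U
              hsU = ≤-trans t₀-hi (*-monoʳ-≤ (2 * u₀) (≤-trans (≤-*ˡ {2 * TU} t₀ (1≤* {2} (s≤s z≤n) 1≤TU)) (≤-reflexive (sym #U))))

              1≤s₂ : 1 ≤ s₂
              1≤s₂ = ≤-trans 1≤h₁ h₁≤s₂

              hℓ : s₂ * (2 * u₀) * νl * (E * (ℓ + ℓ)) ≤ n
              hℓ = ≤-trans (≤-reflexive (eq (s₂ * (2 * u₀) * νl) E ℓ)) (≤-trans (*-monoˡ-≤ ℓ hL₁) ℓ-lo)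
                where
                eq : ∀ m E l → m * (E * (l + l)) ≡ m * (2 * E) * l
                eq = solve-∀

              -- By `ℓ-hi` this many stages of length `ℓ` cover all `n` positions.
              N : ℕ
              N = 2 * L₀

              hN : 2 * (N * b) ≤ t₀
              hN = ≤-trans (≤-reflexive (eq L₀ b)) bt
                where
                eq : ∀ l b → 2 * (2 * l * b) ≡ 4 * l * b
                eq = solve-∀

              supply : Travel.Supply χ χ-proper b {{b≢0}} band Eh E≤Eh
              supply = record
                { ld = ld ; 0<n = 0<n ; 1≤D = 1≤D ; 1≤E = 1≤E ; Y = Y ; aY = LY ; Y-low = Y-low ; U = U ; t₀ = t₀ ; e₁ = e₁ ; U-codeg = U-codeg
                ; 1≤e₁ = 1≤* {2} (s≤s z≤n) 1≤TU ; U≤ = hU ; τ = τ ; sU = 2 * u₀ ; νl = νl ; νh = νh ; s₂ = s₂ ; ℓ = ℓ ; N = N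
                ; νl-def = νl-def ; νh-def = νh-def ; s₂-def = s₂-def ; hq₁ = hq₁ ; hq₂ = hq₂ ; hEh = hEh ; hτ = hτ ; 2U≤Y = 2U≤Y ; hsU = hsU
                ; 1≤sU = 1≤* {2} (s≤s z≤n) 1≤u₀ ; 1≤s₂ = 1≤s₂ ; 1≤νl = 1≤νl ; hℓ = hℓ ; hσ₁ = hσ₁ ; hσ₂ = hσ₂ ; hN = hN }

              Stage : ℕ → ℕ → Set
              Stage = Travel.Stages.Stage χ χ-proper b {{b≢0}} band Eh E≤Eh supply stX

              first-stage : Stage 0 (LY + LX)
              first-stage = record
                { S = S₁ ; st = stX ; P = P ; part-size = λ i → ≤-trans (P-large i) (*-monoˡ-≤ (# (part i)) h₁≤s₂) ; part-avoid = part-U ; S-hub = λ _ _ → refl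
                ; dom-in = domX-in ; dom-all = domX-all
                ; roomP = λ i → hub-room (used stX (part i) + ℓ) (P-large i) (+-mono-≤ (≤-trans (used-le stX (λ v d → proj₁ (domX-in v d)) (part i)) (+-monoˡ-≤ LX LY≤LX)) ℓ≤LX)
                ; usedU = ≤-reflexive (#-none {n} {λ v → dom stX v ∧ U (φ stX v)} (λ v → ¬true (λ r → true≢false (∧-elimʳ {dom stX v} r) (avoids v (∧-elimˡ r)))))
                ; origin = ⟶-refl ; aY≤a = m≤m+n LY LX }

              last-stage : Stage N (LY + LX + N * ℓ)
              last-stage = Travel.Stages.run-stages χ χ-proper b {{b≢0}} band Eh E≤Eh supply stX bℓ N 0 (LY + LX) (n≤1+n N) first-stage

              module Final (a : ℕ) (n≤a : n ≤ a) (fin : Stage N a) where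

                module F = Travel.Stages.Stage {{b≢0}} fin

                everywhere : ∀ v → Y v ≡ false → v ∈ dom F.st
                everywhere v y = F.dom-all v (≤-trans (Finₚ.toℕ<n v) n≤a) y

                A⟶F : stA ⟶ F.st
                A⟶F = ⟶-trans EX.ext F.origin

                hit-x : ∀ u y x → x ∈ AB.hit u y → φ F.st x ≡ φ stA x
                hit-x u y x r = φ≡ A⟶F x (AB.hit-dom u y x x r (near-refl 3 x))

                -- The neighbours of `y` were embedded before any absorber was placed, so the image
                -- of `x` in `C stY y` is adjacent to all their images, and later steps change none
                -- of these.
                hit-y : ∀ u y x v → y ∈ Y → x ∈ AB.hit u y → v ∈ h y → φ F.st x ∈ g (φ F.st v)
                hit-y u y x v y∈ r e = subst₂ (λ s t → s ∈ g t) (sym (hit-x u y x r)) (sym (trans (φ≡ A⟶F v (dom⊆ AB.ext v v∈)) (φ≡ AB.ext v v∈)))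
                  (C-adj stY y (φ stA x) v (y∉ y y∈) (subst (λ Z → φ stA x ∈ Z) (if-true y∈) (AB.hit-centre u y x r)) v∈ e)
                  where
                  v∈ : v ∈ dom stY
                  v∈ = domY-all v (Y-nbr-low y v y∈ e) (proj₂ (Y-nbr y v y∈ e))

                hit-u : ∀ u y x v → x ∈ AB.hit u y → v ∈ h x → φ F.st v ∈ g u
                hit-u u y x v r e = subst (_∈ g u) (sym (φ≡ A⟶F v (AB.hit-dom u y x v r (near-mono {1} {3} x v (s≤s z≤n) (near-step 0 x x v (near-refl 0 x) e))))) (AB.hit-nbrs u y x v r e)

                copy : Copy
                copy = Absorb.absorbed g h gs hs hi (φ F.st) X Y (λ v w p r → inj F.st v w (everywhere v p) (everywhere w r)) (λ v w p r → hom F.st v w (everywhere v p) (everywhere w r))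
                  X-Y X-nbr Y-nbr AB.hit AB.hit-X hit-y hit-u (λ u y → ≤-trans #Y≤ (AB.hit-many u y))

              N-enough : n ≤ LY + LX + N * ℓ
              N-enough = ≤-trans ℓ-hi (m≤n+m (N * ℓ) (LY + LX))

              copy′ : Copy
              copy′ = Final.copy (LY + LX + N * ℓ) N-enough last-stage

            copy-X : Copy
            copy-X = AfterAll.copy′ embed-X

          copy-A : Copy
          copy-A = AfterX.copy-X absorbers-exist

        copy-Y : Copy
        copy-Y = AfterY.copy-A embed-Y

      LX+LY≤n : LY + LX ≤ n
      LX+LY≤n = ≤-trans (+-monoˡ-≤ LX LY≤LX) (≤-trans (≤-reflexive (cong (LX +_) (sym (+-identityʳ LX)))) (≤-trans (*-monoˡ-≤ LX (≤-trans (≤-trans (m≤m+n 2 14) (≤-*ʳ {γ} 16 (≤-trans 1≤h₁ h₁≤γ))) hx₁)) LX-lo))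

      reservoir-exists : Σ (Sub n) λ U → (# U ≡ 2 * TU * t₀) × (∀ u v → t₀ ≤ # (U ∩ g u ∩ g v))
      reservoir-exists = reservoir g 0<n e 1≤e codeg (2 * TU * t₀) t₀ t₀ (≤-trans (≤-reflexive (sym (*-assoc (2 * e) (2 * TU) t₀))) (≤-trans (*-monoˡ-≤ t₀ hu₄) t₀-lo))
        (≤-reflexive (trans (cong (_* (t₀ + t₀)) (sym TU-def)) (eq TU t₀))) t₀-exp
        where
        eq : ∀ T t → T * (t + t) ≡ 2 * T * t
        eq = solve-∀

      module WithReservoir (U : Sub n) (#U : # U ≡ 2 * TU * t₀) (U-codeg : ∀ u v → t₀ ≤ # (U ∩ g u ∩ g v)) where

        -- `below L₁` serves as a small set of vertices of `G`, taken by position for convenience.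
        -- Inside it the first hub takes only a small share of any codegree, so `Rz` stays large
        -- after `B₀` is removed.
        R : Sub n
        R = below L₁ ∖ U

        R-size : n ≤ 16 * e * # R
        R-size = ≤-trans (scale-trans (2 * (4 * e)) 2 L₁-hi half) (≤-reflexive (cong (_* # R) (eq e)))
          where
          eq : ∀ e → 2 * (4 * e) * 2 ≡ 16 * e
          eq = solve-∀
          L₁≤n : L₁ ≤ n
          L₁≤n = ≤-trans (≤-*ˡ {4 * e} L₁ (1≤* {4} (s≤s z≤n) 1≤e)) L₁-lo
          half : L₁ ≤ 2 * # R
          half = lin 0 (+-mono-≤ (*-monoʳ-≤ 2 (≤-trans (≤-reflexive (sym (#-below L₁ L₁≤n))) (≤-trans (#-∖ (below L₁) U) (≤-reflexive (cong (# R +_) #U))))) UL₁) (eq′ L₁ (# R) TU t₀)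
            where
            eq′ : ∀ l r T t → l + (2 * (r + 2 * T * t) + l) + 0 ≡ 2 * r + (2 * l + 4 * T * t)
            eq′ = solve-∀

        found : Σ (Hub g k Eh (2 * Qc D (suc k))) λ P → (∀ i → Hub.part P i ⊆ R) × (∀ i → # R ≤ ν Eh (Qc D (suc k)) * # (Hub.part P i))
        found = hub-exists gs ld 0<n 1≤D k Eh (≤-trans 1≤E E≤Eh) R (16 * e) R-size hσ₀

        with-colouring : (Σ (Fin n → Fin k) λ χ → ∀ v w → w ∈ near 8 v → χ v ≡ χ w → v ≡ w) → Copy
        with-colouring (χ , χ-dist) = Choices.copy-Y (record
            { χ = χ ; χ-dist = χ-dist ; U = U ; #U = #U ; U-codeg = U-codeg ; P = Hub-weaken hq₁ (proj₁ found) ; P⊆ = proj₁ (proj₂ found)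
            ; P-large = λ i → ≤-trans (scale-trans (16 * e) (ν Eh (Qc D (suc k))) R-size (proj₂ (proj₂ found) i)) (≤-reflexive (cong (_* # (Hub.part (proj₁ found) i)) (trans (cong (16 * e *_) (sym νh-def)) (sym h₁-def))))
            ; c₁ = proj₁ popY ; c₂ = proj₁ popX ; popY = proj₂ popY ; popX = proj₂ popX ; LX+LY≤n = LX+LY≤n })
          where
          popY = popular 1≤k χ (range 0 (LY ∸ b))
          popX = popular 1≤k χ (range (LY + 5 * b) (LX ∸ 10 * b))

      copy-with-lengths : Copy
      copy-with-lengths = WithReservoir.with-colouring (proj₁ reservoir-exists) (proj₁ (proj₂ reservoir-exists)) (proj₂ (proj₂ reservoir-exists))
        (colour-exists (near 8) (near-sym 8) k 1≤k (λ v → ≤-<-trans (near-count Δ deg 8 v) hk))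

    opaque
      copy-exists : Copy
      copy-exists = go (fraction (4 * e) n (1≤* {4} (s≤s z≤n) 1≤e) (≤-trans hn₁ n₀≤n)) (fraction x₀ n 1≤x₀ (≤-trans hn₂ n₀≤n)) (fraction y₀ n 1≤y₀ (≤-trans hn₃ n₀≤n))
          (fraction (4 * u₀) n (1≤* {4} (s≤s z≤n) 1≤u₀) (≤-trans (≤-trans (*-monoˡ-≤ u₀ {4} {8} (m≤m+n 4 4)) (≤-*ʳ (8 * u₀) (1≤* {8} (s≤s z≤n) 1≤u₀))) (≤-trans hn₄ n₀≤n))) (fraction L₀ n 1≤L₀ (≤-trans hn₅ n₀≤n))
        where
        Frac : ℕ → Set
        Frac c = ∃ λ L → c * L ≤ n × n ≤ 2 * c * L × 1 ≤ L
        go : Frac (4 * e) → Frac x₀ → Frac y₀ → Frac (4 * u₀) → Frac L₀ → Copy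
        go (L₁ , p₁ , q₁ , _) (LX , p₂ , q₂ , r₂) (LY , p₃ , q₃ , _) (a , p₄ , q₄ , _) (ℓ , p₅ , q₅ , _) =
          -- `t₀` is the multiple `4 * a`, since `square≤2^` bounds the number of pairs by
          -- `2 ^ (4 * a)`.
          Lengths.copy-with-lengths (record
            { L₁ = L₁ ; LX = LX ; LY = LY ; t₀ = 4 * a ; ℓ = ℓ ; L₁-lo = p₁ ; L₁-hi = q₁ ; LX-lo = p₂ ; LX-hi = q₂ ; 1≤LX = r₂ ; LY-lo = p₃ ; LY-hi = q₃
            ; t₀-lo = ≤-trans (≤-reflexive (eq₁ u₀ a)) p₄ ; t₀-hi = ≤-trans q₄ (≤-reflexive (eq₂ u₀ a)) ; t₀-exp = square≤2^ n (8 * u₀) a n≤ 8u₀≤a ; ℓ-lo = p₅ ; ℓ-hi = q₅ })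
          where
          eq₁ : ∀ u a → u * (4 * a) ≡ 4 * u * a
          eq₁ = solve-∀
          eq₂ : ∀ u a → 2 * (4 * u) * a ≡ 2 * u * (4 * a)
          eq₂ = solve-∀
          eq₃ : ∀ u a → 2 * (4 * u) * a ≡ 8 * u * a
          eq₃ = solve-∀
          n≤ : n ≤ 8 * u₀ * a
          n≤ = ≤-trans q₄ (≤-reflexive (eq₃ u₀ a))
          8u₀≤a : 8 * u₀ ≤ a
          8u₀≤a = *-cancelˡ-≤ (8 * u₀) {{>-nonZero (1≤* {8} (s≤s z≤n) 1≤u₀)}} (≤-trans (≤-trans hn₄ n₀≤n) n≤)

-- Rational parameters

open import Defs hiding (sym)
import Data.Integer as ℤ
import Data.Integer.Properties as ℤₚ
import Data.List as List
import Data.List.Properties as Listₚ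
import Data.Nat.Coprimality as Coprime
import Data.Rational as ℚ
import Data.Rational.Properties as ℚₚ
import Data.Rational.Unnormalised as ℚᵘ
import Data.Rational.Unnormalised.Properties as ℚᵘₚ
open import Data.Rational using (ℚ; mkℚ; ½; Positive; toℚᵘ) renaming (_+_ to _+ℚ_; _*_ to _*ℚ_; _≤_ to _≤ℚ_)
open import Data.Rational.Solver using (module +-*-Solver)
open import Data.Fin.Permutation using (_⟨$⟩ʳ_; _⟨$⟩ˡ_; inverseˡ; inverseʳ)
open import Data.Fin.Subset using () renaming (∣_∣ to card)
open import Data.Nat.Combinatorics using (_C_; nC1≡n; nCk+nC[k+1]≡[n+1]C[k+1])
open import Data.Nat.ListAction using (sum)

ℕ→ℚ-toℚᵘ : ∀ k → toℚᵘ (ℕ→ℚ k) ≡ ℚᵘ.mkℚᵘ (ℤ.+ k) 0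
ℕ→ℚ-toℚᵘ k = cong toℚᵘ (ℚₚ.fromℚᵘ-toℚᵘ (mkℚ (ℤ.+ k) 0 (Coprime.sym (Coprime.1-coprimeTo k))))

ℕ→ℚ-≃ : ∀ k → toℚᵘ (ℕ→ℚ k) ℚᵘ.≃ ℚᵘ.mkℚᵘ (ℤ.+ k) 0
ℕ→ℚ-≃ k = ℚᵘₚ.≃-reflexive (ℕ→ℚ-toℚᵘ k)

ℕ→ℚ-+ : ∀ x y → ℕ→ℚ (x + y) ≡ ℕ→ℚ x ℚ.+ ℕ→ℚ y
ℕ→ℚ-+ x y = ℚₚ.toℚᵘ-injective (ℚᵘₚ.≃-trans (ℕ→ℚ-≃ (x + y)) (ℚᵘₚ.≃-sym (ℚᵘₚ.≃-trans (ℚₚ.toℚᵘ-homo-+ (ℕ→ℚ x) (ℕ→ℚ y)) (ℚᵘₚ.≃-trans (ℚᵘₚ.+-cong (ℕ→ℚ-≃ x) (ℕ→ℚ-≃ y)) (ℚᵘ.*≡* (cong (ℤ._* ℤ.+ 1) (trans (cong₂ ℤ._+_ (ℤₚ.*-identityʳ (ℤ.+ x)) (ℤₚ.*-identityʳ (ℤ.+ y))) (sym (ℤₚ.pos-+ x y)))))))))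

ℕ→ℚ-* : ∀ x y → ℕ→ℚ (x * y) ≡ ℕ→ℚ x ℚ.* ℕ→ℚ y
ℕ→ℚ-* x y = ℚₚ.toℚᵘ-injective (ℚᵘₚ.≃-trans (ℕ→ℚ-≃ (x * y)) (ℚᵘₚ.≃-sym (ℚᵘₚ.≃-trans (ℚₚ.toℚᵘ-homo-* (ℕ→ℚ x) (ℕ→ℚ y)) (ℚᵘₚ.≃-trans (ℚᵘₚ.*-cong (ℕ→ℚ-≃ x) (ℕ→ℚ-≃ y)) (ℚᵘ.*≡* (cong (ℤ._* ℤ.+ 1) (sym (ℤₚ.pos-* x y))))))))

ℕ→ℚ-cancel-≤ : ∀ {x y} → ℕ→ℚ x ℚ.≤ ℕ→ℚ y → x ≤ y
ℕ→ℚ-cancel-≤ {x} {y} p with subst₂ ℚᵘ._≤_ (ℕ→ℚ-toℚᵘ x) (ℕ→ℚ-toℚᵘ y) (ℚₚ.toℚᵘ-mono-≤ p)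
... | ℚᵘ.*≤* r = ℤₚ.drop‿+≤+ (subst₂ ℤ._≤_ (ℤₚ.*-identityʳ (ℤ.+ x)) (ℤₚ.*-identityʳ (ℤ.+ y)) r)

ℕ→ℚ-nonNeg : ∀ x → ℚ.NonNegative (ℕ→ℚ x)
ℕ→ℚ-nonNeg x = subst ℚᵘ.NonNegative (sym (ℕ→ℚ-toℚᵘ x)) (record { nonNeg = _ })

*ℕ-mono : ∀ k {p r : ℚ} → p ℚ.≤ r → ℕ→ℚ k ℚ.* p ℚ.≤ ℕ→ℚ k ℚ.* r
*ℕ-mono k = ℚₚ.*-monoˡ-≤-nonNeg (ℕ→ℚ k) {{ℕ→ℚ-nonNeg k}}

denominator-cancel : ∀ a k .(c : Coprime.Coprime a (suc k)) → ℕ→ℚ (suc k) ℚ.* mkℚ (ℤ.+ a) k c ≡ ℕ→ℚ a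
denominator-cancel a k c = ℚₚ.toℚᵘ-injective (ℚᵘₚ.≃-trans (ℚₚ.toℚᵘ-homo-* (ℕ→ℚ (suc k)) (mkℚ (ℤ.+ a) k c)) (ℚᵘₚ.≃-trans (ℚᵘₚ.*-congʳ {ℚᵘ.mkℚᵘ (ℤ.+ a) k} (ℕ→ℚ-≃ (suc k))) (ℚᵘₚ.≃-trans (ℚᵘ.*≡* eq) (ℚᵘₚ.≃-sym (ℕ→ℚ-≃ a)))))
  where
  eq : (ℤ.+ suc k ℤ.* ℤ.+ a) ℤ.* ℤ.+ 1 ≡ ℤ.+ a ℤ.* ℤ.+ (1 * suc k)
  eq = trans (ℤₚ.*-identityʳ _) (trans (ℤₚ.*-comm (ℤ.+ suc k) (ℤ.+ a)) (cong (λ z → ℤ.+ a ℤ.* ℤ.+ z) (sym (*-identityˡ (suc k)))))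

-- The fraction `1 / suc k`, already in lowest terms.
reciprocal : ℕ → ℚ
reciprocal k = mkℚ (ℤ.+ 1) k (Coprime.1-coprimeTo (suc k))

reciprocal-cancel : ∀ k x → ℕ→ℚ (suc k) ℚ.* (reciprocal k ℚ.* ℕ→ℚ x) ≡ ℕ→ℚ x
reciprocal-cancel k x = trans (sym (ℚₚ.*-assoc (ℕ→ℚ (suc k)) (reciprocal k) (ℕ→ℚ x))) (trans (cong (ℚ._* ℕ→ℚ x) (denominator-cancel 1 k (Coprime.1-coprimeTo (suc k)))) (trans (sym (ℕ→ℚ-* 1 x)) (cong ℕ→ℚ (*-identityˡ x))))

≤-reciprocal : ∀ k {x y} → ℕ→ℚ x ℚ.≤ reciprocal k ℚ.* ℕ→ℚ y → suc k * x ≤ y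
≤-reciprocal k {x} {y} p = ℕ→ℚ-cancel-≤ (subst₂ ℚ._≤_ (sym (ℕ→ℚ-* (suc k) x)) (reciprocal-cancel k y) (*ℕ-mono (suc k) p))

-- Both denominators are cleared, and the numerator `suc a` is lowered to 1. This only weakens the
-- density to `1 / suc m`.
dense-ℕ : ∀ a m .(c : Coprime.Coprime (suc a) (suc m)) k {B N e} → (mkℚ (ℤ.+ suc a) m c ℚ.* ℕ→ℚ B) ℚ.- (reciprocal k ℚ.* ℕ→ℚ N) ℚ.≤ ℕ→ℚ e → suc k * B ≤ suc m * (suc k * e) + suc m * N
dense-ℕ a m c k {B} {N} {e} h = ≤-trans (m≤m+n (suc k * B) (a * (suc k * B))) (ℕ→ℚ-cancel-≤ (subst₂ ℚ._≤_ lhs rhs (*ℕ-mono (suc m) (*ℕ-mono (suc k) h′))))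
  where
  open +-*-Solver
  d = mkℚ (ℤ.+ suc a) m c
  ρN = reciprocal k ℚ.* ℕ→ℚ N
  h′ : d ℚ.* ℕ→ℚ B ℚ.≤ ℕ→ℚ e ℚ.+ ρN
  h′ = subst (ℚ._≤ ℕ→ℚ e ℚ.+ ρN) (solve 2 (λ x y → (x :- y) :+ y := x) refl (d ℚ.* ℕ→ℚ B) ρN) (ℚₚ.+-monoˡ-≤ ρN h)
  lhs : ℕ→ℚ (suc m) ℚ.* (ℕ→ℚ (suc k) ℚ.* (d ℚ.* ℕ→ℚ B)) ≡ ℕ→ℚ (suc a * (suc k * B))
  lhs = trans (solve 4 (λ m k d B → m :* (k :* (d :* B)) := (m :* d) :* (k :* B)) refl (ℕ→ℚ (suc m)) (ℕ→ℚ (suc k)) d (ℕ→ℚ B)) (trans (cong₂ ℚ._*_ (denominator-cancel (suc a) m c) (sym (ℕ→ℚ-* (suc k) B))) (sym (ℕ→ℚ-* (suc a) (suc k * B))))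
  rhs : ℕ→ℚ (suc m) ℚ.* (ℕ→ℚ (suc k) ℚ.* (ℕ→ℚ e ℚ.+ ρN)) ≡ ℕ→ℚ (suc m * (suc k * e) + suc m * N)
  rhs = trans (solve 4 (λ m k e r → m :* (k :* (e :+ r)) := m :* (k :* e) :+ m :* (k :* r)) refl (ℕ→ℚ (suc m)) (ℕ→ℚ (suc k)) (ℕ→ℚ e) ρN)
    (trans (cong₂ ℚ._+_ (trans (cong (ℕ→ℚ (suc m) ℚ.*_) (sym (ℕ→ℚ-* (suc k) e))) (sym (ℕ→ℚ-* (suc m) (suc k * e)))) (trans (cong (ℕ→ℚ (suc m) ℚ.*_) (reciprocal-cancel k N)) (sym (ℕ→ℚ-* (suc m) N)))) (sym (ℕ→ℚ-+ (suc m * (suc k * e)) (suc m * N))))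

degree-ℕ : ∀ a m .(c : Coprime.Coprime (suc a) (suc m)) {n d} → (½ ℚ.+ mkℚ (ℤ.+ suc a) m c) ℚ.* ℕ→ℚ n ℚ.≤ ℕ→ℚ d → suc m * n + 2 * n ≤ 2 * (suc m * d)
degree-ℕ a m c {n} {d} h = ≤-trans (+-monoʳ-≤ (suc m * n) (*-monoʳ-≤ 2 (m≤m+n n (a * n)))) (ℕ→ℚ-cancel-≤ (subst₂ ℚ._≤_ lhs rhs (*ℕ-mono 2 (*ℕ-mono (suc m) h))))
  where
  open +-*-Solver
  η = mkℚ (ℤ.+ suc a) m c
  lhs : ℕ→ℚ 2 ℚ.* (ℕ→ℚ (suc m) ℚ.* ((½ ℚ.+ η) ℚ.* ℕ→ℚ n)) ≡ ℕ→ℚ (suc m * n + 2 * (suc a * n))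
  lhs = trans (solve 5 (λ t m f η n → t :* (m :* ((f :+ η) :* n)) := (t :* f) :* (m :* n) :+ t :* ((m :* η) :* n)) refl (ℕ→ℚ 2) (ℕ→ℚ (suc m)) ½ η (ℕ→ℚ n))
    (trans (cong₂ ℚ._+_ (trans (ℚₚ.*-identityˡ _) (sym (ℕ→ℚ-* (suc m) n))) (trans (cong (λ z → ℕ→ℚ 2 ℚ.* (z ℚ.* ℕ→ℚ n)) (denominator-cancel (suc a) m c)) (trans (cong (ℕ→ℚ 2 ℚ.*_) (sym (ℕ→ℚ-* (suc a) n))) (sym (ℕ→ℚ-* 2 (suc a * n)))))) (sym (ℕ→ℚ-+ (suc m * n) (2 * (suc a * n)))))
  rhs : ℕ→ℚ 2 ℚ.* (ℕ→ℚ (suc m) ℚ.* ℕ→ℚ d) ≡ ℕ→ℚ (2 * (suc m * d))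
  rhs = trans (cong (ℕ→ℚ 2 ℚ.*_) (sym (ℕ→ℚ-* (suc m) d))) (sym (ℕ→ℚ-* 2 (suc m * d)))

-- Density and codegrees of the given graphs

sum-tabulate : ∀ {n} (f : Fin n → ℕ) → sum (List.tabulate f) ≡ ∑ f
sum-tabulate {zero} f = sym (∑-empty f)
sum-tabulate {suc n} f = trans (cong (f zero +_) (sum-tabulate (λ i → f (suc i)))) (sym (∑-suc f))

sum-allFin : ∀ {n} (f : Fin n → ℕ) → sum (List.map f (List.allFin n)) ≡ ∑ f
sum-allFin {n} f = trans (cong sum (Listₚ.map-tabulate (λ i → i) f)) (sum-tabulate f)

count-# : ∀ {n} (A : Sub n) → count n A ≡ # A
count-# A = trans (sum-allFin _) (∑-cong (λ i → pt (A i)))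
  where
  pt : ∀ b → (if b then 1 else 0) ≡ 𝟙 b
  pt true = refl
  pt false = refl

∣tabulate∣ : ∀ {n} (A : Sub n) → card (tabulate A) ≡ # A
∣tabulate∣ {zero} A = sym (∑-empty _)
∣tabulate∣ {suc n} A with A zero in eq
... | true = trans (cong suc (∣tabulate∣ (λ i → A (suc i)))) (sym (trans (∑-suc _) (cong (λ b → 𝟙 b + # (λ i → A (suc i))) eq)))
... | false = trans (∣tabulate∣ (λ i → A (suc i))) (sym (trans (∑-suc _) (cong (λ b → 𝟙 b + # (λ i → A (suc i))) eq)))

choose-2 : ∀ x → 2 * (x C 2) + x ≡ x * x
choose-2 zero = refl
choose-2 (suc x) = trans (cong (λ c → 2 * c + suc x) (trans (sym (nCk+nC[k+1]≡[n+1]C[k+1] x 1)) (cong (_+ x C 2) (nC1≡n x)))) (trans (eq x (x C 2)) (trans (cong (λ z → z + (x + suc x)) (choose-2 x)) (eq′ x)))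
  where
  eq : ∀ x c → 2 * (x + c) + suc x ≡ 2 * c + x + (x + suc x)
  eq = solve-∀
  eq′ : ∀ x → x * x + (x + suc x) ≡ suc x * suc x
  eq′ = solve-∀

-- `edgesIn` counts an edge once, with its smaller end first; `edges` counts it as two ordered
-- pairs.
edgesIn-≤ : ∀ {n} (G : Graph n) (A : Sub n) → 2 * edgesIn G (tabulate A) ≤ edges (adj G) A A
edgesIn-≤ {n} G A = begin
  2 * edgesIn G (tabulate A) ≡⟨ cong (2 *_) (trans (sum-allFin _) (∑-cong (λ i → trans (count-# _) (#-cong (λ j → cong₂ (λ a b → (toℕ i <ᵇ toℕ j) ∧ a ∧ b ∧ adj G i j) (lookup∘tabulate A i) (lookup∘tabulate A j)))))) ⟩
  2 * ∑∑ t ≡⟨ cong (∑∑ t +_) (+-identityʳ _) ⟩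
  ∑∑ t + ∑∑ t ≡⟨ cong (∑∑ t +_) (∑-comm t) ⟩
  ∑∑ t + ∑∑ (λ i j → t j i) ≡⟨ sym (∑∑-+ t _) ⟩
  ∑∑ (λ i j → t i j + t j i) ≤⟨ ∑∑-mono pt ⟩
  ∑∑ (λ i j → 𝟙 (A i) * 𝟙 (A j ∧ adj G i j)) ≡⟨ ∑-cong (λ i → ∑-*ˡ (𝟙 (A i)) (λ j → 𝟙 (A j ∧ adj G i j))) ⟩
  edges (adj G) A A ∎
  where
  open ≤-Reasoning
  t : Fin n → Fin n → ℕ
  t i j = 𝟙 ((toℕ i <ᵇ toℕ j) ∧ A i ∧ A j ∧ adj G i j)
  asym : ∀ i j → (i <ᵇ j) ≡ true → (j <ᵇ i) ≡ true → ⊥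
  asym (suc i) (suc j) p q = asym i j p q
  pt : ∀ i j → t i j + t j i ≤ 𝟙 (A i) * 𝟙 (A j ∧ adj G i j)
  pt i j rewrite Graph.sym G j i = cases (toℕ i <ᵇ toℕ j) (toℕ j <ᵇ toℕ i) (A i) (A j) (adj G i j) (asym (toℕ i) (toℕ j))
    where
    cases : ∀ p q a b c → (p ≡ true → q ≡ true → ⊥) → 𝟙 (p ∧ a ∧ b ∧ c) + 𝟙 (q ∧ b ∧ a ∧ c) ≤ 𝟙 a * 𝟙 (b ∧ c)
    cases true true a b c h = ⊥-elim (h refl refl)
    cases true false true b c h = ≤-reflexive refl
    cases true false false b c h = z≤n
    cases false q true true true h = ≤-trans (𝟙≤1 (q ∧ true)) ≤-refl
    cases false true true true false h = z≤n
    cases false false true true false h = z≤n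
    cases false true true false c h = z≤n
    cases false false true false c h = z≤n
    cases false true false true c h = z≤n
    cases false true false false c h = z≤n
    cases false false false b c h = z≤n

-- After multiplication by 8 the left side is `4 * r * (x * x)` minus `4 * r * x`. The latter is at
-- most `r * (x * x)` because `4 ≤ x`, and so is the error term by the choice of `r`. Half of the
-- density remains.
dense-arith : ∀ {m σ r n x B e E} → r ≡ 8 * m * (σ * σ) → 0 < r → r * B ≤ m * (r * e) + m * (n * n) → 2 * B + x ≡ x * x → 2 * e ≤ E → n ≤ σ * x → 4 ≤ x → x * x ≤ 2 * m * E
dense-arith {m} {σ} {r} {n} {x} {B} {e} {E} r-eq 0<r h C-eq eE nσ 4≤x = *-cancelˡ-≤ (2 * r) {{>-nonZero (1≤* {2} (s≤s z≤n) 0<r)}} (≤-trans main (≤-reflexive (eq₀ r m E)))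
  where
  eq₀ : ∀ r m E → 4 * m * r * E ≡ 2 * r * (2 * m * E)
  eq₀ = solve-∀
  n² : 8 * m * (n * n) ≤ r * (x * x)
  n² = ≤-trans (*-monoʳ-≤ (8 * m) (*-mono-≤ nσ nσ)) (≤-reflexive (trans (eq m σ x) (cong (_* (x * x)) (sym r-eq))))
    where
    eq : ∀ m s x → 8 * m * (s * x * (s * x)) ≡ 8 * m * (s * s) * (x * x)
    eq = solve-∀
  rx : r * (4 * x) ≤ r * (x * x)
  rx = *-monoʳ-≤ r (*-monoˡ-≤ x 4≤x)
  edge : 8 * (m * (r * e)) ≤ 4 * m * r * E
  edge = ≤-trans (≤-reflexive (eq m r e)) (*-monoʳ-≤ (4 * m * r) eE)
    where
    eq : ∀ m r e → 8 * (m * (r * e)) ≡ 4 * m * r * (2 * e)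
    eq = solve-∀
  main : 2 * r * (x * x) ≤ 4 * m * r * E
  main = lin 0 (+-mono-≤ (+-mono-≤ (*-monoʳ-≤ 8 h) n²) (+-mono-≤ rx edge)) (certificate (x * x) C-eq)
    where
    certificate : ∀ X → 2 * B + x ≡ X → 2 * r * X + (8 * (m * (r * e) + m * (n * n)) + r * X + (r * X + 4 * m * r * E)) + 0 ≡ 4 * m * r * E + (8 * (r * B) + 8 * m * (n * n) + (r * (4 * x) + 8 * (m * (r * e))))
    certificate _ refl = eq r m B x E n e
      where
      eq : ∀ r m B x E n e → 2 * r * (2 * B + x) + (8 * (m * (r * e) + m * (n * n)) + r * (2 * B + x) + (r * (2 * B + x) + 4 * m * r * E)) + 0 ≡ 4 * m * r * E + (8 * (r * B) + 8 * m * (n * n) + (r * (4 * x) + 8 * (m * (r * e))))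
      eq = solve-∀

locallyDense-from : ∀ {n} (G : Graph n) a m .(c : Coprime.Coprime (suc a) (suc m)) k σ → suc k ≡ 8 * suc m * (σ * σ) → 4 * σ ≤ n → 0 < σ → Dense (reciprocal k) (mkℚ (ℤ.+ suc a) m c) G → LocallyDense (adj G) σ (2 * suc m)
locallyDense-from {n} G a m c k σ k-eq hn 0<σ dense A hA = dense-arith {suc m} {σ} {suc k} {n} {# A} {# A C 2} {edgesIn G (tabulate A)} k-eq (s≤s z≤n)
  (dense-ℕ a m c k {# A C 2} {n * n} {edgesIn G (tabulate A)} (subst (λ x → (mkℚ (ℤ.+ suc a) m c ℚ.* ℕ→ℚ (x C 2)) ℚ.- (reciprocal k ℚ.* ℕ→ℚ (n * n)) ℚ.≤ ℕ→ℚ (edgesIn G (tabulate A))) (∣tabulate∣ A) (dense (tabulate A))))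
  (choose-2 (# A)) (edgesIn-≤ G A) hA (*-cancelˡ-≤ σ {{>-nonZero 0<σ}} (≤-trans (≤-reflexive (*-comm σ 4)) (≤-trans hn hA)))

-- Two neighbourhoods of size at least `(1/2 + η) * n` overlap in at least `2 * η * n` vertices. The
-- numerator of `η` is again lowered to 1.
codegree-from : ∀ {n} (G : Graph n) a m .(c : Coprime.Coprime (suc a) (suc m)) → (∀ v → (½ ℚ.+ mkℚ (ℤ.+ suc a) m c) ℚ.* ℕ→ℚ n ℚ.≤ ℕ→ℚ (deg G v)) → ∀ u v → n ≤ suc m * # (adj G u ∩ adj G v)
codegree-from {n} G a m c h u v = *-cancelˡ-≤ 2 (lin (2 * n) (+-mono-≤ (+-mono-≤ (each u) (each v)) (*-monoʳ-≤ (2 * suc m) incl-excl)) (eq (suc m) n (# (adj G u)) (# (adj G v)) (# (adj G u ∩ adj G v))))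
  where
  each : ∀ v → suc m * n + 2 * n ≤ 2 * (suc m * # (adj G v))
  each v = subst (λ d → suc m * n + 2 * n ≤ 2 * (suc m * d)) (count-# (adj G v)) (degree-ℕ a m c {n} {deg G v} (h v))
  incl-excl : # (adj G u) + # (adj G v) ≤ # (adj G u ∩ adj G v) + n
  incl-excl = begin
    # (adj G u) + # (adj G v) ≡⟨ cong (_+ # (adj G v)) (#-split (adj G u) (adj G v)) ⟩
    # (adj G u ∩ adj G v) + # (adj G u ∖ adj G v) + # (adj G v) ≡⟨ +-assoc (# (adj G u ∩ adj G v)) _ _ ⟩
    # (adj G u ∩ adj G v) + (# (adj G u ∖ adj G v) + # (adj G v)) ≤⟨ +-monoʳ-≤ (# (adj G u ∩ adj G v)) (+-monoˡ-≤ (# (adj G v)) (#-mono {B = (λ _ → true) ∖ adj G v} (λ x p → ∧-elimʳ {adj G u x} p))) ⟩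
    # (adj G u ∩ adj G v) + (# ((λ _ → true) ∖ adj G v) + # (adj G v)) ≡⟨ cong (# (adj G u ∩ adj G v) +_) (trans (+-comm _ (# (adj G v))) (trans (sym (#-split (λ _ → true) (adj G v))) (#-full n))) ⟩
    # (adj G u ∩ adj G v) + n ∎
    where open ≤-Reasoning
  eq : ∀ m n a b c → 2 * n + (2 * (m * a) + 2 * (m * b) + 2 * m * (c + n)) + 2 * n ≡ 2 * (m * c) + (m * n + 2 * n + (m * n + 2 * n) + 2 * m * (a + b))
  eq = solve-∀

#-preimage : ∀ {n} (A : Sub n) (π : Fin n → Fin n) → (∀ x y → π x ≡ π y → x ≡ y) → # (λ x → A (π x)) ≤ # A
#-preimage {n} A π inj = begin
  # (λ x → A (π x)) ≤⟨ ∑-mono (λ x → ≤-trans (≤-reflexive (trans (sym (*-identityʳ _)) (cong (λ b → 𝟙 (A (π x)) * 𝟙 b) (sym (≡ᶠ-refl (π x)))))) (term≤∑ (λ y → 𝟙 (A y) * 𝟙 (π x ≡ᶠ y)) (π x))) ⟩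
  ∑ (λ x → ∑ (λ y → 𝟙 (A y) * 𝟙 (π x ≡ᶠ y))) ≡⟨ trans (∑-comm _) (∑-cong (λ y → ∑-*ˡ (𝟙 (A y)) (λ x → 𝟙 (π x ≡ᶠ y)))) ⟩
  ∑ (λ y → 𝟙 (A y) * # (λ x → π x ≡ᶠ y)) ≤⟨ ∑-mono (λ y → *-monoʳ-≤ (𝟙 (A y)) (fibre y)) ⟩
  ∑ (λ y → 𝟙 (A y) * 1) ≡⟨ ∑-cong (λ y → *-identityʳ _) ⟩
  # A ∎
  where
  open ≤-Reasoning
  fibre : ∀ y → # (λ x → π x ≡ᶠ y) ≤ 1
  fibre y with true? (any (λ x → π x ≡ᶠ y))
  ... | no p = ≤-trans (≤-reflexive (#-none {n} {λ x → π x ≡ᶠ y} (λ x → ¬true (λ r → p (any-intro {A = λ x → π x ≡ᶠ y} x r))))) z≤n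
  ... | yes p with any-elim {A = λ x → π x ≡ᶠ y} p
  ... | x₀ , r = ≤-trans (#-mono {A = λ x → π x ≡ᶠ y} {B = x₀ ≡ᶠ_} (λ x s → subst (λ z → (x₀ ≡ᶠ z) ≡ true) (inj x₀ x (trans (≡ᶠ-sound r) (sym (≡ᶠ-sound s)))) (≡ᶠ-refl x₀))) (≤-reflexive (#-singleton x₀))

pred-suc : ∀ {c} → 1 ≤ c → suc (pred c) ≡ c
pred-suc (s≤s _) = refl

module _ {Δ D e k q E : ℕ} (K : Constants Δ D e k q E) where

  open Constants K using (σ; b₀; n₀)

  -- `H` is relabelled along its bandwidth order, so that positions in `Fin n` are the labels; the
  -- copy found is composed with the relabelling.
  contains-copy : ∀ {n} (H G : Graph n) → n₀ ≤ n → 0 < b₀ → b₀ ≤ n → LocallyDense (adj G) σ D → (∀ u v → n ≤ e * # (adj G u ∩ adj G v)) →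
    MaxDegree≤ H Δ → BandwidthAtMost H (reciprocal (pred b₀) ℚ.* ℕ→ℚ n) → ContainsCopy G H
  contains-copy {n} H G n₀≤n 0<b₀ b₀≤n ld codeg maxdeg (π , near) = (λ i → proj₁ copy (π ⟨$⟩ʳ i)) ,
      (λ {i} {j} eq → trans (sym (inverseˡ π)) (trans (cong (π ⟨$⟩ˡ_) (proj₁ (proj₂ copy) _ _ eq)) (inverseˡ π))) ,
      λ i j ij → proj₂ (proj₂ copy) (π ⟨$⟩ʳ i) (π ⟨$⟩ʳ j) (trans (cong₂ (adj H) (inverseˡ π) (inverseˡ π)) ij)
    where
    instance
      b₀≢0 : NonZero b₀
      b₀≢0 = >-nonZero 0<b₀
    b : ℕ
    b = n / b₀
    1≤b : 1 ≤ b
    1≤b = m≥n⇒m/n>0 b₀≤n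
    h : Fin n → Sub n
    h x y = adj H (π ⟨$⟩ˡ x) (π ⟨$⟩ˡ y)
    band : ∀ x v → v ∈ h x → toℕ v ≤ toℕ x + b
    band x v xv = ≤-trans (≤-trans (m≤n+∣n-m∣ (toℕ v) (toℕ x)) (+-monoʳ-≤ (toℕ x) dist)) ≤-refl
      where
      close : b₀ * ∣ toℕ x - toℕ v ∣ ≤ n
      close = subst₂ (λ i j → b₀ * ∣ toℕ i - toℕ j ∣ ≤ n) (inverseʳ π) (inverseʳ π)
        (subst (λ c → c * d ≤ n) (pred-suc 0<b₀) (≤-reciprocal (pred b₀) {d} {n} (near (π ⟨$⟩ˡ x) (π ⟨$⟩ˡ v) xv)))
        where
        d : ℕ
        d = ∣ toℕ (π ⟨$⟩ʳ (π ⟨$⟩ˡ x)) - toℕ (π ⟨$⟩ʳ (π ⟨$⟩ˡ v)) ∣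
      dist : ∣ toℕ x - toℕ v ∣ ≤ b
      dist = ≤-trans (≤-reflexive (sym (m*n/n≡m ∣ toℕ x - toℕ v ∣ b₀))) (/-monoˡ-≤ b₀ (≤-trans (≤-reflexive (*-comm ∣ toℕ x - toℕ v ∣ b₀)) close))
    copy : Σ (Fin n → Fin n) λ f → (∀ v w → f v ≡ f w → v ≡ w) × (∀ v w → w ∈ h v → f w ∈ adj G (f v))
    setup : Setup n
    setup = record
      { g = adj G ; h = h ; gs = Graph.sym G ; gi = irrefl G ; hs = λ x y → Graph.sym H (π ⟨$⟩ˡ x) (π ⟨$⟩ˡ y) ; hi = λ x → irrefl H (π ⟨$⟩ˡ x) ; Δ = Δ ; q = q ; k = k ; E = E
      ; deg = λ x → ≤-trans (#-preimage (adj H (π ⟨$⟩ˡ x)) (π ⟨$⟩ˡ_) (λ y z eq → trans (sym (inverseʳ π)) (trans (cong (π ⟨$⟩ʳ_) eq) (inverseʳ π)))) (≤-trans (≤-reflexive (sym (count-# (adj H (π ⟨$⟩ˡ x))))) (maxdeg (π ⟨$⟩ˡ x)))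
      ; 1≤q = Constants.1≤q K ; hE = Constants.hE K }
    copy = Core.Assembly.copy-exists setup (record
      { D = D ; e = e ; K = K ; ld = ld ; codeg = codeg ; b = b ; b≢0 = >-nonZero 1≤b ; band = band
      ; b-small = ≤-trans (≤-reflexive (*-comm b₀ b)) (m/n*n≤m n b₀) ; 0<n = ≤-trans 0<b₀ b₀≤n ; n₀≤n = n₀≤n })

theorem2 : (Δ : ℕ) (d η : ℚ) → Positive d → Positive η →
    Σ ℚ λ ρ → Σ ℚ λ β → Σ ℕ λ n₀ →
    Positive ρ × Positive β × 1 ≤ n₀ ×
    (∀ (n : ℕ) → n ≥ n₀ → (H G : Graph n) →
    MaxDegree≤ H Δ →
    BandwidthAtMost H (β *ℚ ℕ→ℚ n) →
    Dense ρ d G →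
    (∀ v → (½ +ℚ η) *ℚ ℕ→ℚ n ≤ℚ ℕ→ℚ (deg G v)) →
    ContainsCopy G H)
theorem2 Δ (mkℚ (ℤ.+ suc a) m c) (mkℚ (ℤ.+ suc a′) m′ c′) _ _ =
  -- `r` makes the error term of density harmless on all sets of at least `n / σ` vertices. In the
  -- bound on `n`, `4 * σ` gives these sets at least 4 elements, and `b₀` makes the integer
  -- bandwidth `n / b₀` positive.
  reciprocal (pred r) , reciprocal (pred b₀) , n₀ + (4 * σ + b₀) , _ , _ , ≤-trans 0<b₀ (≤-trans (m≤n+m b₀ (4 * σ)) (m≤n+m (4 * σ + b₀) n₀)) ,
  λ n hn H G maxdeg bw dense mindeg → contains-copy K H G (≤-trans (m≤m+n n₀ _) hn) 0<b₀ (≤-trans (≤-trans (m≤n+m b₀ (4 * σ)) (m≤n+m (4 * σ + b₀) n₀)) hn)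
    (locallyDense-from G a m c (pred r) σ (pred-suc 0<r) (≤-trans (≤-trans (m≤m+n (4 * σ) b₀) (m≤n+m (4 * σ + b₀) n₀)) hn) 0<σ dense)
    (codegree-from G a′ m′ c′ mindeg) maxdeg bw
  where
  chosen : ∃ λ k → ∃ λ q → ∃ λ E → Constants Δ (2 * suc m) (suc m′) k q E
  chosen = constants Δ (2 * suc m) (suc m′) (s≤s z≤n) (s≤s z≤n)
  K = proj₂ (proj₂ (proj₂ chosen))
  open Constants K using (σ; b₀; n₀; hσ₀; hb₂; 1≤L₀; 1≤e; 1≤D)
  0<σ : 0 < σ
  0<σ = ≤-trans (1≤* (1≤* {16} (s≤s z≤n) 1≤e) (^-≥1 (2 * (2 * suc m)) (suc (proj₁ chosen)) (1≤* {2} (s≤s z≤n) 1≤D))) hσ₀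
  0<b₀ : 0 < b₀
  0<b₀ = ≤-trans (1≤* {2 * Constants.L₀ K} {4} (1≤* {2} (s≤s z≤n) 1≤L₀) (s≤s z≤n)) hb₂
  r : ℕ
  r = 8 * suc m * (σ * σ)
  0<r : 0 < r
  0<r = 1≤* {8 * suc m} {σ * σ} (1≤* {8} {suc m} (s≤s z≤n) (s≤s z≤n)) (1≤* 0<σ 0<σ)
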